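{- For $n$ a positive integer and $N=2n$, \begin{equation*} \sum_{\boldsymbol{m}\in\mathbb N^{N-1}} \frac{q^{\frac{1}{2}\boldsymbol{m} C \boldsymbol{m}^t}}{(q)_{\boldsymbol{m}}} =\frac{1}{(q)_{\infty}^{2n^2-n}} \sum \xi(\boldsymbol{v}/\boldsymbol{\rho}) (-1)^{|\boldsymbol{v}|-|\boldsymbol{\rho}|} q^{\tfrac{||\boldsymbol{v}||^2-||\boldsymbol{\rho}||^2}{2(2n+3)}}, \end{equation*} where the sum on the right is over $\boldsymbol{v}\in(\mathbb Z/2)^n$ such that $v_i\equiv\rho_i\pmod{2n+3}$, and \begin{equation*} \sum_{\boldsymbol{m}\in\mathbb N^{N-1}} \frac{q^{\frac{1}{2}\boldsymbol{m} C \boldsymbol{m}^t+|\boldsymbol{m}|_{ - }}}{(q)_{\boldsymbol{m}}} =\frac{1}{(q)_{\infty}^{2n^2-n}} \sum \xi(\boldsymbol{v}/\boldsymbol{\rho}) (-1)^{|\boldsymbol{v}|-|\boldsymbol{\rho}+1|} q^{\tfrac{||\boldsymbol{v}||^2-||\boldsymbol{\rho}+1||^2}{2(2n+3)}}, \end{equation*} where the sum on the right is over $\boldsymbol{v}\in(\mathbb Z/2)^n$ such that $v_i\equiv \rho_i+1\pmod{2n+3}$.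
   Context: Notation: $(a)_m=(a;q)_m=\prod_{i=1}^m(1-aq^{i-1})$ for $m\in\mathbb N\cup\{\infty\}$, $\mathbb N=\{0,1,2,\dots\}$; $(q)_{\boldsymbol{m}}=(q)_{m_1}\cdots(q)_{m_{N-1}}$. $C$ is the Cartan matrix of $\textup{A}_{N-1}$, so $\frac{1}{2}\boldsymbol{m} C\boldsymbol{m}^t=\sum_{i=1}^{N-1}m_i^2-\sum_{i=1}^{N-2}m_im_{i+1}$, and $|\boldsymbol{m}|_{ - }=\sum_{i=1}^{N-1}(-1)^{i-1}m_i$. For $\boldsymbol{v}=(v_1,\dots,v_n)$: $|\boldsymbol{v}|=v_1+\cdots+v_n$, $||\boldsymbol{v}||^2=v_1^2+\cdots+v_n^2$; $\boldsymbol{\rho}=(1/2,3/2,\dots,n-1/2)$; for a scalar $a$, $\boldsymbol{w}+a=(w_1+a,\dots,w_n+a)$; and $\xi(\boldsymbol{v}/\boldsymbol{w})=\prod_{1\leq i<j\leq n}\frac{v_i^2-v_j^2}{w_i^2-w_j^2}$. -}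

module Defs where

open import Data.Nat as ℕ using (ℕ; zero; suc; _∸_)
open import Data.Nat.DivMod using (_%_)
open import Data.Integer as ℤ using (ℤ; +_; -[1+_])
open import Data.Rational as ℚ using (ℚ; 0ℚ; 1ℚ; _+_; _-_; _*_; -_; _÷_; mkℚ)
open import Data.Rational.Properties using (_≟_)
open import Data.Vec using (Vec; []; _∷_; zipWith; foldr)
import Data.Vec
open import Data.Bool using (if_then_else_)
open import Relation.Nullary using (yes; no)

-- Division on ℚ; the junk value 0 for a zero divisor is never used in the
-- theorem (all divisors there are nonzero).
_÷'_ : ℚ → ℚ → ℚ
p ÷' q with q ≟ 0ℚ
... | yes _  = 0ℚ
... | no q≢0 = _÷_ p q {{ℚ.≢-nonZero q≢0}}

ℕtoℚ : ℕ → ℚ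
ℕtoℚ n = ((+ n) ℚ./ 1)

sq : ℚ → ℚ
sq x = x * x

-- (-1)^x for a rational x that is an integer (junk value 0 otherwise;
-- in the theorem x is always an integer).
negOnePow : ℚ → ℚ
negOnePow (mkℚ z zero _) = if (ℤ.∣ z ∣ % 2) ℕ.≡ᵇ 0 then 1ℚ else (- 1ℚ)
negOnePow (mkℚ z (suc _) _) = 0ℚ

sumTo : ℕ → (ℕ → ℚ) → ℚ
sumTo zero    f = 0ℚ
sumTo (suc n) f = sumTo n f + f n

Series : Set
Series = ℕ → ℚ

oneS : Series
oneS zero    = 1ℚ
oneS (suc _) = 0ℚ

_⊛_ : Series → Series → Series
(f ⊛ g) k = sumTo (suc k) (λ i → f i * g (k ∸ i))

powS : Series → ℕ → Series
powS f zero    = oneS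
powS f (suc d) = powS f d ⊛ f

-- 1/(1 - q^(suc b)) = Σ_j q^((suc b) j)
geomInv : ℕ → Series
geomInv b j = if (j % suc b) ℕ.≡ᵇ 0 then 1ℚ else 0ℚ

invPoch : ℕ → Series
invPoch zero    = oneS
invPoch (suc m) = invPoch m ⊛ geomInv m

invPochVec : ∀ {d} → Vec ℕ d → Series
invPochVec []       = oneS
invPochVec (m ∷ ms) = invPoch m ⊛ invPochVec ms

coeffShiftℤ : ℤ → Series → ℤ → ℚ
coeffShiftℤ e S k with k ℤ.- e
... | + j      = S j
... | -[1+ _ ] = 0ℚ

coeffShiftℚ : ℚ → Series → ℤ → ℚ
coeffShiftℚ e S k with (k ℚ./ 1) - e
... | mkℚ (+ j) zero _ = S j
... | _                = 0ℚ

boxSumℕ : (d B : ℕ) → (Vec ℕ d → ℚ) → ℚ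
boxSumℕ zero    B f = f []
boxSumℕ (suc d) B f = sumTo (suc B) (λ i → boxSumℕ d B (λ v → f (i ∷ v)))

boxSumℤ : (d B : ℕ) → (Vec ℤ d → ℚ) → ℚ
boxSumℤ zero    B f = f []
boxSumℤ (suc d) B f =
  sumTo (suc (2 ℕ.* B)) (λ i → boxSumℤ d B (λ v → f ((+ i ℤ.- + B) ∷ v)))

-- ½ m C m^t = Σ m_i² - Σ m_i m_{i+1}
sumSqℕ : ∀ {d} → Vec ℕ d → ℤ
sumSqℕ []       = + 0
sumSqℕ (x ∷ xs) = + (x ℕ.* x) ℤ.+ sumSqℕ xs

adjProd : ∀ {d} → Vec ℕ d → ℤ
adjProd []           = + 0
adjProd (x ∷ [])     = + 0
adjProd (x ∷ y ∷ xs) = + (x ℕ.* y) ℤ.+ adjProd (y ∷ xs)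

halfmCm : ∀ {d} → Vec ℕ d → ℤ
halfmCm m = sumSqℕ m ℤ.- adjProd m

altSum : ∀ {d} → Vec ℕ d → ℤ
altSum []       = + 0
altSum (x ∷ xs) = + x ℤ.- altSum xs

lhsCoeff : (n : ℕ) → (∀ {d} → Vec ℕ d → ℤ) → ℕ → ℤ → ℚ
lhsCoeff n lin B k =
  boxSumℕ (2 ℕ.* n ∸ 1) B (λ m → coeffShiftℤ (halfmCm m ℤ.+ lin m) (invPochVec m) k)

noLin : ∀ {d} → Vec ℕ d → ℤ
noLin _ = + 0

sumV : ∀ {n} → Vec ℚ n → ℚ
sumV = foldr _ _+_ 0ℚ

normSq : ∀ {n} → Vec ℚ n → ℚ
normSq = foldr _ (λ x s → sq x + s) 0ℚ

prodV : ∀ {n} → Vec ℚ n → ℚ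
prodV = foldr _ _*_ 1ℚ

rhoFrom : (i n : ℕ) → Vec ℚ n
rhoFrom i zero    = []
rhoFrom i (suc n) = (ℕtoℚ (2 ℕ.* i ℕ.+ 1) ÷' ℕtoℚ 2) ∷ rhoFrom (suc i) n

ρ : (n : ℕ) → Vec ℚ n
ρ n = rhoFrom 0 n

addScalar : ∀ {n} → Vec ℚ n → ℚ → Vec ℚ n
addScalar w a = Data.Vec.map (λ x → x + a) w

ξ : ∀ {n} → Vec ℚ n → Vec ℚ n → ℚ
ξ []       []       = 1ℚ
ξ (x ∷ xs) (y ∷ ys) =
  prodV (zipWith (λ x' y' → (sq x - sq x') ÷' (sq y - sq y')) xs ys) * ξ xs ys

-- v = w + (2n+3) t, i.e. v ∈ (ℤ/2)^n with v_i ≡ w_i mod 2n+3 (w half-integral)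
shiftBy : ∀ {n} → ℕ → Vec ℚ n → Vec ℤ n → Vec ℚ n
shiftBy M w t = zipWith (λ wi ti → wi + ((+ M ℤ.* ti) ℚ./ 1)) w t

-- coefficient of q^k in
--   (1/(q)_B^(2n²-n)) Σ_{v = w + (2n+3)t, t ∈ {-B..B}^n}
--        ξ(v/ρ) (-1)^(|v|-|w|) q^((||v||²-||w||²)/(2(2n+3)))
-- (w = ρ or ρ+1; ξ is always relative to ρ, as in the paper)
rhsCoeff : (n : ℕ) → Vec ℚ n → ℕ → ℤ → ℚ
rhsCoeff n w B k =
  boxSumℤ n B (λ t →
    let v = shiftBy (2 ℕ.* n ℕ.+ 3) w t in
    ξ v (ρ n) * negOnePow (sumV v - sumV w)
      * coeffShiftℚ ((normSq v - normSq w) ÷' ℕtoℚ (2 ℕ.* (2 ℕ.* n ℕ.+ 3)))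
                    (powS (invPoch B) (2 ℕ.* n ℕ.* n ∸ n)) k)

{-# OPTIONS --safe #-}
module Submission where

-- The quadratic form ½ m C mᵗ (plus |m|₋ in the second case) is a sum of triangular numbers over
-- the steps of the path 0 → m₁ → … → m_{N-1} → 0, so the left-hand side is an N-fold iterate of a
-- kernel. The polynomials p_m of continuous big q-Hermite type intertwine this kernel with the
-- operator of multiplication by Σ_i q^{i(i+1)/2} z^i, and the left-hand side becomes
-- (q)_∞^{-N} u_N(j) with j = 0 or j = n, where u_N is the coefficient sequence of that theta series
-- to the N-th power times a quintuple product.
--
-- The sequence u_N is antisymmetric and quasi-periodic modulo N + 3 = 2n + 3, so only the n + 1
-- components c_r indexed by odd residues remain. As Σ_i (-1)^i q^{i(i+1)/2} = 0, each theta factor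
-- lowers the degree by one, and the signed moments of u_N of degree below N vanish. Pairing u_N with
-- a Vandermonde determinant in the squares of n of the residues isolates one component:
-- 2 c_r W = μ w, where w is the alternating theta sum over the remaining n residues, W the one over
-- all n + 1, and μ the N-th moment. The next moment and the heat equation of the theta sums give
-- P DW = e (DP) W for P = (q)_∞ and D = q d/dq, so W is a constant multiple of P^e; likewise μ is a
-- multiple of P^{3N+1}. Hence c_r is w times a power of P, up to a constant read off at q = 0.

open import Defs
open import Algebra.Bundles using (CommutativeRing)
import Algebra.Solver.Ring as RingSolver
import Algebra.Solver.Ring.AlmostCommutativeRing as ACR
open import Data.Bool using (if_then_else_)
open import Data.Empty using (⊥-elim)
open import Data.Integer as ℤ using (ℤ; +_; -[1+_])
import Data.Integer.Properties as ℤP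
open import Data.Integer.Solver using (module +-*-Solver)
open import Data.Maybe as Maybe using (Maybe)
open import Data.Nat as ℕ using (ℕ; zero; suc; _∸_; _≤_; _<_; z≤n; s≤s)
import Data.Nat.Coprimality as Coprimality
open import Data.Nat.DivMod using (_%_; m<n⇒m%n≡m; [m+n]%n≡m%n)
open import Data.Nat.Induction using (<-rec)
import Data.Nat.Properties as ℕP
import Data.Nat.Solver
open import Data.Product using (_×_; _,_; proj₁; proj₂; ∃)
open import Data.Rational as ℚ using (ℚ; 0ℚ; 1ℚ)
import Data.Rational.Properties as ℚP
import Data.Rational.Unnormalised as ℚᵘ
import Data.Rational.Unnormalised.Properties as ℚᵘP
open import Data.Sum using (_⊎_; inj₁; inj₂)
open import Data.Unit using (⊤; tt)
open import Data.Vec using (Vec; []; _∷_; zipWith)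
import Data.Vec as Vec
open import Data.Vec.Membership.Propositional using (_∈_)
open import Data.Vec.Relation.Unary.All using (All; []; _∷_)
open import Data.Vec.Relation.Unary.Any using (here; there)
open import Function using (_∘_; id)
open import Relation.Binary.PropositionalEquality hiding (J)
import Relation.Binary.Reasoning.Setoid as SetoidReasoning
open import Relation.Nullary using (yes; no)
open import Relation.Nullary.Decidable using (dec⇒maybe)
open import Tactic.RingSolver using (solve-∀)
open import Tactic.RingSolver.Core.AlmostCommutativeRing using (AlmostCommutativeRing; fromCommutativeRing)

-- The end condition of a path is a Kronecker delta in m. It becomes a value at 0 because the
-- quintuple product represents a functional that kills every p_m with m > 0, for δ = q in the first
-- case and for δ = 1 in the second. In the second case the kernel alone is not multiplication by a
-- theta series; it becomes one only after multiplication by 1 + 1/z, so the steps are treated in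
-- pairs that share this factor. The Vandermonde determinant involves n squares besides V², so its
-- degree in V is 2n = N, the first degree in which a signed moment survives. The relation 2 c_r W =
-- μ w contains two unknown series, c_r and W; a second relation is needed, and the moment of degree
-- N + 2 supplies it. No infinite product enters before the end. The reciprocal of P first appears
-- as the normalising constant of the kernel, fixed by the path with a single step, and Jacobi's
-- identity for P^3 comes out of comparing N = 0 with N = 1. The pentagonal number theorem then
-- links P to the finite products of the statement.

module ZS = +-*-Solver
module NS = Data.Nat.Solver.+-*-Solver

ℚ-ring : AlmostCommutativeRing _ _
ℚ-ring = fromCommutativeRing ℚP.+-*-commutativeRing (λ x → dec⇒maybe (0ℚ ℚP.≟ x))

-- Finite sums of rationals

sumTo-cong< : ∀ n {f g} → (∀ i → i < n → f i ≡ g i) → sumTo n f ≡ sumTo n g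
sumTo-cong< zero    e = refl
sumTo-cong< (suc n) e =
  cong₂ ℚ._+_ (sumTo-cong< n (λ i l → e i (ℕP.m<n⇒m<1+n l))) (e n ℕP.≤-refl)

sumTo-cong : ∀ n {f g} → (∀ i → f i ≡ g i) → sumTo n f ≡ sumTo n g
sumTo-cong n e = sumTo-cong< n (λ i _ → e i)

sumTo-0 : ∀ n {f} → (∀ i → i < n → f i ≡ 0ℚ) → sumTo n f ≡ 0ℚ
sumTo-0 zero    e = refl
sumTo-0 (suc n) e =
  trans (cong₂ ℚ._+_ (sumTo-0 n (λ i l → e i (ℕP.m<n⇒m<1+n l))) (e n ℕP.≤-refl)) (ℚP.+-identityˡ 0ℚ)

+-interchange : ∀ a b c d → (a ℚ.+ b) ℚ.+ (c ℚ.+ d) ≡ (a ℚ.+ c) ℚ.+ (b ℚ.+ d)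
+-interchange = solve-∀ ℚ-ring

sumTo-+ : ∀ n f g → sumTo n (λ i → f i ℚ.+ g i) ≡ sumTo n f ℚ.+ sumTo n g
sumTo-+ zero    f g = sym (ℚP.+-identityˡ 0ℚ)
sumTo-+ (suc n) f g =
  trans (cong (ℚ._+ (f n ℚ.+ g n)) (sumTo-+ n f g)) (+-interchange (sumTo n f) (sumTo n g) (f n) (g n))

sumTo-*ˡ : ∀ n c f → sumTo n (λ i → c ℚ.* f i) ≡ c ℚ.* sumTo n f
sumTo-*ˡ zero    c f = sym (ℚP.*-zeroʳ c)
sumTo-*ˡ (suc n) c f =
  trans (cong (ℚ._+ (c ℚ.* f n)) (sumTo-*ˡ n c f)) (sym (ℚP.*-distribˡ-+ c (sumTo n f) (f n)))

sumTo-neg : ∀ n f → sumTo n (λ i → ℚ.- f i) ≡ ℚ.- sumTo n f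
sumTo-neg zero    f = refl
sumTo-neg (suc n) f =
  trans (cong (ℚ._+ (ℚ.- f n)) (sumTo-neg n f)) (sym (ℚP.neg-distrib-+ (sumTo n f) (f n)))

sumTo-peel : ∀ n f → sumTo (suc n) f ≡ f 0 ℚ.+ sumTo n (f ∘ suc)
sumTo-peel zero    f = trans (ℚP.+-identityˡ (f 0)) (sym (ℚP.+-identityʳ (f 0)))
sumTo-peel (suc n) f =
  trans (cong (ℚ._+ f (suc n)) (sumTo-peel n f)) (ℚP.+-assoc (f 0) (sumTo n (f ∘ suc)) (f (suc n)))

sumTo-swap : ∀ m n (f : ℕ → ℕ → ℚ) →
  sumTo m (λ i → sumTo n (f i)) ≡ sumTo n (λ j → sumTo m (λ i → f i j))
sumTo-swap zero    n f = sym (sumTo-0 n (λ _ _ → refl))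
sumTo-swap (suc m) n f =
  trans (cong (ℚ._+ sumTo n (f m)) (sumTo-swap m n f))
        (sym (sumTo-+ n (λ j → sumTo m (λ i → f i j)) (f m)))

sumTo-split : ∀ m n f → sumTo (m ℕ.+ n) f ≡ sumTo m f ℚ.+ sumTo n (λ i → f (m ℕ.+ i))
sumTo-split m zero    f = trans (cong (λ x → sumTo x f) (ℕP.+-identityʳ m)) (sym (ℚP.+-identityʳ _))
sumTo-split m (suc n) f =
  trans (cong (λ x → sumTo x f) (ℕP.+-suc m n))
  (trans (cong (ℚ._+ f (m ℕ.+ n)) (sumTo-split m n f)) (ℚP.+-assoc (sumTo m f) _ _))

sumTo-extend : ∀ {m n} f → m ≤ n → (∀ i → m ≤ i → f i ≡ 0ℚ) → sumTo n f ≡ sumTo m f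
sumTo-extend {m} {n} f m≤n e =
  trans (cong (λ x → sumTo x f) (sym (ℕP.m+[n∸m]≡n m≤n)))
  (trans (sumTo-split m (n ∸ m) f)
  (trans (cong (sumTo m f ℚ.+_) (sumTo-0 (n ∸ m) (λ i _ → e (m ℕ.+ i) (ℕP.m≤m+n m i))))
         (ℚP.+-identityʳ _)))

-- Formal power series

infix 4 _≈_
record _≈_ (f g : Series) : Set where
  constructor mk≈
  field at : ∀ k → f k ≡ g k
open _≈_ public

≈-refl : ∀ {f} → f ≈ f
≈-refl .at k = refl

≈-sym : ∀ {f g} → f ≈ g → g ≈ f
≈-sym e .at k = sym (at e k)

≈-trans : ∀ {f g h} → f ≈ g → g ≈ h → f ≈ h
≈-trans e e′ .at k = trans (at e k) (at e′ k)

infixl 6 _⊕_ _⊖_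
infix 8 ⊝_
infixl 7 _·_
infixr 7 _∙_

opaque
  _⊕_ : Series → Series → Series
  (f ⊕ g) k = f k ℚ.+ g k

  ⊕-at : ∀ f g k → (f ⊕ g) k ≡ f k ℚ.+ g k
  ⊕-at f g k = refl

  ⊝_ : Series → Series
  (⊝ f) k = ℚ.- f k

  ⊝-at : ∀ f k → (⊝ f) k ≡ ℚ.- f k
  ⊝-at f k = refl

  0S : Series
  0S k = 0ℚ

  0S-at : ∀ k → 0S k ≡ 0ℚ
  0S-at k = refl

  _·_ : Series → Series → Series
  f · g = f ⊛ g

  ·-at : ∀ f g k → (f · g) k ≡ (f ⊛ g) k
  ·-at f g k = refl

  tl : Series → Series
  tl f k = f (suc k)

  ⊛-tl : ∀ f g k → (f ⊛ g) (suc k) ≡ f 0 ℚ.* g (suc k) ℚ.+ (tl f ⊛ g) k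
  ⊛-tl f g k = sumTo-peel (suc k) (λ i → f i ℚ.* g (suc k ∸ i))

  ⊛-tlʳ : ∀ f g k → (f ⊛ g) (suc k) ≡ (f ⊛ tl g) k ℚ.+ f (suc k) ℚ.* g 0
  ⊛-tlʳ f g k = cong₂ ℚ._+_
    (sumTo-cong< (suc k) (λ { i (s≤s l) → cong (λ x → f i ℚ.* g x) (ℕP.+-∸-assoc 1 l) }))
    (cong (λ x → f (suc k) ℚ.* g x) (ℕP.n∸n≡0 k))

  ⊛-comm : ∀ f g k → (f ⊛ g) k ≡ (g ⊛ f) k
  ⊛-comm f g zero    = cong (0ℚ ℚ.+_) (ℚP.*-comm (f 0) (g 0))
  ⊛-comm f g (suc k) =
    trans (⊛-tl f g k)
    (trans (cong₂ ℚ._+_ (ℚP.*-comm (f 0) (g (suc k))) (⊛-comm (tl f) g k))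
    (trans (ℚP.+-comm (g (suc k) ℚ.* f 0) _) (sym (⊛-tlʳ g f k))))

  ⊛-cong : ∀ {f f′ g g′} → f ≈ f′ → g ≈ g′ → (f ⊛ g) ≈ (f′ ⊛ g′)
  ⊛-cong e e′ .at k = sumTo-cong (suc k) (λ i → cong₂ ℚ._*_ (at e i) (at e′ (k ∸ i)))

  ⊛-distribˡ : ∀ f g h k → (f ⊛ (g ⊕ h)) k ≡ (f ⊛ g) k ℚ.+ (f ⊛ h) k
  ⊛-distribˡ f g h k =
    trans (sumTo-cong (suc k) (λ i → ℚP.*-distribˡ-+ (f i) (g (k ∸ i)) (h (k ∸ i))))
          (sumTo-+ (suc k) _ _)

  ⊛-distribʳ : ∀ f g h k → ((g ⊕ h) ⊛ f) k ≡ (g ⊛ f) k ℚ.+ (h ⊛ f) k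
  ⊛-distribʳ f g h k =
    trans (⊛-comm (g ⊕ h) f k)
    (trans (⊛-distribˡ f g h k) (cong₂ ℚ._+_ (⊛-comm f g k) (⊛-comm f h k)))

  _∙_ : ℚ → Series → Series
  (c ∙ f) k = c ℚ.* f k

  ∙-at : ∀ c f k → (c ∙ f) k ≡ c ℚ.* f k
  ∙-at c f k = refl

  ∙-⊛ : ∀ c f g k → ((c ∙ f) ⊛ g) k ≡ c ℚ.* (f ⊛ g) k
  ∙-⊛ c f g k =
    trans (sumTo-cong (suc k) (λ i → ℚP.*-assoc c (f i) (g (k ∸ i)))) (sumTo-*ˡ (suc k) c _)

  ⊛-assoc : ∀ f g h k → ((f ⊛ g) ⊛ h) k ≡ (f ⊛ (g ⊛ h)) k
  ⊛-assoc f g h zero    = assoc₀ (f 0) (g 0) (h 0)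
    where
    assoc₀ : ∀ a b c → 0ℚ ℚ.+ (0ℚ ℚ.+ a ℚ.* b) ℚ.* c ≡ 0ℚ ℚ.+ a ℚ.* (0ℚ ℚ.+ b ℚ.* c)
    assoc₀ = solve-∀ ℚ-ring
  ⊛-assoc f g h (suc k) = begin
    ((f ⊛ g) ⊛ h) (suc k)
      ≡⟨ ⊛-tl (f ⊛ g) h k ⟩
    (f ⊛ g) 0 ℚ.* h (suc k) ℚ.+ (tl (f ⊛ g) ⊛ h) k
      ≡⟨ cong (((f ⊛ g) 0 ℚ.* h (suc k)) ℚ.+_)
           (at (⊛-cong {g = h} (mk≈ {tl (f ⊛ g)} {(f 0 ∙ tl g) ⊕ (tl f ⊛ g)} (⊛-tl f g)) ≈-refl) k) ⟩
    (f ⊛ g) 0 ℚ.* h (suc k) ℚ.+ (((f 0 ∙ tl g) ⊕ (tl f ⊛ g)) ⊛ h) k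
      ≡⟨ cong (((f ⊛ g) 0 ℚ.* h (suc k)) ℚ.+_) (trans (⊛-distribʳ h (f 0 ∙ tl g) (tl f ⊛ g) k)
           (cong₂ ℚ._+_ (∙-⊛ (f 0) (tl g) h k) (⊛-assoc (tl f) g h k))) ⟩
    (f ⊛ g) 0 ℚ.* h (suc k) ℚ.+ (f 0 ℚ.* (tl g ⊛ h) k ℚ.+ (tl f ⊛ (g ⊛ h)) k)
      ≡⟨ regroup (f 0) (g 0) (h (suc k)) _ _ ⟩
    f 0 ℚ.* (g 0 ℚ.* h (suc k) ℚ.+ (tl g ⊛ h) k) ℚ.+ (tl f ⊛ (g ⊛ h)) k
      ≡⟨ cong (λ x → f 0 ℚ.* x ℚ.+ (tl f ⊛ (g ⊛ h)) k) (sym (⊛-tl g h k)) ⟩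
    f 0 ℚ.* (g ⊛ h) (suc k) ℚ.+ (tl f ⊛ (g ⊛ h)) k
      ≡⟨ sym (⊛-tl f (g ⊛ h) k) ⟩
    (f ⊛ (g ⊛ h)) (suc k) ∎
    where
    open ≡-Reasoning
    regroup : ∀ a b c d e → (0ℚ ℚ.+ a ℚ.* b) ℚ.* c ℚ.+ (a ℚ.* d ℚ.+ e) ≡ a ℚ.* (b ℚ.* c ℚ.+ d) ℚ.+ e
    regroup = solve-∀ ℚ-ring

  ⊛-identityˡ : ∀ f k → (oneS ⊛ f) k ≡ f k
  ⊛-identityˡ f zero    = trans (ℚP.+-identityˡ _) (ℚP.*-identityˡ (f 0))
  ⊛-identityˡ f (suc k) = trans (⊛-tl oneS f k)
    (trans (cong₂ ℚ._+_ (ℚP.*-identityˡ (f (suc k)))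
      (sumTo-0 (suc k) (λ i _ → ℚP.*-zeroˡ (f (k ∸ i))))) (ℚP.+-identityʳ _))

  ⊕-cong : ∀ {f f′ g g′} → f ≈ f′ → g ≈ g′ → f ⊕ g ≈ f′ ⊕ g′
  ⊕-cong e e′ .at k = cong₂ ℚ._+_ (at e k) (at e′ k)

  ⊝-cong : ∀ {f f′} → f ≈ f′ → ⊝ f ≈ ⊝ f′
  ⊝-cong e .at k = cong ℚ.-_ (at e k)

  ·-cong : ∀ {f f′ g g′} → f ≈ f′ → g ≈ g′ → f · g ≈ f′ · g′
  ·-cong = ⊛-cong

  ⊕-assoc : ∀ f g h → (f ⊕ g) ⊕ h ≈ f ⊕ (g ⊕ h)
  ⊕-assoc f g h .at k = ℚP.+-assoc (f k) (g k) (h k)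

  ⊕-comm : ∀ f g → f ⊕ g ≈ g ⊕ f
  ⊕-comm f g .at k = ℚP.+-comm (f k) (g k)

  ⊕-identityˡ : ∀ f → 0S ⊕ f ≈ f
  ⊕-identityˡ f .at k = ℚP.+-identityˡ (f k)

  ⊕-identityʳ : ∀ f → f ⊕ 0S ≈ f
  ⊕-identityʳ f .at k = ℚP.+-identityʳ (f k)

  ⊕-inverseˡ : ∀ f → ⊝ f ⊕ f ≈ 0S
  ⊕-inverseˡ f .at k = ℚP.+-inverseˡ (f k)

  ⊕-inverseʳ : ∀ f → f ⊕ ⊝ f ≈ 0S
  ⊕-inverseʳ f .at k = ℚP.+-inverseʳ (f k)

  ·-assoc : ∀ f g h → (f · g) · h ≈ f · (g · h)
  ·-assoc f g h = mk≈ (⊛-assoc f g h)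

  ·-comm : ∀ f g → f · g ≈ g · f
  ·-comm f g = mk≈ (⊛-comm f g)

  ·-identityˡ : ∀ f → oneS · f ≈ f
  ·-identityˡ f = mk≈ (⊛-identityˡ f)

  ·-identityʳ : ∀ f → f · oneS ≈ f
  ·-identityʳ f .at k = trans (⊛-comm f oneS k) (⊛-identityˡ f k)

  ·-distribˡ : ∀ f g h → f · (g ⊕ h) ≈ f · g ⊕ f · h
  ·-distribˡ f g h = mk≈ (⊛-distribˡ f g h)

  ·-distribʳ : ∀ f g h → (g ⊕ h) · f ≈ g · f ⊕ h · f
  ·-distribʳ f g h = mk≈ (⊛-distribʳ f g h)

_⊖_ : Series → Series → Series
f ⊖ g = f ⊕ (⊝ g)

S-commutativeRing : CommutativeRing _ _
S-commutativeRing = record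
  { Carrier = Series ; _≈_ = _≈_ ; _+_ = _⊕_ ; _*_ = _·_ ; -_ = ⊝_ ; 0# = 0S ; 1# = oneS
  ; isCommutativeRing = record
    { isRing = record
      { +-isAbelianGroup = record
        { isGroup = record
          { isMonoid = record
            { isSemigroup = record
              { isMagma = record
                { isEquivalence = record { refl = ≈-refl ; sym = ≈-sym ; trans = ≈-trans }
                ; ∙-cong = ⊕-cong }
              ; assoc = ⊕-assoc }
            ; identity = ⊕-identityˡ , ⊕-identityʳ }
          ; inverse = ⊕-inverseˡ , ⊕-inverseʳ
          ; ⁻¹-cong = ⊝-cong }
        ; comm = ⊕-comm }
      ; *-cong = ·-cong
      ; *-assoc = ·-assoc
      ; *-identity = ·-identityˡ , ·-identityʳ
      ; distrib = ·-distribˡ , ·-distribʳ }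
    ; *-comm = ·-comm } }

-- Constant series and a ring solver with integer coefficients

ℤ→ℚ : ℤ → ℚ
ℤ→ℚ z = z ℚ./ 1

private
  ι : ℤ → ℚᵘ.ℚᵘ
  ι z = z ℚᵘ./ 1

  toι : ∀ z → ℚ.toℚᵘ (ℤ→ℚ z) ℚᵘ.≃ ι z
  toι z = ℚP.toℚᵘ-fromℚᵘ (ι z)

ℤ→ℚ-+ : ∀ a b → ℤ→ℚ (a ℤ.+ b) ≡ ℤ→ℚ a ℚ.+ ℤ→ℚ b
ℤ→ℚ-+ a b = ℚP.toℚᵘ-injective
  (ℚᵘP.≃-trans (toι (a ℤ.+ b))
  (ℚᵘP.≃-trans (ℚᵘ.*≡* (cong (ℤ._* + 1) (sym (cong₂ ℤ._+_ (ℤP.*-identityʳ a) (ℤP.*-identityʳ b)))))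
  (ℚᵘP.≃-trans (ℚᵘP.+-cong (ℚᵘP.≃-sym (toι a)) (ℚᵘP.≃-sym (toι b)))
  (ℚᵘP.≃-sym (ℚP.toℚᵘ-homo-+ (ℤ→ℚ a) (ℤ→ℚ b))))))

ℤ→ℚ-* : ∀ a b → ℤ→ℚ (a ℤ.* b) ≡ ℤ→ℚ a ℚ.* ℤ→ℚ b
ℤ→ℚ-* a b = ℚP.toℚᵘ-injective
  (ℚᵘP.≃-trans (toι (a ℤ.* b))
  (ℚᵘP.≃-trans (ℚᵘP.*-cong (ℚᵘP.≃-sym (toι a)) (ℚᵘP.≃-sym (toι b)))
  (ℚᵘP.≃-sym (ℚP.toℚᵘ-homo-* (ℤ→ℚ a) (ℤ→ℚ b)))))

ℤ→ℚ-neg : ∀ a → ℤ→ℚ (ℤ.- a) ≡ ℚ.- ℤ→ℚ a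
ℤ→ℚ-neg a = ℚP.toℚᵘ-injective
  (ℚᵘP.≃-trans (toι (ℤ.- a))
  (ℚᵘP.≃-trans (ℚᵘP.-‿cong (ℚᵘP.≃-sym (toι a)))
  (ℚᵘP.≃-sym (ℚP.toℚᵘ-homo‿- (ℤ→ℚ a)))))

opaque
  unfolding _⊕_

  const : ℚ → Series
  const c zero    = c
  const c (suc _) = 0ℚ

  const-· : ∀ c f → const c · f ≈ c ∙ f
  const-· c f .at zero    = ℚP.+-identityˡ _
  const-· c f .at (suc k) = trans (⊛-tl (const c) f k)
    (trans (cong ((c ℚ.* f (suc k)) ℚ.+_) (sumTo-0 (suc k) (λ i _ → ℚP.*-zeroˡ (f (k ∸ i))))) (ℚP.+-identityʳ _))

  const-+ : ∀ a b → const (a ℚ.+ b) ≈ const a ⊕ const b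
  const-+ a b .at zero    = refl
  const-+ a b .at (suc k) = refl

  const-* : ∀ a b → const (a ℚ.* b) ≈ const a · const b
  const-* a b = ≈-sym (≈-trans (const-· a (const b)) (mk≈ λ { zero → refl ; (suc k) → ℚP.*-zeroʳ a }))

  const-neg : ∀ a → const (ℚ.- a) ≈ ⊝ const a
  const-neg a .at zero    = refl
  const-neg a .at (suc k) = refl

  const-cong : ∀ {a b} → a ≡ b → const a ≈ const b
  const-cong refl = ≈-refl

  const-0 : const 0ℚ ≈ 0S
  const-0 .at zero    = refl
  const-0 .at (suc k) = refl

  const-1 : const 1ℚ ≈ oneS
  const-1 .at zero    = refl
  const-1 .at (suc k) = refl

  const-at0 : ∀ c → const c 0 ≡ c
  const-at0 c = refl

ℤS : ℤ → Series
ℤS (+ 0)    = 0S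
ℤS (+ 1)    = oneS
ℤS -[1+ 0 ] = ⊝ oneS
ℤS z        = const (ℤ→ℚ z)

ℤS≈const : ∀ z → ℤS z ≈ const (ℤ→ℚ z)
ℤS≈const (+ 0)             = ≈-sym const-0
ℤS≈const (+ 1)             = ≈-sym const-1
ℤS≈const (+ suc (suc n))   = ≈-refl
ℤS≈const -[1+ 0 ]          = ≈-trans (⊝-cong (≈-sym const-1)) (≈-sym (const-neg 1ℚ))
ℤS≈const -[1+ suc n ]      = ≈-refl

ℤS-+ : ∀ a b → ℤS (a ℤ.+ b) ≈ ℤS a ⊕ ℤS b
ℤS-+ a b = ≈-trans (ℤS≈const (a ℤ.+ b)) (≈-trans (const-cong (ℤ→ℚ-+ a b))
  (≈-trans (const-+ _ _) (≈-sym (⊕-cong (ℤS≈const a) (ℤS≈const b)))))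

ℤS-* : ∀ a b → ℤS (a ℤ.* b) ≈ ℤS a · ℤS b
ℤS-* a b = ≈-trans (ℤS≈const (a ℤ.* b)) (≈-trans (const-cong (ℤ→ℚ-* a b))
  (≈-trans (const-* _ _) (≈-sym (·-cong (ℤS≈const a) (ℤS≈const b)))))

ℤS-neg : ∀ a → ℤS (ℤ.- a) ≈ ⊝ ℤS a
ℤS-neg a = ≈-trans (ℤS≈const (ℤ.- a)) (≈-trans (const-cong (ℤ→ℚ-neg a))
  (≈-trans (const-neg _) (⊝-cong (≈-sym (ℤS≈const a)))))

S-acr : ACR.AlmostCommutativeRing _ _
S-acr = ACR.fromCommutativeRing S-commutativeRing

ℤS-homomorphism : CommutativeRing.rawRing ℤP.+-*-commutativeRing ACR.-Raw-AlmostCommutative⟶ S-acr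
ℤS-homomorphism = record
  { ⟦_⟧ = ℤS ; +-homo = ℤS-+ ; *-homo = ℤS-* ; -‿homo = ℤS-neg ; 0-homo = ≈-refl ; 1-homo = ≈-refl }

ℤS-≟ : ∀ a b → Maybe (ℤS a ≈ ℤS b)
ℤS-≟ a b = Maybe.map (λ { refl → ≈-refl }) (dec⇒maybe (a ℤP.≟ b))

module SS = RingSolver (CommutativeRing.rawRing ℤP.+-*-commutativeRing) S-acr ℤS-homomorphism ℤS-≟

module SR = CommutativeRing S-commutativeRing
open SS using (solve; _:=_; _:+_; _:*_; _:-_; :-_; con)
open SetoidReasoning SR.setoid

⊖-cong : ∀ {f f′ g g′} → f ≈ f′ → g ≈ g′ → f ⊖ g ≈ f′ ⊖ g′
⊖-cong e e′ = ⊕-cong e (⊝-cong e′)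

⊕-congˡ : ∀ {f g g′} → g ≈ g′ → f ⊕ g ≈ f ⊕ g′
⊕-congˡ = ⊕-cong ≈-refl

⊕-congʳ : ∀ {f f′ g} → f ≈ f′ → f ⊕ g ≈ f′ ⊕ g
⊕-congʳ e = ⊕-cong e ≈-refl

·-congˡ : ∀ {f g g′} → g ≈ g′ → f · g ≈ f · g′
·-congˡ = ·-cong ≈-refl

·-congʳ : ∀ {f f′ g} → f ≈ f′ → f · g ≈ f′ · g
·-congʳ e = ·-cong e ≈-refl

≡⇒≈ : ∀ {f g} → f ≡ g → f ≈ g
≡⇒≈ refl = ≈-refl

opaque
  unfolding _⊕_

  qp : ℕ → Series
  qp zero    k       = oneS k
  qp (suc n) zero    = 0ℚ
  qp (suc n) (suc k) = qp n k

  qp0 : qp 0 ≈ oneS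
  qp0 .at k = refl

  qp-shift : ∀ n f k → (qp n · f) (n ℕ.+ k) ≡ f k
  qp-shift zero    f k = trans (at (·-cong {g = f} qp0 ≈-refl) k) (⊛-identityˡ f k)
  qp-shift (suc n) f k = trans (⊛-tl (qp (suc n)) f (n ℕ.+ k))
    (trans (cong₂ ℚ._+_ (ℚP.*-zeroˡ (f (suc (n ℕ.+ k)))) (qp-shift n f k)) (ℚP.+-identityˡ (f k)))

  qp-below : ∀ n f k → k < n → (qp n · f) k ≡ 0ℚ
  qp-below (suc n) f zero    _       = trans (ℚP.+-identityˡ _) (ℚP.*-zeroˡ (f 0))
  qp-below (suc n) f (suc k) (s≤s l) = trans (⊛-tl (qp (suc n)) f k)
    (trans (cong₂ ℚ._+_ (ℚP.*-zeroˡ (f (suc k))) (qp-below n f k l)) (ℚP.+-identityˡ 0ℚ))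

  qp-+ : ∀ m n → qp (m ℕ.+ n) ≈ qp m · qp n
  qp-+ m n = mk≈ λ k → sym (go m k)
    where
    go : ∀ m k → (qp m ⊛ qp n) k ≡ qp (m ℕ.+ n) k
    go zero    k       = trans (at (·-cong {g = qp n} qp0 ≈-refl) k) (⊛-identityˡ (qp n) k)
    go (suc m) zero    = trans (ℚP.+-identityˡ _) (ℚP.*-zeroˡ (qp n 0))
    go (suc m) (suc k) = trans (⊛-tl (qp (suc m)) (qp n) k)
      (trans (cong₂ ℚ._+_ (ℚP.*-zeroˡ (qp n (suc k))) (go m k)) (ℚP.+-identityˡ (qp (m ℕ.+ n) k)))

qp-cancel : ∀ n {f g} → qp n · f ≈ qp n · g → f ≈ g
qp-cancel n {f} {g} e .at k =
  trans (sym (qp-shift n f k)) (trans (at e (n ℕ.+ k)) (qp-shift n g k))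

qp-≡ : ∀ {m n} → m ≡ n → qp m ≈ qp n
qp-≡ refl = ≈-refl

-- Convergent families of series

-- `F i` is divisible by q to the power i + 1 - C, so each coefficient of the sum over i is a finite
-- sum with an explicit cutoff. The offset C is carried along because reindexing by one costs one
-- unit of it.
record Tame (C : ℕ) (F : ℕ → Series) : Set where
  constructor mkTame
  field tame : ∀ i k → k ℕ.+ C ≤ i → F i k ≡ 0ℚ
open Tame

tame-raise : ∀ {C C′ F} → C ≤ C′ → Tame C F → Tame C′ F
tame-raise C≤ t .tame i k l = tame t i k (ℕP.≤-trans (ℕP.+-monoʳ-≤ k C≤) l)

tame-cong : ∀ {C F G} → (∀ i → F i ≈ G i) → Tame C F → Tame C G
tame-cong e t .tame i k l = trans (sym (at (e i) k)) (tame t i k l)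

tame-qp : ∀ {C} (e : ℕ → ℕ) (F : ℕ → Series) → (∀ i → i < e i ℕ.+ C) → Tame C (λ i → qp (e i) · F i)
tame-qp {C} e F b .tame i k l = qp-below (e i) (F i) k (ℕP.+-cancelʳ-< C k (e i) (ℕP.≤-<-trans l (b i)))

opaque
  unfolding _⊕_

  tame-· : ∀ {C F} (X : ℕ → Series) → Tame C F → Tame C (λ i → X i · F i)
  tame-· {C} {F} X t .tame i k l = sumTo-0 (suc k) (λ j _ →
    trans (cong (X i j ℚ.*_) (tame t i (k ∸ j) (ℕP.≤-trans (ℕP.+-monoˡ-≤ C (ℕP.m∸n≤m k j)) l)))
          (ℚP.*-zeroʳ (X i j)))

  tsum : ℕ → (ℕ → Series) → Series
  tsum C F k = sumTo (k ℕ.+ C) (λ i → F i k)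

  tsum-at : ∀ C F k → tsum C F k ≡ sumTo (k ℕ.+ C) (λ i → F i k)
  tsum-at C F k = refl

  tsum-cong : ∀ C {F G} → (∀ i → F i ≈ G i) → tsum C F ≈ tsum C G
  tsum-cong C e .at k = sumTo-cong (k ℕ.+ C) (λ i → at (e i) k)

  tsum-⊕ : ∀ C F G → tsum C (λ i → F i ⊕ G i) ≈ tsum C F ⊕ tsum C G
  tsum-⊕ C F G .at k = sumTo-+ (k ℕ.+ C) _ _

  tsum-⊝ : ∀ C F → tsum C (λ i → ⊝ F i) ≈ ⊝ tsum C F
  tsum-⊝ C F .at k = sumTo-neg (k ℕ.+ C) _

  tsum-0 : ∀ C {F} → (∀ i → F i ≈ 0S) → tsum C F ≈ 0S
  tsum-0 C e .at k = sumTo-0 (k ℕ.+ C) (λ i _ → at (e i) k)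

  tsum-stable : ∀ {C F} → Tame C F → ∀ {B} k → k ℕ.+ C ≤ B → sumTo B (λ i → F i k) ≡ tsum C F k
  tsum-stable t k l = sumTo-extend _ l (λ i → tame t i k)

  tsum-raise : ∀ {C C′ F} → Tame C F → C ≤ C′ → tsum C′ F ≈ tsum C F
  tsum-raise t C≤ .at k = tsum-stable t k (ℕP.+-monoʳ-≤ k C≤)

  tsum-· : ∀ {C F} X → Tame C F → X · tsum C F ≈ tsum C (λ i → X · F i)
  tsum-· {C} {F} X t .at k = trans
    (sumTo-cong (suc k) (λ j → trans
      (cong (X j ℚ.*_) (sym (tsum-stable t (k ∸ j) (ℕP.+-monoˡ-≤ C (ℕP.m∸n≤m k j)))))
      (sym (sumTo-*ˡ (k ℕ.+ C) (X j) _))))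
    (sumTo-swap (suc k) (k ℕ.+ C) (λ j i → X j ℚ.* F i (k ∸ j)))

  tsum-peel : ∀ {C F} → Tame C F → tsum C F ≈ F 0 ⊕ tsum C (λ i → F (suc i))
  tsum-peel {C} {F} t .at k =
    trans (sym (tsum-stable t k (ℕP.n≤1+n (k ℕ.+ C)))) (sumTo-peel (k ℕ.+ C) (λ i → F i k))

  tsum-swap : ∀ C (F : ℕ → ℕ → Series) → tsum C (λ i → tsum C (F i)) ≈ tsum C (λ j → tsum C (λ i → F i j))
  tsum-swap C F .at k = sumTo-swap (k ℕ.+ C) (k ℕ.+ C) (λ i j → F i j k)

  tame-tsum : ∀ {C C′} (F : ℕ → ℕ → Series) → (∀ j → Tame C (λ i → F i j)) → Tame C (λ i → tsum C′ (F i))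
  tame-tsum {C} {C′} F t .tame i k l = sumTo-0 (k ℕ.+ C′) {λ j → F i j k} (λ j _ → tame (t j) i k l)

-- Sums over all integers and triangular exponents

record Tameℤ (C : ℕ) (f : ℤ → Series) : Set where
  constructor mkTameℤ
  field
    tame₊ : Tame C (λ i → f (+ i))
    tame₋ : Tame C (λ i → f -[1+ i ])
open Tameℤ

tameℤ-raise : ∀ {C C′ f} → C ≤ C′ → Tameℤ C f → Tameℤ C′ f
tameℤ-raise l (mkTameℤ t s) = mkTameℤ (tame-raise l t) (tame-raise l s)

tameℤ-cong : ∀ {C f g} → (∀ j → f j ≈ g j) → Tameℤ C f → Tameℤ C g
tameℤ-cong e (mkTameℤ t s) = mkTameℤ (tame-cong (λ i → e (+ i)) t) (tame-cong (λ i → e -[1+ i ]) s)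

tameℤ-· : ∀ {C f} (X : ℤ → Series) → Tameℤ C f → Tameℤ C (λ j → X j · f j)
tameℤ-· X (mkTameℤ t s) = mkTameℤ (tame-· (λ i → X (+ i)) t) (tame-· (λ i → X -[1+ i ]) s)

tameℤ-·ʳ : ∀ {C f} (X : ℤ → Series) → Tameℤ C f → Tameℤ C (λ j → f j · X j)
tameℤ-·ʳ {f = f} X t = tameℤ-cong (λ j → ·-comm (X j) (f j)) (tameℤ-· X t)

-- Size measured from the centre -1/2: it is invariant under `flip`, j ↦ -1 - j, which is also the
-- symmetry of the exponents j(j+1)/2.
∣_∣₋ : ℤ → ℕ
∣ + i ∣₋      = i
∣ -[1+ i ] ∣₋ = i

tameℤ-qp : ∀ {C} (e : ℤ → ℕ) (f : ℤ → Series) → (∀ j → ∣ j ∣₋ < e j ℕ.+ C) → Tameℤ C (λ j → qp (e j) · f j)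
tameℤ-qp e f b = mkTameℤ (tame-qp (λ i → e (+ i)) (λ i → f (+ i)) (λ i → b (+ i)))
                         (tame-qp (λ i → e -[1+ i ]) (λ i → f -[1+ i ]) (λ i → b -[1+ i ]))

tameℤ-at : ∀ {C f} → Tameℤ C f → ∀ j k → k ℕ.+ C ≤ ∣ j ∣₋ → f j k ≡ 0ℚ
tameℤ-at (mkTameℤ t s) (+ i)    k l = tame t i k l
tameℤ-at (mkTameℤ t s) -[1+ i ] k l = tame s i k l

mkTameℤ′ : ∀ {C f} → (∀ j k → k ℕ.+ C ≤ ∣ j ∣₋ → f j k ≡ 0ℚ) → Tameℤ C f
mkTameℤ′ t = mkTameℤ (mkTame (λ i → t (+ i))) (mkTame (λ i → t -[1+ i ]))

flip : ℤ → ℤ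
flip (+ i)    = -[1+ i ]
flip -[1+ i ] = + i

opaque
  sumℤ : ℕ → (ℤ → Series) → Series
  sumℤ C f = tsum C (λ i → f (+ i)) ⊕ tsum C (λ i → f -[1+ i ])

  sumℤ-def : ∀ C f → sumℤ C f ≈ tsum C (λ i → f (+ i)) ⊕ tsum C (λ i → f -[1+ i ])
  sumℤ-def C f = ≈-refl

  sumℤ-cong : ∀ C {f g} → (∀ j → f j ≈ g j) → sumℤ C f ≈ sumℤ C g
  sumℤ-cong C e = ⊕-cong (tsum-cong C (λ i → e (+ i))) (tsum-cong C (λ i → e -[1+ i ]))

  sumℤ-0 : ∀ C {f} → (∀ j → f j ≈ 0S) → sumℤ C f ≈ 0S
  sumℤ-0 C e = ≈-trans (⊕-cong (tsum-0 C (λ i → e (+ i))) (tsum-0 C (λ i → e -[1+ i ]))) (⊕-identityˡ 0S)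

  ⊕-interchange : ∀ a b c d → (a ⊕ b) ⊕ (c ⊕ d) ≈ (a ⊕ c) ⊕ (b ⊕ d)
  ⊕-interchange = solve 4 (λ a b c d → (a :+ b) :+ (c :+ d) := (a :+ c) :+ (b :+ d)) ≈-refl

  sumℤ-⊕ : ∀ C f g → sumℤ C (λ j → f j ⊕ g j) ≈ sumℤ C f ⊕ sumℤ C g
  sumℤ-⊕ C f g = ≈-trans (⊕-cong (tsum-⊕ C _ _) (tsum-⊕ C _ _)) (⊕-interchange _ _ _ _)

  sumℤ-⊝ : ∀ C f → sumℤ C (λ j → ⊝ f j) ≈ ⊝ sumℤ C f
  sumℤ-⊝ C f = ≈-trans (⊕-cong (tsum-⊝ C _) (tsum-⊝ C _))
    (solve 2 (λ a b → :- a :+ :- b := :- (a :+ b)) ≈-refl _ _)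

  sumℤ-· : ∀ {C f} X → Tameℤ C f → X · sumℤ C f ≈ sumℤ C (λ j → X · f j)
  sumℤ-· X (mkTameℤ t s) = ≈-trans (·-distribˡ X _ _) (⊕-cong (tsum-· X t) (tsum-· X s))

  sumℤ-raise : ∀ {C C′ f} → Tameℤ C f → C ≤ C′ → sumℤ C′ f ≈ sumℤ C f
  sumℤ-raise (mkTameℤ t s) l = ⊕-cong (tsum-raise t l) (tsum-raise s l)

  sumℤ-swap : ∀ C (F : ℤ → ℤ → Series) →
    sumℤ C (λ i → sumℤ C (F i)) ≈ sumℤ C (λ j → sumℤ C (λ i → F i j))
  sumℤ-swap C F = ≈-trans
    (⊕-cong (tsum-⊕ C _ _) (tsum-⊕ C _ _))
    (≈-trans (⊕-cong (⊕-cong (tsum-swap C _) (tsum-swap C _)) (⊕-cong (tsum-swap C _) (tsum-swap C _)))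
    (≈-trans (⊕-interchange _ _ _ _)
    (≈-sym (⊕-cong (tsum-⊕ C _ _) (tsum-⊕ C _ _)))))

  tsum-sumℤ-swap : ∀ C (F : ℕ → ℤ → Series) →
    tsum C (λ i → sumℤ C (F i)) ≈ sumℤ C (λ j → tsum C (λ i → F i j))
  tsum-sumℤ-swap C F = ≈-trans (tsum-⊕ C _ _) (⊕-cong (tsum-swap C _) (tsum-swap C _))

  sumℤ-flip : ∀ C f → sumℤ C (λ j → f (flip j)) ≈ sumℤ C f
  sumℤ-flip C f = ⊕-comm _ _

  sumℤ-shift : ∀ {C f} → Tameℤ C f → sumℤ (suc C) (λ j → f (ℤ.suc j)) ≈ sumℤ (suc C) f
  sumℤ-shift {C} {f} (mkTameℤ t s) = begin
    tsum (suc C) (λ i → f (+ suc i)) ⊕ tsum (suc C) (λ i → f (ℤ.suc -[1+ i ]))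
      ≈⟨ ⊕-cong ≈-refl (tsum-peel s′) ⟩
    tsum (suc C) (λ i → f (+ suc i)) ⊕ (f (+ 0) ⊕ tsum (suc C) (λ i → f -[1+ i ]))
      ≈⟨ solve 3 (λ a b c → a :+ (b :+ c) := (b :+ a) :+ c) ≈-refl _ _ _ ⟩
    (f (+ 0) ⊕ tsum (suc C) (λ i → f (+ suc i))) ⊕ tsum (suc C) (λ i → f -[1+ i ])
      ≈⟨ ⊕-cong (≈-sym (tsum-peel (tame-raise (ℕP.n≤1+n C) t))) ≈-refl ⟩
    tsum (suc C) (λ i → f (+ i)) ⊕ tsum (suc C) (λ i → f -[1+ i ]) ∎
    where
    s′ : Tame (suc C) (λ i → f (ℤ.suc -[1+ i ]))
    s′ .tame zero    k l = ⊥-elim (ℕP.<⇒≱ (ℕP.≤-trans (s≤s z≤n) (ℕP.≤-reflexive (sym (ℕP.+-suc k C)))) l)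
    s′ .tame (suc i) k l = tame s i k (ℕP.≤-pred (ℕP.≤-trans (ℕP.≤-reflexive (sym (ℕP.+-suc k C))) l))

T : ℕ → ℕ
T zero    = 0
T (suc i) = T i ℕ.+ suc i

i≤T : ∀ i → i ≤ T i
i≤T zero    = z≤n
i≤T (suc i) = ℕP.m≤n+m (suc i) (T i)

Tℤ : ℤ → ℕ
Tℤ (+ i)    = T i
Tℤ -[1+ i ] = T i

τ : ℤ → Series
τ j = qp (Tℤ j)

Tℤ-flip : ∀ j → Tℤ (flip j) ≡ Tℤ j
Tℤ-flip (+ i)    = refl
Tℤ-flip -[1+ i ] = refl

τ-flip : ∀ j → τ (flip j) ≈ τ j
τ-flip j = qp-≡ (Tℤ-flip j)

∣∣₋≤T : ∀ j → ∣ j ∣₋ ≤ Tℤ j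
∣∣₋≤T (+ i)    = i≤T i
∣∣₋≤T -[1+ i ] = i≤T i

Tℤ-bound : ∀ C j → ∣ j ∣₋ < Tℤ j ℕ.+ suc C
Tℤ-bound C j = ℕP.≤-trans (s≤s (∣∣₋≤T j)) (ℕP.≤-trans (ℕP.m≤m+n (suc (Tℤ j)) C) (ℕP.≤-reflexive (sym (ℕP.+-suc (Tℤ j) C))))

-- T(d+1) = T(d) + (d+1), multiplicatively, with the exponent d + 1 split as a - b.
τ-suc : ∀ d a b → + a ≡ ℤ.suc d ℤ.+ + b → qp b · τ (ℤ.suc d) ≈ qp a · τ d
τ-suc d a b e = ≈-trans (≈-sym (qp-+ b _)) (≈-trans (qp-≡ (go d e)) (qp-+ a _))
  where
  go : ∀ d → + a ≡ ℤ.suc d ℤ.+ + b → b ℕ.+ Tℤ (ℤ.suc d) ≡ a ℕ.+ Tℤ d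
  go (+ i) e with ℤP.+-injective e
  ... | refl = trans (cong (b ℕ.+_) (ℕP.+-comm (T i) (suc i)))
                 (trans (sym (ℕP.+-assoc b (suc i) (T i))) (cong (ℕ._+ T i) (ℕP.+-comm b (suc i))))
  go -[1+ zero ] e with ℤP.+-injective e
  ... | refl = refl
  go -[1+ suc i ] e = trans (cong (ℕ._+ T i) b≡) (trans (ℕP.+-assoc a (suc i) (T i)) (cong (a ℕ.+_) (ℕP.+-comm (suc i) (T i))))
    where
    b≡ : b ≡ a ℕ.+ suc i
    b≡ = ℤP.+-injective (trans (sym (trans (sym (ℤP.+-assoc (+ suc i) -[1+ i ] (+ b))) (trans (cong (ℤ._+ + b) (ℤP.+-inverseʳ (+ suc i))) (ℤP.+-identityˡ (+ b)))))
           (trans (cong (λ x → + suc i ℤ.+ x) (sym e)) (cong +_ (ℕP.+-comm (suc i) a))))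

-- A call of the ring solver first writes one side of a goal as the other side plus multiples of
-- differences l - r of known relations; each use of this lemma then removes one multiple. The
-- multipliers are the certificate of the elimination.
kill : ∀ {X l r} c → l ≈ r → X ⊕ c · (l ⊖ r) ≈ X
kill {X} {l} {r} c e = ≈-trans (⊕-congˡ (·-congˡ (⊕-congʳ e)))
  (solve 3 (λ X c r → X :+ c :* (r :- r) := X) ≈-refl X c r)

-- The recurrence of the q-Hermite polynomials

q : Series
q = qp 1

q^ : ℕ → Series
q^ zero    = oneS
q^ (suc m) = q · q^ m

qp≈q^ : ∀ m → qp m ≈ q^ m
qp≈q^ zero    = qp0
qp≈q^ (suc m) = ≈-trans (qp-+ 1 m) (·-congˡ (qp≈q^ m))

q^-+ : ∀ m n → q^ (m ℕ.+ n) ≈ q^ m · q^ n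
q^-+ zero    n = ≈-sym (·-identityˡ (q^ n))
q^-+ (suc m) n = ≈-trans (·-congˡ (q^-+ m n)) (≈-sym (·-assoc q (q^ m) (q^ n)))

q^-cancel : ∀ n {f g} → q^ n · f ≈ q^ n · g → f ≈ g
q^-cancel n e = qp-cancel n (≈-trans (·-congʳ (qp≈q^ n)) (≈-trans e (·-congʳ (≈-sym (qp≈q^ n)))))

qc : ℕ → Series
qc m = oneS ⊖ q^ m

prev : (ℕ → ℤ → Series) → ℕ → ℤ → Series
prev Y zero    j = 0S
prev Y (suc m) j = Y m j

rec : (δ γ : Series) → (ℕ → ℤ → Series) → ℕ → ℤ → Series
rec δ γ Y m j = ((δ · Y m (ℤ.suc j) ⊕ Y m (ℤ.pred j)) ⊕ (γ · q^ m) · Y m j) ⊖ (δ · qc m) · prev Y m j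

IsRec : (δ γ : Series) → (ℕ → ℤ → Series) → Set
IsRec δ γ Y = ∀ m j → Y (suc m) j ≈ rec δ γ Y m j

-- The three-term recurrence of the continuous big q-Hermite polynomials p_m in X = δz + 1/z,
-- acting on sequences through z ↦ shift.
pf : (δ γ : Series) → ℕ → (ℤ → Series) → ℤ → Series
pf δ γ zero          u j = u j
pf δ γ (suc zero)    u j = ((δ · u (ℤ.suc j) ⊕ u (ℤ.pred j)) ⊕ (γ · q^ 0) · u j) ⊖ (δ · qc 0) · 0S
pf δ γ (suc (suc m)) u j =
  ((δ · pf δ γ (suc m) u (ℤ.suc j) ⊕ pf δ γ (suc m) u (ℤ.pred j)) ⊕ (γ · q^ (suc m)) · pf δ γ (suc m) u j)
    ⊖ (δ · qc (suc m)) · pf δ γ m u j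

pf-rec : ∀ δ γ u → IsRec δ γ (λ m → pf δ γ m u)
pf-rec δ γ u zero    j = ≈-refl
pf-rec δ γ u (suc m) j = ≈-refl

-- With a - b = j + o, the factor q^(j+o) is the effect of z ↦ qz on coefficients of z^j. This is
-- the q-difference relation that lowers the degree m of the q-Hermite polynomials; the pair a, b
-- keeps negative powers of q away.
Lowered : (δ : Series) (o : ℤ) (Y Z : ℕ → ℤ → Series) → ℕ → Set
Lowered δ o Y Z m = ∀ j a b → + a ≡ (j ℤ.+ o) ℤ.+ + b →
  q^ a · Y m j ⊖ q^ b · Z m j ≈ qc m · ((δ · q^ a) · prev Y m (ℤ.suc j) ⊖ q^ b · prev Z m (ℤ.pred j))

module _ (δ γ : Series) (o : ℤ) (Y Z : ℕ → ℤ → Series) (recY : IsRec δ γ Y) (recZ : IsRec δ γ Z)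
         (base : ∀ j a b → + a ≡ (j ℤ.+ o) ℤ.+ + b → q^ a · Y 0 j ≈ q^ b · Z 0 j) where

  private
    up : ∀ j a b → + a ≡ (j ℤ.+ o) ℤ.+ + b → + suc a ≡ (ℤ.suc j ℤ.+ o) ℤ.+ + b
    up j a b e = trans (cong ℤ.suc e)
      (ZS.solve 3 (λ j o b → ZS.con (+ 1) ZS.:+ ((j ZS.:+ o) ZS.:+ b) ZS.:= ((ZS.con (+ 1) ZS.:+ j) ZS.:+ o) ZS.:+ b)
        refl j o (+ b))

    down : ∀ j a b → + a ≡ (j ℤ.+ o) ℤ.+ + b → + a ≡ (ℤ.pred j ℤ.+ o) ℤ.+ + suc b
    down j a b e = trans e
      (ZS.solve 3 (λ j o b → (j ZS.:+ o) ZS.:+ b ZS.:= ((ZS.con -[1+ 0 ] ZS.:+ j) ZS.:+ o) ZS.:+ (ZS.con (+ 1) ZS.:+ b))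
        refl j o (+ b))

    first : ∀ δ γ q x y Y₊ Y₀ Y₋ Z₊ Z₀ Z₋ →
      x · (((δ · Y₊ ⊕ Y₋) ⊕ (γ · oneS) · Y₀) ⊖ (δ · (oneS ⊖ oneS)) · 0S)
        ⊖ y · (((δ · Z₊ ⊕ Z₋) ⊕ (γ · oneS) · Z₀) ⊖ (δ · (oneS ⊖ oneS)) · 0S) ≈
      ((((oneS ⊖ q · oneS) · ((δ · x) · Y₊ ⊖ y · Z₋)
        ⊕ δ · ((q · x) · Y₊ ⊖ y · Z₊)) ⊕ oneS · (x · Y₋ ⊖ (q · y) · Z₋)) ⊕ γ · (x · Y₀ ⊖ y · Z₀))
    first = solve 11 (λ δ γ q x y Y₊ Y₀ Y₋ Z₊ Z₀ Z₋ →
      x :* (((δ :* Y₊ :+ Y₋) :+ (γ :* con (+ 1)) :* Y₀) :- (δ :* (con (+ 1) :- con (+ 1))) :* con (+ 0))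
        :- y :* (((δ :* Z₊ :+ Z₋) :+ (γ :* con (+ 1)) :* Z₀) :- (δ :* (con (+ 1) :- con (+ 1))) :* con (+ 0)) :=
      ((((con (+ 1) :- q :* con (+ 1)) :* ((δ :* x) :* Y₊ :- y :* Z₋)
        :+ δ :* ((q :* x) :* Y₊ :- y :* Z₊)) :+ con (+ 1) :* (x :* Y₋ :- (q :* y) :* Z₋)) :+ γ :* (x :* Y₀ :- y :* Z₀)))
      ≈-refl

    step : ∀ δ γ q Q x y Yp Y₀ Ym A₂ A₁ A₀ C₁ Zp Z₀ Zm B₀ B₁ B₂ D₁ →
        x · (((δ · Yp ⊕ Ym) ⊕ (γ · (q · Q)) · Y₀) ⊖ (δ · (oneS ⊖ q · Q)) · A₀)
          ⊖ y · (((δ · Zp ⊕ Zm) ⊕ (γ · (q · Q)) · Z₀) ⊖ (δ · (oneS ⊖ q · Q)) · B₀)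
        ≈ ((((((oneS ⊖ q · (q · Q)) · ((δ · x) · Yp ⊖ y · Zm)
          ⊕ δ · (((q · x) · Yp ⊖ y · Zp) ⊖ (oneS ⊖ q · Q) · ((δ · (q · x)) · A₂ ⊖ y · B₀)))
          ⊕ oneS · ((x · Ym ⊖ (q · y) · Zm) ⊖ (oneS ⊖ q · Q) · ((δ · x) · A₀ ⊖ (q · y) · B₂)))
          ⊕ (γ · (q · Q)) · ((x · Y₀ ⊖ y · Z₀) ⊖ (oneS ⊖ q · Q) · ((δ · x) · A₁ ⊖ y · B₁)))
          ⊕ (⊝ (q · ((oneS ⊖ q · Q) · (δ · x)))) · (Yp ⊖ (((δ · A₂ ⊕ A₀) ⊕ (γ · Q) · A₁) ⊖ (δ · (oneS ⊖ Q)) · C₁)))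
          ⊕ (q · ((oneS ⊖ q · Q) · y)) · (Zm ⊖ (((δ · B₀ ⊕ B₂) ⊕ (γ · Q) · B₁) ⊖ (δ · (oneS ⊖ Q)) · D₁)))
          ⊕ (⊝ (q · ((oneS ⊖ q · Q) · δ))) · ((x · A₀ ⊖ y · B₀) ⊖ (oneS ⊖ Q) · ((δ · x) · C₁ ⊖ y · D₁))
    step = solve 20 (λ δ γ q Q x y Yp Y₀ Ym A₂ A₁ A₀ C₁ Zp Z₀ Zm B₀ B₁ B₂ D₁ →
      x :* (((δ :* Yp :+ Ym) :+ (γ :* (q :* Q)) :* Y₀) :- (δ :* (con (+ 1) :- q :* Q)) :* A₀)
        :- y :* (((δ :* Zp :+ Zm) :+ (γ :* (q :* Q)) :* Z₀) :- (δ :* (con (+ 1) :- q :* Q)) :* B₀)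
      := ((((((con (+ 1) :- q :* (q :* Q)) :* ((δ :* x) :* Yp :- y :* Zm)
        :+ δ :* (((q :* x) :* Yp :- y :* Zp) :- (con (+ 1) :- q :* Q) :* ((δ :* (q :* x)) :* A₂ :- y :* B₀)))
        :+ con (+ 1) :* ((x :* Ym :- (q :* y) :* Zm) :- (con (+ 1) :- q :* Q) :* ((δ :* x) :* A₀ :- (q :* y) :* B₂)))
        :+ (γ :* (q :* Q)) :* ((x :* Y₀ :- y :* Z₀) :- (con (+ 1) :- q :* Q) :* ((δ :* x) :* A₁ :- y :* B₁)))
        :+ (:- (q :* ((con (+ 1) :- q :* Q) :* (δ :* x)))) :* (Yp :- (((δ :* A₂ :+ A₀) :+ (γ :* Q) :* A₁) :- (δ :* (con (+ 1) :- Q)) :* C₁)))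
        :+ (q :* ((con (+ 1) :- q :* Q) :* y)) :* (Zm :- (((δ :* B₀ :+ B₂) :+ (γ :* Q) :* B₁) :- (δ :* (con (+ 1) :- Q)) :* D₁)))
        :+ (:- (q :* ((con (+ 1) :- q :* Q) :* δ))) :* ((x :* A₀ :- y :* B₀) :- (con (+ 1) :- Q) :* ((δ :* x) :* C₁ :- y :* D₁))) ≈-refl

  -- Induction over two preceding degrees. After the recurrences of Y and Z in degree m + 2 are
  -- inserted, what remains is a combination of the relation in degree m + 1 at j - 1, j and j + 1,
  -- the relation in degree m at j, and one further recurrence each for Y and Z.
  lowering : ∀ m → Lowered δ o Y Z m
  lowering-suc : ∀ m → Lowered δ o Y Z (suc m)

  lowering zero j a b e = ≈-trans (⊖-cong (base j a b e) ≈-refl)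
    (≈-trans (⊕-inverseʳ _) (≈-sym (solve 3 (λ z x y → (con (+ 1) :- con (+ 1)) :* (z :* con (+ 0) :- y :* con (+ 0)) := con (+ 0))
      ≈-refl (δ · q^ a) (q^ a) (q^ b))))
  lowering (suc m) = lowering-suc m

  lowering-suc zero j a b e = begin
    q^ a · Y 1 j ⊖ q^ b · Z 1 j
      ≈⟨ ⊖-cong (·-congˡ (recY 0 j)) (·-congˡ (recZ 0 j)) ⟩
    q^ a · rec δ γ Y 0 j ⊖ q^ b · rec δ γ Z 0 j
      ≈⟨ first δ γ q (q^ a) (q^ b) _ _ _ _ _ _ ⟩
    _
      ≈⟨ kill γ (base j a b e) ⟩
    _
      ≈⟨ kill oneS (base (ℤ.pred j) a (suc b) (down j a b e)) ⟩
    _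
      ≈⟨ kill δ (base (ℤ.suc j) (suc a) b (up j a b e)) ⟩
    qc 1 · ((δ · q^ a) · Y 0 (ℤ.suc j) ⊖ q^ b · Z 0 (ℤ.pred j)) ∎
  lowering-suc (suc m) j a b e = begin
    q^ a · Y (suc (suc m)) j ⊖ q^ b · Z (suc (suc m)) j
      ≈⟨ ⊖-cong (·-congˡ (recY (suc m) j)) (·-congˡ (recZ (suc m) j)) ⟩
    q^ a · rec δ γ Y (suc m) j ⊖ q^ b · rec δ γ Z (suc m) j
      ≈⟨ step δ γ q (q^ m) (q^ a) (q^ b) _ _ _ (Y m (ℤ.suc (ℤ.suc j))) (Y m (ℤ.suc j)) (Y m j) (prev Y m (ℤ.suc j))
           _ _ _ (Z m j) (Z m (ℤ.pred j)) (Z m (ℤ.pred (ℤ.pred j))) (prev Z m (ℤ.pred j)) ⟩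
    _
      ≈⟨ kill _ (lowering m j a b e) ⟩
    _
      ≈⟨ kill _ (≈-trans (recZ m (ℤ.pred j)) (⊖-cong (⊕-congʳ (⊕-congʳ (·-congˡ (≡⇒≈ (cong (Z m) (ℤP.suc-pred j)))))) ≈-refl)) ⟩
    _
      ≈⟨ kill _ (≈-trans (recY m (ℤ.suc j)) (⊖-cong (⊕-congʳ (⊕-congˡ (≡⇒≈ (cong (Y m) (ℤP.pred-suc j))))) ≈-refl)) ⟩
    _
      ≈⟨ kill _ (lowering-suc m j a b e) ⟩
    _
      ≈⟨ kill _ (≈-trans (lowering-suc m (ℤ.pred j) a (suc b) (down j a b e))
            (·-congˡ (⊕-congʳ (·-congˡ (≡⇒≈ (cong (Y m) (ℤP.suc-pred j))))))) ⟩
    _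
      ≈⟨ kill _ (≈-trans (lowering-suc m (ℤ.suc j) (suc a) b (up j a b e))
            (·-congˡ (⊕-congˡ (⊝-cong (·-congˡ (≡⇒≈ (cong (Z m) (ℤP.pred-suc j)))))))) ⟩
    qc (suc (suc m)) · ((δ · q^ a) · Y (suc m) (ℤ.suc j) ⊖ q^ b · Z (suc m) (ℤ.pred j)) ∎

module _ {δ γ : Series} where

  rec-cong : ∀ {Y Z} m j → (∀ i → Y m i ≈ Z m i) → prev Y m j ≈ prev Z m j → rec δ γ Y m j ≈ rec δ γ Z m j
  rec-cong m j e p = ⊖-cong (⊕-cong (⊕-cong (·-congˡ (e _)) (e _)) (·-congˡ (e j))) (·-congˡ p)

  module _ {Y Z} (recY : IsRec δ γ Y) (recZ : IsRec δ γ Z) (base : ∀ j → Y 0 j ≈ Z 0 j) where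

    rec-unique : ∀ m j → Y m j ≈ Z m j
    prev-unique : ∀ m j → prev Y m j ≈ prev Z m j

    rec-unique zero    j = base j
    rec-unique (suc m) j = ≈-trans (recY m j)
      (≈-trans (rec-cong {Y} {Z} m j (rec-unique m) (prev-unique m j)) (≈-sym (recZ m j)))

    prev-unique zero    j = ≈-refl
    prev-unique (suc m) j = rec-unique m j

-- Linear operators that commute with the shift, as multiplication by a series in z does. They
-- commute with every p_m, since the recurrence of p_m is built from shifts and scalars only.
record Equivariant (Φ : (ℤ → Series) → ℤ → Series) : Set where
  field
    Φ-cong : ∀ {u v} → (∀ j → u j ≈ v j) → ∀ j → Φ u j ≈ Φ v j
    Φ-⊕    : ∀ u v j → Φ (λ i → u i ⊕ v i) j ≈ Φ u j ⊕ Φ v j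
    Φ-·    : ∀ c u j → Φ (λ i → c · u i) j ≈ c · Φ u j
    Φ-suc  : ∀ u j → Φ (λ i → u (ℤ.suc i)) j ≈ Φ u (ℤ.suc j)

  Φ-pred : ∀ u j → Φ (λ i → u (ℤ.pred i)) j ≈ Φ u (ℤ.pred j)
  Φ-pred u j = ≈-trans (≡⇒≈ (cong (Φ (λ i → u (ℤ.pred i))) (sym (ℤP.suc-pred j))))
    (≈-trans (≈-sym (Φ-suc (λ i → u (ℤ.pred i)) (ℤ.pred j)))
             (Φ-cong (λ i → ≡⇒≈ (cong u (ℤP.pred-suc i))) (ℤ.pred j)))

  Φ-0 : ∀ j → Φ (λ _ → 0S) j ≈ 0S
  Φ-0 j = ≈-trans (Φ-cong (λ _ → ≈-sym (SR.zeroˡ 0S)) j) (≈-trans (Φ-· 0S (λ _ → 0S) j) (SR.zeroˡ _))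

  Φ-⊖· : ∀ u c v j → Φ (λ i → u i ⊖ c · v i) j ≈ Φ u j ⊖ c · Φ v j
  Φ-⊖· u c v j = begin
    Φ (λ i → u i ⊖ c · v i) j
      ≈⟨ Φ-cong (λ i → solve 3 (λ u c v → u :- c :* v := u :+ (:- c) :* v) ≈-refl (u i) c (v i)) j ⟩
    Φ (λ i → u i ⊕ (⊝ c) · v i) j
      ≈⟨ ≈-trans (Φ-⊕ u (λ i → (⊝ c) · v i) j) (⊕-congˡ (Φ-· (⊝ c) v j)) ⟩
    Φ u j ⊕ (⊝ c) · Φ v j
      ≈⟨ solve 3 (λ u c v → u :+ (:- c) :* v := u :- c :* v) ≈-refl _ _ _ ⟩
    Φ u j ⊖ c · Φ v j ∎

  Φ-rec : ∀ {δ γ Y} → IsRec δ γ Y → IsRec δ γ (λ m → Φ (Y m))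
  Φ-rec {δ} {γ} {Y} recY m j = begin
    Φ (Y (suc m)) j
      ≈⟨ Φ-cong (recY m) j ⟩
    Φ (rec δ γ Y m) j
      ≈⟨ Φ-⊖· (λ i → (δ · Y m (ℤ.suc i) ⊕ Y m (ℤ.pred i)) ⊕ (γ · q^ m) · Y m i) (δ · qc m) (prev Y m) j ⟩
    _
      ≈⟨ ⊖-cong (≈-trans (Φ-⊕ _ _ j) (⊕-cong (≈-trans (Φ-⊕ _ _ j)
           (⊕-cong (≈-trans (Φ-· δ _ j) (·-congˡ (Φ-suc (Y m) j))) (Φ-pred (Y m) j))) (Φ-· _ _ j))) (·-congˡ (prev-Φ m)) ⟩
    rec δ γ (λ m → Φ (Y m)) m j ∎
    where
    prev-Φ : ∀ m → Φ (prev Y m) j ≈ prev (λ m → Φ (Y m)) m j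
    prev-Φ zero    = Φ-0 j
    prev-Φ (suc m) = ≈-refl

open Equivariant

pf-cong : ∀ δ γ {u v} → (∀ j → u j ≈ v j) → ∀ m j → pf δ γ m u j ≈ pf δ γ m v j
pf-cong δ γ {u} {v} = rec-unique (pf-rec δ γ u) (pf-rec δ γ v)

pf-Φ : ∀ {Φ} → Equivariant Φ → ∀ δ γ m u j → pf δ γ m (Φ u) j ≈ Φ (pf δ γ m u) j
pf-Φ {Φ} eq δ γ m u = rec-unique (pf-rec δ γ (Φ u)) (Φ-rec eq (pf-rec δ γ u)) (λ _ → ≈-refl) m

suc-equivariant : Equivariant (λ u j → u (ℤ.suc j))
suc-equivariant = record
  { Φ-cong = λ e j → e (ℤ.suc j) ; Φ-⊕ = λ _ _ _ → ≈-refl ; Φ-· = λ _ _ _ → ≈-refl ; Φ-suc = λ _ _ → ≈-refl }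

pf-⊕ : ∀ δ γ u v m j → pf δ γ m (λ i → u i ⊕ v i) j ≈ pf δ γ m u j ⊕ pf δ γ m v j
pf-⊕ δ γ u v = rec-unique (pf-rec δ γ _) recY⊕ (λ _ → ≈-refl)
  where
  Y = λ m → pf δ γ m u
  Z = λ m → pf δ γ m v
  prev-⊕ : ∀ m j → prev (λ m j → Y m j ⊕ Z m j) m j ≈ prev Y m j ⊕ prev Z m j
  prev-⊕ zero    j = ≈-sym (⊕-identityˡ 0S)
  prev-⊕ (suc m) j = ≈-refl
  recY⊕ : IsRec δ γ (λ m j → Y m j ⊕ Z m j)
  recY⊕ m j = ≈-trans (⊕-cong (pf-rec δ γ u m j) (pf-rec δ γ v m j))
    (≈-trans (solve 11 (λ δ γ Q c a b d p a′ b′ d′ → ((δ :* a :+ b) :+ Q :* d :- c :* p) :+ ((δ :* a′ :+ b′) :+ Q :* d′ :- c :* γ)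
          := (δ :* (a :+ a′) :+ (b :+ b′)) :+ Q :* (d :+ d′) :- c :* (p :+ γ)) ≈-refl
          δ (prev Z m j) (γ · q^ m) (δ · qc m) _ _ _ (prev Y m j) _ _ _)
       (⊖-cong ≈-refl (·-congˡ (≈-sym (prev-⊕ m j)))))

pf-· : ∀ δ γ c u m j → pf δ γ m (λ i → c · u i) j ≈ c · pf δ γ m u j
pf-· δ γ c u = rec-unique (pf-rec δ γ _) rec· (λ _ → ≈-refl)
  where
  Y = λ m → pf δ γ m u
  prev-· : ∀ m j → prev (λ m j → c · Y m j) m j ≈ c · prev Y m j
  prev-· zero    j = ≈-sym (·-0 c)
    where ·-0 = SR.zeroʳ
  prev-· (suc m) j = ≈-refl
  rec· : IsRec δ γ (λ m j → c · Y m j)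
  rec· m j = ≈-trans (·-congˡ (pf-rec δ γ u m j))
    (≈-trans (solve 8 (λ x δ Q c a b d p → x :* ((δ :* a :+ b) :+ Q :* d :- c :* p)
          := (δ :* (x :* a) :+ x :* b) :+ Q :* (x :* d) :- c :* (x :* p)) ≈-refl
          c δ (γ · q^ m) (δ · qc m) _ _ _ (prev Y m j))
       (⊖-cong ≈-refl (·-congˡ (≈-sym (prev-· m j)))))

-- Inverse q-Pochhammer symbols

geomInv-small : ∀ b k → k < suc b → geomInv b k ≡ oneS k
geomInv-small b k l = trans (cong (λ x → if x ℕ.≡ᵇ 0 then 1ℚ else 0ℚ) (m<n⇒m%n≡m l)) (go k)
  where
  go : ∀ k → (if k ℕ.≡ᵇ 0 then 1ℚ else 0ℚ) ≡ oneS k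
  go zero    = refl
  go (suc k) = refl

geomInv-periodic : ∀ b k → geomInv b (suc b ℕ.+ k) ≡ geomInv b k
geomInv-periodic b k = cong (λ x → if x ℕ.≡ᵇ 0 then 1ℚ else 0ℚ)
  (trans (cong (_% suc b) (ℕP.+-comm (suc b) k)) ([m+n]%n≡m%n k (suc b)))

geomInv-inverse : ∀ b → qc (suc b) · geomInv b ≈ oneS
geomInv-inverse b = ≈-trans (·-congʳ (⊖-cong {f = oneS} ≈-refl (≈-sym (qp≈q^ (suc b)))))
  (≈-trans (solve 2 (λ x g → (con (+ 1) :- x) :* g := g :- x :* g) ≈-refl (qp (suc b)) (geomInv b))
  (mk≈ λ k → trans (trans (⊕-at _ _ k) (cong (geomInv b k ℚ.+_) (⊝-at _ k))) (go k)))
  where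
  go : ∀ k → geomInv b k ℚ.+ ℚ.- ((qp (suc b) · geomInv b) k) ≡ oneS k
  go k with k ℕP.<? suc b
  ... | yes l = trans (cong₂ (λ x y → x ℚ.+ ℚ.- y) (geomInv-small b k l) (qp-below (suc b) (geomInv b) k l)) (ℚP.+-identityʳ _)
  ... | no ¬l with ℕP.m≤n⇒∃[o]m+o≡n (ℕP.≮⇒≥ ¬l)
  ...   | (k′ , refl) = trans (cong₂ (λ x y → x ℚ.+ ℚ.- y) (geomInv-periodic b k′) (qp-shift (suc b) (geomInv b) k′)) (ℚP.+-inverseʳ (geomInv b k′))

opaque
  unfolding _⊕_

  invPoch-suc : ∀ l → invPoch (suc l) ≈ invPoch l · geomInv l
  invPoch-suc l = ≈-refl

qc-invPoch : ∀ l → qc (suc l) · invPoch (suc l) ≈ invPoch l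
qc-invPoch l = ≈-trans (·-congˡ (invPoch-suc l))
  (≈-trans (solve 3 (λ c i g → c :* (i :* g) := i :* (c :* g)) ≈-refl (qc (suc l)) (invPoch l) (geomInv l))
  (≈-trans (·-congˡ (geomInv-inverse l)) (·-identityʳ (invPoch l))))

-- The kernel and its iterates

module Kernel (α : ℕ) where

  δ : Series
  δ = q^ α

  κ : ℕ → ℕ → Series
  κ l m = τ (+ l ℤ.- + (m ℕ.+ α))

  κ-suc : ∀ l m → κ (suc l) (suc m) ≡ κ l m
  κ-suc l m = cong τ (ZS.solve 2 (λ l x → (ZS.con (+ 1) ZS.:+ l) ZS.:- (ZS.con (+ 1) ZS.:+ x) ZS.:= l ZS.:- x) refl (+ l) (+ (m ℕ.+ α)))

  -- T(d) - T(d-1) = d for d = l - m - α, arranged so that no exponent is negative.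
  κ-ratio : ∀ l m → q^ l · κ l (suc m) ≈ (δ · q^ m) · κ l m
  κ-ratio l m = ≈-sym (begin
    (δ · q^ m) · κ l m
      ≈⟨ ·-congʳ (≈-trans (·-comm δ (q^ m)) (≈-trans (≈-sym (q^-+ m α)) (≈-sym (qp≈q^ (m ℕ.+ α))))) ⟩
    qp (m ℕ.+ α) · κ l m
      ≈⟨ ·-congˡ (≡⇒≈ (cong τ (ZS.solve 2 (λ l x → l ZS.:- x ZS.:= ZS.con (+ 1) ZS.:+ (l ZS.:- (ZS.con (+ 1) ZS.:+ x))) refl (+ l) (+ (m ℕ.+ α))))) ⟩
    qp (m ℕ.+ α) · τ (ℤ.suc (+ l ℤ.- + suc (m ℕ.+ α)))
      ≈⟨ τ-suc (+ l ℤ.- + suc (m ℕ.+ α)) l (m ℕ.+ α) (ZS.solve 2 (λ l x → l ZS.:= (ZS.con (+ 1) ZS.:+ (l ZS.:- (ZS.con (+ 1) ZS.:+ x))) ZS.:+ x) refl (+ l) (+ (m ℕ.+ α))) ⟩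
    qp l · κ l (suc m)
      ≈⟨ ·-congʳ (qp≈q^ l) ⟩
    q^ l · κ l (suc m) ∎)

  κ-bound : ∀ l m → l < Tℤ (+ l ℤ.- + (m ℕ.+ α)) ℕ.+ suc (m ℕ.+ α)
  κ-bound l m with n ← m ℕ.+ α rewrite ℤP.m-n≡m⊖n l n with n ℕP.≤? l
  ... | yes n≤l rewrite ℤP.⊖-≥ n≤l = ℕP.≤-trans (s≤s (ℕP.≤-trans (ℕP.≤-reflexive (sym (ℕP.m∸n+n≡m n≤l))) (ℕP.+-monoˡ-≤ n (i≤T (l ∸ n)))))
                                         (ℕP.≤-reflexive (sym (ℕP.+-suc (T (l ∸ n)) n)))
  ... | no  n≰l = ℕP.≤-trans (ℕP.m≤n⇒m≤1+n (ℕP.≰⇒> n≰l)) (ℕP.m≤n+m (suc n) _)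

  tame-κ : ∀ m (F : ℕ → Series) → Tame (suc (m ℕ.+ α)) (λ l → κ l m · F l)
  tame-κ m F = tame-qp _ F (λ l → κ-bound l m)

  weight : ℕ → ℕ → Series
  weight l m = κ l m · invPoch l

  tame-weight : ∀ m (F : ℕ → Series) → Tame (suc (m ℕ.+ α)) (λ l → weight l m · F l)
  tame-weight m F = tame-cong (λ l → ≈-sym (·-assoc (κ l m) (invPoch l) (F l))) (tame-κ m (λ l → invPoch l · F l))

  -- The kernel is applied to the polynomials with γ = q, and as a function of m the result obeys
  -- the recurrence with γ = δ. For α = 1 the two families coincide; for α = 0 they differ, which is
  -- why the alternating case needs two families.
  R : ℕ → (ℤ → Series) → ℤ → Series
  R m u j = tsum (suc (m ℕ.+ α)) (λ l → weight l m · pf δ q l u j)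

  R-equivariant : ∀ m → Equivariant (R m)
  R-equivariant m = record
    { Φ-cong = λ e j → tsum-cong _ (λ l → ·-congˡ (pf-cong δ q e l j))
    ; Φ-⊕ = λ u v j → ≈-trans (tsum-cong _ (λ l → ≈-trans (·-congˡ (pf-⊕ δ q u v l j)) (·-distribˡ _ _ _))) (tsum-⊕ _ _ _)
    ; Φ-· = λ c u j → ≈-trans (tsum-cong _ (λ l → ≈-trans (·-congˡ (pf-· δ q c u l j))
         (solve 3 (λ w c x → w :* (c :* x) := c :* (w :* x)) ≈-refl (weight l m) c _)))
         (≈-sym (tsum-· c (tame-weight m _)))
    ; Φ-suc = λ u j → tsum-cong _ (λ l → ·-congˡ (pf-Φ suc-equivariant δ q l u j)) }

  tsum-R : ∀ {C m} u j → suc (m ℕ.+ α) ≤ C → tsum C (λ l → weight l m · pf δ q l u j) ≈ R m u j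
  tsum-R {m = m} u j l = tsum-raise (tame-weight m _) l

  -- Rearranging X p_l = p_{l+1} - q^{l+1} p_l + δ(1 - q^l) p_{l-1} by coefficients of p_l.
  R-rec : ∀ u → IsRec δ δ (λ m → R m u)
  R-rec u m j = begin
    R (suc m) u j
      ≈⟨ ≈-sym (tsum-R u j C₁) ⟩
    tsum C (λ l → weight l (suc m) · p l j)
      ≈⟨ tsum-cong C pointwise ⟩
    tsum C (λ l → ((((δ · (weight l m · p l (ℤ.suc j)) ⊕ weight l m · p l (ℤ.pred j)) ⊕ (δ · q^ m) · (weight l m · p l j))
        ⊖ (δ · qc m) · prevW l) ⊕ (A l ⊖ weight l m · p (suc l) j)) ⊕ (B l ⊖ weight l m · ((δ · qc l) · prev p l j)))
      ≈⟨ ≈-trans (tsum-⊕ C _ _) (⊕-cong (≈-trans (tsum-⊕ C _ _)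
           (⊕-cong (≈-trans (tsum-⊕ C _ _) (⊕-cong (≈-trans (tsum-⊕ C _ _) (⊕-cong (tsum-⊕ C _ _) ≈-refl)) ≈-refl)) (tsum-⊕ C _ _))) (tsum-⊕ C _ _)) ⟩
    ((((tsum C (λ l → δ · (weight l m · p l (ℤ.suc j))) ⊕ tsum C (λ l → weight l m · p l (ℤ.pred j)))
       ⊕ tsum C (λ l → (δ · q^ m) · (weight l m · p l j))) ⊕ tsum C (λ l → ⊝ ((δ · qc m) · prevW l)))
       ⊕ (tsum C A ⊕ tsum C (λ l → ⊝ (weight l m · p (suc l) j))))
       ⊕ (tsum C B ⊕ tsum C (λ l → ⊝ (weight l m · ((δ · qc l) · prev p l j))))
      ≈⟨ ⊕-cong (⊕-cong (⊕-cong (⊕-cong (⊕-cong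
            (≈-trans (≈-sym (tsum-· δ (tm (λ l → p l (ℤ.suc j))))) (·-congˡ (tsum-R u _ C₀)))
            (tsum-R u _ C₀))
            (≈-trans (≈-sym (tsum-· (δ · q^ m) (tm (λ l → p l j)))) (·-congˡ (tsum-R u _ C₀))))
            (≈-trans (tsum-⊝ C _) (⊝-cong (sumPrev m))))
            (≈-trans (⊕-cong peelA (tsum-⊝ C _)) (⊕-inverseʳ _)))
            (≈-trans (⊕-cong (≈-sym peelB) (tsum-⊝ C _)) (⊕-inverseʳ _)) ⟩
    (rec δ δ (λ m → R m u) m j ⊕ 0S) ⊕ 0S
      ≈⟨ ≈-trans (⊕-identityʳ _) (⊕-identityʳ _) ⟩
    rec δ δ (λ m → R m u) m j ∎
    where
    C = suc (suc (m ℕ.+ α))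
    C₁ : suc (suc m ℕ.+ α) ≤ C
    C₁ = ℕP.≤-refl
    C₀ : suc (m ℕ.+ α) ≤ C
    C₀ = ℕP.n≤1+n _
    p : ℕ → ℤ → Series
    p l = pf δ q l u
    tm : ∀ F → Tame C (λ l → weight l m · F l)
    tm F = tame-raise C₀ (tame-weight m F)
    -- The index shift l ↦ l + 1 and the cancellation of 1 - q^(l+1) against (q)_(l+1) turn the sum
    -- of `A` into that of the terms with p_(l+1). The same shift turns the terms with p_(l-1) into
    -- `B`, so the last two differences of the expansion vanish after summation.
    A B prevW : ℕ → Series
    A l = weight l (suc m) · (qc l · p l j)
    B l = δ · (weight (suc l) m · (qc (suc l) · p l j))
    prevW l = weight (suc l) m · (qc (suc l) · p l j)
    peelA : tsum C A ≈ tsum C (λ l → weight l m · p (suc l) j)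
    peelA = ≈-trans (tsum-peel (tame-weight (suc m) (λ l → qc l · p l j)))
      (≈-trans (⊕-cong (≈-trans (·-congˡ (≈-trans (·-congʳ (⊕-inverseʳ oneS)) (SR.zeroˡ _))) (SR.zeroʳ _))
        (tsum-cong C (λ l → ≈-trans (solve 4 (λ k i c x → (k :* i) :* (c :* x) := (k :* (c :* i)) :* x) ≈-refl
            (κ (suc l) (suc m)) (invPoch (suc l)) (qc (suc l)) _)
          (·-congʳ (·-cong (≡⇒≈ (κ-suc l m)) (qc-invPoch l)))))) (⊕-identityˡ _))
    peelB : tsum C (λ l → weight l m · ((δ · qc l) · prev p l j)) ≈ tsum C B
    peelB = ≈-trans (tsum-peel (tm (λ l → (δ · qc l) · prev p l j)))
      (≈-trans (⊕-cong (≈-trans (·-congˡ (SR.zeroʳ _)) (SR.zeroʳ _))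
        (tsum-cong C (λ l → solve 4 (λ w d c x → w :* ((d :* c) :* x) := d :* (w :* (c :* x))) ≈-refl
            (weight (suc l) m) δ (qc (suc l)) _))) (⊕-identityˡ _))
    sumPrev : ∀ m → tsum (suc (suc (m ℕ.+ α))) (λ l → (δ · qc m) · (weight (suc l) m · (qc (suc l) · p l j)))
                  ≈ (δ · qc m) · prev (λ m → R m u) m j
    sumPrev zero    = ≈-trans (tsum-0 _ (λ l → ≈-trans (·-congʳ (≈-trans (·-congˡ (⊕-inverseʳ oneS)) (SR.zeroʳ δ))) (SR.zeroˡ _))) (≈-sym (SR.zeroʳ _))
    sumPrev (suc m) = ≈-trans (tsum-cong _ (λ l → ·-congˡ (≈-trans
        (solve 4 (λ k i c x → (k :* i) :* (c :* x) := (k :* (c :* i)) :* x) ≈-refl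
            (κ (suc l) (suc m)) (invPoch (suc l)) (qc (suc l)) _)
          (·-congʳ (·-cong (≡⇒≈ (κ-suc l m)) (qc-invPoch l))))))
      (≈-trans (≈-sym (tsum-· _ (tame-raise (ℕP.≤-trans (ℕP.n≤1+n _) (ℕP.n≤1+n _)) (tame-weight m (λ l → p l j)))))
         (·-congˡ (tsum-R u j (ℕP.≤-trans (ℕP.n≤1+n _) (ℕP.n≤1+n _)))))
    pointwise : ∀ l → weight l (suc m) · p l j ≈
      (((((δ · (weight l m · p l (ℤ.suc j)) ⊕ weight l m · p l (ℤ.pred j)) ⊕ (δ · q^ m) · (weight l m · p l j))
        ⊖ (δ · qc m) · prevW l) ⊕ (A l ⊖ weight l m · p (suc l) j)) ⊕ (B l ⊖ weight l m · ((δ · qc l) · prev p l j)))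
    pointwise l = ≈-sym (begin
      _
        ≈⟨ solve 15 (λ δ q Q Qm k′ k k⁺ i i⁺ c⁺ Pp Pm P₀ pp p⁺ →
             (((((δ :* ((k :* i) :* Pp) :+ (k :* i) :* Pm) :+ (δ :* Qm) :* ((k :* i) :* P₀))
               :- (δ :* (con (+ 1) :- Qm)) :* ((k⁺ :* i⁺) :* (c⁺ :* P₀))) :+ ((k′ :* i) :* ((con (+ 1) :- Q) :* P₀) :- (k :* i) :* p⁺))
               :+ (δ :* ((k⁺ :* i⁺) :* (c⁺ :* P₀)) :- (k :* i) :* ((δ :* (con (+ 1) :- Q)) :* pp)))
             := ((((k′ :* i) :* P₀) :+ (:- (i :* P₀)) :* (Q :* k′ :- (δ :* Qm) :* k)) :+ (:- (i :* P₀)) :* ((q :* Q) :* k :- (δ :* Qm) :* k⁺)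
                :+ (:- (k :* i)) :* (p⁺ :- (((δ :* Pp :+ Pm) :+ (q :* Q) :* P₀) :- (δ :* (con (+ 1) :- Q)) :* pp)))
                :+ ((δ :* Qm) :* k⁺ :* P₀) :* (c⁺ :* i⁺ :- i)) ≈-refl
             δ q (q^ l) (q^ m) (κ l (suc m)) (κ l m) (κ (suc l) m) (invPoch l) (invPoch (suc l)) (qc (suc l))
             (p l (ℤ.suc j)) (p l (ℤ.pred j)) (p l j) (prev p l j) (p (suc l) j) ⟩
      _
        ≈⟨ kill _ (qc-invPoch l) ⟩
      _
        ≈⟨ kill _ (pf-rec δ q u l j) ⟩
      _
        ≈⟨ kill _ (≈-trans (·-congˡ (≡⇒≈ (sym (κ-suc l m)))) (κ-ratio (suc l) m)) ⟩
      _
        ≈⟨ kill _ (κ-ratio l m) ⟩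
      weight l (suc m) · p l j ∎)

  -- Both sides obey the recurrence with γ = δ and agree at m = 0. The dependence of the kernel on m
  -- is thereby moved into the polynomial, and only the operator R_0 remains to be identified.
  R-reduce : ∀ m u j → R m u j ≈ R 0 (pf δ δ m u) j
  R-reduce m u j = rec-unique (R-rec u) (Φ-rec (R-equivariant 0) (pf-rec δ δ u)) (λ _ → ≈-refl) m j

·-zeroˡ : ∀ {f} g → f ≈ 0S → f · g ≈ 0S
·-zeroˡ g e = ≈-trans (·-congʳ e) (SR.zeroˡ g)

·-zeroʳ : ∀ f {g} → g ≈ 0S → f · g ≈ 0S
·-zeroʳ f e = ≈-trans (·-congˡ e) (SR.zeroʳ f)

≈0-at : ∀ {f} → f ≈ 0S → ∀ k → f k ≡ 0ℚ
≈0-at e k = trans (at e k) (0S-at k)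

sumℤ-indep : ∀ {C C′ f} → Tameℤ C f → Tameℤ C′ f → sumℤ C f ≈ sumℤ C′ f
sumℤ-indep {C} {C′} t t′ = ≈-trans (≈-sym (sumℤ-raise t (ℕP.m≤m+n C C′))) (sumℤ-raise t′ (ℕP.m≤n+m C′ C))

-- The kernel at m = 0 as a convolution

conv-tame : ∀ C (v : ℤ → Series) → Tameℤ (suc C) (λ i → τ i · v i)
conv-tame C v = tameℤ-qp Tℤ v (Tℤ-bound C)

conv : (ℤ → Series) → ℤ → Series
conv u j = sumℤ 2 (λ i → τ i · u (j ℤ.+ i))

δ₀ : ℤ → Series
δ₀ (+ zero)  = oneS
δ₀ (+ suc _) = 0S
δ₀ -[1+ _ ]  = 0S

neg-pred : ∀ s → ℤ.- (ℤ.pred s) ≡ ℤ.suc (ℤ.- s)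
neg-pred s = ZS.solve 1 (λ s → ZS.:- (ZS.con -[1+ 0 ] ZS.:+ s) ZS.:= ZS.con (+ 1) ZS.:+ (ZS.:- s)) refl s

neg-suc : ∀ s → ℤ.- (ℤ.suc s) ≡ ℤ.pred (ℤ.- s)
neg-suc s = ZS.solve 1 (λ s → ZS.:- (ZS.con (+ 1) ZS.:+ s) ZS.:= ZS.con -[1+ 0 ] ZS.:+ (ZS.:- s)) refl s

<-pred : ∀ {l} s → suc l < ∣ s ∣₋ → l < ∣ ℤ.pred s ∣₋
<-pred (+ suc i)    (s≤s p) = p
<-pred -[1+ i ]     p       = ℕP.<-trans (ℕP.n<1+n _) (ℕP.m<n⇒m<1+n p)

<-suc : ∀ {l} s → suc l < ∣ s ∣₋ → l < ∣ ℤ.suc s ∣₋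
<-suc (+ i)          p       = ℕP.<-trans (ℕP.n<1+n _) (ℕP.m<n⇒m<1+n p)
<-suc -[1+ suc i ]   (s≤s p) = p

τ-unique : ∀ (h : ℤ → Series) → (∀ n → h (+ suc n) ≈ q^ (suc n) · h (+ n)) → h -[1+ 0 ] ≈ h (+ 0) →
  (∀ n → h -[1+ suc n ] ≈ q^ (suc n) · h -[1+ n ]) → ∀ s → h s ≈ τ s · h (+ 0)
τ-unique h up mid down = go
  where
  step : ∀ n {x y z} → y ≈ q^ (suc n) · x → x ≈ qp (T n) · z → y ≈ qp (T (suc n)) · z
  step n {x} {y} {z} e e′ = ≈-trans e (≈-trans (·-cong (≈-sym (qp≈q^ (suc n))) e′)
    (≈-trans (solve 3 (λ a b z → a :* (b :* z) := (b :* a) :* z) ≈-refl (qp (suc n)) (qp (T n)) z)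
             (·-congʳ (≈-sym (qp-+ (T n) (suc n))))))
  unit : ∀ {x} → x ≈ qp 0 · x
  unit = ≈-sym (≈-trans (·-congʳ qp0) (·-identityˡ _))
  go : ∀ s → h s ≈ τ s · h (+ 0)
  go (+ zero)       = unit
  go (+ suc n)      = step n (up n) (go (+ n))
  go -[1+ zero ]    = ≈-trans mid unit
  go -[1+ suc n ]   = step n (down n) (go -[1+ n ])

module Coefficients (α : ℕ) where
  open Kernel α public

  -- Coefficients of p_l as a Laurent polynomial in the shift: `E l s` multiplies u(j + s). The
  -- argument is negated because p_l is read off from its action on a delta at 0.
  E : ℕ → ℤ → Series
  E l s = pf δ q l δ₀ (ℤ.- s)

  E-zero : ∀ l s → l < ∣ s ∣₋ → E l s ≈ 0S
  E-zero-rec : ∀ l s → suc l < ∣ s ∣₋ → prev (λ m → pf δ q m δ₀) l (ℤ.- s) ≈ 0S → E (suc l) s ≈ 0S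
  E-zero zero          (+ suc i)    _ = ≈-refl
  E-zero zero          -[1+ suc i ] _ = ≈-refl
  E-zero (suc zero)    s p = E-zero-rec 0 s p ≈-refl
  E-zero (suc (suc l)) s p = E-zero-rec (suc l) s p (E-zero l s (ℕP.<-trans (ℕP.n<1+n l) (ℕP.<-trans (ℕP.n<1+n (suc l)) p)))
  E-zero-rec l s p e = ≈-trans (pf-rec δ q δ₀ l (ℤ.- s)) (≈-trans
    (⊖-cong (⊕-cong (⊕-cong
      (·-zeroʳ δ (≈-trans (≡⇒≈ (cong (pf δ q l δ₀) (sym (neg-pred s)))) (E-zero l (ℤ.pred s) (<-pred s p))))
      (≈-trans (≡⇒≈ (cong (pf δ q l δ₀) (sym (neg-suc s)))) (E-zero l (ℤ.suc s) (<-suc s p))))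
      (·-zeroʳ (q · q^ l) (E-zero l s (ℕP.<-trans (ℕP.n<1+n l) p))))
      (·-zeroʳ (δ · qc l) e))
    (solve 0 (((con (+ 0) :+ con (+ 0)) :+ con (+ 0)) :- con (+ 0) := con (+ 0)) ≈-refl))

  tame-E : ∀ l (F : ℤ → Series) → Tameℤ (suc l) (λ s → E l s · F s)
  tame-E l F = mkTameℤ′ (λ s k p → ≈0-at (·-zeroˡ (F s) (E-zero l s (ℕP.≤-trans (ℕP.m≤n+m (suc l) k) p))) k)

  Ex : (ℤ → Series) → ℕ → ℤ → Series
  Ex u l j = sumℤ (suc (suc l)) (λ s → E l s · u (j ℤ.+ s))

  Ex-rec : ∀ u → IsRec δ q (Ex u)
  Ex-rec u m j = begin
    sumℤ C (λ s → E (suc m) s · u (j ℤ.+ s))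
      ≈⟨ sumℤ-cong C (λ s → ≈-trans (·-congʳ (≈-trans (pf-rec δ q δ₀ m (ℤ.- s)) (⊖-cong (⊕-cong (⊕-cong
           (·-congˡ (≡⇒≈ (cong (pf δ q m δ₀) (sym (neg-pred s)))))
           (≡⇒≈ (cong (pf δ q m δ₀) (sym (neg-suc s))))) ≈-refl) ≈-refl)))
         (solve 8 (λ δ a b Q c d p u → (((δ :* a :+ b) :+ Q :* c) :- d :* p) :* u
            := ((δ :* (a :* u) :+ b :* u) :+ Q :* (c :* u)) :+ (:- (d :* (p :* u)))) ≈-refl
            δ (E m (ℤ.pred s)) (E m (ℤ.suc s)) (q · q^ m) (E m s) (δ · qc m) (Ep m s) (u (j ℤ.+ s)))) ⟩
    sumℤ C (λ s → ((δ · (E m (ℤ.pred s) · u (j ℤ.+ s)) ⊕ E m (ℤ.suc s) · u (j ℤ.+ s)) ⊕ (q · q^ m) · (E m s · u (j ℤ.+ s)))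
                  ⊕ ⊝ ((δ · qc m) · (Ep m s · u (j ℤ.+ s))))
      ≈⟨ ≈-trans (sumℤ-⊕ C _ _) (⊕-cong (≈-trans (sumℤ-⊕ C _ _) (⊕-cong (sumℤ-⊕ C _ _) ≈-refl)) (sumℤ-⊝ C _)) ⟩
    ((sumℤ C (λ s → δ · (E m (ℤ.pred s) · u (j ℤ.+ s))) ⊕ sumℤ C (λ s → E m (ℤ.suc s) · u (j ℤ.+ s)))
       ⊕ sumℤ C (λ s → (q · q^ m) · (E m s · u (j ℤ.+ s)))) ⊖ sumℤ C (λ s → (δ · qc m) · (Ep m s · u (j ℤ.+ s)))
      ≈⟨ ⊖-cong (⊕-cong (⊕-cong
           (≈-trans (≈-sym (sumℤ-· δ tame-pred)) (·-congˡ shift-pred))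
           shift-suc)
           (≈-trans (≈-sym (sumℤ-· (q · q^ m) (tameℤ-raise C₀ (tame-E m _)))) (·-congˡ (sumℤ-indep (tameℤ-raise C₀ (tame-E m _)) (tameℤ-raise (ℕP.n≤1+n _) (tame-E m _))))))
           (prevSum m) ⟩
    rec δ q (Ex u) m j ∎
    where
    C = suc (suc (suc m))
    C₀ : suc m ≤ C
    C₀ = ℕP.≤-trans (ℕP.n≤1+n _) (ℕP.n≤1+n _)
    Ep : ℕ → ℤ → Series
    Ep m s = prev (λ m → pf δ q m δ₀) m (ℤ.- s)
    tame-pred₀ : Tameℤ (suc (suc m)) (λ s → E m (ℤ.pred s) · u (j ℤ.+ s))
    tame-pred₀ = mkTameℤ′ (λ s k p → ≈0-at (·-zeroˡ _ (E-zero m (ℤ.pred s) (<-pred s (ℕP.≤-trans (ℕP.m≤n+m _ k) p)))) k)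
    tame-pred : Tameℤ C (λ s → E m (ℤ.pred s) · u (j ℤ.+ s))
    tame-pred = tameℤ-raise (ℕP.n≤1+n _) tame-pred₀
    shift-pred : sumℤ C (λ s → E m (ℤ.pred s) · u (j ℤ.+ s)) ≈ Ex u m (ℤ.suc j)
    shift-pred = ≈-trans (≈-sym (sumℤ-shift tame-pred₀))
      (≈-trans (sumℤ-cong C (λ s → ·-cong (≡⇒≈ (cong (E m) (ℤP.pred-suc s))) (≡⇒≈ (cong u
          (ZS.solve 2 (λ j s → j ZS.:+ (ZS.con (+ 1) ZS.:+ s) ZS.:= (ZS.con (+ 1) ZS.:+ j) ZS.:+ s) refl j s)))))
        (sumℤ-indep (tameℤ-raise C₀ (tame-E m _)) (tameℤ-raise (ℕP.n≤1+n _) (tame-E m _))))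
    shift-suc : sumℤ C (λ s → E m (ℤ.suc s) · u (j ℤ.+ s)) ≈ Ex u m (ℤ.pred j)
    shift-suc = ≈-trans (sumℤ-cong C (λ s → ·-congˡ (≡⇒≈ (cong u
          (ZS.solve 2 (λ j s → j ZS.:+ s ZS.:= (ZS.con -[1+ 0 ] ZS.:+ j) ZS.:+ (ZS.con (+ 1) ZS.:+ s)) refl j s)))))
      (≈-trans (sumℤ-shift {f = λ s → E m s · u (ℤ.pred j ℤ.+ s)} (tameℤ-raise (ℕP.n≤1+n _) (tame-E m _)))
        (sumℤ-indep (tameℤ-raise C₀ (tame-E m _)) (tameℤ-raise (ℕP.n≤1+n _) (tame-E m _))))
    prevSum : ∀ m → sumℤ (suc (suc (suc m))) (λ s → (δ · qc m) · (Ep m s · u (j ℤ.+ s))) ≈ (δ · qc m) · prev (Ex u) m j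
    prevSum zero = ≈-trans (sumℤ-0 _ (λ s → ·-zeroʳ _ (SR.zeroˡ _))) (≈-sym (SR.zeroʳ _))
    prevSum (suc m) = ≈-trans (≈-sym (sumℤ-· _ (tameℤ-raise (ℕP.m≤n+m (suc m) 3) (tame-E m _))))
      (·-congˡ (sumℤ-indep (tameℤ-raise (ℕP.m≤n+m (suc m) 3) (tame-E m _)) (tameℤ-raise (ℕP.n≤1+n _) (tame-E m _))))

  pf-expand : ∀ l u j → pf δ q l u j ≈ Ex u l j
  pf-expand l u = rec-unique (pf-rec δ q u) (Ex-rec u) (λ j → ≈-sym (base j)) l
    where
    base : ∀ j → Ex u 0 j ≈ u j
    base j = ≈-trans (sumℤ-def 2 _) (≈-trans (⊕-cong
      (≈-trans (tsum-peel (tame-raise (s≤s z≤n) (tame₊ (tame-E 0 (λ s → u (j ℤ.+ s))))))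
        (⊕-cong (·-identityˡ _) (tsum-0 2 (λ i → SR.zeroˡ _))))
      (tsum-0 2 (λ i → SR.zeroˡ _)))
      (≈-trans (⊕-identityʳ _) (≈-trans (⊕-identityʳ _) (≡⇒≈ (cong u (ℤP.+-identityʳ j))))))

  a : ℤ → Series
  a s = R 0 δ₀ (ℤ.- s)

  -- The bound is uniform in l: if l is smaller than the size of s, the coefficient of p_l vanishes;
  -- otherwise l itself is large and the weight has high order.
  tame-aux : ∀ l (F : ℤ → Series) → Tameℤ (suc α) (λ s → weight l 0 · (E l s · F s))
  tame-aux l F = mkTameℤ′ go
    where
    go : ∀ s k → k ℕ.+ suc α ≤ ∣ s ∣₋ → (weight l 0 · (E l s · F s)) k ≡ 0ℚ
    go s k p with l ℕP.<? ∣ s ∣₋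
    ... | yes l< = ≈0-at (·-zeroʳ (weight l 0) (·-zeroˡ (F s) (E-zero l s l<))) k
    ... | no  l≮ = tame (tame-weight 0 (λ l → E l s · F s)) l k (ℕP.≤-trans p (ℕP.≮⇒≥ l≮))

  tame-a : ∀ (F : ℤ → Series) → Tameℤ (suc α) (λ s → a s · F s)
  tame-a F = tameℤ-·ʳ F (mkTameℤ
    (tame-tsum (λ s l → weight l 0 · E l (+ s)) (λ l → tame-cong (λ s → ·-congˡ (·-identityʳ (E l (+ s)))) (tame₊ (tame-aux l (λ _ → oneS)))))
    (tame-tsum (λ s l → weight l 0 · E l -[1+ s ]) (λ l → tame-cong (λ s → ·-congˡ (·-identityʳ (E l -[1+ s ]))) (tame₋ (tame-aux l (λ _ → oneS))))))

  R-expand : ∀ u j → R 0 u j ≈ sumℤ (suc α) (λ s → a s · u (j ℤ.+ s))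
  R-expand u j = begin
    tsum C (λ l → weight l 0 · pf δ q l u j)
      ≈⟨ tsum-cong C (λ l → ≈-trans (·-congˡ (pf-expand l u j))
          (≈-trans (sumℤ-· (weight l 0) (tameℤ-raise (ℕP.n≤1+n _) (tame-E l _)))
            (sumℤ-indep (tameℤ-· (λ _ → weight l 0) (tameℤ-raise (ℕP.n≤1+n _) (tame-E l _))) (tame-aux l (λ s → u (j ℤ.+ s)))))) ⟩
    tsum C (λ l → sumℤ C (λ s → weight l 0 · (E l s · u (j ℤ.+ s))))
      ≈⟨ tsum-sumℤ-swap C (λ l s → weight l 0 · (E l s · u (j ℤ.+ s))) ⟩
    sumℤ C (λ s → tsum C (λ l → weight l 0 · (E l s · u (j ℤ.+ s))))
      ≈⟨ sumℤ-cong C (λ s → ≈-trans (tsum-cong C (λ l → solve 3 (λ w e u → w :* (e :* u) := u :* (w :* e)) ≈-refl (weight l 0) (E l s) _))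
          (≈-trans (≈-sym (tsum-· (u (j ℤ.+ s)) (tame-weight 0 (λ l → E l s)))) (·-comm _ _))) ⟩
    sumℤ C (λ s → a s · u (j ℤ.+ s)) ∎
    where C = suc α

  -- The lowering relation is summed against `weight l 1`. Its factor 1 - q^l cancels against (q)_l,
  -- and the shift l ↦ l + 1 leaves `weight l 0`.
  lower-R : ∀ j x y → + x ≡ j ℤ.+ + y →
    (q^ x ⊖ q^ y) · R 1 δ₀ j ≈ (δ · q^ x) · R 0 δ₀ (ℤ.suc j) ⊖ q^ y · R 0 δ₀ (ℤ.pred j)
  lower-R j x y e = begin
    (q^ x ⊖ q^ y) · R 1 δ₀ j
      ≈⟨ tsum-· _ (tame-weight 1 (λ l → p l j)) ⟩
    tsum C (λ l → (q^ x ⊖ q^ y) · (weight l 1 · p l j))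
      ≈⟨ tsum-cong C (λ l → ≈-trans
           (solve 4 (λ x y w p → (x :- y) :* (w :* p) := w :* (x :* p :- y :* p)) ≈-refl (q^ x) (q^ y) (weight l 1) (p l j))
           (·-congˡ (lowering δ q (+ 0) p p (pf-rec δ q δ₀) (pf-rec δ q δ₀) base l j x y
             (trans e (cong (ℤ._+ + y) (sym (ℤP.+-identityʳ j))))))) ⟩
    tsum C (λ l → weight l 1 · (qc l · ((δ · q^ x) · prev p l (ℤ.suc j) ⊖ q^ y · prev p l (ℤ.pred j))))
      ≈⟨ tsum-peel (tame-weight 1 _) ⟩
    _
      ≈⟨ ⊕-cong (·-zeroʳ _ (·-zeroˡ _ (⊕-inverseʳ oneS)))
           (tsum-cong C (λ l → ≈-trans
             (solve 8 (λ k i c X Y a b δ → (k :* i) :* (c :* ((δ :* X) :* a :- Y :* b))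
                := (δ :* X) :* ((k :* (c :* i)) :* a) :+ (:- (Y :* ((k :* (c :* i)) :* b)))) ≈-refl
               (κ (suc l) 1) (invPoch (suc l)) (qc (suc l)) (q^ x) (q^ y) (p l (ℤ.suc j)) (p l (ℤ.pred j)) δ)
             (⊕-cong (·-congˡ (·-congʳ (·-cong (≡⇒≈ (κ-suc l 0)) (qc-invPoch l))))
                     (⊝-cong (·-congˡ (·-congʳ (·-cong (≡⇒≈ (κ-suc l 0)) (qc-invPoch l)))))))) ⟩
    0S ⊕ tsum C (λ l → (δ · q^ x) · (weight l 0 · p l (ℤ.suc j)) ⊕ ⊝ (q^ y · (weight l 0 · p l (ℤ.pred j))))
      ≈⟨ ≈-trans (⊕-identityˡ _) (tsum-⊕ C _ _) ⟩
    tsum C (λ l → (δ · q^ x) · (weight l 0 · p l (ℤ.suc j))) ⊕ tsum C (λ l → ⊝ (q^ y · (weight l 0 · p l (ℤ.pred j))))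
      ≈⟨ ⊕-cong (≈-trans (≈-sym (tsum-· _ (tm (λ l → p l (ℤ.suc j))))) (·-congˡ (tsum-R δ₀ (ℤ.suc j) C₀)))
                (≈-trans (tsum-⊝ C _) (⊝-cong (≈-trans (≈-sym (tsum-· _ (tm (λ l → p l (ℤ.pred j))))) (·-congˡ (tsum-R δ₀ (ℤ.pred j) C₀))))) ⟩
    (δ · q^ x) · R 0 δ₀ (ℤ.suc j) ⊖ q^ y · R 0 δ₀ (ℤ.pred j) ∎
    where
    C = suc (suc α)
    C₀ : suc α ≤ C
    C₀ = ℕP.n≤1+n _
    p : ℕ → ℤ → Series
    p l = pf δ q l δ₀
    tm : ∀ F → Tame C (λ l → weight l 0 · F l)
    tm F = tame-raise C₀ (tame-weight 0 F)
    base : ∀ j a b → + a ≡ (j ℤ.+ + 0) ℤ.+ + b → q^ a · δ₀ j ≈ q^ b · δ₀ j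
    base (+ zero)  a b e with refl ← ℤP.+-injective e = ≈-refl
    base (+ suc _) a b e = ≈-trans (SR.zeroʳ _) (≈-sym (SR.zeroʳ _))
    base -[1+ _ ]  a b e = ≈-trans (SR.zeroʳ _) (≈-sym (SR.zeroʳ _))

  -- The value of R_1 on the delta is known twice, from the recurrence in m and from `lower-R`.
  -- Eliminating it leaves a second-order relation for the coefficients of R_0.
  a-recurrence : ∀ s x y → + x ≡ s ℤ.+ + y →
    q^ y · (a (ℤ.suc s) ⊕ δ · a s) ≈ (δ · q^ x) · (a s ⊕ a (ℤ.pred s))
  a-recurrence s x y e = ≈-trans
    (solve 7 (λ X Y δ r₀ r₊ r₋ R → Y :* (r₋ :+ δ :* r₀) :=
        ((δ :* X) :* (r₀ :+ r₊) :+ (:- (Y :- X)) :* (R :- (((δ :* r₊ :+ r₋) :+ (δ :* con (+ 1)) :* r₀) :- (δ :* (con (+ 1) :- con (+ 1))) :* con (+ 0))))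
          :+ con (+ 1) :* ((Y :- X) :* R :- ((δ :* Y) :* r₊ :- X :* r₋))) ≈-refl
      (q^ x) (q^ y) δ (a s) (a (ℤ.pred s)) (a (ℤ.suc s)) (R 1 δ₀ (ℤ.- s)))
    (≈-trans (kill _ lowered) (kill _ recurred))
    where
    lowered : (q^ y ⊖ q^ x) · R 1 δ₀ (ℤ.- s) ≈ (δ · q^ y) · a (ℤ.pred s) ⊖ q^ x · a (ℤ.suc s)
    lowered = ≈-trans (lower-R (ℤ.- s) y x (trans (ZS.solve 2 (λ s y → y ZS.:= (ZS.:- s) ZS.:+ (s ZS.:+ y)) refl s (+ y)) (cong (λ z → ℤ.- s ℤ.+ z) (sym e))))
      (⊖-cong (·-congˡ (≡⇒≈ (cong (R 0 δ₀) (sym (neg-pred s))))) (·-congˡ (≡⇒≈ (cong (R 0 δ₀) (sym (neg-suc s))))))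
    recurred : R 1 δ₀ (ℤ.- s) ≈ ((δ · a (ℤ.pred s) ⊕ a (ℤ.suc s)) ⊕ (δ · oneS) · a s) ⊖ (δ · (oneS ⊖ oneS)) · 0S
    recurred = ≈-trans (R-rec δ₀ 0 (ℤ.- s)) (⊖-cong (⊕-congʳ (⊕-cong
      (·-congˡ (≡⇒≈ (cong (R 0 δ₀) (sym (neg-pred s))))) (≡⇒≈ (cong (R 0 δ₀) (sym (neg-suc s)))))) ≈-refl)

conv-equivariant : Equivariant conv
conv-equivariant = record
  { Φ-cong = λ e j → sumℤ-cong 2 (λ i → ·-congˡ (e _))
  ; Φ-⊕ = λ u v j → ≈-trans (sumℤ-cong 2 (λ i → ·-distribˡ _ _ _)) (sumℤ-⊕ 2 _ _)
  ; Φ-· = λ c u j → ≈-trans (sumℤ-cong 2 (λ i → solve 3 (λ t c u → t :* (c :* u) := c :* (t :* u)) ≈-refl (τ i) c (u (j ℤ.+ i))))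
       (≈-sym (sumℤ-· c (conv-tame 1 _)))
  ; Φ-suc = λ u j → sumℤ-cong 2 (λ i → ·-congˡ (≡⇒≈ (cong u
       (ZS.solve 2 (λ j i → ZS.con (+ 1) ZS.:+ (j ZS.:+ i) ZS.:= (ZS.con (+ 1) ZS.:+ j) ZS.:+ i) refl j i)))) }

-- The quintuple product and the polynomials of positive degree

pf-param : ∀ δ {γ γ′} → γ ≈ γ′ → ∀ m u j → pf δ γ m u j ≈ pf δ γ′ m u j
pf-param δ {γ} {γ′} e m u = rec-unique (pf-rec δ γ u)
  (λ m j → ≈-trans (pf-rec δ γ′ u m j) (⊖-cong (⊕-congˡ (·-congʳ (·-congʳ (≈-sym e)))) ≈-refl)) (λ _ → ≈-refl) m

-- Coefficients of the quintuple product: u₀(-3t) = q^{t(3t+1)/2} = - u₀(3t+1).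
ψ : ℕ → Series
ψ 0 = oneS
ψ 1 = ⊝ oneS
ψ 2 = 0S
ψ (suc (suc (suc j))) = q^ (suc j) · ψ j

u₀ : ℤ → Series
u₀ (+ j)    = ψ j
u₀ -[1+ i ] = ⊝ ψ (2 ℕ.+ i)

u₀-quasiperiodic : ∀ j a b → + a ≡ (j ℤ.+ + 1) ℤ.+ + b → q^ a · u₀ j ≈ q^ b · u₀ (+ 3 ℤ.+ j)
u₀-quasiperiodic (+ n) a b e with refl ← ℤP.+-injective e = begin
  q^ ((n ℕ.+ 1) ℕ.+ b) · ψ n        ≈⟨ ·-congʳ (≈-trans (≡⇒≈ (cong q^ (trans (cong (ℕ._+ b) (ℕP.+-comm n 1)) (ℕP.+-comm (suc n) b)))) (q^-+ b (suc n))) ⟩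
  (q^ b · q^ (suc n)) · ψ n         ≈⟨ ·-assoc _ _ _ ⟩
  q^ b · (q^ (suc n) · ψ n) ∎
u₀-quasiperiodic -[1+ 0 ] a b e with refl ← ℤP.+-injective e =
  ·-congˡ (solve 0 (:- con (+ 0) := con (+ 0)) ≈-refl)
u₀-quasiperiodic -[1+ suc n ] a b e = ≈-trans (go n) (·-congʳ (≈-trans (≈-sym (q^-+ a (suc n))) (≡⇒≈ (cong q^ (sym b≡)))))
  where
  b≡ : b ≡ a ℕ.+ suc n
  b≡ = ℤP.+-injective (trans (ZS.solve 2 (λ b n → b ZS.:= ((ZS.:- n) ZS.:+ b) ZS.:+ n) refl (+ b) (+ suc n)) (cong (ℤ._+ + suc n) (sym e)))
  go : ∀ n → q^ a · (⊝ ψ (3 ℕ.+ n)) ≈ (q^ a · q^ (suc n)) · u₀ (+ 3 ℤ.+ -[1+ suc n ])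
  go 0 = solve 2 (λ x y → x :* (:- (y :* con (+ 1))) := (x :* y) :* (:- con (+ 1))) ≈-refl (q^ a) (q^ 1)
  go 1 = solve 2 (λ x y → x :* (:- (y :* (:- con (+ 1)))) := (x :* y) :* con (+ 1)) ≈-refl (q^ a) (q^ 2)
  go (suc (suc n)) = solve 3 (λ x y z → x :* (:- (y :* z)) := (x :* y) :* (:- z)) ≈-refl (q^ a) (q^ (suc (suc (suc n)))) (ψ (2 ℕ.+ n))

module _ (δ : Series) (δ-root : (δ ⊖ oneS) · (δ ⊖ q) ≈ 0S) where

  private
    y : ℕ → ℤ → Series
    y m = pf δ δ m u₀

    z : ℕ → ℤ → Series
    z m j = y m (+ 3 ℤ.+ j)

    recz : IsRec δ δ z
    recz m j = ≈-trans (pf-rec δ δ u₀ m (+ 3 ℤ.+ j)) (⊖-cong (⊕-congʳ (⊕-cong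
      (·-congˡ (≡⇒≈ (cong (y m) (ZS.solve 1 (λ j → ZS.con (+ 1) ZS.:+ (ZS.con (+ 3) ZS.:+ j) ZS.:= ZS.con (+ 3) ZS.:+ (ZS.con (+ 1) ZS.:+ j)) refl j))))
      (≡⇒≈ (cong (y m) (ZS.solve 1 (λ j → ZS.con -[1+ 0 ] ZS.:+ (ZS.con (+ 3) ZS.:+ j) ZS.:= ZS.con (+ 3) ZS.:+ (ZS.con -[1+ 0 ] ZS.:+ j)) refl j)))))
      (·-congˡ (prev-z m)))
      where
      prev-z : ∀ m → prev y m (+ 3 ℤ.+ j) ≈ prev z m j
      prev-z zero    = ≈-refl
      prev-z (suc m) = ≈-refl

    prev-zy : ∀ m j → prev z m j ≈ prev y m (+ 3 ℤ.+ j)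
    prev-zy zero    j = ≈-refl
    prev-zy (suc m) j = ≈-refl

    L : ∀ m → Lowered δ (+ 1) y z m
    L = lowering δ δ (+ 1) y z (pf-rec δ δ u₀) recz u₀-quasiperiodic

    -- Quasi-periodicity with period 3 lets the lowering relation express the values at 2 and -2
    -- through those at -1, 0 and 1, so that these three values form a closed system under the
    -- recurrence.
    L₋₁ : ∀ m → y m (+ 2) ≈ y m -[1+ 0 ] ⊖ qc m · (δ · prev y m (+ 0) ⊖ prev y m (+ 1))
    L₋₁ m = ≈-trans (solve 6 (λ x w c δ u v → w := (x :- c :* (δ :* u :- v)) :+ (:- con (+ 1)) :* ((con (+ 1) :* x :- con (+ 1) :* w) :- c :* ((δ :* con (+ 1)) :* u :- con (+ 1) :* v))) ≈-refl
        (y m -[1+ 0 ]) (y m (+ 2)) (qc m) δ (prev y m (+ 0)) (prev y m (+ 1)))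
      (kill _ (≈-trans (L m -[1+ 0 ] 0 0 refl) (·-congˡ (⊖-cong ≈-refl (·-congˡ (prev-zy m -[1+ 1 ]))))))

    L₋₂ : ∀ m → y m -[1+ 1 ] ≈ q · y m (+ 1) ⊕ qc m · (δ · prev y m -[1+ 0 ] ⊖ q · prev y m (+ 0))
    L₋₂ m = ≈-trans (solve 7 (λ x w c δ u v q → w := (q :* x :+ c :* (δ :* u :- q :* v)) :+ con (+ 1) :* ((con (+ 1) :* w :- (q :* con (+ 1)) :* x) :- c :* ((δ :* con (+ 1)) :* u :- (q :* con (+ 1)) :* v))) ≈-refl
        (y m (+ 1)) (y m -[1+ 1 ]) (qc m) δ (prev y m -[1+ 0 ]) (prev y m (+ 0)) q)
      (kill _ (≈-trans (L m -[1+ 1 ] 0 1 refl) (·-congˡ (⊖-cong ≈-refl (·-congˡ (prev-zy m -[1+ 2 ]))))))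

    next₋ : ∀ m → y (suc m) -[1+ 0 ] ≈ ((δ · y m (+ 0) ⊕ q · y m (+ 1)) ⊕ (δ · q^ m) · y m -[1+ 0 ]) ⊖ (qc m · q) · prev y m (+ 0)
    next₋ m = ≈-trans (pf-rec δ δ u₀ m -[1+ 0 ]) (≈-trans (⊖-cong (⊕-congʳ (⊕-congˡ (L₋₂ m))) ≈-refl)
      (solve 9 (λ δ Y q Z c pX pY Q X → ((δ :* Y :+ (q :* Z :+ c :* (δ :* pX :- q :* pY))) :+ Q :* X) :- (δ :* c) :* pX
         := ((δ :* Y :+ q :* Z) :+ Q :* X) :- (c :* q) :* pY) ≈-refl
         δ (y m (+ 0)) q (y m (+ 1)) (qc m) (prev y m -[1+ 0 ]) (prev y m (+ 0)) (δ · q^ m) (y m -[1+ 0 ])))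

    next₁ : ∀ m → y (suc m) (+ 1) ≈ ((δ · y m -[1+ 0 ] ⊕ y m (+ 0)) ⊕ (δ · q^ m) · y m (+ 1)) ⊖ (δ · (δ · qc m)) · prev y m (+ 0)
    next₁ m = ≈-trans (pf-rec δ δ u₀ m (+ 1)) (≈-trans (⊖-cong (⊕-congʳ (⊕-congʳ (·-congˡ (L₋₁ m)))) ≈-refl)
      (solve 8 (λ δ Y Z c pY pZ Q X → ((δ :* (X :- c :* (δ :* pY :- pZ)) :+ Y) :+ Q :* Z) :- (δ :* c) :* pZ
         := ((δ :* X :+ Y) :+ Q :* Z) :- (δ :* (δ :* c)) :* pY) ≈-refl
         δ (y m (+ 0)) (y m (+ 1)) (qc m) (prev y m (+ 0)) (prev y m (+ 1)) (δ · q^ m) (y m -[1+ 0 ])))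

    y₁₋ : y 1 -[1+ 0 ] ≈ δ ⊖ q
    y₁₋ = ≈-trans (next₋ 0) (solve 2 (λ δ q → ((δ :* con (+ 1) :+ q :* (:- con (+ 1))) :+ (δ :* con (+ 1)) :* (:- con (+ 0))) :- ((con (+ 1) :- con (+ 1)) :* q) :* con (+ 0) := δ :- q) ≈-refl δ q)

    y₁₀ : y 1 (+ 0) ≈ 0S
    y₁₀ = solve 1 (λ δ → ((δ :* (:- con (+ 1)) :+ (:- con (+ 0))) :+ (δ :* con (+ 1)) :* con (+ 1)) :- (δ :* (con (+ 1) :- con (+ 1))) :* con (+ 0) := con (+ 0)) ≈-refl δ

    y₁₁ : y 1 (+ 1) ≈ oneS ⊖ δ
    y₁₁ = ≈-trans (next₁ 0) (solve 1 (λ δ → ((δ :* (:- con (+ 0)) :+ con (+ 1)) :+ (δ :* con (+ 1)) :* (:- con (+ 1))) :- (δ :* (δ :* (con (+ 1) :- con (+ 1)))) :* con (+ 0) := con (+ 1) :- δ) ≈-refl δ)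

    -- The recurrence looks back two degrees, but of the lower one only the value at 0 enters
    -- `next₋` and `next₁`; that value is carried along with the three values in degree m + 2.
    Vanish : ℕ → Set
    Vanish m = y (suc m) (+ 0) ≈ 0S × (y (2 ℕ.+ m) -[1+ 0 ] ≈ 0S × y (2 ℕ.+ m) (+ 0) ≈ 0S × y (2 ℕ.+ m) (+ 1) ≈ 0S)

    vanish : ∀ m → Vanish m
    vanish zero = y₁₀ ,
      ≈-trans (next₋ 1) (≈-trans (⊖-cong (⊕-cong (⊕-cong (·-congˡ y₁₀) (·-congˡ y₁₁)) (·-congˡ y₁₋)) ≈-refl)
        (≈-trans (solve 2 (λ δ q → ((δ :* con (+ 0) :+ q :* (con (+ 1) :- δ)) :+ (δ :* (q :* con (+ 1))) :* (δ :- q)) :- ((con (+ 1) :- q :* con (+ 1)) :* q) :* con (+ 1)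
           := q :* ((δ :- con (+ 1)) :* (δ :- q))) ≈-refl δ q) (·-zeroʳ q δ-root))) ,
      ≈-trans (⊖-cong (⊕-cong (⊕-cong (·-congˡ y₁₁) y₁₋) (·-congˡ y₁₀)) ≈-refl)
        (≈-trans (solve 2 (λ δ q → ((δ :* (con (+ 1) :- δ) :+ (δ :- q)) :+ (δ :* (q :* con (+ 1))) :* con (+ 0)) :- (δ :* (con (+ 1) :- q :* con (+ 1))) :* con (+ 1)
           := (:- con (+ 1)) :* ((δ :- con (+ 1)) :* (δ :- q))) ≈-refl δ q) (·-zeroʳ _ δ-root)) ,
      ≈-trans (next₁ 1) (≈-trans (⊖-cong (⊕-cong (⊕-cong (·-congˡ y₁₋) y₁₀) (·-congˡ y₁₁)) ≈-refl)
        (solve 2 (λ δ q → ((δ :* (δ :- q) :+ con (+ 0)) :+ (δ :* (q :* con (+ 1))) :* (con (+ 1) :- δ)) :- (δ :* (δ :* (con (+ 1) :- q :* con (+ 1)))) :* con (+ 1)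
           := con (+ 0)) ≈-refl δ q))
    vanish (suc m) with vanish m
    ... | e , e₋ , e₀ , e₁ = e₀ ,
      ≈-trans (next₋ (2 ℕ.+ m)) (≈-trans (⊖-cong (⊕-cong (⊕-cong (·-congˡ e₀) (·-congˡ e₁)) (·-congˡ e₋)) (·-congˡ e))
        (solve 4 (λ a b c d → ((a :* con (+ 0) :+ b :* con (+ 0)) :+ c :* con (+ 0)) :- d :* con (+ 0) := con (+ 0)) ≈-refl _ _ _ _)) ,
      ≈-trans (⊖-cong (⊕-cong (⊕-cong (·-congˡ e₁) e₋) (·-congˡ e₀)) (·-congˡ e))
        (solve 3 (λ a c d → ((a :* con (+ 0) :+ con (+ 0)) :+ c :* con (+ 0)) :- d :* con (+ 0) := con (+ 0)) ≈-refl _ _ _) ,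
      ≈-trans (next₁ (2 ℕ.+ m)) (≈-trans (⊖-cong (⊕-cong (⊕-cong (·-congˡ e₋) e₀) (·-congˡ e₁)) (·-congˡ e))
        (solve 3 (λ a c d → ((a :* con (+ 0) :+ con (+ 0)) :+ c :* con (+ 0)) :- d :* con (+ 0) := con (+ 0)) ≈-refl _ _ _))

  -- In degree 1 the value at 0 vanishes for every δ. In degree 2 the values at -1 and 0 are
  -- multiples of (δ - 1)(δ - q); once they vanish, the closed system stays zero. This orthogonality
  -- starts the iteration of the kernel.
  pf-u₀ : ∀ m → pf δ δ (suc m) u₀ (+ 0) ≈ 0S
  pf-u₀ m = proj₁ (vanish m)

-- Path sums as values of iterated convolutions

uN : ℕ → ℤ → Series
uN zero    = u₀
uN (suc N) = conv (uN N)

unit : ℕ → Series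
unit zero    = oneS
unit (suc _) = 0S

infix 8 _^S_
_^S_ : Series → ℕ → Series
x ^S zero  = oneS
x ^S suc n = x · x ^S n

module Straight where
  open Coefficients 1 public

  δ≈q : δ ≈ q
  δ≈q = ·-identityʳ q

  D : ℕ → Series
  D n = a (+ n) ⊖ q^ n · a (ℤ.pred (+ n))

  D-suc : ∀ n → D (suc n) ≈ ⊝ (q · D n)
  D-suc n = ≈-trans (solve 5 (λ q Q a₊ a₀ a₋ → a₊ :- (q :* Q) :* a₀
        := (:- (q :* (a₀ :- Q :* a₋))) :+ con (+ 1) :* (con (+ 1) :* (a₊ :+ (q :* con (+ 1)) :* a₀) :- ((q :* con (+ 1)) :* Q) :* (a₀ :+ a₋))) ≈-refl
        q (q^ n) (a (+ suc n)) (a (+ n)) (a (ℤ.pred (+ n))))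
    (kill _ (a-recurrence (+ n) n 0 (cong +_ (sym (ℕP.+-identityʳ n)))))

  D-power : ∀ n → (D n ≈ q^ n · D 0) ⊎ (D n ≈ ⊝ (q^ n · D 0))
  D-power zero = inj₁ (≈-sym (·-identityˡ _))
  D-power (suc n) with D-power n
  ... | inj₁ e = inj₂ (≈-trans (D-suc n) (⊝-cong (≈-trans (·-congˡ e) (≈-sym (·-assoc _ _ _)))))
  ... | inj₂ e = inj₁ (≈-trans (D-suc n) (≈-trans (⊝-cong (·-congˡ e))
      (solve 3 (λ q Q d → :- (q :* (:- (Q :* d))) := (q :* Q) :* d) ≈-refl q (q^ n) (D 0))))

  T-mono : ∀ {m n} → m ≤ n → T m ≤ T n
  T-mono z≤n = z≤n
  T-mono (s≤s l) = ℕP.+-mono-≤ (T-mono l) (s≤s l)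

  -- For l ≤ n the coefficient `E l (n+1)` is zero, and for larger indices the kernel `κ (l+1) 0`
  -- contributes the factor q^T(l).
  a-small : ∀ n k → k < T n → a (+ suc n) k ≡ 0ℚ
  a-small n k k< = trans (tsum-at _ _ k) (sumTo-0 (k ℕ.+ 2) (λ l _ → go l))
    where
    go : ∀ l → (weight l 0 · E l (+ suc n)) k ≡ 0ℚ
    go l with l ℕP.<? suc n
    ... | yes l< = ≈0-at (·-zeroʳ (weight l 0) (E-zero l (+ suc n) l<)) k
    go zero    | no l≮ = ⊥-elim (l≮ (s≤s z≤n))
    go (suc l) | no l≮ = trans (at (·-assoc (κ (suc l) 0) (invPoch (suc l)) (E (suc l) (+ suc n))) k)
      (qp-below (T l) _ k (ℕP.<-≤-trans k< (T-mono (ℕP.≤-pred (ℕP.≮⇒≥ l≮)))))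

  D-small : ∀ n k → k < T n → D (suc (suc n)) k ≡ 0ℚ
  D-small n k k< = trans (⊕-at _ _ k) (trans (cong₂ ℚ._+_
      (a-small (suc n) k (ℕP.<-≤-trans k< (ℕP.m≤m+n (T n) _)))
      (trans (⊝-at _ k) (cong ℚ.-_ (trans (at (·-comm (q^ (suc (suc n))) (a (+ suc n))) k) (trans (·-at _ _ k)
        (sumTo-0 (suc k) (λ i i≤k → trans (cong (ℚ._* q^ (suc (suc n)) (k ∸ i)) (a-small n i (ℕP.≤-<-trans (ℕP.≤-pred i≤k) k<))) (ℚP.*-zeroˡ (q^ (suc (suc n)) (k ∸ i))))))))))
    refl)

  -- `D` measures the failure of the theta ratio a(n) = q^n a(n-1). By the recurrence D(n) equals
  -- ±q^n D(0), whose order grows only linearly unless D(0) = 0, while the order of a(n) grows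
  -- quadratically. Decay thus selects the theta solution of the second-order recurrence.
  D-zero : D 0 ≈ 0S
  D-zero .at k = trans (sym (qp-shift N (D 0) k)) (trans (at (·-congʳ (qp≈q^ N)) (N ℕ.+ k)) (trans (signed (D-power N)) (sym (0S-at k))))
    where
    -- Large enough that N + k = 2k + 6 is below T(n), which is at least (k + 3) + (k + 4).
    n = 4 ℕ.+ k
    N = suc (suc n)
    bound : N ℕ.+ k < T n
    bound = ℕP.≤-trans (ℕP.≤-reflexive (cong (3 ℕ.+_) (ℕP.+-comm (4 ℕ.+ k) k) )) (ℕP.≤-trans (ℕP.≤-reflexive (sym (ℕP.+-assoc 3 k (4 ℕ.+ k)))) (ℕP.+-monoˡ-≤ (4 ℕ.+ k) (i≤T (3 ℕ.+ k))))
    small : D N (N ℕ.+ k) ≡ 0ℚ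
    small = D-small n (N ℕ.+ k) bound
    signed : (D N ≈ q^ N · D 0) ⊎ (D N ≈ ⊝ (q^ N · D 0)) → (q^ N · D 0) (N ℕ.+ k) ≡ 0ℚ
    signed (inj₁ e) = trans (sym (at e _)) small
    signed (inj₂ e) = ℚP.neg-injective (trans (sym (⊝-at _ _)) (trans (sym (at e _)) small))

  D-all : ∀ n → D n ≈ 0S
  D-all zero    = D-zero
  D-all (suc n) = ≈-trans (D-suc n) (≈-trans (⊝-cong (·-zeroʳ q (D-all n))) (solve 0 (:- con (+ 0) := con (+ 0)) ≈-refl))

  a-up : ∀ n → a (+ n) ≈ q^ n · a (ℤ.pred (+ n))
  a-up n = ≈-trans (solve 2 (λ x y → x := y :+ (x :- y)) ≈-refl (a (+ n)) _) (≈-trans (⊕-congˡ (D-all n)) (⊕-identityʳ _))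

  a-down : ∀ n → a -[1+ n ] ≈ q^ n · a (ℤ.suc -[1+ n ])
  a-down zero    = ≈-trans (≈-sym (·-identityˡ _)) (≈-trans (≈-sym (a-up 0)) (≈-sym (·-identityˡ _)))
  a-down (suc n) = q^-cancel 1 (≈-trans
    (solve 5 (λ q Q x y z → (q :* con (+ 1)) :* z := ((q :* con (+ 1)) :* ((q :* Q) :* y)
        :+ (:- con (+ 1)) :* ((q :* Q) :* (x :+ (q :* con (+ 1)) :* y) :- ((q :* con (+ 1)) :* con (+ 1)) :* (y :+ z))) :+ (:- q) :* (y :- Q :* x)) ≈-refl
      q (q^ n) (a (ℤ.suc -[1+ n ])) (a -[1+ n ]) (a -[1+ suc n ]))
    (≈-trans (kill _ (a-down n)) (kill _ (a-recurrence -[1+ n ] 0 (suc n) (sym (ℤP.+-inverseˡ (+ suc n)))))))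

  a≈ : ∀ s → a s ≈ τ s · a (+ 0)
  a≈ = τ-unique a (λ n → a-up (suc n)) (≈-trans (a-down 0) (·-identityˡ _)) (λ n → a-down (suc n))

  R≈conv : ∀ u j → R 0 u j ≈ a (+ 0) · conv u j
  R≈conv u j = begin
    R 0 u j
      ≈⟨ R-expand u j ⟩
    sumℤ 2 (λ s → a s · u (j ℤ.+ s))
      ≈⟨ sumℤ-cong 2 (λ s → ≈-trans (·-congʳ (≈-trans (a≈ s) (·-comm _ _))) (·-assoc _ _ _)) ⟩
    sumℤ 2 (λ s → a (+ 0) · (τ s · u (j ℤ.+ s)))
      ≈⟨ ≈-sym (sumℤ-· (a (+ 0)) (conv-tame 1 _)) ⟩
    a (+ 0) · conv u j ∎

  chain : ℕ → ℕ → Series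
  chain zero    m = unit m
  chain (suc N) m = tsum (suc (m ℕ.+ 1)) (λ l → weight l m · chain N l)

  -- At N = 0 this is the orthogonality `pf-u₀`. In the step, `R-reduce` and `R≈conv` replace the
  -- kernel by a convolution, which then passes through p_m onto `uN N`.
  chain≈ : ∀ N m → chain N m ≈ a (+ 0) ^S N · pf δ δ m (uN N) (+ 0)
  chain≈ zero zero    = ≈-sym (·-identityˡ oneS)
  chain≈ zero (suc m) = ≈-sym (·-zeroʳ _ (pf-u₀ δ (·-zeroʳ _ (≈-trans (⊕-congʳ δ≈q) (⊕-inverseʳ q))) m))
  chain≈ (suc N) m = begin
    tsum _ (λ l → weight l m · chain N l)
      ≈⟨ tsum-cong _ (λ l → ≈-trans (·-congˡ (≈-trans (chain≈ N l) (·-congˡ (pf-param δ δ≈q l (uN N) (+ 0)))))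
           (solve 3 (λ w c x → w :* (c :* x) := c :* (w :* x)) ≈-refl (weight l m) (a (+ 0) ^S N) _)) ⟩
    tsum _ (λ l → a (+ 0) ^S N · (weight l m · pf δ q l (uN N) (+ 0)))
      ≈⟨ ≈-sym (tsum-· _ (tame-weight m _)) ⟩
    a (+ 0) ^S N · R m (uN N) (+ 0)
      ≈⟨ ·-congˡ (≈-trans (R-reduce m (uN N) (+ 0)) (≈-trans (R≈conv _ (+ 0))
           (·-congˡ (≈-sym (pf-Φ conv-equivariant δ δ m (uN N) (+ 0)))))) ⟩
    a (+ 0) ^S N · (a (+ 0) · pf δ δ m (uN (suc N)) (+ 0))
      ≈⟨ solve 3 (λ c x y → c :* (x :* y) := (x :* c) :* y) ≈-refl _ _ _ ⟩
    a (+ 0) ^S suc N · pf δ δ m (uN (suc N)) (+ 0) ∎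

module Alternating where
  open Coefficients 0 public

  -- For δ = 1 the relation `a-recurrence` is of first order in the sums a(s+1) + a(s). Hence R_0
  -- itself is not a theta convolution, but its product with 1 plus a shift is.
  b : ℤ → Series
  b s = a (ℤ.suc s) ⊕ a s

  b-ratio : ∀ s x y → + x ≡ s ℤ.+ + y → q^ y · b s ≈ q^ x · (a s ⊕ a (ℤ.pred s))
  b-ratio s x y e = ≈-trans (·-congˡ (⊕-congˡ (≈-sym (·-identityˡ _))))
    (≈-trans (a-recurrence s x y e) (·-congʳ (·-identityˡ _)))

  b≈ : ∀ s → b s ≈ τ s · b (+ 0)
  b≈ = τ-unique b
    (λ n → ≈-trans (≈-sym (·-identityˡ _)) (b-ratio (+ suc n) (suc n) 0 (cong +_ (sym (ℕP.+-identityʳ (suc n))))))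
    (≈-sym (≈-trans (≈-sym (·-identityˡ _)) (≈-trans (b-ratio (+ 0) 0 0 refl) (·-identityˡ _))))
    (λ n → ≈-sym (≈-trans (b-ratio -[1+ n ] 0 (suc n) (sym (ℤP.+-inverseˡ (+ suc n)))) (·-identityˡ _)))

  R≈conv : ∀ u j → R 0 u j ⊕ R 0 u (ℤ.pred j) ≈ b (+ 0) · conv u j
  R≈conv u j = begin
    R 0 u j ⊕ R 0 u (ℤ.pred j)
      ≈⟨ ⊕-cong (R-expand u j) (R-expand u (ℤ.pred j)) ⟩
    sumℤ 1 (λ s → a s · u (j ℤ.+ s)) ⊕ sumℤ 1 (λ s → a s · u (ℤ.pred j ℤ.+ s))
      ≈⟨ ⊕-cong (≈-sym (sumℤ-raise (tame-a _) (ℕP.n≤1+n 1)))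
           (≈-trans (≈-sym (sumℤ-raise (tame-a _) (ℕP.n≤1+n 1))) (≈-sym (sumℤ-shift (tame-a _)))) ⟩
    sumℤ 2 (λ s → a s · u (j ℤ.+ s)) ⊕ sumℤ 2 (λ s → a (ℤ.suc s) · u (ℤ.pred j ℤ.+ ℤ.suc s))
      ≈⟨ ≈-sym (sumℤ-⊕ 2 _ _) ⟩
    sumℤ 2 (λ s → a s · u (j ℤ.+ s) ⊕ a (ℤ.suc s) · u (ℤ.pred j ℤ.+ ℤ.suc s))
      ≈⟨ sumℤ-cong 2 (λ s → ≈-trans (⊕-congˡ (·-congˡ (≡⇒≈ (cong u
            (ZS.solve 2 (λ j s → (ZS.con -[1+ 0 ] ZS.:+ j) ZS.:+ (ZS.con (+ 1) ZS.:+ s) ZS.:= j ZS.:+ s) refl j s)))))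
          (≈-trans (solve 3 (λ x y u → x :* u :+ y :* u := (y :+ x) :* u) ≈-refl (a s) (a (ℤ.suc s)) (u (j ℤ.+ s)))
          (≈-trans (·-congʳ (≈-trans (b≈ s) (·-comm _ _))) (·-assoc _ _ _)))) ⟩
    sumℤ 2 (λ s → b (+ 0) · (τ s · u (j ℤ.+ s)))
      ≈⟨ ≈-sym (sumℤ-· (b (+ 0)) (conv-tame 1 _)) ⟩
    b (+ 0) · conv u j ∎

  p p′ : (ℤ → Series) → ℕ → ℤ → Series
  p  u m = pf δ q m u
  p′ u m = pf δ δ m u

  -- The combination on the right obeys the recurrence with γ = 1, by one more use of the recurrence
  -- of p. It connects the parameter the kernel consumes, γ = q, with the parameter it returns.
  p′≈ : ∀ u m j → p′ u m j ≈ p u m j ⊕ qc m · prev (p u) m j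
  p′≈ u m j = rec-unique {Y = p′ u} {Z = Z} (pf-rec δ δ u) recZ (λ i → ≈-sym (≈-trans (⊕-congˡ (SR.zeroʳ _)) (⊕-identityʳ _))) m j
    where
    Z : ℕ → ℤ → Series
    Z m j = p u m j ⊕ qc m · prev (p u) m j
    recZ : IsRec δ δ Z
    recZ zero j = solve 4 (λ q u₊ u₋ u → ((((con (+ 1) :* u₊ :+ u₋) :+ (q :* con (+ 1)) :* u) :- (con (+ 1) :* (con (+ 1) :- con (+ 1))) :* con (+ 0)) :+ (con (+ 1) :- q :* con (+ 1)) :* u)
        := (((con (+ 1) :* (u₊ :+ (con (+ 1) :- con (+ 1)) :* con (+ 0)) :+ (u₋ :+ (con (+ 1) :- con (+ 1)) :* con (+ 0))) :+ (con (+ 1) :* con (+ 1)) :* (u :+ (con (+ 1) :- con (+ 1)) :* con (+ 0))) :- (con (+ 1) :* (con (+ 1) :- con (+ 1))) :* con (+ 0)))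
      ≈-refl q (u (ℤ.suc j)) (u (ℤ.pred j)) (u j)
    recZ (suc m) j = begin
      p u (suc (suc m)) j ⊕ qc (suc (suc m)) · p u (suc m) j
        ≈⟨ ⊕-congʳ (pf-rec δ q u (suc m) j) ⟩
      rec δ q (p u) (suc m) j ⊕ qc (suc (suc m)) · p u (suc m) j
        ≈⟨ solve 9 (λ q Q P₊ P₋ P₀ A₊ A₋ A₀ B₀ →
             ((((con (+ 1) :* P₊ :+ P₋) :+ (q :* (q :* Q)) :* P₀) :- (con (+ 1) :* (con (+ 1) :- q :* Q)) :* A₀) :+ (con (+ 1) :- q :* (q :* Q)) :* P₀)
             := ((((con (+ 1) :* (P₊ :+ (con (+ 1) :- q :* Q) :* A₊) :+ (P₋ :+ (con (+ 1) :- q :* Q) :* A₋)) :+ (con (+ 1) :* (q :* Q)) :* (P₀ :+ (con (+ 1) :- q :* Q) :* A₀))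
                 :- (con (+ 1) :* (con (+ 1) :- q :* Q)) :* (A₀ :+ (con (+ 1) :- Q) :* B₀))
                 :+ (con (+ 1) :- q :* Q) :* (P₀ :- (((con (+ 1) :* A₊ :+ A₋) :+ (q :* Q) :* A₀) :- (con (+ 1) :* (con (+ 1) :- Q)) :* B₀))))
           ≈-refl q (q^ m) (p u (suc m) (ℤ.suc j)) (p u (suc m) (ℤ.pred j)) (p u (suc m) j) (p u m (ℤ.suc j)) (p u m (ℤ.pred j)) (p u m j) (prev (p u) m j) ⟩
      rec δ δ Z (suc m) j ⊕ qc (suc m) · (p u (suc m) j ⊖ rec δ q (p u) m j)
        ≈⟨ kill _ (pf-rec δ q u m j) ⟩
      rec δ δ Z (suc m) j ∎

  -- On the right stands the product of (1 + z) and (1 + 1/z) applied to p_m. One factor makes R_0 a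
  -- theta convolution in the odd step; the other is saved in `doubled` and spent in the following
  -- even step.
  p′-sum : ∀ u m j → p′ u (suc m) j ⊕ p′ u m j ≈ ((p u m (ℤ.suc j) ⊕ p u m j) ⊕ (p u m j ⊕ p u m (ℤ.pred j)))
  p′-sum u m j = begin
    p′ u (suc m) j ⊕ p′ u m j
      ≈⟨ ⊕-cong (p′≈ u (suc m) j) (p′≈ u m j) ⟩
    (p u (suc m) j ⊕ qc (suc m) · p u m j) ⊕ (p u m j ⊕ qc m · prev (p u) m j)
      ≈⟨ ⊕-congʳ (⊕-congʳ (pf-rec δ q u m j)) ⟩
    (rec δ q (p u) m j ⊕ qc (suc m) · p u m j) ⊕ (p u m j ⊕ qc m · prev (p u) m j)
      ≈⟨ solve 6 (λ q Q P₊ P₋ P₀ A → ((((con (+ 1) :* P₊ :+ P₋) :+ (q :* Q) :* P₀) :- (con (+ 1) :* (con (+ 1) :- Q)) :* A) :+ (con (+ 1) :- q :* Q) :* P₀) :+ (P₀ :+ (con (+ 1) :- Q) :* A)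
            := (P₊ :+ P₀) :+ (P₀ :+ P₋)) ≈-refl q (q^ m) (p u m (ℤ.suc j)) (p u m (ℤ.pred j)) (p u m j) (prev (p u) m j) ⟩
    (p u m (ℤ.suc j) ⊕ p u m j) ⊕ (p u m j ⊕ p u m (ℤ.pred j)) ∎

  sumR : ∀ u m j → tsum (suc (suc m ℕ.+ 0)) (λ l → weight l (suc m) · p′ u l j) ≈ R (suc m) u j ⊕ R m u j
  sumR u m j = begin
    tsum C (λ l → weight l (suc m) · p′ u l j)
      ≈⟨ tsum-cong C (λ l → ≈-trans (·-congˡ (p′≈ u l j)) (·-distribˡ _ _ _)) ⟩
    tsum C (λ l → weight l (suc m) · p u l j ⊕ weight l (suc m) · (qc l · prev (p u) l j))
      ≈⟨ tsum-⊕ C _ _ ⟩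
    R (suc m) u j ⊕ tsum C (λ l → weight l (suc m) · (qc l · prev (p u) l j))
      ≈⟨ ⊕-congˡ (≈-trans (tsum-peel (tame-weight (suc m) _)) (≈-trans (⊕-cong (·-zeroʳ _ (SR.zeroʳ _))
           (tsum-cong C (λ l → ≈-trans (solve 4 (λ k i c x → (k :* i) :* (c :* x) := (k :* (c :* i)) :* x) ≈-refl
               (κ (suc l) (suc m)) (invPoch (suc l)) (qc (suc l)) (p u l j))
             (·-congʳ (·-cong (≡⇒≈ (κ-suc l m)) (qc-invPoch l))))))
          (≈-trans (⊕-identityˡ _) (tsum-R u j (ℕP.n≤1+n _))))) ⟩
    R (suc m) u j ⊕ R m u j ∎
    where C = suc (suc m ℕ.+ 0)

  mutual
    -- An odd step has exponent T(l - m - 1), obtained from the kernel with α = 0 by raising m. Both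
    -- kinds of steps can thus use the same operator R_0.
    evenChain oddChain : ℕ → ℕ → Series
    evenChain zero    m = unit m
    evenChain (suc k) m = tsum (suc (m ℕ.+ 0)) (λ l → weight l m · oddChain k l)
    oddChain k m = tsum (suc (suc m ℕ.+ 0)) (λ l → weight l (suc m) · evenChain k l)

  -- Each pair of steps brings in one shift, so that `centred k` is `uN (2k)` translated by k; this
  -- is the origin of the evaluation point n in the second identity.
  centred doubled : ℕ → ℤ → Series
  centred zero      = u₀
  centred (suc k) j = conv (conv (centred k)) (ℤ.suc j)
  doubled k j = conv (centred k) (ℤ.suc j) ⊕ conv (centred k) j

  norm : ℕ → Series
  norm k = b (+ 0) ^S (k ℕ.+ k)

  mutual
    evenChain≈ : ∀ k m → evenChain k m ≈ norm k · p′ (centred k) m (+ 0)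
    evenChain≈ zero zero    = ≈-sym (·-identityˡ oneS)
    evenChain≈ zero (suc m) = ≈-sym (·-zeroʳ _ (pf-u₀ δ (·-zeroˡ _ (⊕-inverseʳ oneS)) m))
    evenChain≈ (suc k) m = begin
      tsum _ (λ l → weight l m · oddChain k l)
        ≈⟨ tsum-cong _ (λ l → ≈-trans (·-congˡ (oddChain≈ k l))
             (solve 3 (λ w c x → w :* (c :* x) := c :* (w :* x)) ≈-refl (weight l m) c _)) ⟩
      tsum _ (λ l → c · (weight l m · p (doubled k) l (+ 0)))
        ≈⟨ ≈-sym (tsum-· c (tame-weight m _)) ⟩
      c · R m (doubled k) (+ 0)
        ≈⟨ ·-congˡ (begin
           R m (doubled k) (+ 0)
             ≈⟨ ≈-trans (R-reduce m (doubled k) (+ 0)) (Φ-cong (R-equivariant 0) (λ j → ≈-trans (pf-⊕ δ δ _ v m j)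
                  (⊕-congʳ (pf-Φ suc-equivariant δ δ m v j))) (+ 0)) ⟩
           R 0 (λ j → g (ℤ.suc j) ⊕ g j) (+ 0)
             ≈⟨ ≈-trans (Φ-⊕ (R-equivariant 0) _ _ (+ 0)) (⊕-congʳ (Φ-suc (R-equivariant 0) g (+ 0))) ⟩
           R 0 g (+ 1) ⊕ R 0 g (+ 0)
             ≈⟨ R≈conv g (+ 1) ⟩
           b (+ 0) · conv g (+ 1)
             ≈⟨ ·-congˡ (≈-trans (≈-sym (pf-Φ conv-equivariant δ δ m v (+ 1))) (≈-sym (pf-Φ suc-equivariant δ δ m (conv v) (+ 0)))) ⟩
           b (+ 0) · p′ (centred (suc k)) m (+ 0) ∎) ⟩
      c · (b (+ 0) · p′ (centred (suc k)) m (+ 0))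
        ≈⟨ ≈-trans (solve 3 (λ c x y → c :* (x :* y) := (x :* c) :* y) ≈-refl c (b (+ 0)) _)
             (·-congʳ (≡⇒≈ (cong (b (+ 0) ^S_) (cong suc (sym (ℕP.+-suc k k)))))) ⟩
      norm (suc k) · p′ (centred (suc k)) m (+ 0) ∎
      where
      c = b (+ 0) ^S suc (k ℕ.+ k)
      v = conv (centred k)
      g = p′ v m

    oddChain≈ : ∀ k m → oddChain k m ≈ b (+ 0) ^S suc (k ℕ.+ k) · p (doubled k) m (+ 0)
    oddChain≈ k m = begin
      tsum C (λ l → weight l (suc m) · evenChain k l)
        ≈⟨ tsum-cong C (λ l → ≈-trans (·-congˡ (evenChain≈ k l))
             (solve 3 (λ w c x → w :* (c :* x) := c :* (w :* x)) ≈-refl (weight l (suc m)) (norm k) _)) ⟩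
      tsum C (λ l → norm k · (weight l (suc m) · p′ w l (+ 0)))
        ≈⟨ ≈-sym (tsum-· (norm k) (tame-weight (suc m) _)) ⟩
      norm k · tsum C (λ l → weight l (suc m) · p′ w l (+ 0))
        ≈⟨ ·-congˡ (begin
           tsum C (λ l → weight l (suc m) · p′ w l (+ 0))
             ≈⟨ sumR w m (+ 0) ⟩
           R (suc m) w (+ 0) ⊕ R m w (+ 0)
             ≈⟨ ⊕-cong (R-reduce (suc m) w (+ 0)) (R-reduce m w (+ 0)) ⟩
           R 0 (p′ w (suc m)) (+ 0) ⊕ R 0 (p′ w m) (+ 0)
             ≈⟨ ≈-trans (≈-sym (Φ-⊕ R₀ _ _ (+ 0))) (Φ-cong R₀ (p′-sum w m) (+ 0)) ⟩
           R 0 (λ j → (f (ℤ.suc j) ⊕ f j) ⊕ (f j ⊕ f (ℤ.pred j))) (+ 0)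
             ≈⟨ Φ-⊕ R₀ _ _ (+ 0) ⟩
           R 0 g (+ 0) ⊕ R 0 (λ j → f j ⊕ f (ℤ.pred j)) (+ 0)
             ≈⟨ ⊕-congˡ (≈-trans (Φ-cong R₀ (λ j → ⊕-congʳ (≡⇒≈ (cong f (sym (ℤP.suc-pred j))))) (+ 0)) (Φ-pred R₀ g (+ 0))) ⟩
           R 0 g (+ 0) ⊕ R 0 g (ℤ.pred (+ 0))
             ≈⟨ R≈conv g (+ 0) ⟩
           b (+ 0) · conv g (+ 0)
             ≈⟨ ·-congˡ (begin
                conv g (+ 0)
                  ≈⟨ ≈-trans (Φ-⊕ conv-equivariant (λ j → f (ℤ.suc j)) f (+ 0)) (⊕-congʳ (Φ-suc conv-equivariant f (+ 0))) ⟩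
                conv f (+ 1) ⊕ conv f (+ 0)
                  ≈⟨ ≈-sym (⊕-cong (≈-trans (pf-Φ suc-equivariant δ q m (conv w) (+ 0)) (pf-Φ conv-equivariant δ q m w (+ 1)))
                                   (pf-Φ conv-equivariant δ q m w (+ 0))) ⟩
                p (λ j → conv w (ℤ.suc j)) m (+ 0) ⊕ p (conv w) m (+ 0)
                  ≈⟨ ≈-sym (pf-⊕ δ q _ _ m (+ 0)) ⟩
                p (doubled k) m (+ 0) ∎) ⟩
           b (+ 0) · p (doubled k) m (+ 0) ∎) ⟩
      norm k · (b (+ 0) · p (doubled k) m (+ 0))
        ≈⟨ solve 3 (λ c x y → c :* (x :* y) := (x :* c) :* y) ≈-refl (norm k) (b (+ 0)) _ ⟩
      b (+ 0) ^S suc (k ℕ.+ k) · p (doubled k) m (+ 0) ∎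
      where
      C = suc (suc m ℕ.+ 0)
      w = centred k
      f = p w m
      R₀ = R-equivariant 0
      g : ℤ → Series
      g j = f (ℤ.suc j) ⊕ f j

centred≈ : ∀ k j → Alternating.centred k j ≈ uN (k ℕ.+ k) (j ℤ.+ + k)
centred≈ zero    j = ≡⇒≈ (cong u₀ (sym (ℤP.+-identityʳ j)))
centred≈ (suc k) j = ≈-trans
  (sumℤ-cong 2 (λ i → ·-congˡ (sumℤ-cong 2 (λ i′ → ·-congˡ (≈-trans (centred≈ k _)
    (≡⇒≈ (cong (uN (k ℕ.+ k)) (ZS.solve 4 (λ j i i′ k → (((ZS.con (+ 1) ZS.:+ j) ZS.:+ i) ZS.:+ i′) ZS.:+ k
       ZS.:= ((j ZS.:+ (ZS.con (+ 1) ZS.:+ k)) ZS.:+ i) ZS.:+ i′) refl j i i′ (+ k)))))))))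
  (≡⇒≈ (cong (λ N → uN N (j ℤ.+ + suc k)) (cong suc (sym (ℕP.+-suc k k)))))

-- Antisymmetry and quasi-periodicity of u_N

flip≡ : ∀ s → flip s ≡ ℤ.- (ℤ.suc s)
flip≡ (+ i)        = refl
flip≡ -[1+ zero ]  = refl
flip≡ -[1+ suc i ] = refl

-- The theta kernel is invariant under s ↦ -1 - s, and substituting s at i and -1 - s at j lowers
-- the sum i + j by one, down to the case N = 0.
uN-antisym : ∀ N i j → i ℤ.+ j ≡ + suc N → uN N i ≈ ⊝ uN N j
uN-antisym zero i j e with j≡ ← trans (ZS.solve 2 (λ i j → j ZS.:= (i ZS.:+ j) ZS.:- i) refl i j) (cong (ℤ._- i) e) = base i j≡
  where
  ⊝⊝ : ∀ x → x ≈ ⊝ (⊝ x)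
  ⊝⊝ = solve 1 (λ x → x := :- (:- x)) ≈-refl
  base : ∀ i → j ≡ + 1 ℤ.- i → u₀ i ≈ ⊝ u₀ j
  base (+ 0)           refl = ⊝⊝ oneS
  base (+ 1)           refl = ≈-refl
  base (+ suc (suc n)) refl = ⊝⊝ _
  base -[1+ n ]        refl = ≈-refl
uN-antisym (suc N) i j e = begin
  sumℤ 2 (λ s → τ s · uN N (i ℤ.+ s))
    ≈⟨ sumℤ-cong 2 (λ s → ≈-trans (·-cong (≈-sym (τ-flip s)) (uN-antisym N (i ℤ.+ s) (j ℤ.+ flip s) (index s)))
         (solve 2 (λ t u → t :* (:- u) := :- (t :* u)) ≈-refl _ _)) ⟩
  sumℤ 2 (λ s → ⊝ (τ (flip s) · uN N (j ℤ.+ flip s)))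
    ≈⟨ ≈-trans (sumℤ-⊝ 2 _) (⊝-cong (sumℤ-flip 2 (λ s → τ s · uN N (j ℤ.+ s)))) ⟩
  ⊝ uN (suc N) j ∎
  where
  index : ∀ s → (i ℤ.+ s) ℤ.+ (j ℤ.+ flip s) ≡ + suc N
  index s = trans (cong (λ z → (i ℤ.+ s) ℤ.+ (j ℤ.+ z)) (flip≡ s))
    (trans (ZS.solve 3 (λ i j s → (i ZS.:+ s) ZS.:+ (j ZS.:+ (ZS.:- (ZS.con (+ 1) ZS.:+ s))) ZS.:= ZS.con -[1+ 0 ] ZS.:+ (i ZS.:+ j)) refl i j s)
           (cong ℤ.pred e))

-- Every integer is a difference of two naturals; used to avoid negative powers of q.
split± : ∀ s → ∃ λ x → ∃ λ y → + x ≡ s ℤ.+ + y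
split± (+ n)    = n , 0 , cong +_ (sym (ℕP.+-identityʳ n))
split± -[1+ n ] = 0 , suc n , sym (ℤP.+-inverseˡ (+ suc n))

∣pred∣ : ∀ s → ∣ s ∣₋ ≤ suc ∣ ℤ.pred s ∣₋
∣pred∣ (+ zero)  = z≤n
∣pred∣ (+ suc i) = ℕP.≤-refl
∣pred∣ -[1+ i ]  = ℕP.≤-trans (ℕP.n≤1+n i) (ℕP.n≤1+n _)

-- Since q^s τ(s-1) = τ(s), the factor q^s produced by the induction hypothesis is absorbed by
-- moving the summation index by one. The period grows by one per convolution, the factor q^(j+1)
-- stays the same.
uN-quasiperiodic : ∀ N j a b → + a ≡ (j ℤ.+ + 1) ℤ.+ + b → q^ a · uN N j ≈ q^ b · uN N (+ (3 ℕ.+ N) ℤ.+ j)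
uN-quasiperiodic zero    j a b e = u₀-quasiperiodic j a b e
uN-quasiperiodic (suc N) j a b e = begin
  q^ a · sumℤ 2 (λ s → τ s · uN N (j ℤ.+ s))
    ≈⟨ sumℤ-· (q^ a) (conv-tame 1 _) ⟩
  sumℤ 2 (λ s → q^ a · (τ s · uN N (j ℤ.+ s)))
    ≈⟨ sumℤ-cong 2 term ⟩
  sumℤ 2 (λ s → q^ b · g s)
    ≈⟨ ≈-sym (sumℤ-· (q^ b) tame-g) ⟩
  q^ b · sumℤ 2 g
    ≈⟨ ·-congˡ (≈-trans (≈-sym (sumℤ-raise tame-g (ℕP.n≤1+n 2))) (≈-trans (≈-sym (sumℤ-shift tame-g))
        (≈-trans (sumℤ-cong 3 (λ s → ·-cong (≡⇒≈ (cong τ (ℤP.pred-suc s))) (≡⇒≈ (cong (uN N)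
           (ZS.solve 3 (λ K j s → K ZS.:+ (j ZS.:+ (ZS.con (+ 1) ZS.:+ s)) ZS.:= ((ZS.con (+ 1) ZS.:+ K) ZS.:+ j) ZS.:+ s) refl K j s)))))
         (sumℤ-raise (conv-tame 1 _) (ℕP.n≤1+n 2))))) ⟩
  q^ b · uN (suc N) (+ (4 ℕ.+ N) ℤ.+ j) ∎
  where
  K = + (3 ℕ.+ N)
  g : ℤ → Series
  g s = τ (ℤ.pred s) · uN N (K ℤ.+ (j ℤ.+ s))
  tame-g : Tameℤ 2 g
  tame-g = tameℤ-qp (λ s → Tℤ (ℤ.pred s)) _ (λ s → ℕP.≤-trans (s≤s (ℕP.≤-trans (∣pred∣ s) (s≤s (∣∣₋≤T (ℤ.pred s))))) (ℕP.≤-reflexive (ℕP.+-comm 2 _)))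
  term : ∀ s → q^ a · (τ s · uN N (j ℤ.+ s)) ≈ q^ b · g s
  term s with split± s
  ... | x , y , e′ = q^-cancel y (begin
    q^ y · (q^ a · (τ s · u))
      ≈⟨ solve 4 (λ y a t u → y :* (a :* (t :* u)) := a :* ((y :* t) :* u)) ≈-refl (q^ y) (q^ a) (τ s) u ⟩
    q^ a · ((q^ y · τ s) · u)
      ≈⟨ ·-congˡ (·-congʳ (≈-trans (·-cong (≈-sym (qp≈q^ y)) (≡⇒≈ (cong τ (sym (ℤP.suc-pred s)))))
           (≈-trans (τ-suc (ℤ.pred s) x y (trans e′ (cong (ℤ._+ + y) (sym (ℤP.suc-pred s))))) (·-congʳ (qp≈q^ x))))) ⟩
    q^ a · ((q^ x · τ (ℤ.pred s)) · u)
      ≈⟨ solve 4 (λ a x t u → a :* ((x :* t) :* u) := t :* ((a :* x) :* u)) ≈-refl (q^ a) (q^ x) (τ (ℤ.pred s)) u ⟩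
    τ (ℤ.pred s) · ((q^ a · q^ x) · u)
      ≈⟨ ·-congˡ (≈-trans (·-congʳ (≈-sym (q^-+ a x))) (≈-trans (uN-quasiperiodic N (j ℤ.+ s) (a ℕ.+ x) (b ℕ.+ y)
            (trans (cong₂ ℤ._+_ e e′) (ZS.solve 4 (λ j s b y → ((j ZS.:+ ZS.con (+ 1)) ZS.:+ b) ZS.:+ (s ZS.:+ y) ZS.:= ((j ZS.:+ s) ZS.:+ ZS.con (+ 1)) ZS.:+ (b ZS.:+ y)) refl j s (+ b) (+ y))))
           (·-congʳ (q^-+ b y)))) ⟩
    τ (ℤ.pred s) · ((q^ b · q^ y) · uN N (K ℤ.+ (j ℤ.+ s)))
      ≈⟨ solve 4 (λ b y t u → t :* ((b :* y) :* u) := y :* (b :* (t :* u))) ≈-refl (q^ b) (q^ y) (τ (ℤ.pred s)) _ ⟩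
    q^ y · (q^ b · g s) ∎)
    where u = uN N (j ℤ.+ s)

½ : Series
½ = const (ℚ.1/ (ℤ→ℚ (+ 2)))

½+½ : ½ ⊕ ½ ≈ oneS
½+½ = ≈-trans (≈-sym (const-+ _ _)) const-1

self-neg : ∀ {x} → x ≈ ⊝ x → x ≈ 0S
self-neg {x} e = begin
  x              ≈⟨ ≈-sym (≈-trans (·-congʳ ½+½) (·-identityˡ x)) ⟩
  (½ ⊕ ½) · x    ≈⟨ solve 2 (λ h x → (h :+ h) :* x := h :* x :+ h :* x) ≈-refl ½ x ⟩
  ½ · x ⊕ ½ · x  ≈⟨ ⊕-congˡ (·-congˡ e) ⟩
  ½ · x ⊕ ½ · ⊝ x ≈⟨ solve 2 (λ h x → h :* x :+ h :* (:- x) := con (+ 0)) ≈-refl ½ x ⟩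
  0S ∎

-- The indices -1 and N + 2 are a period apart with trivial factor, and antisymmetry exchanges them;
-- the value equals its negative. This disposes of the residue class r = 0.
uN-zero : ∀ N → uN N -[1+ 0 ] ≈ 0S
uN-zero N = self-neg (≈-trans (uN-antisym N -[1+ 0 ] (+ (2 ℕ.+ N)) refl) (⊝-cong (≈-sym
  (≈-trans (≈-sym (·-identityˡ _)) (≈-trans (uN-quasiperiodic N -[1+ 0 ] 0 0 refl) (·-identityˡ _))))))

-- Decay of u_N and translations of bilateral sums

cN : ℕ → ℕ
cN zero    = 3
cN (suc N) = 2 ℕ.+ cN N

∣∣₋-abs : ∀ j → ∣ j ∣₋ ≤ ℤ.∣ j ∣
∣∣₋-abs (+ i)    = ℕP.≤-refl
∣∣₋-abs -[1+ i ] = ℕP.n≤1+n i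

abs-∣∣₋ : ∀ j → ℤ.∣ j ∣ ≤ suc ∣ j ∣₋
abs-∣∣₋ (+ i)    = ℕP.n≤1+n i
abs-∣∣₋ -[1+ i ] = ℕP.≤-refl

∣∣₋-triangle : ∀ j s → ∣ j ∣₋ ≤ 2 ℕ.+ (∣ j ℤ.+ s ∣₋ ℕ.+ ∣ s ∣₋)
∣∣₋-triangle j s = ℕP.≤-trans (∣∣₋-abs j) (ℕP.≤-trans (ℕP.≤-reflexive (cong ℤ.∣_∣ (ZS.solve 2 (λ j s → j ZS.:= (j ZS.:+ s) ZS.:- s) refl j s)))
  (ℕP.≤-trans (ℤP.∣i-j∣≤∣i∣+∣j∣ (j ℤ.+ s) s) (ℕP.≤-trans (ℕP.+-mono-≤ (abs-∣∣₋ (j ℤ.+ s)) (abs-∣∣₋ s))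
  (ℕP.≤-reflexive (cong suc (ℕP.+-suc _ _))))))

-- If k is not below T(s), the factor τ(s) uses up T(s) orders, at least the size of s, and this
-- pays for moving the argument from j to j + s. The cutoff is therefore uniform in s, as the
-- exchange of double sums requires.
τ-shift-vanish : ∀ {C} (f : ℤ → Series) → Tameℤ C f → ∀ s j k → k ℕ.+ (2 ℕ.+ C) ≤ ∣ j ∣₋ → (τ s · f (j ℤ.+ s)) k ≡ 0ℚ
τ-shift-vanish {C} f t s j k p with k ℕP.<? Tℤ s
... | yes k< = qp-below (Tℤ s) _ k k<
... | no k≮ with ℕP.m≤n⇒∃[o]m+o≡n (ℕP.≮⇒≥ k≮)
...   | (k′ , refl) = trans (qp-shift (Tℤ s) _ k′) (tameℤ-at t (j ℤ.+ s) k′ bound)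
  where
  bound : k′ ℕ.+ C ≤ ∣ j ℤ.+ s ∣₋
  bound = ℕP.+-cancelʳ-≤ (2 ℕ.+ ∣ s ∣₋) _ _ (ℕP.≤-trans
    (ℕP.≤-reflexive (trans (ℕP.+-comm (k′ ℕ.+ C) _) (cong (2 ℕ.+_) refl)))
    (ℕP.≤-trans (ℕP.+-monoˡ-≤ (k′ ℕ.+ C) (s≤s (s≤s (∣∣₋≤T s))))
    (ℕP.≤-trans (ℕP.≤-reflexive (trans (cong (2 ℕ.+_) (sym (ℕP.+-assoc (Tℤ s) k′ C)))
        (trans (cong suc (sym (ℕP.+-suc _ C))) (sym (ℕP.+-suc _ (suc C))))))
    (ℕP.≤-trans p (ℕP.≤-trans (∣∣₋-triangle j s) (ℕP.≤-reflexive (trans (cong suc (sym (ℕP.+-suc _ _))) (sym (ℕP.+-suc _ _)))))))))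

uN-tame : ∀ N → Tameℤ (cN N) (uN N)
uN-tame zero = mkTameℤ (mkTame (λ i k p → small i k p)) (mkTame (λ i k p → trans (⊝-at _ k) (cong ℚ.-_ (small (2 ℕ.+ i) k (ℕP.≤-trans p (ℕP.m≤n+m i 2))))))
  where
  small : ∀ i k → k ℕ.+ 3 ≤ i → ψ i k ≡ 0ℚ
  small zero                k p with () ← ℕP.≤-trans (ℕP.m≤n+m 3 k) p
  small (suc zero)          k p with s≤s () ← ℕP.≤-trans (ℕP.m≤n+m 3 k) p
  small (suc (suc zero))    k p with s≤s (s≤s ()) ← ℕP.≤-trans (ℕP.m≤n+m 3 k) p
  small (suc (suc (suc i))) k p = trans (sym (at (·-congʳ (qp≈q^ (suc i))) k))
    (qp-below (suc i) (ψ i) k (s≤s (ℕP.+-cancelʳ-≤ 3 k i (ℕP.≤-trans p (ℕP.≤-reflexive (ℕP.+-comm 3 i))))))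
uN-tame (suc N) = mkTameℤ′ (λ j k p → vanish j k p)
  where
  vanish : ∀ j k → k ℕ.+ (2 ℕ.+ cN N) ≤ ∣ j ∣₋ → conv (uN N) j k ≡ 0ℚ
  vanish j k p = trans (at (sumℤ-def 2 _) k) (trans (⊕-at _ _ k) (cong₂ ℚ._+_
    (trans (tsum-at 2 _ k) (sumTo-0 (k ℕ.+ 2) (λ i _ → τ-shift-vanish (uN N) (uN-tame N) (+ i) j k p)))
    (trans (tsum-at 2 _ k) (sumTo-0 (k ℕ.+ 2) (λ i _ → τ-shift-vanish (uN N) (uN-tame N) -[1+ i ] j k p)))))

tame-suc : ∀ {C f} → Tameℤ C f → Tameℤ (suc C) (λ j → f (ℤ.suc j))
tame-suc {C} {f} t = mkTameℤ′ (λ j k p → tameℤ-at t (ℤ.suc j) k (ℕP.≤-pred (ℕP.≤-trans (ℕP.≤-reflexive (sym (ℕP.+-suc k C))) (ℕP.≤-trans p (aux j)))))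
  where
  aux : ∀ j → ∣ j ∣₋ ≤ suc ∣ ℤ.suc j ∣₋
  aux (+ i)        = ℕP.≤-trans (ℕP.n≤1+n i) (ℕP.n≤1+n _)
  aux -[1+ zero ]  = z≤n
  aux -[1+ suc i ] = ℕP.≤-refl

tame-pred : ∀ {C f} → Tameℤ C f → Tameℤ (suc C) (λ j → f (ℤ.pred j))
tame-pred {C} {f} t = mkTameℤ′ (λ j k p → tameℤ-at t (ℤ.pred j) k (ℕP.≤-pred (ℕP.≤-trans (ℕP.≤-reflexive (sym (ℕP.+-suc k C))) (ℕP.≤-trans p (∣pred∣ j)))))

-- Translating by i moves the cutoff by an amount that grows with i, hence the existential;
-- `sum-τ-shift` trades it for a uniform one.
Shifted : ℕ → (ℤ → Series) → ℤ → Set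
Shifted C f i = ∃ λ C′ → Tameℤ C′ (λ j → f (j ℤ.+ i)) × sumℤ C′ (λ j → f (j ℤ.+ i)) ≈ sumℤ C f

shifted : ∀ {C f} → Tameℤ C f → ∀ i → Shifted C f i
shifted {C} {f} t = go
  where
  along : ∀ {C′ g h} → (∀ j → h j ≡ g j) → Tameℤ C′ h × sumℤ C′ h ≈ sumℤ C f → Tameℤ C′ g × sumℤ C′ g ≈ sumℤ C f
  along {C′} e (t , s) = tameℤ-cong (λ j → ≡⇒≈ (e j)) t , ≈-trans (sumℤ-cong C′ (λ j → ≡⇒≈ (sym (e j)))) s
  up : ∀ i → Shifted C f i → Shifted C f (ℤ.suc i)
  up i (C′ , t′ , s) = suc C′ , along (λ j → cong f (ZS.solve 2 (λ j i → (ZS.con (+ 1) ZS.:+ j) ZS.:+ i ZS.:= j ZS.:+ (ZS.con (+ 1) ZS.:+ i)) refl j i))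
    (tame-suc t′ , ≈-trans (sumℤ-shift t′) (≈-trans (sumℤ-raise t′ (ℕP.n≤1+n C′)) s))
  down : ∀ i → Shifted C f i → Shifted C f (ℤ.pred i)
  down i (C′ , t′ , s) = suc (suc C′) , along (λ j → cong f (ZS.solve 2 (λ j i → (ZS.con -[1+ 0 ] ZS.:+ j) ZS.:+ i ZS.:= j ZS.:+ (ZS.con -[1+ 0 ] ZS.:+ i)) refl j i))
    (tameℤ-raise (ℕP.n≤1+n _) (tame-pred t′) ,
     ≈-trans (≈-sym (sumℤ-shift (tame-pred t′))) (≈-trans (sumℤ-cong _ (λ j → ≡⇒≈ (cong (λ z → f (z ℤ.+ i)) (ℤP.pred-suc j))))
       (≈-trans (sumℤ-raise t′ (ℕP.≤-trans (ℕP.n≤1+n _) (ℕP.n≤1+n _))) s)))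
  go : ∀ i → Shifted C f i
  go (+ zero)     = C , along (λ j → cong f (sym (ℤP.+-identityʳ j))) (t , ≈-refl)
  go (+ suc i)    = up (+ i) (go (+ i))
  go -[1+ zero ]  = down (+ 0) (go (+ 0))
  go -[1+ suc i ] = down -[1+ i ] (go -[1+ i ])

tame-τ-shift : ∀ {C f} → Tameℤ C f → ∀ i → Tameℤ (2 ℕ.+ C) (λ j → τ i · f (j ℤ.+ i))
tame-τ-shift {f = f} t i = mkTameℤ′ (τ-shift-vanish f t i)

sum-τ-shift : ∀ {C f} → Tameℤ C f → ∀ i → sumℤ (2 ℕ.+ C) (λ j → τ i · f (j ℤ.+ i)) ≈ τ i · sumℤ C f
sum-τ-shift t i with shifted t i
... | C′ , t′ , s = ≈-trans (sumℤ-indep (tame-τ-shift t i) (tameℤ-· (λ _ → τ i) t′))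
  (≈-trans (≈-sym (sumℤ-· (τ i) t′)) (·-congˡ s))

-- Signed moments of u_N

sgn : ℕ → Series
sgn zero    = oneS
sgn (suc n) = ⊝ sgn n

sg : ℤ → Series
sg j = sgn ℤ.∣ j ∣

⊝-involutive : ∀ x → x ≈ ⊝ (⊝ x)
⊝-involutive = solve 1 (λ x → x := :- (:- x)) ≈-refl

sg-suc : ∀ j → sg (ℤ.suc j) ≈ ⊝ sg j
sg-suc (+ i)        = ≈-refl
sg-suc -[1+ zero ]  = ⊝-involutive oneS
sg-suc -[1+ suc i ] = ⊝-involutive _

sg-pred : ∀ j → sg (ℤ.pred j) ≈ ⊝ sg j
sg-pred j = ≈-trans (⊝-involutive _) (⊝-cong (≈-trans (≈-sym (sg-suc (ℤ.pred j))) (≡⇒≈ (cong sg (ℤP.suc-pred j)))))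

sg-+ : ∀ i j → sg (i ℤ.+ j) ≈ sg i · sg j
sg-+ = λ { (+ i) j → pos i j ; -[1+ i ] j → neg i j }
  where
  ⊝· : ∀ x y → ⊝ (x · y) ≈ (⊝ x) · y
  ⊝· = solve 2 (λ x y → :- (x :* y) := (:- x) :* y) ≈-refl
  pos : ∀ i j → sg (+ i ℤ.+ j) ≈ sg (+ i) · sg j
  pos zero    j = ≈-trans (≡⇒≈ (cong sg (ℤP.+-identityˡ j))) (≈-sym (·-identityˡ _))
  pos (suc i) j = ≈-trans (≡⇒≈ (cong sg (ZS.solve 2 (λ i j → (ZS.con (+ 1) ZS.:+ i) ZS.:+ j ZS.:= ZS.con (+ 1) ZS.:+ (i ZS.:+ j)) refl (+ i) j)))
    (≈-trans (sg-suc (+ i ℤ.+ j)) (≈-trans (⊝-cong (pos i j)) (⊝· _ _)))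
  neg : ∀ i j → sg (-[1+ i ] ℤ.+ j) ≈ sg -[1+ i ] · sg j
  neg zero    j = ≈-trans (sg-pred j) (≈-trans (⊝-cong (≈-sym (·-identityˡ _))) (⊝· _ _))
  neg (suc i) j = ≈-trans (≡⇒≈ (cong sg (ZS.solve 2 (λ i j → (ZS.con -[1+ 0 ] ZS.:+ i) ZS.:+ j ZS.:= ZS.con -[1+ 0 ] ZS.:+ (i ZS.:+ j)) refl -[1+ i ] j)))
    (≈-trans (sg-pred (-[1+ i ] ℤ.+ j)) (≈-trans (⊝-cong (neg i j)) (⊝· _ _)))

sgn-square : ∀ n → sgn n · sgn n ≈ oneS
sgn-square zero    = ·-identityˡ oneS
sgn-square (suc n) = ≈-trans (solve 1 (λ x → (:- x) :* (:- x) := x :* x) ≈-refl (sgn n)) (sgn-square n)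

sg-neg : ∀ j → sg (ℤ.- j) ≈ sg j
sg-neg j = ≡⇒≈ (cong sgn (ℤP.∣-i∣≡∣i∣ j))

sg-flip : ∀ j → sg (flip j) ≈ ⊝ sg j
sg-flip j = ≈-trans (≡⇒≈ (cong sg (flip≡ j))) (≈-trans (sg-neg (ℤ.suc j)) (sg-suc j))

-- V = N + 1 - 2j is the doubled index measured from the centre of antisymmetry: j ↦ N + 1 - j
-- becomes V ↦ -V.
Mom : ℕ → (ℤ → Series) → Series
Mom N H = sumℤ (cN N) (λ j → sg j · (uN N j · H (+ suc N ℤ.- (j ℤ.+ j))))

tame-Mom : ∀ N (H : ℤ → Series) → Tameℤ (cN N) (λ j → sg j · (uN N j · H j))
tame-Mom N H = tameℤ-· sg (tameℤ-·ʳ H (uN-tame N))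

Mom-cong : ∀ N {H H′} → (∀ V → H V ≈ H′ V) → Mom N H ≈ Mom N H′
Mom-cong N e = sumℤ-cong _ (λ j → ·-congˡ (·-congˡ (e _)))

Mom-⊕ : ∀ N H H′ → Mom N (λ V → H V ⊕ H′ V) ≈ Mom N H ⊕ Mom N H′
Mom-⊕ N H H′ = ≈-trans (sumℤ-cong _ (λ j → solve 4 (λ s u h h′ → s :* (u :* (h :+ h′)) := s :* (u :* h) :+ s :* (u :* h′)) ≈-refl _ _ _ _)) (sumℤ-⊕ _ _ _)

Mom-· : ∀ N H c → Mom N (λ V → H V · c) ≈ Mom N H · c
Mom-· N H c = ≈-trans (sumℤ-cong _ (λ j → solve 4 (λ s u h c → s :* (u :* (h :* c)) := c :* (s :* (u :* h))) ≈-refl _ _ _ c))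
  (≈-trans (≈-sym (sumℤ-· c (tame-Mom N _))) (·-comm c _))

Mom-0 : ∀ N → Mom N (λ _ → 0S) ≈ 0S
Mom-0 N = sumℤ-0 _ (λ j → ·-zeroʳ _ (SR.zeroʳ _))

odd : ℤ → ℤ
odd i = (i ℤ.+ i) ℤ.+ + 1

-- In the double sum the inner index j + i becomes the new j: the sign splits off (-1)^i, and V
-- changes by the odd number 2i + 1.
Mom-suc : ∀ N H → Mom (suc N) H ≈ sumℤ (2 ℕ.+ cN N) (λ i → (sg i · τ i) · Mom N (λ V → H (V ℤ.+ odd i)))
Mom-suc N H = begin
  sumℤ C (λ j → sg j · (conv (uN N) j · h j))
    ≈⟨ sumℤ-cong C (λ j → ≈-trans (·-congˡ (≈-trans (·-comm _ _) (≈-trans (·-congˡ (≈-sym (sumℤ-raise (conv-tame 1 _) (s≤s (s≤s z≤n)))))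
         (sumℤ-· (h j) (conv-tame (suc (cN N)) _))))) (sumℤ-· (sg j) (tameℤ-· (λ _ → h j) (conv-tame (suc (cN N)) _)))) ⟩
  sumℤ C (λ j → sumℤ C (λ i → sg j · (h j · (τ i · uN N (j ℤ.+ i)))))
    ≈⟨ sumℤ-swap C _ ⟩
  sumℤ C (λ i → sumℤ C (λ j → sg j · (h j · (τ i · uN N (j ℤ.+ i)))))
    ≈⟨ sumℤ-cong C (λ i → ≈-trans (sumℤ-cong C (λ j → term i j)) (≈-trans (sum-τ-shift (tameℤ-· (λ _ → sg i) (tame-Mom N _)) i)
         (≈-trans (·-congˡ (≈-sym (sumℤ-· (sg i) (tame-Mom N _)))) (solve 3 (λ t s m → t :* (s :* m) := (s :* t) :* m) ≈-refl (τ i) (sg i) _)))) ⟩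
  sumℤ C (λ i → (sg i · τ i) · Mom N (λ V → H (V ℤ.+ odd i))) ∎
  where
  C = 2 ℕ.+ cN N
  h : ℤ → Series
  h j = H (+ suc (suc N) ℤ.- (j ℤ.+ j))
  F : ℤ → ℤ → Series
  F i j = sg i · (sg j · (uN N j · H ((+ suc N ℤ.- (j ℤ.+ j)) ℤ.+ odd i)))
  term : ∀ i j → sg j · (h j · (τ i · uN N (j ℤ.+ i))) ≈ τ i · F i (j ℤ.+ i)
  term i j = ≈-sym (≈-trans (·-congˡ (·-congˡ (·-cong (sg-+ j i) (·-congˡ (≡⇒≈ (cong H (ZS.solve 3 (λ n j i →
        (n ZS.:- ((j ZS.:+ i) ZS.:+ (j ZS.:+ i))) ZS.:+ ((i ZS.:+ i) ZS.:+ ZS.con (+ 1)) ZS.:= (ZS.con (+ 1) ZS.:+ n) ZS.:- (j ZS.:+ j)) refl (+ suc N) j i)))))))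
    (≈-trans (solve 5 (λ t s σ u h → t :* (s :* ((σ :* s) :* (u :* h))) := (s :* s) :* (σ :* (h :* (t :* u)))) ≈-refl (τ i) (sg i) (sg j) (uN N (j ℤ.+ i)) (h j))
    (≈-trans (·-congʳ (sgn-square ℤ.∣ i ∣)) (·-identityˡ _))))

sumS : ℕ → (ℕ → Series) → Series
sumS zero    F = 0S
sumS (suc n) F = sumS n F ⊕ F n

sumS-cong< : ∀ n {F G} → (∀ i → i < n → F i ≈ G i) → sumS n F ≈ sumS n G
sumS-cong< zero    e = ≈-refl
sumS-cong< (suc n) e = ⊕-cong (sumS-cong< n (λ i l → e i (ℕP.m<n⇒m<1+n l))) (e n ℕP.≤-refl)

sumS-cong : ∀ n {F G} → (∀ i → F i ≈ G i) → sumS n F ≈ sumS n G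
sumS-cong n e = sumS-cong< n (λ i _ → e i)

sumS-0 : ∀ n {F} → (∀ i → i < n → F i ≈ 0S) → sumS n F ≈ 0S
sumS-0 zero    e = ≈-refl
sumS-0 (suc n) e = ≈-trans (⊕-cong (sumS-0 n (λ i l → e i (ℕP.m<n⇒m<1+n l))) (e n ℕP.≤-refl)) (⊕-identityˡ 0S)

sumS-⊕ : ∀ n F G → sumS n (λ i → F i ⊕ G i) ≈ sumS n F ⊕ sumS n G
sumS-⊕ zero    F G = ≈-sym (⊕-identityˡ 0S)
sumS-⊕ (suc n) F G = ≈-trans (⊕-congʳ (sumS-⊕ n F G)) (⊕-interchange _ _ _ _)

sumS-· : ∀ n c F → c · sumS n F ≈ sumS n (λ i → c · F i)
sumS-· zero    c F = SR.zeroʳ c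
sumS-· (suc n) c F = ≈-trans (·-distribˡ c _ _) (⊕-congʳ (sumS-· n c F))

sumS-peel : ∀ n F → sumS (suc n) F ≈ F 0 ⊕ sumS n (λ i → F (suc i))
sumS-peel zero    F = ⊕-comm _ _
sumS-peel (suc n) F = ≈-trans (⊕-congʳ (sumS-peel n F)) (⊕-assoc _ _ _)

sumS-at : ∀ n F k → sumS n F k ≡ sumTo n (λ i → F i k)
sumS-at zero    F k = 0S-at k
sumS-at (suc n) F k = trans (⊕-at _ _ k) (cong (ℚ._+ F n k) (sumS-at n F k))

sumℤ-sumS : ∀ C n (F : ℤ → ℕ → Series) → sumℤ C (λ i → sumS n (F i)) ≈ sumS n (λ s → sumℤ C (λ i → F i s))
sumℤ-sumS C zero    F = sumℤ-0 C (λ _ → ≈-refl)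
sumℤ-sumS C (suc n) F = ≈-trans (sumℤ-⊕ C _ _) (⊕-congʳ (sumℤ-sumS C n F))

Mom-sumS : ∀ N n (F : ℕ → ℤ → Series) → Mom N (λ V → sumS n (λ s → F s V)) ≈ sumS n (λ s → Mom N (F s))
Mom-sumS N zero    F = Mom-0 N
Mom-sumS N (suc n) F = ≈-trans (Mom-⊕ N (λ V → sumS n (λ s → F s V)) (F n)) (⊕-congʳ (Mom-sumS N n F))

-- The number "r choose s" times c^(r-s), by Pascal's rule.
bc : Series → ℕ → ℕ → Series
bc c zero    zero    = oneS
bc c zero    (suc s) = 0S
bc c (suc r) zero    = c · bc c r zero
bc c (suc r) (suc s) = bc c r s ⊕ c · bc c r (suc s)

bc-above : ∀ c r d → bc c r (suc (d ℕ.+ r)) ≈ 0S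
bc-above c zero    d = ≈-refl
bc-above c (suc r) d rewrite ℕP.+-suc d r = ≈-trans (⊕-cong (bc-above c r d) (·-zeroʳ c (bc-above c r (suc d)))) (⊕-identityˡ 0S)

binomial : ∀ x c r → (x ⊕ c) ^S r ≈ sumS (suc r) (λ s → x ^S s · bc c r s)
binomial x c zero    = ≈-sym (≈-trans (⊕-identityˡ _) (·-identityˡ oneS))
binomial x c (suc r) = begin
  (x ⊕ c) · (x ⊕ c) ^S r
    ≈⟨ ·-congˡ (binomial x c r) ⟩
  (x ⊕ c) · S
    ≈⟨ solve 3 (λ x c S → (x :+ c) :* S := x :* S :+ c :* (S :+ con (+ 0))) ≈-refl x c S ⟩
  x · S ⊕ c · (S ⊕ 0S)
    ≈⟨ ⊕-cong (sumS-· (suc r) x _) (·-congˡ (≈-trans (⊕-congˡ (≈-sym (·-zeroʳ (x ^S suc r) (bc-above c r 0)))) (sumS-peel (suc r) _))) ⟩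
  sumS (suc r) (λ s → x · (x ^S s · bc c r s)) ⊕ c · (oneS · bc c r 0 ⊕ S′)
    ≈⟨ solve 4 (λ A c b S → A :+ c :* (con (+ 1) :* b :+ S) := con (+ 1) :* (c :* b) :+ (A :+ c :* S)) ≈-refl _ c (bc c r 0) S′ ⟩
  oneS · (c · bc c r 0) ⊕ (sumS (suc r) (λ s → x · (x ^S s · bc c r s)) ⊕ c · S′)
    ≈⟨ ⊕-congˡ (≈-trans (⊕-congˡ (sumS-· (suc r) c _)) (≈-trans (≈-sym (sumS-⊕ (suc r) _ _))
         (sumS-cong (suc r) (λ s → solve 5 (λ x p b c b′ → x :* (p :* b) :+ c :* ((x :* p) :* b′) := (x :* p) :* (b :+ c :* b′)) ≈-refl x (x ^S s) (bc c r s) c (bc c r (suc s)))))) ⟩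
  oneS · (c · bc c r 0) ⊕ sumS (suc r) (λ s → x ^S suc s · bc c (suc r) (suc s))
    ≈⟨ ≈-sym (sumS-peel (suc r) _) ⟩
  sumS (suc (suc r)) (λ s → x ^S s · bc c (suc r) s) ∎
  where
  S = sumS (suc r) (λ s → x ^S s · bc c r s)
  S′ = sumS (suc r) (λ s → x ^S suc s · bc c r (suc s))

nS : ℕ → Series
nS zero    = 0S
nS (suc n) = nS n ⊕ oneS

-- The binomial coefficients of n + 1, n + 2 and n + 3 over 1, 2 and 3.
b₁ b₂ b₃ : ℕ → Series
b₁ n = nS (suc n)
b₂ zero    = oneS
b₂ (suc n) = b₂ n ⊕ b₁ (suc n)
b₃ zero    = oneS
b₃ (suc n) = b₃ n ⊕ b₂ (suc n)

bc-0 : ∀ c r → bc c r r ≈ oneS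
bc-0 c zero    = ≈-refl
bc-0 c (suc r) = ≈-trans (⊕-cong (bc-0 c r) (·-zeroʳ c (bc-above c r 0))) (⊕-identityʳ oneS)

bc-1 : ∀ c r → bc c (suc r) r ≈ b₁ r · c ^S 1
bc-1 c zero    = solve 1 (λ c → c :* con (+ 1) := (con (+ 0) :+ con (+ 1)) :* (c :* con (+ 1))) ≈-refl c
bc-1 c (suc r) = ≈-trans (⊕-cong (bc-1 c r) (·-congˡ (bc-0 c (suc r))))
  (solve 2 (λ b c → b :* (c :* con (+ 1)) :+ c :* con (+ 1) := (b :+ con (+ 1)) :* (c :* con (+ 1))) ≈-refl (b₁ r) c)

bc-2 : ∀ c r → bc c (2 ℕ.+ r) r ≈ b₂ r · c ^S 2
bc-2 c zero    = solve 1 (λ c → c :* (c :* con (+ 1)) := con (+ 1) :* (c :* (c :* con (+ 1)))) ≈-refl c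
bc-2 c (suc r) = ≈-trans (⊕-cong (bc-2 c r) (·-congˡ (bc-1 c (suc r))))
  (solve 3 (λ b b′ c → b :* (c :* (c :* con (+ 1))) :+ c :* (b′ :* (c :* con (+ 1))) := (b :+ b′) :* (c :* (c :* con (+ 1)))) ≈-refl (b₂ r) (b₁ (suc r)) c)

bc-3 : ∀ c r → bc c (3 ℕ.+ r) r ≈ b₃ r · c ^S 3
bc-3 c zero    = solve 1 (λ c → c :* (c :* (c :* con (+ 1))) := con (+ 1) :* (c :* (c :* (c :* con (+ 1))))) ≈-refl c
bc-3 c (suc r) = ≈-trans (⊕-cong (bc-3 c r) (·-congˡ (bc-2 c (suc r))))
  (solve 3 (λ b b′ c → b :* (c :* (c :* (c :* con (+ 1)))) :+ c :* (b′ :* (c :* (c :* con (+ 1)))) := (b :+ b′) :* (c :* (c :* (c :* con (+ 1))))) ≈-refl (b₃ r) (b₂ (suc r)) c)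

b₂≈ : ∀ n → ℤS (+ 2) · b₂ n ≈ b₁ n · (b₁ n ⊕ oneS)
b₂≈ zero    = solve 0 (con (+ 2) :* con (+ 1) := (con (+ 0) :+ con (+ 1)) :* ((con (+ 0) :+ con (+ 1)) :+ con (+ 1))) ≈-refl
b₂≈ (suc n) = ≈-trans (solve 2 (λ b x → con (+ 2) :* (b :+ (x :+ con (+ 1))) := ((x :+ con (+ 1)) :* ((x :+ con (+ 1)) :+ con (+ 1))) :+ con (+ 1) :* (con (+ 2) :* b :- x :* (x :+ con (+ 1)))) ≈-refl (b₂ n) (b₁ n))
  (kill oneS (b₂≈ n))

b₃≈ : ∀ n → ℤS (+ 6) · b₃ n ≈ b₁ n · ((b₁ n ⊕ oneS) · (b₁ n ⊕ ℤS (+ 2)))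
b₃≈ zero    = solve 0 (con (+ 6) :* con (+ 1) := (con (+ 0) :+ con (+ 1)) :* (((con (+ 0) :+ con (+ 1)) :+ con (+ 1)) :* ((con (+ 0) :+ con (+ 1)) :+ con (+ 2)))) ≈-refl
b₃≈ (suc n) = ≈-trans (solve 3 (λ b b′ x → con (+ 6) :* (b :+ b′) :=
      (((x :+ con (+ 1)) :* (((x :+ con (+ 1)) :+ con (+ 1)) :* ((x :+ con (+ 1)) :+ con (+ 2))))
       :+ con (+ 1) :* (con (+ 6) :* b :- x :* ((x :+ con (+ 1)) :* (x :+ con (+ 2))))) :+ con (+ 3) :* (con (+ 2) :* b′ :- (x :+ con (+ 1)) :* ((x :+ con (+ 1)) :+ con (+ 1)))) ≈-refl (b₃ n) (b₂ (suc n)) (b₁ n))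
  (≈-trans (kill _ (b₂≈ (suc n))) (kill _ (b₃≈ n)))

vS : ℤ → Series
vS V = const (ℤ→ℚ V)

vS-+ : ∀ a b → vS (a ℤ.+ b) ≈ vS a ⊕ vS b
vS-+ a b = ≈-trans (const-cong (ℤ→ℚ-+ a b)) (const-+ _ _)

vS-* : ∀ a b → vS (a ℤ.* b) ≈ vS a · vS b
vS-* a b = ≈-trans (const-cong (ℤ→ℚ-* a b)) (const-* _ _)

vS-neg : ∀ a → vS (ℤ.- a) ≈ ⊝ vS a
vS-neg a = ≈-trans (const-cong (ℤ→ℚ-neg a)) (const-neg _)

^S-cong : ∀ {x y} r → x ≈ y → x ^S r ≈ y ^S r
^S-cong zero    e = ≈-refl
^S-cong (suc r) e = ·-cong e (^S-cong r e)

μ : ℕ → ℕ → Series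
μ N r = Mom N (λ V → vS V ^S r)

tame-sgτ : ∀ C (X : ℤ → Series) → Tameℤ (suc C) (λ i → (sg i · τ i) · X i)
tame-sgτ C X = tameℤ-cong (λ i → solve 3 (λ s t x → t :* (s :* x) := (s :* t) :* x) ≈-refl (sg i) (τ i) (X i)) (conv-tame C (λ i → sg i · X i))

-- Moments of the alternating theta kernel. Folded at the centre, `J 1` is twice Jacobi's series of
-- the (-1)^i (2i+1) q^(i(i+1)/2) over i ≥ 0.
J : ℕ → Series
J r = sumℤ 2 (λ i → (sg i · τ i) · vS (odd i) ^S r)

J-coef : ∀ r s (b : Series) e → (∀ c → bc c r s ≈ b · c ^S e) → sumℤ 2 (λ i → (sg i · τ i) · bc (vS (odd i)) r s) ≈ b · J e
J-coef r s b e f = ≈-trans (sumℤ-cong 2 (λ i → ≈-trans (·-congˡ (f _)) (solve 3 (λ t b x → t :* (b :* x) := b :* (t :* x)) ≈-refl _ b _)))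
  (≈-sym (sumℤ-· b (tame-sgτ 1 _)))

odd-flip : ∀ i → odd (flip i) ≡ ℤ.- odd i
odd-flip i = trans (cong odd (flip≡ i)) (ZS.solve 1 (λ i → (ZS.:- (ZS.con (+ 1) ZS.:+ i) ZS.:+ ZS.:- (ZS.con (+ 1) ZS.:+ i)) ZS.:+ ZS.con (+ 1) ZS.:= ZS.:- ((i ZS.:+ i) ZS.:+ ZS.con (+ 1))) refl i)

-- Under `flip` the sign (-1)^i changes, the exponent stays and 2i + 1 is negated, so the terms
-- cancel in pairs for even r.
J-even : ∀ r → (∀ x → (⊝ x) ^S r ≈ x ^S r) → J r ≈ 0S
J-even r e = self-neg (≈-trans (≈-sym (sumℤ-flip 2 _)) (≈-trans (sumℤ-cong 2 (λ i →
   ≈-trans (·-cong (·-cong (sg-flip i) (τ-flip i)) (≈-trans (^S-cong r (≈-trans (≡⇒≈ (cong vS (odd-flip i))) (vS-neg (odd i)))) (e _)))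
     (solve 3 (λ s t x → ((:- s) :* t) :* x := :- ((s :* t) :* x)) ≈-refl (sg i) (τ i) _))) (sumℤ-⊝ 2 _)))

J₀ : J 0 ≈ 0S
J₀ = J-even 0 (λ x → ≈-refl)

J₂ : J 2 ≈ 0S
J₂ = J-even 2 (λ x → solve 1 (λ x → (:- x) :* ((:- x) :* con (+ 1)) := x :* (x :* con (+ 1))) ≈-refl x)

μ-suc : ∀ N r → μ (suc N) r ≈ sumS (suc r) (λ s → μ N s · sumℤ 2 (λ i → (sg i · τ i) · bc (vS (odd i)) r s))
μ-suc N r = begin
  Mom (suc N) (λ V → vS V ^S r)
    ≈⟨ Mom-suc N (λ V → vS V ^S r) ⟩
  sumℤ C (λ i → (sg i · τ i) · Mom N (λ V → vS (V ℤ.+ odd i) ^S r))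
    ≈⟨ sumℤ-cong C (λ i → ≈-trans (·-congˡ (≈-trans (Mom-cong N (λ V → ≈-trans (^S-cong r (vS-+ V (odd i))) (binomial (vS V) (vS (odd i)) r)))
         (≈-trans (Mom-sumS N (suc r) (λ s V → vS V ^S s · bc (vS (odd i)) r s)) (sumS-cong (suc r) (λ s → Mom-· N (λ V → vS V ^S s) _))))) (sumS-· (suc r) _ _)) ⟩
  sumℤ C (λ i → sumS (suc r) (λ s → (sg i · τ i) · (μ N s · bc (vS (odd i)) r s)))
    ≈⟨ sumℤ-sumS C (suc r) _ ⟩
  sumS (suc r) (λ s → sumℤ C (λ i → (sg i · τ i) · (μ N s · bc (vS (odd i)) r s)))
    ≈⟨ sumS-cong (suc r) (λ s → ≈-trans (sumℤ-cong C (λ i → solve 3 (λ t m b → t :* (m :* b) := m :* (t :* b)) ≈-refl _ (μ N s) _))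
         (≈-trans (≈-sym (sumℤ-· (μ N s) (tame-sgτ (suc (cN N)) _))) (·-congˡ (sumℤ-raise (tame-sgτ 1 _) (s≤s (s≤s z≤n)))))) ⟩
  sumS (suc r) (λ s → μ N s · sumℤ 2 (λ i → (sg i · τ i) · bc (vS (odd i)) r s)) ∎
  where C = 2 ℕ.+ cN N

J-coef₀ : ∀ r → sumℤ 2 (λ i → (sg i · τ i) · bc (vS (odd i)) r r) ≈ 0S
J-coef₀ r = ≈-trans (J-coef r r oneS 0 (λ c → ≈-trans (bc-0 c r) (≈-sym (·-identityˡ oneS)))) (·-zeroʳ oneS J₀)

μ-zero : ∀ N r → r < N → μ N r ≈ 0S
μ-zero (suc N) r (s≤s r≤N) = ≈-trans (μ-suc N r) (sumS-0 (suc r) term)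
  where
  term : ∀ s → s < suc r → μ N s · sumℤ 2 (λ i → (sg i · τ i) · bc (vS (odd i)) r s) ≈ 0S
  term s (s≤s s≤r) with s ℕP.<? N
  ... | yes s<N = ·-zeroˡ _ (μ-zero N s s<N)
  ... | no  s≮N with refl ← ℕP.≤-antisym s≤r (ℕP.≤-trans r≤N (ℕP.≮⇒≥ s≮N)) = ·-zeroʳ _ (J-coef₀ s)

μ-top : ∀ N → μ (suc N) (suc N) ≈ μ N N · (b₁ N · J 1)
μ-top N = ≈-trans (μ-suc N (suc N)) (≈-trans
  (⊕-cong (⊕-cong (sumS-0 N (λ s l → ·-zeroˡ _ (μ-zero N s l))) (·-congˡ (J-coef (suc N) N (b₁ N) 1 (λ c → bc-1 c N)))) (·-zeroʳ _ (J-coef₀ (suc N))))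
  (≈-trans (⊕-identityʳ _) (⊕-identityˡ _)))

μ-next : ∀ N → μ (suc N) (3 ℕ.+ N) ≈ μ N N · (b₃ N · J 3) ⊕ μ N (2 ℕ.+ N) · (b₁ (2 ℕ.+ N) · J 1)
μ-next N = ≈-trans (μ-suc N (3 ℕ.+ N)) (≈-trans
  (⊕-cong (⊕-cong (⊕-cong (⊕-cong (sumS-0 N (λ s l → ·-zeroˡ _ (μ-zero N s l)))
      (·-congˡ (J-coef (3 ℕ.+ N) N (b₃ N) 3 (λ c → bc-3 c N))))
      (·-zeroʳ _ (≈-trans (J-coef (3 ℕ.+ N) (1 ℕ.+ N) (b₂ (suc N)) 2 (λ c → bc-2 c (suc N))) (·-zeroʳ _ J₂))))
      (·-congˡ (J-coef (3 ℕ.+ N) (2 ℕ.+ N) (b₁ (2 ℕ.+ N)) 1 (λ c → bc-1 c (2 ℕ.+ N)))))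
      (·-zeroʳ _ (J-coef₀ (3 ℕ.+ N))))
  (≈-trans (⊕-identityʳ _) (⊕-congʳ (≈-trans (⊕-identityʳ _) (⊕-identityˡ _)))))

-- `μ-top` and `μ-next` form a linear recurrence for the first two surviving moments. This is its
-- solution, with denominators cleared by the factor μ_00 J_1 and by 6.
μ-relation : ∀ N → ℤS (+ 6) · (μ N (2 ℕ.+ N) · (μ 0 0 · J 1)) ≈
  (b₁ N · b₁ (suc N)) · (μ N N · (ℤS (+ 3) · (μ 0 2 · J 1) ⊕ nS N · (μ 0 0 · J 3)))
μ-relation zero = solve 4 (λ G H j₁ j₃ → con (+ 6) :* (H :* (G :* j₁)) :=
    ((con (+ 0) :+ con (+ 1)) :* ((con (+ 0) :+ con (+ 1)) :+ con (+ 1))) :* (G :* (con (+ 3) :* (H :* j₁) :+ con (+ 0) :* (G :* j₃)))) ≈-refl (μ 0 0) (μ 0 2) (J 1) (J 3)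
μ-relation (suc N) = begin
  ℤS (+ 6) · (μ (suc N) (3 ℕ.+ N) · (G · j₁))
    ≈⟨ ·-congˡ (·-congʳ (μ-next N)) ⟩
  ℤS (+ 6) · ((g · (b₃ N · j₃) ⊕ h · (b₁ (2 ℕ.+ N) · j₁)) · (G · j₁))
    ≈⟨ solve 8 (λ g h b₃ n G H j₁ j₃ →
         con (+ 6) :* ((g :* (b₃ :* j₃) :+ h :* ((((n :+ con (+ 1)) :+ con (+ 1)) :+ con (+ 1)) :* j₁)) :* (G :* j₁)) :=
         (((((n :+ con (+ 1)) :+ con (+ 1)) :* (((n :+ con (+ 1)) :+ con (+ 1)) :+ con (+ 1))) :* ((g :* ((n :+ con (+ 1)) :* j₁)) :* (con (+ 3) :* (H :* j₁) :+ (n :+ con (+ 1)) :* (G :* j₃))))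
           :+ (g :* j₃ :* (G :* j₁)) :* (con (+ 6) :* b₃ :- (n :+ con (+ 1)) :* (((n :+ con (+ 1)) :+ con (+ 1)) :* ((n :+ con (+ 1)) :+ con (+ 2)))))
         :+ ((((n :+ con (+ 1)) :+ con (+ 1)) :+ con (+ 1)) :* j₁) :* (con (+ 6) :* (h :* (G :* j₁)) :- ((n :+ con (+ 1)) :* ((n :+ con (+ 1)) :+ con (+ 1))) :* (g :* (con (+ 3) :* (H :* j₁) :+ n :* (G :* j₃)))))
       ≈-refl g h (b₃ N) (nS N) G H j₁ j₃ ⟩
  _
    ≈⟨ ≈-trans (kill _ (μ-relation N)) (kill _ (b₃≈ N)) ⟩
  (b₁ (suc N) · b₁ (2 ℕ.+ N)) · ((g · (b₁ N · j₁)) · (ℤS (+ 3) · (H · j₁) ⊕ nS (suc N) · (G · j₃)))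
    ≈⟨ ·-congˡ (·-congʳ (≈-sym (μ-top N))) ⟩
  (b₁ (suc N) · b₁ (2 ℕ.+ N)) · (μ (suc N) (suc N) · (ℤS (+ 3) · (H · j₁) ⊕ nS (suc N) · (G · j₃))) ∎
  where
  g = μ N N
  h = μ N (2 ℕ.+ N)
  G = μ 0 0
  H = μ 0 2
  j₁ = J 1
  j₃ = J 3

-- Decomposition into residue classes

sumTo-blocks : ∀ B K f → sumTo (B ℕ.* K) f ≡ sumTo B (λ b → sumTo K (λ r → f (b ℕ.* K ℕ.+ r)))
sumTo-blocks zero    K f = refl
sumTo-blocks (suc B) K f = trans (cong (λ n → sumTo n f) (ℕP.+-comm K (B ℕ.* K)))
  (trans (sumTo-split (B ℕ.* K) K f) (cong (λ x → x ℚ.+ sumTo K (λ r → f (B ℕ.* K ℕ.+ r))) (sumTo-blocks B K f)))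

tsum-blocks : ∀ {C F} K → Tame C F → tsum C F ≈ sumS (suc K) (λ r → tsum C (λ b → F (b ℕ.* suc K ℕ.+ r)))
tsum-blocks {C} {F} K t .at k = sym (trans (sumS-at (suc K) _ k) (trans
  (sumTo-cong (suc K) (λ r → tsum-at C _ k))
  (trans (sumTo-swap (suc K) B (λ r b → F (b ℕ.* suc K ℕ.+ r) k))
  (trans (sym (sumTo-blocks B (suc K) (λ i → F i k))) (tsum-stable t k (ℕP.m≤m*n B (suc K)))))))
  where B = k ℕ.+ C

sumS-reverse : ∀ n F → sumS n F ≈ sumS n (λ r → F (n ∸ suc r))
sumS-reverse zero    F = ≈-refl
sumS-reverse (suc n) F = ≈-trans (⊕-congʳ (sumS-reverse n F)) (≈-trans (⊕-comm _ _) (≈-sym (sumS-peel n _)))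

class₊ : ∀ K r b → + r ℤ.+ + K ℤ.* + b ≡ + (b ℕ.* K ℕ.+ r)
class₊ K r b = trans (cong (λ z → + r ℤ.+ z) (sym (ℤP.pos-* K b))) (cong +_ (trans (ℕP.+-comm r (K ℕ.* b)) (cong (ℕ._+ r) (ℕP.*-comm K b))))

class₋ : ∀ K r b → r < K → + r ℤ.+ + K ℤ.* -[1+ b ] ≡ -[1+ b ℕ.* K ℕ.+ (K ∸ suc r) ]
class₋ K r b r<K with ℕP.m≤n⇒∃[o]m+o≡n r<K
... | (d , refl) = trans
  (ZS.solve 3 (λ r b d → r ZS.:+ ((ZS.con (+ 1) ZS.:+ r) ZS.:+ d) ZS.:* (ZS.:- (ZS.con (+ 1) ZS.:+ b))
       ZS.:= ZS.:- (ZS.con (+ 1) ZS.:+ (b ZS.:* ((ZS.con (+ 1) ZS.:+ r) ZS.:+ d) ZS.:+ d))) refl (+ r) (+ b) (+ d))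
  (cong (λ z → ℤ.- (+ 1 ℤ.+ z)) (trans (cong (ℤ._+ + d) (sym (ℤP.pos-* b (suc r ℕ.+ d)))) (cong (λ x → + (b ℕ.* (suc r ℕ.+ d) ℕ.+ x)) (sym (ℕP.m+n∸m≡n r d)))))

-- The negative half is cut into blocks from -1 downwards, so its residues appear in reverse order
-- and have to be reversed before the halves are joined.
sumℤ-blocks : ∀ {C f} K → Tameℤ C f → sumℤ C f ≈ sumS (suc K) (λ r → sumℤ C (λ t → f (+ r ℤ.+ + suc K ℤ.* t)))
sumℤ-blocks {C} {f} K (mkTameℤ t₊ t₋) = begin
  sumℤ C f
    ≈⟨ sumℤ-def C f ⟩
  tsum C (λ i → f (+ i)) ⊕ tsum C (λ i → f -[1+ i ])
    ≈⟨ ⊕-cong (tsum-blocks K t₊) (≈-trans (tsum-blocks K t₋) (sumS-reverse (suc K) _)) ⟩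
  sumS (suc K) (λ r → tsum C (λ b → f (+ (b ℕ.* suc K ℕ.+ r)))) ⊕ sumS (suc K) (λ r → tsum C (λ b → f -[1+ b ℕ.* suc K ℕ.+ (K ∸ r) ]))
    ≈⟨ ≈-sym (sumS-⊕ (suc K) _ _) ⟩
  sumS (suc K) (λ r → tsum C (λ b → f (+ (b ℕ.* suc K ℕ.+ r))) ⊕ tsum C (λ b → f -[1+ b ℕ.* suc K ℕ.+ (K ∸ r) ]))
    ≈⟨ sumS-cong< (suc K) (λ r r<K → ≈-trans (⊕-cong (tsum-cong C (λ b → ≡⇒≈ (cong f (sym (class₊ (suc K) r b)))))
          (tsum-cong C (λ b → ≡⇒≈ (cong f (sym (class₋ (suc K) r b r<K)))))) (≈-sym (sumℤ-def C _))) ⟩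
  sumS (suc K) (λ r → sumℤ C (λ t → f (+ r ℤ.+ + suc K ℤ.* t))) ∎

tame-class : ∀ {C f} K r → r < suc K → Tameℤ C f → Tameℤ C (λ t → f (+ r ℤ.+ + suc K ℤ.* t))
tame-class {C} {f} K r r<K (mkTameℤ t₊ t₋) = mkTameℤ
  (mkTame (λ b k p → trans (cong (λ z → f z k) (class₊ (suc K) r b)) (tame t₊ _ k (ℕP.≤-trans p (ℕP.≤-trans (ℕP.m≤m*n b (suc K)) (ℕP.m≤m+n _ r))))))
  (mkTame (λ b k p → trans (cong (λ z → f z k) (class₋ (suc K) r b r<K)) (tame t₋ _ k (ℕP.≤-trans p (ℕP.≤-trans (ℕP.m≤m*n b (suc K)) (ℕP.m≤m+n _ _))))))

tame-neg : ∀ {C g} → Tameℤ C g → Tameℤ (suc C) (λ t → g (ℤ.- t))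
tame-neg {C} {g} t = mkTameℤ′ (λ { (+ zero) k p → ⊥-elim (ℕP.<⇒≱ (ℕP.≤-trans (s≤s z≤n) (ℕP.≤-reflexive (sym (ℕP.+-suc k C)))) p)
  ; (+ suc i) k p → tameℤ-at t -[1+ i ] k (ℕP.≤-pred (ℕP.≤-trans (ℕP.≤-reflexive (sym (ℕP.+-suc k C))) p))
  ; -[1+ i ] k p → tameℤ-at t (+ suc i) k (ℕP.≤-trans (ℕP.+-monoʳ-≤ k (ℕP.n≤1+n C)) (ℕP.≤-trans p (ℕP.n≤1+n i))) })

sumℤ-neg : ∀ {C C′ g} → Tameℤ C g → Tameℤ C′ (λ t → g (ℤ.- t)) → sumℤ C′ (λ t → g (ℤ.- t)) ≈ sumℤ C g
sumℤ-neg {C} {C′} {g} t t′ = ≈-trans (sumℤ-indep t′ (tameℤ-raise (ℕP.n≤1+n _) (tame-neg t)))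
  (≈-trans (≈-sym (sumℤ-shift (tame-neg t))) (≈-trans (sumℤ-cong (2 ℕ.+ C) (λ s → ≡⇒≈ (cong g (sym (flip≡ s)))))
  (≈-trans (sumℤ-flip (2 ℕ.+ C) g) (sumℤ-raise t (ℕP.≤-trans (ℕP.n≤1+n C) (ℕP.n≤1+n _))))))

-- b X + K b(b-1)/2, the exponent accumulated by b steps of quasi-periodicity. Hence `expo A B t` is
-- t(Kt + B - A)/2 with K = A + B, as a natural number for both signs of t.
eP : (X K : ℕ) → ℕ → ℕ
eP X K zero    = 0
eP X K (suc b) = eP X K b ℕ.+ (X ℕ.+ K ℕ.* b)

expo : (A B : ℕ) → ℤ → ℕ
expo A B (+ b)    = eP B (A ℕ.+ B) b
expo A B -[1+ b ] = eP A (A ℕ.+ B) (suc b)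

wt : (A B : ℕ) → ℤ → Series
wt A B t = sg (+ (A ℕ.+ B) ℤ.* t) · qp (expo A B t)

Vr : (A B : ℕ) → ℤ → ℤ
Vr A B t = (+ B ℤ.- + A) ℤ.+ + (A ℕ.+ B) ℤ.* (t ℤ.+ t)

opaque
  -- The contribution to a moment of the residue class of A - 1 modulo K = A + B, with the value of
  -- u_N and the sign at the representative A - 1 factored out. There V = B - A + 2Kt.
  Row : (A B : ℕ) → (ℤ → Series) → Series
  Row A B X = sumℤ 1 (λ t → wt A B t · X (Vr A B t))

  Row-def : ∀ A B X → Row A B X ≈ sumℤ 1 (λ t → wt A B t · X (Vr A B t))
  Row-def A B X = ≈-refl

eP-≥ : ∀ X K b → 1 ≤ X → b ≤ eP X K b
eP-≥ X K zero    l = z≤n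
eP-≥ X K (suc b) l = ℕP.≤-trans (ℕP.≤-reflexive (ℕP.+-comm 1 b)) (ℕP.+-mono-≤ (eP-≥ X K b l) (ℕP.≤-trans l (ℕP.m≤m+n X _)))

expo-≥ : ∀ A B t → 1 ≤ B → ∣ t ∣₋ ≤ expo A B t
expo-≥ A B (+ b)    l = eP-≥ B (A ℕ.+ B) b l
expo-≥ A B -[1+ b ] l = ℕP.≤-trans (ℕP.≤-trans (ℕP.≤-trans (ℕP.≤-reflexive (sym (ℕP.*-identityˡ b))) (ℕP.*-monoˡ-≤ b (ℕP.≤-trans l (ℕP.m≤n+m B A)))) (ℕP.m≤n+m _ A)) (ℕP.m≤n+m _ (eP A (A ℕ.+ B) b))

tame-wt : ∀ A B → 1 ≤ B → (X : ℤ → Series) → Tameℤ 1 (λ t → wt A B t · X t)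
tame-wt A B l X = tameℤ-cong (λ t → solve 3 (λ s e x → e :* (s :* x) := (s :* e) :* x) ≈-refl (sg (+ (A ℕ.+ B) ℤ.* t)) (qp (expo A B t)) (X t))
  (tameℤ-qp (expo A B) (λ t → sg (+ (A ℕ.+ B) ℤ.* t) · X t) (λ t → ℕP.≤-trans (s≤s (expo-≥ A B t l)) (ℕP.≤-reflexive (ℕP.+-comm 1 _))))

opaque
  unfolding Row

  Row-cong : ∀ A B {X Y} → (∀ V → X V ≈ Y V) → Row A B X ≈ Row A B Y
  Row-cong A B e = sumℤ-cong 1 (λ t → ·-congˡ (e _))

  Row-0 : ∀ A B {X} → (∀ V → X V ≈ 0S) → Row A B X ≈ 0S
  Row-0 A B e = sumℤ-0 1 (λ t → ·-zeroʳ _ (e _))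

expo-mirror : ∀ A B t → expo A B (ℤ.- t) ≡ expo B A t
expo-mirror A B (+ zero)  = refl
expo-mirror A B (+ suc b) = cong (λ K → eP A K (suc b)) (ℕP.+-comm A B)
expo-mirror A B -[1+ b ]  = cong (λ K → eP B K (suc b)) (ℕP.+-comm A B)

opaque
  unfolding Row

  Row-mirror : ∀ A B X → 1 ≤ A → 1 ≤ B → Row A B X ≈ Row B A (λ V → X (ℤ.- V))
  Row-mirror A B X a b = ≈-trans (≈-sym (sumℤ-neg (tame-wt A B b (λ t → X (Vr A B t))) tame′)) (sumℤ-cong 1 eq)
    where
    V-mirror : ∀ t → Vr A B (ℤ.- t) ≡ ℤ.- Vr B A t
    V-mirror t = ZS.solve 3 (λ A B t → (B ZS.:- A) ZS.:+ (A ZS.:+ B) ZS.:* ((ZS.:- t) ZS.:+ (ZS.:- t)) ZS.:= ZS.:- ((A ZS.:- B) ZS.:+ (B ZS.:+ A) ZS.:* (t ZS.:+ t))) refl (+ A) (+ B) t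
    eq : ∀ t → wt A B (ℤ.- t) · X (Vr A B (ℤ.- t)) ≈ wt B A t · X (ℤ.- Vr B A t)
    eq t = ·-cong (·-cong (≈-trans (≡⇒≈ (cong sg (ZS.solve 3 (λ A B t → (A ZS.:+ B) ZS.:* (ZS.:- t) ZS.:= ZS.:- ((B ZS.:+ A) ZS.:* t)) refl (+ A) (+ B) t))) (sg-neg (+ (B ℕ.+ A) ℤ.* t)))
         (qp-≡ (expo-mirror A B t))) (≡⇒≈ (cong X (V-mirror t)))
    tame′ : Tameℤ 1 (λ t → wt A B (ℤ.- t) · X (Vr A B (ℤ.- t)))
    tame′ = tameℤ-cong (λ t → ≈-sym (eq t)) (tame-wt B A a _)

uN-class : ∀ N A B → A ℕ.+ B ≡ 3 ℕ.+ N → ∀ t → uN N (ℤ.pred (+ A ℤ.- + (A ℕ.+ B) ℤ.* t)) ≈ qp (expo A B t) · uN N (ℤ.pred (+ A))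
uN-class N A B e = λ { (+ b) → pos b ; -[1+ b ] → neg b }
  where
  K = A ℕ.+ B
  j₋ j₊ : ℕ → ℤ
  j₋ b = ℤ.pred (+ A ℤ.- + K ℤ.* + b)
  j₊ b = ℤ.pred (+ A ℤ.+ + K ℤ.* + b)
  qp-step : ∀ x y {u v w} → u ≈ q^ y · v → v ≈ qp x · w → u ≈ qp (x ℕ.+ y) · w
  qp-step x y e₁ e₂ = ≈-trans e₁ (≈-trans (·-cong (≈-sym (qp≈q^ y)) e₂)
    (≈-trans (solve 3 (λ y x w → y :* (x :* w) := (x :* y) :* w) ≈-refl (qp y) (qp x) _) (·-congʳ (≈-sym (qp-+ x y)))))
  base : ∀ j → j ≡ ℤ.pred (+ A) → uN N j ≈ qp 0 · uN N (ℤ.pred (+ A))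
  base j refl = ≈-sym (≈-trans (·-congʳ qp0) (·-identityˡ _))
  down : ∀ b → uN N (j₋ (suc b)) ≈ q^ (B ℕ.+ K ℕ.* b) · uN N (j₋ b)
  down b = ≈-trans (≈-sym (·-identityˡ _)) (≈-trans (uN-quasiperiodic N (j₋ (suc b)) 0 (B ℕ.+ K ℕ.* b)
      (trans (ZS.solve 3 (λ A B b → ZS.con (+ 0) ZS.:= ((ZS.con -[1+ 0 ] ZS.:+ (A ZS.:- (A ZS.:+ B) ZS.:* (ZS.con (+ 1) ZS.:+ b))) ZS.:+ ZS.con (+ 1)) ZS.:+ (B ZS.:+ (A ZS.:+ B) ZS.:* b)) refl (+ A) (+ B) (+ b))
        (cong (λ z → (j₋ (suc b) ℤ.+ + 1) ℤ.+ (+ B ℤ.+ z)) (sym (ℤP.pos-* K b)))))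
    (·-congˡ (≡⇒≈ (cong (uN N) (trans (cong (λ z → + z ℤ.+ j₋ (suc b)) (sym e))
      (ZS.solve 3 (λ A B b → (A ZS.:+ B) ZS.:+ (ZS.con -[1+ 0 ] ZS.:+ (A ZS.:- (A ZS.:+ B) ZS.:* (ZS.con (+ 1) ZS.:+ b))) ZS.:= ZS.con -[1+ 0 ] ZS.:+ (A ZS.:- (A ZS.:+ B) ZS.:* b)) refl (+ A) (+ B) (+ b)))))))
  up : ∀ b → uN N (j₊ (suc b)) ≈ q^ (A ℕ.+ K ℕ.* b) · uN N (j₊ b)
  up b = ≈-sym (≈-trans (uN-quasiperiodic N (j₊ b) (A ℕ.+ K ℕ.* b) 0
      (trans (cong (λ z → + A ℤ.+ z) (ℤP.pos-* K b)) (ZS.solve 2 (λ A x → A ZS.:+ x ZS.:= ((ZS.con -[1+ 0 ] ZS.:+ (A ZS.:+ x)) ZS.:+ ZS.con (+ 1)) ZS.:+ ZS.con (+ 0)) refl (+ A) (+ K ℤ.* + b))))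
    (≈-trans (·-identityˡ _) (≡⇒≈ (cong (uN N) (trans (cong (λ z → + z ℤ.+ j₊ b) (sym e))
      (ZS.solve 3 (λ A K b → K ZS.:+ (ZS.con -[1+ 0 ] ZS.:+ (A ZS.:+ K ZS.:* b)) ZS.:= ZS.con -[1+ 0 ] ZS.:+ (A ZS.:+ K ZS.:* (ZS.con (+ 1) ZS.:+ b))) refl (+ A) (+ K) (+ b)))))))
  pos : ∀ b → uN N (j₋ b) ≈ qp (eP B K b) · uN N (ℤ.pred (+ A))
  pos zero    = base _ (cong ℤ.pred (ZS.solve 2 (λ A K → A ZS.:- K ZS.:* ZS.con (+ 0) ZS.:= A) refl (+ A) (+ K)))
  pos (suc b) = qp-step (eP B K b) _ (down b) (pos b)
  pos′ : ∀ b → uN N (j₊ b) ≈ qp (eP A K b) · uN N (ℤ.pred (+ A))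
  pos′ zero    = base _ (cong ℤ.pred (ZS.solve 2 (λ A K → A ZS.:+ K ZS.:* ZS.con (+ 0) ZS.:= A) refl (+ A) (+ K)))
  pos′ (suc b) = qp-step (eP A K b) _ (up b) (pos′ b)
  neg : ∀ b → uN N (ℤ.pred (+ A ℤ.- + K ℤ.* -[1+ b ])) ≈ qp (eP A K (suc b)) · uN N (ℤ.pred (+ A))
  neg b = ≈-trans (≡⇒≈ (cong (uN N) (cong ℤ.pred (ZS.solve 3 (λ A K b → A ZS.:- K ZS.:* (ZS.:- b) ZS.:= A ZS.:+ K ZS.:* b) refl (+ A) (+ K) (+ suc b))))) (pos′ (suc b))

cf : ℕ → ℕ → Series
cf N r = sg (ℤ.pred (+ r)) · uN N (ℤ.pred (+ r))

Mom-classes : ∀ N H → Mom N H ≈ sumS (3 ℕ.+ N) (λ r → cf N r · Row r (3 ℕ.+ N ∸ r) H)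
Mom-classes N H = begin
  sumℤ (cN N) f
    ≈⟨ ≈-sym (sumℤ-raise tf (ℕP.≤-trans (ℕP.n≤1+n _) (ℕP.n≤1+n _))) ⟩
  sumℤ (2 ℕ.+ cN N) f
    ≈⟨ sumℤ-cong (2 ℕ.+ cN N) (λ j → ≡⇒≈ (cong f (sym (ℤP.pred-suc j)))) ⟩
  sumℤ (2 ℕ.+ cN N) (λ j → f (ℤ.pred (ℤ.suc j)))
    ≈⟨ sumℤ-shift (tame-pred tf) ⟩
  sumℤ (2 ℕ.+ cN N) (λ j → f (ℤ.pred j))
    ≈⟨ sumℤ-blocks (2 ℕ.+ N) tf′ ⟩
  sumS K (λ r → sumℤ (2 ℕ.+ cN N) (λ t → f (ℤ.pred (+ r ℤ.+ + K ℤ.* t))))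
    ≈⟨ sumS-cong< K class ⟩
  sumS K (λ r → cf N r · Row r (K ∸ r) H) ∎
  where
  K = 3 ℕ.+ N
  f : ℤ → Series
  f j = sg j · (uN N j · H (+ suc N ℤ.- (j ℤ.+ j)))
  tf : Tameℤ (cN N) f
  tf = tame-Mom N _
  tf′ : Tameℤ (2 ℕ.+ cN N) (λ j → f (ℤ.pred j))
  tf′ = tameℤ-raise (ℕP.n≤1+n _) (tame-pred tf)
  class : ∀ r → r < K → sumℤ (2 ℕ.+ cN N) (λ t → f (ℤ.pred (+ r ℤ.+ + K ℤ.* t))) ≈ cf N r · Row r (K ∸ r) H
  class r r<K = ≈-trans (≈-sym (sumℤ-neg tg (tame-neg tg)))
    (≈-trans (sumℤ-cong _ term) (≈-trans (sumℤ-raise (tameℤ-· (λ _ → cf N r) tw) (s≤s z≤n)) (≈-trans (≈-sym (sumℤ-· (cf N r) tw)) (·-congˡ (≈-sym (Row-def r B H))))))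
    where
    B = K ∸ r
    sum≡ : r ℕ.+ B ≡ K
    sum≡ = ℕP.m+[n∸m]≡n (ℕP.<⇒≤ r<K)
    tg : Tameℤ (2 ℕ.+ cN N) (λ t → f (ℤ.pred (+ r ℤ.+ + K ℤ.* t)))
    tg = tame-class {f = λ j → f (ℤ.pred j)} (2 ℕ.+ N) r r<K tf′
    tw : Tameℤ 1 (λ t → wt r B t · H (Vr r B t))
    tw = tame-wt r B (ℕP.m<n⇒0<n∸m r<K) (λ t → H (Vr r B t))
    index : ∀ t → ℤ.pred (+ r ℤ.+ + K ℤ.* (ℤ.- t)) ≡ ℤ.pred (+ r ℤ.- + (r ℕ.+ B) ℤ.* t)
    index t = trans (cong ℤ.pred (ZS.solve 3 (λ r K t → r ZS.:+ K ZS.:* (ZS.:- t) ZS.:= r ZS.:- K ZS.:* t) refl (+ r) (+ K) t))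
      (cong (λ z → ℤ.pred (+ r ℤ.- + z ℤ.* t)) (sym sum≡))
    term : ∀ t → f (ℤ.pred (+ r ℤ.+ + K ℤ.* (ℤ.- t))) ≈ cf N r · (wt r B t · H (Vr r B t))
    term t = ≈-trans (≡⇒≈ (cong f (index t))) (≈-trans
      (·-cong (≈-trans (≡⇒≈ (cong sg (ZS.solve 3 (λ r K t → ZS.con -[1+ 0 ] ZS.:+ (r ZS.:- K ZS.:* t) ZS.:= (ZS.con -[1+ 0 ] ZS.:+ r) ZS.:+ (ZS.:- (K ZS.:* t))) refl (+ r) (+ (r ℕ.+ B)) t)))
           (≈-trans (sg-+ (ℤ.pred (+ r)) _) (·-congˡ (sg-neg (+ (r ℕ.+ B) ℤ.* t)))))
        (·-cong (uN-class N r B sum≡ t) (≡⇒≈ (cong H (trans (cong (λ z → + z ℤ.- (j ℤ.+ j)) (cong (_∸ 2) (sym sum≡))) (value (r ℕ.+ B) sum≡))))))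
      (solve 5 (λ s σ e u h → (s :* σ) :* ((e :* u) :* h) := (s :* u) :* ((σ :* e) :* h)) ≈-refl (sg (ℤ.pred (+ r))) (sg (+ (r ℕ.+ B) ℤ.* t)) (qp (expo r B t)) (uN N (ℤ.pred (+ r))) (H (Vr r B t))))
      where
      j = ℤ.pred (+ r ℤ.- + (r ℕ.+ B) ℤ.* t)
      value : ∀ M → M ≡ K → + (M ∸ 2) ℤ.- (j ℤ.+ j) ≡ Vr r B t
      value M refl = trans (ZS.solve 4 (λ n r K t → n ZS.:- ((ZS.con -[1+ 0 ] ZS.:+ (r ZS.:- K ZS.:* t)) ZS.:+ (ZS.con -[1+ 0 ] ZS.:+ (r ZS.:- K ZS.:* t)))
           ZS.:= ((ZS.con (+ 2) ZS.:+ n) ZS.:- r ZS.:- r) ZS.:+ K ZS.:* (t ZS.:+ t)) refl (+ suc N) (+ r) (+ (r ℕ.+ B)) t)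
        (cong (ℤ._+ + (r ℕ.+ B) ℤ.* (t ℤ.+ t)) (trans (cong (λ z → + z ℤ.- + r ℤ.- + r) (sym sum≡))
          (ZS.solve 2 (λ r B → (r ZS.:+ B) ZS.:- r ZS.:- r ZS.:= B ZS.:- r) refl (+ r) (+ B))))

-- Cancellation in the ring of series, and the derivation q d/dq

ℤ→ℚ-mkℚ : ∀ z → ℤ→ℚ z ≡ ℚ.mkℚ z 0 (Coprimality.sym (Coprimality.1-coprimeTo ℤ.∣ z ∣))
ℤ→ℚ-mkℚ z = ℚP.↥p/↧p≡p (ℚ.mkℚ z 0 (Coprimality.sym (Coprimality.1-coprimeTo ℤ.∣ z ∣)))

ℤ→ℚ-injective : ∀ {a b} → ℤ→ℚ a ≡ ℤ→ℚ b → a ≡ b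
ℤ→ℚ-injective {a} {b} e = cong ℚ.↥_ (trans (sym (ℤ→ℚ-mkℚ a)) (trans e (ℤ→ℚ-mkℚ b)))

*-cancel-0 : ∀ {c x} → c ≢ 0ℚ → c ℚ.* x ≡ 0ℚ → x ≡ 0ℚ
*-cancel-0 {c} {x} c≢0 e = trans (sym (ℚP.*-identityˡ x)) (trans (cong (ℚ._* x) (sym (ℚP.*-inverseˡ c)))
  (trans (ℚP.*-assoc (ℚ.1/ c) c x) (trans (cong (ℚ.1/ c ℚ.*_) e) (ℚP.*-zeroʳ (ℚ.1/ c)))))
  where instance _ = ℚ.≢-nonZero c≢0

·-at0 : ∀ f g → (f · g) 0 ≡ f 0 ℚ.* g 0
·-at0 f g = trans (·-at f g 0) (ℚP.+-identityˡ _)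

∸suc< : ∀ {k} i → i < k → k ∸ suc i < k
∸suc< {suc k} i _ = s≤s (ℕP.m∸n≤m k i)

zero-cancel : ∀ f z → f 0 ≢ 0ℚ → f · z ≈ 0S → z ≈ 0S
zero-cancel f z f≢0 e .at k = trans (<-rec (λ k → z k ≡ 0ℚ) step k) (sym (0S-at k))
  where
  step : ∀ k → (∀ {j} → j < k → z j ≡ 0ℚ) → z k ≡ 0ℚ
  step k ih = *-cancel-0 f≢0 (trans (sym (ℚP.+-identityʳ _)) (trans
    (cong ((f 0 ℚ.* z k) ℚ.+_) (sym (sumTo-0 k (λ i i<k → trans (cong (f (suc i) ℚ.*_) (ih (∸suc< i i<k))) (ℚP.*-zeroʳ (f (suc i)))))))
    (trans (sym (sumTo-peel k (λ i → f i ℚ.* z (k ∸ i)))) (trans (sym (·-at f z k)) (≈0-at e k)))))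

·-cancelˡ : ∀ f {x y} → f 0 ≢ 0ℚ → f · x ≈ f · y → x ≈ y
·-cancelˡ f {x} {y} f≢0 e = ≈-trans (solve 2 (λ x y → x := y :+ (x :- y)) ≈-refl x y) (≈-trans (⊕-congˡ
  (zero-cancel f (x ⊖ y) f≢0 (≈-trans (solve 3 (λ f x y → f :* (x :- y) := f :* x :- f :* y) ≈-refl f x y) (≈-trans (⊖-cong e ≈-refl) (⊕-inverseʳ _)))))
  (⊕-identityʳ y))

opaque
  D : Series → Series
  D f k = ℤ→ℚ (+ k) ℚ.* f k

  D-at : ∀ f k → D f k ≡ ℤ→ℚ (+ k) ℚ.* f k
  D-at f k = refl

opaque
  unfolding D _⊕_ tsum sumℤ qp const

  D-cong : ∀ {f g} → f ≈ g → D f ≈ D g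
  D-cong e .at k = cong (ℤ→ℚ (+ k) ℚ.*_) (at e k)

  D-⊕ : ∀ f g → D (f ⊕ g) ≈ D f ⊕ D g
  D-⊕ f g .at k = ℚP.*-distribˡ-+ (ℤ→ℚ (+ k)) (f k) (g k)

  D-⊝ : ∀ f → D (⊝ f) ≈ ⊝ D f
  D-⊝ f .at k = sym (ℚP.neg-distribʳ-* (ℤ→ℚ (+ k)) (f k))

  D-· : ∀ f g → D (f · g) ≈ D f · g ⊕ f · D g
  D-· f g .at k = trans (sym (sumTo-*ˡ (suc k) (ℤ→ℚ (+ k)) _))
    (trans (sumTo-cong< (suc k) (λ { i (s≤s i≤k) → trans
        (cong (λ n → ℤ→ℚ n ℚ.* (f i ℚ.* g (k ∸ i))) (cong +_ (sym (ℕP.m+[n∸m]≡n i≤k))))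
        (trans (cong (ℚ._* (f i ℚ.* g (k ∸ i))) (ℤ→ℚ-+ (+ i) (+ (k ∸ i)))) (leibniz (ℤ→ℚ (+ i)) (ℤ→ℚ (+ (k ∸ i))) (f i) (g (k ∸ i)))) }))
      (sumTo-+ (suc k) _ _))
    where
    leibniz : ∀ i j x y → (i ℚ.+ j) ℚ.* (x ℚ.* y) ≡ (i ℚ.* x) ℚ.* y ℚ.+ x ℚ.* (j ℚ.* y)
    leibniz = solve-∀ ℚ-ring

  D-tsum : ∀ C F → D (tsum C F) ≈ tsum C (λ i → D (F i))
  D-tsum C F .at k = sym (sumTo-*ˡ (k ℕ.+ C) (ℤ→ℚ (+ k)) _)

  D-sumℤ : ∀ C f → D (sumℤ C f) ≈ sumℤ C (λ j → D (f j))
  D-sumℤ C f = ≈-trans (D-⊕ _ _) (⊕-cong (D-tsum C _) (D-tsum C _))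

  D-const : ∀ c → D (const c) ≈ 0S
  D-const c .at zero    = ℚP.*-zeroˡ c
  D-const c .at (suc k) = ℚP.*-zeroʳ (ℤ→ℚ (+ suc k))

  D-q : D (qp 1) ≈ qp 1
  D-q .at zero          = ℚP.*-zeroˡ 0ℚ
  D-q .at (suc zero)    = refl
  D-q .at (suc (suc k)) = ℚP.*-zeroʳ (ℤ→ℚ (+ suc (suc k)))

  qp-at0 : ∀ n → qp (suc n) 0 ≡ 0ℚ
  qp-at0 n = refl

  sumℤ-at0 : ∀ f → sumℤ 1 f 0 ≡ f (+ 0) 0 ℚ.+ f -[1+ 0 ] 0
  sumℤ-at0 f = cong₂ ℚ._+_ (ℚP.+-identityˡ (f (+ 0) 0)) (ℚP.+-identityˡ (f -[1+ 0 ] 0))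

D-one : D oneS ≈ 0S
D-one = ≈-trans (D-cong (≈-sym const-1)) (D-const 1ℚ)

D-qp : ∀ n → D (qp n) ≈ vS (+ n) · qp n
D-qp zero    = ≈-trans (D-cong qp0) (≈-trans D-one (≈-sym (·-zeroˡ _ const-0)))
D-qp (suc n) = ≈-trans (D-cong (qp-+ 1 n)) (≈-trans (D-· q (qp n)) (≈-trans (⊕-cong (·-congʳ D-q) (·-congˡ (D-qp n)))
  (≈-trans (solve 3 (λ q v Q → q :* Q :+ q :* (v :* Q) := (con (+ 1) :+ v) :* (q :* Q)) ≈-refl q (vS (+ n)) (qp n))
    (·-cong (≈-trans (⊕-congʳ (≈-sym const-1)) (≈-sym (vS-+ (+ 1) (+ n)))) (≈-sym (qp-+ 1 n))))))

D-sgn : ∀ n → D (sgn n) ≈ 0S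
D-sgn zero    = D-one
D-sgn (suc n) = ≈-trans (D-⊝ _) (≈-trans (⊝-cong (D-sgn n)) (solve 0 (:- con (+ 0) := con (+ 0)) ≈-refl))

D-wt : ∀ A B t X → D (wt A B t · X) ≈ wt A B t · (vS (+ expo A B t) · X ⊕ D X)
D-wt A B t X = ≈-trans (D-· _ X) (≈-trans (⊕-congʳ (·-congʳ (≈-trans (D-· s e) (⊕-cong (·-zeroˡ e (D-sgn ℤ.∣ + (A ℕ.+ B) ℤ.* t ∣)) (·-congˡ (D-qp (expo A B t)))))))
  (solve 5 (λ s v e X X′ → (con (+ 0) :+ s :* (v :* e)) :* X :+ (s :* e) :* X′ := (s :* e) :* (v :* X :+ X′)) ≈-refl s (vS (+ expo A B t)) e X (D X)))
  where
  s = sg (+ (A ℕ.+ B) ℤ.* t)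
  e = qp (expo A B t)

eP-quad : ∀ X K b → + 2 ℤ.* + eP X K b ≡ + b ℤ.* (+ K ℤ.* + b ℤ.+ ((+ X ℤ.+ + X) ℤ.- + K))
eP-quad X K zero    = refl
eP-quad X K (suc b) = trans (cong (λ z → + 2 ℤ.* (+ eP X K b ℤ.+ (+ X ℤ.+ z))) (ℤP.pos-* K b))
  (trans (ZS.solve 4 (λ e X K b → ZS.con (+ 2) ZS.:* (e ZS.:+ (X ZS.:+ K ZS.:* b)) ZS.:= ZS.con (+ 2) ZS.:* e ZS.:+ ZS.con (+ 2) ZS.:* (X ZS.:+ K ZS.:* b)) refl (+ eP X K b) (+ X) (+ K) (+ b))
  (trans (cong (ℤ._+ (+ 2 ℤ.* (+ X ℤ.+ + K ℤ.* + b))) (eP-quad X K b))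
   (ZS.solve 3 (λ X K b → b ZS.:* (K ZS.:* b ZS.:+ ((X ZS.:+ X) ZS.:- K)) ZS.:+ ZS.con (+ 2) ZS.:* (X ZS.:+ K ZS.:* b)
      ZS.:= (ZS.con (+ 1) ZS.:+ b) ZS.:* (K ZS.:* (ZS.con (+ 1) ZS.:+ b) ZS.:+ ((X ZS.:+ X) ZS.:- K))) refl (+ X) (+ K) (+ b))))

expo-quad : ∀ A B t → + 2 ℤ.* + expo A B t ≡ t ℤ.* (+ (A ℕ.+ B) ℤ.* t ℤ.+ (+ B ℤ.- + A))
expo-quad A B (+ b) = trans (eP-quad B (A ℕ.+ B) b)
  (ZS.solve 3 (λ A B b → b ZS.:* ((A ZS.:+ B) ZS.:* b ZS.:+ ((B ZS.:+ B) ZS.:- (A ZS.:+ B))) ZS.:= b ZS.:* ((A ZS.:+ B) ZS.:* b ZS.:+ (B ZS.:- A))) refl (+ A) (+ B) (+ b))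
expo-quad A B -[1+ b ] = trans (eP-quad A (A ℕ.+ B) (suc b))
  (ZS.solve 3 (λ A B b → b ZS.:* ((A ZS.:+ B) ZS.:* b ZS.:+ ((A ZS.:+ A) ZS.:- (A ZS.:+ B))) ZS.:= (ZS.:- b) ZS.:* ((A ZS.:+ B) ZS.:* (ZS.:- b) ZS.:+ (B ZS.:- A))) refl (+ A) (+ B) (+ suc b))

-- v² - ρ² = 2K·(exponent), in doubled variables: the heat equation of the theta functions.
V-square : ∀ A B t → Vr A B t ℤ.* Vr A B t ≡ (+ 8 ℤ.* + (A ℕ.+ B)) ℤ.* + expo A B t ℤ.+ (+ B ℤ.- + A) ℤ.* (+ B ℤ.- + A)
V-square A B t = trans
  (ZS.solve 3 (λ A B t → ((B ZS.:- A) ZS.:+ (A ZS.:+ B) ZS.:* (t ZS.:+ t)) ZS.:* ((B ZS.:- A) ZS.:+ (A ZS.:+ B) ZS.:* (t ZS.:+ t))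
     ZS.:= (ZS.con (+ 4) ZS.:* (A ZS.:+ B)) ZS.:* (t ZS.:* ((A ZS.:+ B) ZS.:* t ZS.:+ (B ZS.:- A))) ZS.:+ (B ZS.:- A) ZS.:* (B ZS.:- A)) refl (+ A) (+ B) t)
  (trans (cong (λ z → (+ 4 ℤ.* + (A ℕ.+ B)) ℤ.* z ℤ.+ (+ B ℤ.- + A) ℤ.* (+ B ℤ.- + A)) (sym (expo-quad A B t)))
  (ZS.solve 3 (λ K e x → (ZS.con (+ 4) ZS.:* K) ZS.:* (ZS.con (+ 2) ZS.:* e) ZS.:+ x ZS.:= (ZS.con (+ 8) ZS.:* K) ZS.:* e ZS.:+ x) refl (+ (A ℕ.+ B)) (+ expo A B t) ((+ B ℤ.- + A) ℤ.* (+ B ℤ.- + A))))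

Tℤ-quad : ∀ s → + 2 ℤ.* + Tℤ s ≡ s ℤ.* (s ℤ.+ + 1)
Tℤ-quad = λ { (+ i) → pos i ; -[1+ i ] → trans (pos i) (ZS.solve 1 (λ i → i ZS.:* (i ZS.:+ ZS.con (+ 1)) ZS.:= (ZS.:- (ZS.con (+ 1) ZS.:+ i)) ZS.:* ((ZS.:- (ZS.con (+ 1) ZS.:+ i)) ZS.:+ ZS.con (+ 1))) refl (+ i)) }
  where
  pos : ∀ i → + 2 ℤ.* + T i ≡ + i ℤ.* (+ i ℤ.+ + 1)
  pos zero    = refl
  pos (suc i) = trans (ZS.solve 2 (λ T i → ZS.con (+ 2) ZS.:* (T ZS.:+ (ZS.con (+ 1) ZS.:+ i)) ZS.:= ZS.con (+ 2) ZS.:* T ZS.:+ ZS.con (+ 2) ZS.:* (ZS.con (+ 1) ZS.:+ i)) refl (+ T i) (+ i))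
    (trans (cong (ℤ._+ (+ 2 ℤ.* (+ 1 ℤ.+ + i))) (pos i)) (ZS.solve 1 (λ i → i ZS.:* (i ZS.:+ ZS.con (+ 1)) ZS.:+ ZS.con (+ 2) ZS.:* (ZS.con (+ 1) ZS.:+ i) ZS.:= (ZS.con (+ 1) ZS.:+ i) ZS.:* ((ZS.con (+ 1) ZS.:+ i) ZS.:+ ZS.con (+ 1))) refl (+ i)))

opaque
  unfolding Row

  Row-⊕ : ∀ A B X Y → Row A B (λ V → X V ⊕ Y V) ≈ Row A B X ⊕ Row A B Y
  Row-⊕ A B X Y = ≈-trans (sumℤ-cong 1 (λ t → ·-distribˡ _ _ _)) (sumℤ-⊕ 1 _ _)

  Row-· : ∀ A B c X → 1 ≤ B → Row A B (λ V → c · X V) ≈ c · Row A B X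
  Row-· A B c X l = ≈-trans (sumℤ-cong 1 (λ t → solve 3 (λ w c x → w :* (c :* x) := c :* (w :* x)) ≈-refl _ c _)) (≈-sym (sumℤ-· c (tame-wt A B l _)))

-- D = q d/dq acts on a theta series as multiplication by the exponent.
opaque
  unfolding Row

  Row-heat : ∀ A B X → 1 ≤ B →
    (vS (+ 8) · vS (+ (A ℕ.+ B))) · D (Row A B X) ⊕ (vS (+ B ℤ.- + A) · vS (+ B ℤ.- + A)) · Row A B X
      ≈ Row A B (λ V → (vS V · vS V) · X V) ⊕ (vS (+ 8) · vS (+ (A ℕ.+ B))) · Row A B (λ V → D (X V))
  Row-heat A B X l = begin
    c · D (Row A B X) ⊕ r · Row A B X
      ≈⟨ ⊕-cong (≈-trans (·-congˡ (≈-trans (D-sumℤ 1 _) (sumℤ-cong 1 (λ t → D-wt A B t _)))) (sumℤ-· c (tame-wt A B l _))) (sumℤ-· r (tame-wt A B l _)) ⟩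
    sumℤ 1 (λ t → c · (wt A B t · (e t · x t ⊕ D (x t)))) ⊕ sumℤ 1 (λ t → r · (wt A B t · x t))
      ≈⟨ ≈-sym (sumℤ-⊕ 1 _ _) ⟩
    sumℤ 1 (λ t → c · (wt A B t · (e t · x t ⊕ D (x t))) ⊕ r · (wt A B t · x t))
      ≈⟨ sumℤ-cong 1 (λ t → ≈-trans
          (solve 6 (λ c r w e x d → c :* (w :* (e :* x :+ d)) :+ r :* (w :* x) := w :* ((c :* e :+ r) :* x) :+ c :* (w :* d)) ≈-refl c r (wt A B t) (e t) (x t) (D (x t)))
          (⊕-congʳ (·-congˡ (·-congʳ (≈-sym (quad t)))))) ⟩
    sumℤ 1 (λ t → wt A B t · ((vS (Vr A B t) · vS (Vr A B t)) · x t) ⊕ c · (wt A B t · D (x t)))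
      ≈⟨ ≈-trans (sumℤ-⊕ 1 _ _) (⊕-congˡ (≈-sym (sumℤ-· c (tame-wt A B l _)))) ⟩
    Row A B (λ V → (vS V · vS V) · X V) ⊕ c · Row A B (λ V → D (X V)) ∎
    where
    c r : Series
    c = vS (+ 8) · vS (+ (A ℕ.+ B))
    r = vS (+ B ℤ.- + A) · vS (+ B ℤ.- + A)
    e x : ℤ → Series
    e t = vS (+ expo A B t)
    x t = X (Vr A B t)
    quad : ∀ t → vS (Vr A B t) · vS (Vr A B t) ≈ c · e t ⊕ r
    quad t = ≈-trans (≈-sym (vS-* (Vr A B t) (Vr A B t))) (≈-trans (≡⇒≈ (cong vS (V-square A B t)))
      (≈-trans (vS-+ ((+ 8 ℤ.* + (A ℕ.+ B)) ℤ.* + expo A B t) _)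
        (⊕-cong (≈-trans (vS-* (+ 8 ℤ.* + (A ℕ.+ B)) (+ expo A B t)) (·-congʳ (vS-* (+ 8) (+ (A ℕ.+ B))))) (vS-* (+ B ℤ.- + A) (+ B ℤ.- + A)))))

-- Euler's pentagonal series with terms (-1)^t q^(t(3t+1)/2). It stands for (q)_∞; its relation to
-- the product is established only in `P-agree`.
P : Series
P = Row 1 2 (λ _ → oneS)

ℤS≈vS : ∀ z → ℤS z ≈ vS z
ℤS≈vS = ℤS≈const

vS-at0 : ∀ z → vS z 0 ≡ ℤ→ℚ z
vS-at0 z = const-at0 (ℤ→ℚ z)

qp0-at0 : qp 0 0 ≡ 1ℚ
qp0-at0 = at qp0 0

opaque
  unfolding Row

  Row-at0 : ∀ A B X → 1 ≤ A → 1 ≤ B → Row A B X 0 ≡ X (+ B ℤ.- + A) 0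
  Row-at0 (suc A) B X _ _ = trans (sumℤ-at0 _) (trans (cong₂ ℚ._+_
      (trans (·-at0 (wt (suc A) B (+ 0)) (X (Vr (suc A) B (+ 0)))) (trans (cong₂ ℚ._*_ w₀ (cong (λ z → X z 0) V₀)) (ℚP.*-identityˡ (X (+ B ℤ.- + suc A) 0))))
      (trans (·-at0 (wt (suc A) B -[1+ 0 ]) (X (Vr (suc A) B -[1+ 0 ]))) (trans (cong (ℚ._* X (Vr (suc A) B -[1+ 0 ]) 0) w₁) (ℚP.*-zeroˡ (X (Vr (suc A) B -[1+ 0 ]) 0)))))
    (ℚP.+-identityʳ (X (+ B ℤ.- + suc A) 0)))
    where
    K : ℤ
    K = + (suc A ℕ.+ B)
    w₀ : wt (suc A) B (+ 0) 0 ≡ 1ℚ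
    w₀ = trans (·-at0 (sg (K ℤ.* + 0)) (qp 0)) (cong₂ ℚ._*_ (cong (λ z → sg z 0) (ℤP.*-zeroʳ K)) qp0-at0)
    w₁ : wt (suc A) B -[1+ 0 ] 0 ≡ 0ℚ
    w₁ = trans (·-at0 (sg (K ℤ.* -[1+ 0 ])) (qp (expo (suc A) B -[1+ 0 ])))
      (trans (cong (sg (K ℤ.* -[1+ 0 ]) 0 ℚ.*_) (qp-at0 _)) (ℚP.*-zeroʳ (sg (K ℤ.* -[1+ 0 ]) 0)))
    V₀ : Vr (suc A) B (+ 0) ≡ + B ℤ.- + suc A
    V₀ = trans (cong (λ z → (+ B ℤ.- + suc A) ℤ.+ z) (ℤP.*-zeroʳ K)) (ℤP.+-identityʳ (+ B ℤ.- + suc A))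

P-at0 : P 0 ≡ 1ℚ
P-at0 = Row-at0 1 2 (λ _ → oneS) (s≤s z≤n) (s≤s z≤n)

-- The cases N = 0 and N = 1, and Jacobi's identity

Mom₀ : ∀ H → (∀ V → H (ℤ.- V) ≈ H V) → Mom 0 H ≈ Row 1 2 H ⊕ Row 1 2 H
Mom₀ H even = ≈-trans (Mom-classes 0 H) (⊕-cong
  (≈-trans (⊕-cong (≈-trans (⊕-identityˡ _) (·-zeroˡ _ (·-zeroʳ _ (uN-zero 0)))) (≈-trans (·-congʳ (·-identityˡ oneS)) (·-identityˡ _))) (⊕-identityˡ _))
  (≈-trans (·-congʳ (solve 0 ((:- con (+ 1)) :* (:- con (+ 1)) := con (+ 1)) ≈-refl)) (≈-trans (·-identityˡ _)
    (≈-trans (Row-mirror 2 1 H (s≤s z≤n) (s≤s z≤n)) (Row-cong 1 2 even)))))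

c₁ : Series
c₁ = uN 1 (+ 0)

-- Of the four classes, r = 0 vanishes by `uN-zero`, r = 2 because j = 1 is the fixed point of
-- antisymmetry, and r = 3 mirrors r = 1.
Mom₁ : ∀ H → (∀ V → H (ℤ.- V) ≈ ⊝ H V) → Mom 1 H ≈ (c₁ ⊕ c₁) · Row 1 3 H
Mom₁ H odd = ≈-trans (Mom-classes 1 H) (≈-trans (⊕-cong (⊕-cong (⊕-cong (⊕-cong ≈-refl
   (·-zeroˡ _ (·-zeroʳ _ (uN-zero 1)))) ≈-refl) (·-zeroˡ _ (·-zeroʳ _ (self-neg (uN-antisym 1 (+ 1) (+ 1) refl)))))
   (·-cong (·-congˡ (uN-antisym 1 (+ 2) (+ 0) refl)) (≈-trans (Row-mirror 3 1 H (s≤s z≤n) (s≤s z≤n)) (≈-trans (Row-cong 1 3 odd)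
      (≈-trans (Row-cong 1 3 (λ V → solve 1 (λ x → :- x := (:- con (+ 1)) :* x) ≈-refl (H V))) (Row-· 1 3 (⊝ oneS) H (s≤s z≤n)))))))
  (solve 2 (λ c r → (((con (+ 0) :+ con (+ 0)) :+ (con (+ 1) :* c) :* r) :+ con (+ 0)) :+ ((:- (:- con (+ 1))) :* (:- c)) :* ((:- con (+ 1)) :* r) := (c :+ c) :* r) ≈-refl c₁ (Row 1 3 H)))

^S-· : ∀ x y r → (x · y) ^S r ≈ x ^S r · y ^S r
^S-· x y zero    = ≈-sym (·-identityˡ oneS)
^S-· x y (suc r) = ≈-trans (·-congˡ (^S-· x y r)) (solve 4 (λ x y a b → (x :* y) :* (a :* b) := (x :* a) :* (y :* b)) ≈-refl x y _ _)

Odd : ℕ → Set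
Odd r = ∀ x → (⊝ x) ^S r ≈ ⊝ (x ^S r)

odd₁ : Odd 1
odd₁ = solve 1 (λ x → (:- x) :* con (+ 1) := :- (x :* con (+ 1))) ≈-refl

odd₃ : Odd 3
odd₃ = solve 1 (λ x → (:- x) :* ((:- x) :* ((:- x) :* con (+ 1))) := :- (x :* (x :* (x :* con (+ 1))))) ≈-refl

-- The terms of `J r` with even index 2t. They reappear in `Row₁₃`, where V = 2(4t + 1) and the
-- exponent is T(2t): the moments of u_1 and the kernel moments J are the same theta series.
Y : ℕ → Series
Y r = sumℤ 2 (λ t → τ (t ℤ.+ t) · vS (odd (t ℤ.+ t)) ^S r)

tame-Y : ∀ r → Tameℤ 1 (λ t → τ (t ℤ.+ t) · vS (odd (t ℤ.+ t)) ^S r)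
tame-Y r = tameℤ-qp (λ t → Tℤ (t ℤ.+ t)) _ (λ { (+ i) → ℕP.≤-trans (s≤s (ℕP.≤-trans (ℕP.m≤m+n i i) (i≤T (i ℕ.+ i)))) (ℕP.≤-reflexive (ℕP.+-comm 1 _))
  ; -[1+ i ] → ℕP.≤-trans (s≤s (ℕP.≤-trans (ℕP.≤-trans (ℕP.m≤m+n i i) (ℕP.n≤1+n _)) (i≤T (suc (i ℕ.+ i))))) (ℕP.≤-reflexive (ℕP.+-comm 1 _)) })

sg-double : ∀ t → sg (t ℤ.+ t) ≈ oneS
sg-double t = ≈-trans (sg-+ t t) (sgn-square ℤ.∣ t ∣)

-- The terms with i even and i odd agree.
J≈Y : ∀ r → Odd r → J r ≈ Y r ⊕ Y r
J≈Y r o = ≈-trans (sumℤ-blocks 1 (tame-sgτ 1 _)) (≈-trans (⊕-cong (≈-trans (⊕-identityˡ _) (sumℤ-cong 2 (λ t → even t _ refl)))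
   (≈-trans (sumℤ-cong 2 (λ t → ≈-trans (flipped t) (even (flip t) _ refl))) (sumℤ-flip 2 _))) ≈-refl)
  where
  f : ℤ → Series
  f i = (sg i · τ i) · vS (odd i) ^S r
  even : ∀ t i → i ≡ + 0 ℤ.+ + 2 ℤ.* t → f i ≈ τ (t ℤ.+ t) · vS (odd (t ℤ.+ t)) ^S r
  even t i e = ≈-trans (≡⇒≈ (cong f (trans e (ZS.solve 1 (λ t → ZS.con (+ 0) ZS.:+ ZS.con (+ 2) ZS.:* t ZS.:= t ZS.:+ t) refl t))))
    (·-congʳ (≈-trans (·-congʳ (sg-double t)) (·-identityˡ _)))
  f-flip : ∀ i → f (flip i) ≈ f i
  f-flip i = ≈-trans (·-cong (·-cong (sg-flip i) (τ-flip i)) (≈-trans (^S-cong r (≈-trans (≡⇒≈ (cong vS (odd-flip i))) (vS-neg (odd i)))) (o _)))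
    (solve 3 (λ s t x → ((:- s) :* t) :* (:- x) := (s :* t) :* x) ≈-refl (sg i) (τ i) _)
  flipped : ∀ t → f (+ 1 ℤ.+ + 2 ℤ.* t) ≈ f (+ 0 ℤ.+ + 2 ℤ.* flip t)
  flipped t = ≈-trans (≡⇒≈ (cong f (sym (trans (flip≡ (+ 0 ℤ.+ + 2 ℤ.* flip t)) (trans (cong (λ z → ℤ.- (ℤ.suc (+ 0 ℤ.+ + 2 ℤ.* z))) (flip≡ t))
     (ZS.solve 1 (λ t → ZS.:- (ZS.con (+ 1) ZS.:+ (ZS.con (+ 0) ZS.:+ ZS.con (+ 2) ZS.:* (ZS.:- (ZS.con (+ 1) ZS.:+ t)))) ZS.:= ZS.con (+ 1) ZS.:+ ZS.con (+ 2) ZS.:* t) refl t)))))) (f-flip (+ 0 ℤ.+ + 2 ℤ.* flip t))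

opaque
  unfolding Row

  Row₁₃ : ∀ r → Row 1 3 (λ V → vS V ^S r) ≈ vS (+ 2) ^S r · Y r
  Row₁₃ r = ≈-trans (sumℤ-cong 1 (λ t → ≈-trans
      (·-cong (≈-trans (·-cong (≈-trans (≡⇒≈ (cong sg (ZS.solve 1 (λ t → ZS.con (+ 4) ZS.:* t ZS.:= (t ZS.:+ t) ZS.:+ (t ZS.:+ t)) refl t))) (sg-double (t ℤ.+ t))) (qp-≡ (exponent t))) (·-identityˡ _))
         (≈-trans (^S-cong r (≈-trans (≡⇒≈ (cong vS (ZS.solve 1 (λ t → ZS.con (+ 2) ZS.:+ ZS.con (+ 4) ZS.:* (t ZS.:+ t) ZS.:= ZS.con (+ 2) ZS.:* (((t ZS.:+ t) ZS.:+ (t ZS.:+ t)) ZS.:+ ZS.con (+ 1))) refl t))) (vS-* (+ 2) (odd (t ℤ.+ t)))))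
           (^S-· (vS (+ 2)) (vS (odd (t ℤ.+ t))) r)))
      (solve 3 (λ t a b → t :* (a :* b) := a :* (t :* b)) ≈-refl _ _ _)))
    (≈-trans (≈-sym (sumℤ-· _ (tame-Y r))) (·-congˡ (≈-sym (sumℤ-raise (tame-Y r) (s≤s z≤n)))))
    where
    exponent : ∀ t → expo 1 3 t ≡ Tℤ (t ℤ.+ t)
    exponent t = ℤP.+-injective (ℤP.*-cancelˡ-≡ (+ 2) _ _ (trans (expo-quad 1 3 t) (trans
      (ZS.solve 1 (λ t → t ZS.:* (ZS.con (+ 4) ZS.:* t ZS.:+ ZS.con (+ 2)) ZS.:= (t ZS.:+ t) ZS.:* ((t ZS.:+ t) ZS.:+ ZS.con (+ 1))) refl t) (sym (Tℤ-quad (t ℤ.+ t))))))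

G H₂ : Series
G  = μ 0 0
H₂ = μ 0 2

G≈ : G ≈ P ⊕ P
G≈ = Mom₀ _ (λ V → ≈-refl)

μ₁≈ : ∀ r → Odd r → μ 1 r ≈ (c₁ ⊕ c₁) · (vS (+ 2) ^S r · Y r)
μ₁≈ r o = ≈-trans (Mom₁ _ (λ V → ≈-trans (^S-cong r (vS-neg V)) (o _))) (·-congˡ (Row₁₃ r))

2≢0 : ℤ→ℚ (+ 2) ≢ 0ℚ
2≢0 ()

J₁-at0 : J 1 0 ≡ ℤ→ℚ (+ 2)
J₁-at0 = trans (at (sumℤ-raise (tame-sgτ 0 (λ i → vS (odd i) ^S 1)) (s≤s z≤n)) 0) (trans (sumℤ-at0 _) (cong₂ ℚ._+_
  (trans (·-at0 _ _) (cong₂ ℚ._*_ (trans (·-at0 _ _) (cong (1ℚ ℚ.*_) qp0-at0)) (trans (·-at0 _ _) (cong (ℚ._* 1ℚ) (vS-at0 (+ 1))))))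
  (trans (·-at0 _ _) (cong₂ ℚ._*_ (trans (·-at0 _ _) (cong₂ ℚ._*_ (⊝-at oneS 0) qp0-at0)) (trans (·-at0 _ _) (cong (ℚ._* 1ℚ) (vS-at0 -[1+ 0 ])))))))

J₁≢0 : J 1 0 ≢ 0ℚ
J₁≢0 e = 2≢0 (trans (sym J₁-at0) e)

-- The first moment of u_1 computed twice: `μ-top` gives G J_1, and the residue classes give 2 c₁
-- J_1.
G≈c₁ : G ≈ c₁ ⊕ c₁
G≈c₁ = ·-cancelˡ (J 1) J₁≢0 (begin
  J 1 · G
    ≈⟨ solve 2 (λ j g → j :* g := g :* ((con (+ 0) :+ con (+ 1)) :* j)) ≈-refl (J 1) G ⟩
  G · (b₁ 0 · J 1)
    ≈⟨ ≈-trans (≈-sym (μ-top 0)) (≈-trans (μ₁≈ 1 odd₁) (·-congˡ (·-congʳ (·-congʳ (≈-sym (ℤS≈vS (+ 2))))))) ⟩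
  (c₁ ⊕ c₁) · ((ℤS (+ 2) · oneS) · Y 1)
    ≈⟨ solve 2 (λ c y → c :* ((con (+ 2) :* con (+ 1)) :* y) := (y :+ y) :* c) ≈-refl (c₁ ⊕ c₁) (Y 1) ⟩
  (Y 1 ⊕ Y 1) · (c₁ ⊕ c₁)
    ≈⟨ ·-congʳ (≈-sym (J≈Y 1 odd₁)) ⟩
  J 1 · (c₁ ⊕ c₁) ∎)

halve : ∀ {x y} → x ⊕ x ≈ y ⊕ y → x ≈ y
halve {x} {y} e = ≈-trans (half x) (≈-trans (·-congˡ e) (≈-sym (half y)))
  where
  half : ∀ x → x ≈ ½ · (x ⊕ x)
  half x = ≈-trans (≈-sym (·-identityˡ x)) (≈-trans (·-congʳ (≈-sym ½+½)) (solve 2 (λ h x → (h :+ h) :* x := h :* (x :+ x)) ≈-refl ½ x))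

c₁≈P : c₁ ≈ P
c₁≈P = halve (≈-trans (≈-sym G≈c₁) G≈)

G-at0 : G 0 ≡ ℤ→ℚ (+ 2)
G-at0 = trans (at G≈ 0) (trans (⊕-at P P 0) (cong₂ ℚ._+_ P-at0 P-at0))

72≢0 : ℤ→ℚ (+ 18) ℚ.* (ℤ→ℚ (+ 2) ℚ.* ℤ→ℚ (+ 2)) ≢ 0ℚ
72≢0 ()

-- The residue classes give the third moment of u_1 as 4 G J_3. Inserted into `μ-relation 1`, it
-- yields 24 G J_3 on one side against 6(3 H₂ J_1 + G J_3) on the other, both times G J_1; the
-- difference leaves the cancelled factor 18 G J_1.
GJ₃≈HJ₁ : G · J 3 ≈ H₂ · J 1
GJ₃≈HJ₁ = ·-cancelˡ (ℤS (+ 18) · (G · J 1)) nonzero (begin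
  (ℤS (+ 18) · (G · J 1)) · (G · J 3)
    ≈⟨ ·-cong (·-congˡ (·-congˡ (J≈Y 1 odd₁))) (·-congˡ (J≈Y 3 odd₃)) ⟩
  (ℤS (+ 18) · (G · (Y 1 ⊕ Y 1))) · (G · (Y 3 ⊕ Y 3))
    ≈⟨ solve 4 (λ G H y₁ y₃ → (con (+ 18) :* (G :* (y₁ :+ y₁))) :* (G :* (y₃ :+ y₃)) :=
          ((con (+ 18) :* (G :* (y₁ :+ y₁))) :* (H :* (y₁ :+ y₁)))
           :+ con (+ 1) :* (con (+ 6) :* ((G :* ((con (+ 2) :* (con (+ 2) :* (con (+ 2) :* con (+ 1)))) :* y₃)) :* (G :* (y₁ :+ y₁))) :-
               ((con (+ 0) :+ con (+ 1) :+ con (+ 1)) :* (con (+ 0) :+ con (+ 1) :+ con (+ 1) :+ con (+ 1))) :* ((G :* ((con (+ 2) :* con (+ 1)) :* y₁)) :* (con (+ 3) :* (H :* (y₁ :+ y₁)) :+ (con (+ 0) :+ con (+ 1)) :* (G :* (y₃ :+ y₃))))))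
        ≈-refl G H₂ (Y 1) (Y 3) ⟩
  _
    ≈⟨ kill oneS (≈-trans (·-congˡ (·-cong (≈-sym μ₁₃) (·-congˡ (≈-sym (J≈Y 1 odd₁))))) (≈-trans (μ-relation 1)
          (·-congˡ (·-cong μ₁₁ (⊕-cong (·-congˡ (·-congˡ (J≈Y 1 odd₁))) (·-congˡ (·-congˡ (J≈Y 3 odd₃)))))))) ⟩
  (ℤS (+ 18) · (G · (Y 1 ⊕ Y 1))) · (H₂ · (Y 1 ⊕ Y 1))
    ≈⟨ ≈-sym (·-cong (·-congˡ (·-congˡ (J≈Y 1 odd₁))) (·-congˡ (J≈Y 1 odd₁))) ⟩
  (ℤS (+ 18) · (G · J 1)) · (H₂ · J 1) ∎)
  where
  two : vS (+ 2) ≈ ℤS (+ 2)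
  two = ≈-sym (ℤS≈vS (+ 2))
  μ₁₃ : μ 1 3 ≈ G · ((ℤS (+ 2) · (ℤS (+ 2) · (ℤS (+ 2) · oneS))) · Y 3)
  μ₁₃ = ≈-trans (μ₁≈ 3 odd₃) (·-cong (≈-sym G≈c₁) (·-congʳ (^S-cong 3 two)))
  μ₁₁ : μ 1 1 ≈ G · ((ℤS (+ 2) · oneS) · Y 1)
  μ₁₁ = ≈-trans (μ₁≈ 1 odd₁) (·-cong (≈-sym G≈c₁) (·-congʳ (^S-cong 1 two)))
  nonzero : (ℤS (+ 18) · (G · J 1)) 0 ≢ 0ℚ
  nonzero e = 72≢0 (trans (sym (trans (·-at0 _ _) (cong₂ ℚ._*_ (trans (at (ℤS≈vS (+ 18)) 0) (vS-at0 (+ 18))) (trans (·-at0 G (J 1)) (cong₂ ℚ._*_ G-at0 J₁-at0))))) e)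

μ-ratio : ∀ N → ℤS (+ 6) · (μ N (2 ℕ.+ N) · G) ≈ (nS (3 ℕ.+ N) · (b₁ N · b₁ (suc N))) · (μ N N · H₂)
μ-ratio N = ·-cancelˡ (J 1) J₁≢0 (begin
  J 1 · (ℤS (+ 6) · (h · G))
    ≈⟨ solve 3 (λ j h G → j :* (con (+ 6) :* (h :* G)) := con (+ 6) :* (h :* (G :* j))) ≈-refl (J 1) h G ⟩
  ℤS (+ 6) · (h · (G · J 1))
    ≈⟨ μ-relation N ⟩
  (b₁ N · b₁ (suc N)) · (g · (ℤS (+ 3) · (H₂ · J 1) ⊕ nS N · (G · J 3)))
    ≈⟨ ·-congˡ (·-congˡ (⊕-congˡ (·-congˡ GJ₃≈HJ₁))) ⟩
  (b₁ N · b₁ (suc N)) · (g · (ℤS (+ 3) · (H₂ · J 1) ⊕ nS N · (H₂ · J 1)))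
    ≈⟨ solve 5 (λ b g H j n → b :* (g :* (con (+ 3) :* (H :* j) :+ n :* (H :* j))) := j :* (((((n :+ con (+ 1)) :+ con (+ 1)) :+ con (+ 1)) :* b) :* (g :* H))) ≈-refl (b₁ N · b₁ (suc N)) g H₂ (J 1) (nS N) ⟩
  J 1 · ((nS (3 ℕ.+ N) · (b₁ N · b₁ (suc N))) · (g · H₂)) ∎)
  where
  h = μ N (2 ℕ.+ N)
  g = μ N N

H₂≈ : H₂ ≈ (ℤS (+ 24) · D P ⊕ P) ⊕ (ℤS (+ 24) · D P ⊕ P)
H₂≈ = ≈-trans (Mom₀ _ (λ V → ≈-trans (^S-cong 2 (vS-neg V)) (solve 1 (λ x → (:- x) :* ((:- x) :* con (+ 1)) := x :* (x :* con (+ 1))) ≈-refl (vS V)))) (⊕-cong heat heat)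
  where
  heat : Row 1 2 (λ V → vS V ^S 2) ≈ ℤS (+ 24) · D P ⊕ P
  heat = ≈-trans (Row-cong 1 2 (λ V → solve 1 (λ x → x :* (x :* con (+ 1)) := (x :* x) :* con (+ 1)) ≈-refl (vS V)))
    (≈-trans (≈-sym (≈-trans (⊕-congˡ (·-zeroʳ _ (Row-0 1 2 (λ _ → D-one)))) (⊕-identityʳ _)))
    (≈-trans (≈-sym (Row-heat 1 2 (λ _ → oneS) (s≤s z≤n))) (⊕-cong
      (·-congʳ (≈-trans (≈-sym (vS-* (+ 8) (+ 3))) (≈-sym (ℤS≈vS (+ 24)))))
      (≈-trans (·-congʳ (≈-trans (≈-sym (vS-* (+ 1) (+ 1))) (≈-sym (ℤS≈vS (+ 1))))) (·-identityˡ P)))))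

J₃≈ : J 3 ≈ ℤS (+ 8) · D (J 1) ⊕ J 1
J₃≈ = begin
  J 3
    ≈⟨ sumℤ-cong 2 term ⟩
  sumℤ 2 (λ i → ℤS (+ 8) · D ((sg i · τ i) · c i) ⊕ (sg i · τ i) · c i)
    ≈⟨ ≈-trans (sumℤ-⊕ 2 _ _) (⊕-congʳ (≈-sym (sumℤ-· (ℤS (+ 8)) tame-D))) ⟩
  ℤS (+ 8) · sumℤ 2 (λ i → D ((sg i · τ i) · c i)) ⊕ J 1
    ≈⟨ ⊕-congʳ (·-congˡ (≈-sym (D-sumℤ 2 _))) ⟩
  ℤS (+ 8) · D (J 1) ⊕ J 1 ∎
  where
  c : ℤ → Series
  c i = vS (odd i) ^S 1
  D-term : ∀ i → D ((sg i · τ i) · c i) ≈ (sg i · τ i) · (vS (+ Tℤ i) · c i)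
  D-term i = ≈-trans (D-· _ _) (≈-trans (⊕-cong (·-congʳ (≈-trans (D-· (sg i) (τ i)) (⊕-cong (·-zeroˡ _ (D-sgn ℤ.∣ i ∣)) (·-congˡ (D-qp (Tℤ i))))))
       (·-congˡ (≈-trans (D-· (vS (odd i)) oneS) (⊕-cong (·-zeroˡ _ (D-const _)) (·-zeroʳ _ D-one)))))
     (solve 4 (λ s t v c → (con (+ 0) :+ s :* (v :* t)) :* c :+ (s :* t) :* (con (+ 0) :+ con (+ 0)) := (s :* t) :* (v :* c)) ≈-refl (sg i) (τ i) (vS (+ Tℤ i)) (c i)))
  tame-D : Tameℤ 2 (λ i → D ((sg i · τ i) · c i))
  tame-D = tameℤ-cong (λ i → ≈-sym (D-term i)) (tame-sgτ 1 _)
  square : ∀ i → vS (odd i) · vS (odd i) ≈ ℤS (+ 8) · vS (+ Tℤ i) ⊕ oneS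
  square i = ≈-trans (≈-sym (vS-* (odd i) (odd i))) (≈-trans (≡⇒≈ (cong vS (trans
      (ZS.solve 1 (λ i → ((i ZS.:+ i) ZS.:+ ZS.con (+ 1)) ZS.:* ((i ZS.:+ i) ZS.:+ ZS.con (+ 1)) ZS.:= ZS.con (+ 4) ZS.:* (i ZS.:* (i ZS.:+ ZS.con (+ 1))) ZS.:+ ZS.con (+ 1)) refl i)
      (trans (cong (λ z → + 4 ℤ.* z ℤ.+ + 1) (sym (Tℤ-quad i))) (ZS.solve 1 (λ t → ZS.con (+ 4) ZS.:* (ZS.con (+ 2) ZS.:* t) ZS.:+ ZS.con (+ 1) ZS.:= ZS.con (+ 8) ZS.:* t ZS.:+ ZS.con (+ 1)) refl (+ Tℤ i))))))
    (≈-trans (vS-+ (+ 8 ℤ.* + Tℤ i) (+ 1)) (⊕-cong (≈-trans (vS-* (+ 8) (+ Tℤ i)) (·-congʳ (≈-sym (ℤS≈vS (+ 8))))) (≈-sym (ℤS≈vS (+ 1))))))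
  term : ∀ i → (sg i · τ i) · vS (odd i) ^S 3 ≈ ℤS (+ 8) · D ((sg i · τ i) · c i) ⊕ (sg i · τ i) · c i
  term i = ≈-trans (solve 3 (λ w v T → w :* (v :* (v :* (v :* con (+ 1)))) := (con (+ 8) :* (w :* (T :* (v :* con (+ 1)))) :+ w :* (v :* con (+ 1))) :+ (w :* v) :* (v :* v :- (con (+ 8) :* T :+ con (+ 1)))) ≈-refl (sg i · τ i) (vS (odd i)) (vS (+ Tℤ i)))
    (≈-trans (kill _ (square i)) (⊕-congʳ (·-congˡ (≈-sym (D-term i)))))

16≢0 : ℤ→ℚ (+ 16) ≢ 0ℚ
16≢0 ()

-- By (2i+1)² = 8 T(i) + 1 and V² = 24e + 1, multiplying the terms by these squares amounts to
-- differentiation. The relation G J_3 = H₂ J_1 thereby becomes Jacobi's identity in differential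
-- form.
J₁-ode : P · D (J 1) ≈ ℤS (+ 3) · (J 1 · D P)
J₁-ode = ·-cancelˡ (ℤS (+ 16)) (λ e → 16≢0 (trans (sym (trans (at (ℤS≈vS (+ 16)) 0) (vS-at0 (+ 16)))) e)) (begin
  ℤS (+ 16) · (P · D (J 1))
    ≈⟨ solve 3 (λ P j′ j → con (+ 16) :* (P :* j′) := (P :+ P) :* (con (+ 8) :* j′ :+ j) :- (P :+ P) :* j) ≈-refl P (D (J 1)) (J 1) ⟩
  (P ⊕ P) · (ℤS (+ 8) · D (J 1) ⊕ J 1) ⊖ (P ⊕ P) · J 1
    ≈⟨ ⊖-cong (≈-trans (·-cong (≈-sym G≈) (≈-sym J₃≈)) (≈-trans GJ₃≈HJ₁ (·-congʳ H₂≈))) ≈-refl ⟩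
  ((ℤS (+ 24) · D P ⊕ P) ⊕ (ℤS (+ 24) · D P ⊕ P)) · J 1 ⊖ (P ⊕ P) · J 1
    ≈⟨ solve 3 (λ P p j → ((con (+ 24) :* p :+ P) :+ (con (+ 24) :* p :+ P)) :* j :- (P :+ P) :* j := con (+ 16) :* (con (+ 3) :* (j :* p))) ≈-refl P (D P) (J 1) ⟩
  ℤS (+ 16) · (ℤS (+ 3) · (J 1 · D P)) ∎)

_⊡_ : ∀ {d} → (Vec ℤ d → ℚ) → (Vec ℤ d → ℚ) → Vec ℤ d → ℚ
(g ⊡ h) vs = g vs ℚ.* h vs

-- Alternating theta sums

-- Only adjacent transpositions are required, with all earlier entries held fixed. This matches
-- `Wsum`, which sums over one entry at a time.
IsAlternating : ∀ d → (Vec ℤ d → ℚ) → Set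
IsAlternating zero          h = ⊤
IsAlternating (suc zero)    h = ⊤
IsAlternating (suc (suc d)) h =
  (∀ x y zs → h (x ∷ y ∷ zs) ≡ ℚ.- h (y ∷ x ∷ zs)) × (∀ x → IsAlternating (suc d) (λ zs → h (x ∷ zs)))

IsSymmetric : ∀ d → (Vec ℤ d → ℚ) → Set
IsSymmetric zero          h = ⊤
IsSymmetric (suc zero)    h = ⊤
IsSymmetric (suc (suc d)) h =
  (∀ x y zs → h (x ∷ y ∷ zs) ≡ h (y ∷ x ∷ zs)) × (∀ x → IsSymmetric (suc d) (λ zs → h (x ∷ zs)))

alternating-⊡ : ∀ d {g h} → IsSymmetric d g → IsAlternating d h → IsAlternating d (g ⊡ h)
alternating-⊡ zero          s a = tt
alternating-⊡ (suc zero)    s a = tt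
alternating-⊡ (suc (suc d)) {g} {h} (s , s′) (a , a′) =
  (λ x y zs → trans (cong₂ ℚ._*_ (s x y zs) (a x y zs)) (sym (ℚP.neg-distribʳ-* (g (y ∷ x ∷ zs)) (h (y ∷ x ∷ zs))))) ,
  (λ x → alternating-⊡ (suc d) (s′ x) (a′ x))

symmetric-map : ∀ (f : ℚ → ℚ) d {g} → IsSymmetric d g → IsSymmetric d (λ vs → f (g vs))
symmetric-map f zero          s        = tt
symmetric-map f (suc zero)    s        = tt
symmetric-map f (suc (suc d)) (s , s′) = (λ x y zs → cong f (s x y zs)) , (λ x → symmetric-map f (suc d) (s′ x))

sqℤ : ℤ → ℚ
sqℤ x = ℤ→ℚ x ℚ.* ℤ→ℚ x

pd : ∀ {d} → ℤ → Vec ℤ d → ℚ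
pd x []       = 1ℚ
pd x (y ∷ ys) = (sqℤ x ℚ.- sqℤ y) ℚ.* pd x ys

vand : ∀ {d} → Vec ℤ d → ℚ
vand []       = 1ℚ
vand (x ∷ xs) = pd x xs ℚ.* vand xs

p₁ : ∀ {d} → Vec ℤ d → ℚ
p₁ []       = 0ℚ
p₁ (x ∷ xs) = sqℤ x ℚ.+ p₁ xs

pd-symmetric : ∀ x d → IsSymmetric d (pd x)
pd-symmetric x zero          = tt
pd-symmetric x (suc zero)    = tt
pd-symmetric x (suc (suc d)) =
  (λ y z zs → swap (sqℤ x ℚ.- sqℤ y) (sqℤ x ℚ.- sqℤ z) (pd x zs)) , (λ y → symmetric-map ((sqℤ x ℚ.- sqℤ y) ℚ.*_) (suc d) (pd-symmetric x (suc d)))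
  where
  swap : ∀ a b c → a ℚ.* (b ℚ.* c) ≡ b ℚ.* (a ℚ.* c)
  swap = solve-∀ ℚ-ring

p₁-symmetric : ∀ d → IsSymmetric d p₁
p₁-symmetric zero          = tt
p₁-symmetric (suc zero)    = tt
p₁-symmetric (suc (suc d)) = (λ x y zs → swap (sqℤ x) (sqℤ y) (p₁ zs)) , (λ x → symmetric-map (sqℤ x ℚ.+_) (suc d) (p₁-symmetric (suc d)))
  where
  swap : ∀ a b c → a ℚ.+ (b ℚ.+ c) ≡ b ℚ.+ (a ℚ.+ c)
  swap = solve-∀ ℚ-ring

vand-alternating : ∀ d → IsAlternating d vand
vand-alternating zero          = tt
vand-alternating (suc zero)    = tt
vand-alternating (suc (suc d)) =
  (λ x y zs → swap (sqℤ x) (sqℤ y) (pd x zs) (pd y zs) (vand zs)) ,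
  (λ x → alternating-⊡ (suc d) (pd-symmetric x (suc d)) (vand-alternating (suc d)))
  where
  swap : ∀ a b p r v → ((a ℚ.- b) ℚ.* p) ℚ.* (r ℚ.* v) ≡ ℚ.- (((b ℚ.- a) ℚ.* r) ℚ.* (p ℚ.* v))
  swap = solve-∀ ℚ-ring

p₁vand-alternating : ∀ d → IsAlternating d (p₁ ⊡ vand)
p₁vand-alternating d = alternating-⊡ d (p₁-symmetric d) (vand-alternating d)

infix 8 _^ℚ_
_^ℚ_ : ℚ → ℕ → ℚ
x ^ℚ zero  = 1ℚ
x ^ℚ suc n = x ℚ.* x ^ℚ n

-- The coefficient of X^s in the product of the factors X - v² over the entries v.
pc : ∀ {d} → Vec ℤ d → ℕ → ℚ
pc []       zero    = 1ℚ
pc []       (suc s) = 0ℚ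
pc (x ∷ vs) zero    = ℚ.- sqℤ x ℚ.* pc vs zero
pc (x ∷ vs) (suc s) = pc vs s ℚ.+ ℚ.- sqℤ x ℚ.* pc vs (suc s)

pc-above : ∀ {d} (vs : Vec ℤ d) e → pc vs (suc (e ℕ.+ d)) ≡ 0ℚ
pc-above []       e = refl
pc-above {suc d} (x ∷ vs) e rewrite ℕP.+-suc e d =
  trans (cong₂ (λ a b → a ℚ.+ ℚ.- sqℤ x ℚ.* b) (pc-above vs e) (pc-above vs (suc e))) (trans (cong (0ℚ ℚ.+_) (ℚP.*-zeroʳ (ℚ.- sqℤ x))) refl)

pc-top : ∀ {d} (vs : Vec ℤ d) → pc vs d ≡ 1ℚ
pc-top []       = refl
pc-top (x ∷ vs) = trans (cong₂ (λ a b → a ℚ.+ ℚ.- sqℤ x ℚ.* b) (pc-top vs) (pc-above vs 0)) (trans (cong (1ℚ ℚ.+_) (ℚP.*-zeroʳ (ℚ.- sqℤ x))) refl)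

pc-next : ∀ {d} (vs : Vec ℤ (suc d)) → pc vs d ≡ ℚ.- p₁ vs
pc-next {zero}  (x ∷ []) = aux (sqℤ x)
  where
  aux : ∀ a → ℚ.- a ℚ.* 1ℚ ≡ ℚ.- (a ℚ.+ 0ℚ)
  aux = solve-∀ ℚ-ring
pc-next {suc d} (x ∷ vs) = trans (cong₂ (λ a b → a ℚ.+ ℚ.- sqℤ x ℚ.* b) (pc-next vs) (pc-top vs)) (aux (sqℤ x) (p₁ vs))
  where
  aux : ∀ a p → ℚ.- p ℚ.+ ℚ.- a ℚ.* 1ℚ ≡ ℚ.- (a ℚ.+ p)
  aux = solve-∀ ℚ-ring

pd-expand : ∀ {d} V (vs : Vec ℤ d) → pd V vs ≡ sumTo (suc d) (λ s → sqℤ V ^ℚ s ℚ.* pc vs s)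
pd-expand V []       = refl
pd-expand {suc d} V (x ∷ vs) = trans (cong ((X ℚ.- y) ℚ.*_) (pd-expand V vs)) (trans (split X y S)
  (trans (cong₂ (λ a b → a ℚ.+ ℚ.- y ℚ.* b) (sym (sumTo-*ˡ (suc d) X _)) (trans (extend S) (sumTo-peel (suc d) (λ s → X ^ℚ s ℚ.* pc vs s))))
  (trans (regroup (sumTo (suc d) (λ s → X ℚ.* (X ^ℚ s ℚ.* pc vs s))) y (pc vs 0) (sumTo (suc d) (λ s → X ^ℚ suc s ℚ.* pc vs (suc s))))
  (trans (cong (1ℚ ℚ.* (ℚ.- y ℚ.* pc vs 0) ℚ.+_) (trans (cong (λ z → sumTo (suc d) (λ s → X ℚ.* (X ^ℚ s ℚ.* pc vs s)) ℚ.+ z) (sym (sumTo-*ˡ (suc d) (ℚ.- y) _))) (trans (sym (sumTo-+ (suc d) _ _))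
      (sumTo-cong (suc d) (λ s → term X y (X ^ℚ s) (pc vs s) (pc vs (suc s)))))))
  (sym (sumTo-peel (suc d) (λ s → X ^ℚ s ℚ.* pc (x ∷ vs) s)))))))
  where
  X = sqℤ V
  y = sqℤ x
  S = sumTo (suc d) (λ s → X ^ℚ s ℚ.* pc vs s)
  split : ∀ X y S → (X ℚ.- y) ℚ.* S ≡ X ℚ.* S ℚ.+ ℚ.- y ℚ.* S
  split = solve-∀ ℚ-ring
  extend : ∀ S → S ≡ S ℚ.+ X ^ℚ suc d ℚ.* pc vs (suc d)
  extend S = sym (trans (cong (λ z → S ℚ.+ X ^ℚ suc d ℚ.* z) (pc-above vs 0)) (trans (cong (S ℚ.+_) (ℚP.*-zeroʳ (X ^ℚ suc d))) (ℚP.+-identityʳ S)))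
  regroup : ∀ A y p B → A ℚ.+ ℚ.- y ℚ.* (1ℚ ℚ.* p ℚ.+ B) ≡ 1ℚ ℚ.* (ℚ.- y ℚ.* p) ℚ.+ (A ℚ.+ ℚ.- y ℚ.* B)
  regroup = solve-∀ ℚ-ring
  term : ∀ X y p a b → X ℚ.* (p ℚ.* a) ℚ.+ ℚ.- y ℚ.* ((X ℚ.* p) ℚ.* b) ≡ (X ℚ.* p) ℚ.* (a ℚ.+ ℚ.- y ℚ.* b)
  term = solve-∀ ℚ-ring

const-^ : ∀ V s → const (sqℤ V ^ℚ s) ≈ vS V ^S (s ℕ.+ s)
const-^ V zero    = const-1
const-^ V (suc s) = ≈-trans (const-* _ _) (≈-trans (·-cong (const-* _ _) (const-^ V s))
  (≈-trans (·-assoc _ _ _) (≡⇒≈ (cong (λ n → vS V · vS V ^S n) (sym (ℕP.+-suc s s))))))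

sumS-pick : ∀ n {F} i → i < n → (∀ j → j < n → j ≢ i → F j ≈ 0S) → sumS n F ≈ F i
sumS-pick (suc n) {F} i (s≤s i≤n) z with i ℕP.≟ n
... | yes refl = ≈-trans (⊕-congʳ (sumS-0 n (λ j j<n → z j (ℕP.m<n⇒m<1+n j<n) (ℕP.<⇒≢ j<n)))) (⊕-identityˡ _)
... | no  i≢n  = ≈-trans (⊕-cong (sumS-pick n i (ℕP.≤∧≢⇒< i≤n i≢n) (λ j j<n → z j (ℕP.m<n⇒m<1+n j<n))) (z n ℕP.≤-refl (λ e → i≢n (sym e)))) (⊕-identityʳ _)

sumS-pick₂ : ∀ n {F} i i′ → i < i′ → i′ < n → (∀ j → j < n → j ≢ i → j ≢ i′ → F j ≈ 0S) → sumS n F ≈ F i ⊕ F i′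
sumS-pick₂ (suc n) {F} i i′ i<i′ (s≤s i′≤n) z with i′ ℕP.≟ n
... | yes refl = ⊕-congʳ (sumS-pick n i i<i′ (λ j j<n j≢i → z j (ℕP.m<n⇒m<1+n j<n) j≢i (ℕP.<⇒≢ j<n)))
... | no i′≢n = ≈-trans (⊕-cong (sumS-pick₂ n i i′ i<i′ (ℕP.≤∧≢⇒< i′≤n i′≢n) (λ j j<n → z j (ℕP.m<n⇒m<1+n j<n)))
    (z n ℕP.≤-refl (λ e → ℕP.<⇒≢ (ℕP.<-≤-trans i<i′ i′≤n) (sym e)) (λ e → i′≢n (sym e)))) (⊕-identityʳ _)

module Rows (N : ℕ) where
  K : ℕ
  K = 3 ℕ.+ N

  Valid : ℕ → Set
  Valid r = 1 ≤ r × r < K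

  B≥1 : ∀ {r} → Valid r → 1 ≤ K ∸ r
  B≥1 (_ , r<K) = ℕP.m<n⇒0<n∸m r<K

  -- As `vand` is a determinant of even powers, `Wsum rs vand` is, up to sign, the determinant of
  -- the even theta moments of the rows.
  Wsum : ∀ {d} → Vec ℕ d → (Vec ℤ d → ℚ) → Series
  Wsum []       h = const (h [])
  Wsum (r ∷ rs) h = Row r (K ∸ r) (λ V → Wsum rs (λ vs → h (V ∷ vs)))

  Wsum-cong : ∀ {d} (rs : Vec ℕ d) {g h} → (∀ vs → g vs ≡ h vs) → Wsum rs g ≈ Wsum rs h
  Wsum-cong []       e = const-cong (e [])
  Wsum-cong (r ∷ rs) e = Row-cong r (K ∸ r) (λ V → Wsum-cong rs (λ vs → e (V ∷ vs)))

  Wsum-+ : ∀ {d} (rs : Vec ℕ d) g h → Wsum rs (λ vs → g vs ℚ.+ h vs) ≈ Wsum rs g ⊕ Wsum rs h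
  Wsum-+ []       g h = const-+ _ _
  Wsum-+ (r ∷ rs) g h = ≈-trans (Row-cong r (K ∸ r) (λ V → Wsum-+ rs _ _)) (Row-⊕ r (K ∸ r) _ _)

  Wsum-* : ∀ {d} (rs : Vec ℕ d) c h → All Valid rs → Wsum rs (λ vs → c ℚ.* h vs) ≈ const c · Wsum rs h
  Wsum-* []       c h []       = const-* _ _
  Wsum-* (r ∷ rs) c h (v ∷ vr) = ≈-trans (Row-cong r (K ∸ r) (λ V → Wsum-* rs c _ vr)) (Row-· r (K ∸ r) (const c) _ (B≥1 v))

  Wsum-neg : ∀ {d} (rs : Vec ℕ d) h → All Valid rs → Wsum rs (λ vs → ℚ.- h vs) ≈ ⊝ Wsum rs h
  Wsum-neg rs h v = ≈-trans (Wsum-cong rs (λ vs → aux (h vs))) (≈-trans (Wsum-* rs (ℚ.- 1ℚ) h v)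
    (≈-trans (·-congʳ (≈-trans (const-neg 1ℚ) (⊝-cong const-1))) (solve 1 (λ x → (:- con (+ 1)) :* x := :- x) ≈-refl _)))
    where
    aux : ∀ x → ℚ.- x ≡ ℚ.- 1ℚ ℚ.* x
    aux = solve-∀ ℚ-ring

  Wsum-sumTo : ∀ {d} (rs : Vec ℕ d) n (F : ℕ → Vec ℤ d → ℚ) → All Valid rs →
    Wsum rs (λ vs → sumTo n (λ s → F s vs)) ≈ sumS n (λ s → Wsum rs (F s))
  Wsum-sumTo rs zero    F v = ≈-trans (Wsum-cong rs {h = λ vs → 0ℚ ℚ.* 0ℚ} (λ _ → refl)) (≈-trans (Wsum-* rs 0ℚ (λ _ → 0ℚ) v) (·-zeroˡ _ const-0))
  Wsum-sumTo rs (suc n) F v = ≈-trans (Wsum-+ rs _ _) (⊕-congʳ (Wsum-sumTo rs n F v))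

  opaque
    unfolding Row

    Row-swap : ∀ r s (X : ℤ → ℤ → Series) → Valid r → Valid s →
      Row r (K ∸ r) (λ V → Row s (K ∸ s) (X V)) ≈ Row s (K ∸ s) (λ V′ → Row r (K ∸ r) (λ V → X V V′))
    Row-swap r s X vr vs = begin
      sumℤ 1 (λ t → wr t · sumℤ 1 (λ t′ → ws t′ · x t t′))
        ≈⟨ sumℤ-cong 1 (λ t → sumℤ-· (wr t) (tame-wt s (K ∸ s) (B≥1 vs) _)) ⟩
      sumℤ 1 (λ t → sumℤ 1 (λ t′ → wr t · (ws t′ · x t t′)))
        ≈⟨ sumℤ-swap 1 _ ⟩
      sumℤ 1 (λ t′ → sumℤ 1 (λ t → wr t · (ws t′ · x t t′)))
        ≈⟨ sumℤ-cong 1 (λ t′ → ≈-trans (sumℤ-cong 1 (λ t → solve 3 (λ a b c → a :* (b :* c) := b :* (a :* c)) ≈-refl (wr t) (ws t′) (x t t′)))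
             (≈-sym (sumℤ-· (ws t′) (tame-wt r (K ∸ r) (B≥1 vr) _)))) ⟩
      sumℤ 1 (λ t′ → ws t′ · sumℤ 1 (λ t → wr t · x t t′)) ∎
      where
      wr ws : ℤ → Series
      wr = wt r (K ∸ r)
      ws = wt s (K ∸ s)
      x : ℤ → ℤ → Series
      x t t′ = X (Vr r (K ∸ r) t) (Vr s (K ∸ s) t′)

  Wsum-transpose : ∀ {d} r s (rs : Vec ℕ d) h → All Valid (r ∷ s ∷ rs) → IsAlternating (suc (suc d)) h →
    Wsum (r ∷ s ∷ rs) h ≈ ⊝ Wsum (s ∷ r ∷ rs) h
  Wsum-transpose r s rs h (vr ∷ vs ∷ vrs) (a , _) = ≈-trans (Row-swap r s (λ V V′ → Wsum rs (λ vs → h (V ∷ V′ ∷ vs))) vr vs)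
    (≈-trans (Row-cong s (K ∸ s) (λ V′ → Row-cong r (K ∸ r) (λ V → Wsum-cong rs (λ zs → a V V′ zs))))
      (Wsum-neg (s ∷ r ∷ rs) h (vs ∷ vr ∷ vrs)))

  -- Transpositions carry the first row inwards to its second copy; exchanging two equal rows leaves
  -- the sum unchanged and negates it.
  Wsum-repeat : ∀ {d} r (rs : Vec ℕ d) h → r ∈ rs → All Valid (r ∷ rs) → IsAlternating (suc d) h → Wsum (r ∷ rs) h ≈ 0S
  Wsum-repeat r (r ∷ rs) h (here refl) v a = self-neg (Wsum-transpose r r rs h v a)
  Wsum-repeat r (s ∷ rs) h (there i) (vr ∷ vs ∷ v) a = ≈-trans (Wsum-transpose r s rs h (vr ∷ vs ∷ v) a)
    (≈-trans (⊝-cong (Row-0 s (K ∸ s) (λ V → Wsum-repeat r rs _ i (vr ∷ v) (proj₂ a V)))) (solve 0 (:- con (+ 0) := con (+ 0)) ≈-refl))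

  Rr : ℕ → ℤ
  Rr r = + (K ∸ r) ℤ.- + r

  Wsum-at0 : ∀ {d} (rs : Vec ℕ d) h → All Valid rs → Wsum rs h 0 ≡ h (Vec.map Rr rs)
  Wsum-at0 []       h []       = const-at0 _
  Wsum-at0 (r ∷ rs) h (v ∷ vr) = trans (Row-at0 r (K ∸ r) _ (proj₁ v) (B≥1 v)) (Wsum-at0 rs _ vr)

  ΣR² : ∀ {d} → Vec ℕ d → Series
  ΣR² []       = 0S
  ΣR² (r ∷ rs) = vS (Rr r) · vS (Rr r) ⊕ ΣR² rs

  -- `Row-heat` is applied row by row. The factor 8K is common to all rows because r and K - r
  -- always add up to K, so the derivatives combine by the product structure of the sum.
  Wsum-heat : ∀ {d} (rs : Vec ℕ d) h → All Valid rs →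
    Wsum rs (p₁ ⊡ h) ≈ (vS (+ 8) · vS (+ K)) · D (Wsum rs h) ⊕ ΣR² rs · Wsum rs h
  Wsum-heat [] h [] = ≈-trans (const-cong (ℚP.*-zeroˡ (h []))) (≈-trans const-0 (≈-sym (≈-trans (⊕-cong (·-zeroʳ _ (D-const _)) (SR.zeroˡ _)) (⊕-identityˡ _))))
  Wsum-heat (r ∷ rs) h (v ∷ vr) = begin
    Row r B (λ V → Wsum rs (λ vs → (sqℤ V ℚ.+ p₁ vs) ℚ.* h (V ∷ vs)))
      ≈⟨ Row-cong r B (λ V → ≈-trans (Wsum-cong rs (λ vs → ℚP.*-distribʳ-+ (h (V ∷ vs)) (sqℤ V) (p₁ vs)))
           (≈-trans (Wsum-+ rs _ _) (⊕-cong (≈-trans (Wsum-* rs (sqℤ V) _ vr) (·-congʳ (const-* _ _))) (Wsum-heat rs _ vr)))) ⟩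
    Row r B (λ V → (vS V · vS V) · X V ⊕ (c · D (X V) ⊕ ΣR² rs · X V))
      ≈⟨ ≈-trans (Row-⊕ r B _ _) (⊕-congˡ (≈-trans (Row-⊕ r B _ _) (⊕-cong (Row-· r B c _ (B≥1 v)) (Row-· r B (ΣR² rs) _ (B≥1 v))))) ⟩
    Row r B (λ V → (vS V · vS V) · X V) ⊕ (c · Row r B (λ V → D (X V)) ⊕ ΣR² rs · Row r B X)
      ≈⟨ ≈-sym (⊕-assoc _ _ _) ⟩
    (Row r B (λ V → (vS V · vS V) · X V) ⊕ c · Row r B (λ V → D (X V))) ⊕ ΣR² rs · Row r B X
      ≈⟨ ⊕-congʳ (≈-trans (⊕-congˡ (·-congʳ c≈)) (≈-trans (≈-sym (Row-heat r B X (B≥1 v))) (⊕-congʳ (·-congʳ (≈-sym c≈))))) ⟩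
    (c · D (Row r B X) ⊕ (vS (Rr r) · vS (Rr r)) · Row r B X) ⊕ ΣR² rs · Row r B X
      ≈⟨ solve 4 (λ a r s x → (a :+ r :* x) :+ s :* x := a :+ (r :+ s) :* x) ≈-refl (c · D (Row r B X)) (vS (Rr r) · vS (Rr r)) (ΣR² rs) (Row r B X) ⟩
    c · D (Wsum (r ∷ rs) h) ⊕ ΣR² (r ∷ rs) · Wsum (r ∷ rs) h ∎
    where
    B = K ∸ r
    c = vS (+ 8) · vS (+ K)
    c≈ : c ≈ vS (+ 8) · vS (+ (r ℕ.+ B))
    c≈ = ·-congˡ (≡⇒≈ (cong (λ k → vS (+ k)) (sym (ℕP.m+[n∸m]≡n (ℕP.<⇒≤ (proj₂ v))))))
    X : ℤ → Series
    X V = Wsum rs (λ vs → h (V ∷ vs))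

-- First-order equations and powers of P

sumTo-*ʳ : ∀ n f c → sumTo n f ℚ.* c ≡ sumTo n (λ i → f i ℚ.* c)
sumTo-*ʳ n f c = trans (ℚP.*-comm (sumTo n f) c) (trans (sym (sumTo-*ˡ n c f)) (sumTo-cong n (λ i → ℚP.*-comm c (f i))))

*-nonzero : ∀ {a b} → a ≢ 0ℚ → b ≢ 0ℚ → a ℚ.* b ≢ 0ℚ
*-nonzero a≢0 b≢0 e = b≢0 (*-cancel-0 a≢0 e)

nS≈vS : ∀ n → nS n ≈ vS (+ n)
nS≈vS zero    = ≈-sym const-0
nS≈vS (suc n) = ≈-trans (⊕-cong (nS≈vS n) (≈-sym const-1)) (≈-trans (⊕-comm _ _) (≈-sym (vS-+ (+ 1) (+ n))))

D-^ : ∀ n → P · D (P ^S n) ≈ nS n · (P ^S n · D P)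
D-^ zero    = ≈-trans (·-zeroʳ P D-one) (≈-sym (SR.zeroˡ _))
D-^ (suc n) = ≈-trans (·-congˡ (D-· P (P ^S n))) (≈-trans
  (solve 5 (λ P p X x n → P :* (p :* X :+ P :* x) := ((n :+ con (+ 1)) :* ((P :* X) :* p)) :+ P :* (P :* x :- n :* (X :* p))) ≈-refl P (D P) (P ^S n) (D (P ^S n)) (nS n))
  (kill P (D-^ n)))

D-at0 : ∀ f → D f 0 ≡ 0ℚ
D-at0 f = trans (D-at f 0) (ℚP.*-zeroˡ (f 0))

-- The derivation multiplies coefficient k by k, P starts with 1 and DP has no constant term. So the
-- equation for X - Y expresses k times its k-th coefficient through lower ones, all of which
-- vanish.
ode-unique : ∀ c {X Y} → P · D X ≈ c · (X · D P) → P · D Y ≈ c · (Y · D P) → X 0 ≡ Y 0 → X ≈ Y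
ode-unique c {X} {Y} eX eY e₀ = ≈-trans (solve 2 (λ x y → x := y :+ (x :- y)) ≈-refl X Y) (≈-trans (⊕-congˡ Z≈0) (⊕-identityʳ Y))
  where
  Z : Series
  Z = X ⊖ Y
  eZ : P · D Z ≈ D P · (c · Z)
  eZ = ≈-trans (·-congˡ (≈-trans (D-⊕ X (⊝ Y)) (⊕-congˡ (D-⊝ Y))))
    (≈-trans (solve 3 (λ P x y → P :* (x :+ :- y) := P :* x :- P :* y) ≈-refl P (D X) (D Y))
    (≈-trans (⊖-cong eX eY) (solve 4 (λ c x y p → c :* (x :* p) :- c :* (y :* p) := p :* (c :* (x :- y))) ≈-refl c X Y (D P))))
  vanish : ∀ k → Z k ≡ 0ℚ
  vanish = <-rec (λ k → Z k ≡ 0ℚ) step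
    where
    step : ∀ k → (∀ {j} → j < k → Z j ≡ 0ℚ) → Z k ≡ 0ℚ
    step zero    ih = trans (⊕-at X (⊝ Y) 0) (trans (cong₂ ℚ._+_ e₀ (⊝-at Y 0)) (ℚP.+-inverseʳ (Y 0)))
    step (suc k) ih = *-cancel-0 {ℤ→ℚ (+ suc k)} (λ e → suc≢0 (ℤ→ℚ-injective {+ suc k} {+ 0} e)) (coefficient)
      where
      suc≢0 : + suc k ≢ + 0
      suc≢0 ()
      cZ-small : ∀ j → j < suc k → (c · Z) j ≡ 0ℚ
      cZ-small j j< = trans (·-at c Z j) (sumTo-0 (suc j) (λ i _ → trans (cong (c i ℚ.*_) (ih (ℕP.≤-<-trans (ℕP.m∸n≤m j i) j<))) (ℚP.*-zeroʳ (c i))))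
      left : (P · D Z) (suc k) ≡ P 0 ℚ.* D Z (suc k)
      left = trans (·-at P (D Z) (suc k)) (trans (sumTo-peel (suc k) (λ i → P i ℚ.* D Z (suc k ∸ i))) (trans (cong (P 0 ℚ.* D Z (suc k) ℚ.+_)
        (sumTo-0 (suc k) (λ i i< → trans (cong (P (suc i) ℚ.*_) (trans (D-at Z (k ∸ i)) (trans (cong (ℤ→ℚ (+ (k ∸ i)) ℚ.*_) (ih (s≤s (ℕP.m∸n≤m k i)))) (ℚP.*-zeroʳ (ℤ→ℚ (+ (k ∸ i))))))) (ℚP.*-zeroʳ (P (suc i))))))
        (ℚP.+-identityʳ (P 0 ℚ.* D Z (suc k)))))
      right : (D P · (c · Z)) (suc k) ≡ 0ℚ
      right = trans (·-at (D P) (c · Z) (suc k)) (trans (sumTo-peel (suc k) (λ i → D P i ℚ.* (c · Z) (suc k ∸ i))) (trans (cong₂ ℚ._+_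
        (trans (cong (ℚ._* (c · Z) (suc k)) (D-at0 P)) (ℚP.*-zeroˡ ((c · Z) (suc k))))
        (sumTo-0 (suc k) (λ i i< → trans (cong (D P (suc i) ℚ.*_) (cZ-small (k ∸ i) (s≤s (ℕP.m∸n≤m k i)))) (ℚP.*-zeroʳ (D P (suc i))))))
        (ℚP.+-identityʳ 0ℚ)))
      coefficient : ℤ→ℚ (+ suc k) ℚ.* Z (suc k) ≡ 0ℚ
      coefficient = trans (sym (D-at Z (suc k))) (trans (sym (ℚP.*-identityˡ (D Z (suc k)))) (trans (cong (ℚ._* D Z (suc k)) (sym P-at0)) (trans (sym left) (trans (at eZ (suc k)) right))))
  Z≈0 : Z ≈ 0S
  Z≈0 .at k = trans (vanish k) (sym (0S-at k))

^S-at0 : ∀ {x} n → x 0 ≡ 1ℚ → (x ^S n) 0 ≡ 1ℚ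
^S-at0 zero    e = refl
^S-at0 {x} (suc n) e = trans (·-at0 x (x ^S n)) (cong₂ ℚ._*_ e (^S-at0 n e))

^S-+ : ∀ x m n → x ^S (m ℕ.+ n) ≈ x ^S m · x ^S n
^S-+ x zero    n = ≈-sym (·-identityˡ _)
^S-+ x (suc m) n = ≈-trans (·-congˡ (^S-+ x m n)) (≈-sym (·-assoc _ _ _))

const-at : ∀ c X → (const c · X) 0 ≡ c ℚ.* X 0
const-at c X = trans (·-at0 (const c) X) (cong (ℚ._* X 0) (const-at0 c))

power-solution : ∀ n {X} → P · D X ≈ nS n · (X · D P) → X ≈ const (X 0) · P ^S n
power-solution n {X} e = ode-unique (nS n) e
  (≈-trans (·-congˡ (D-· (const (X 0)) (P ^S n))) (≈-trans (·-congˡ (⊕-congʳ (·-zeroˡ _ (D-const (X 0)))))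
    (≈-trans (solve 5 (λ P c x N y → P :* (con (+ 0) :+ c :* x) := N :* ((c :* y)) :+ c :* (P :* x :- N :* y)) ≈-refl P (const (X 0)) (D (P ^S n)) (nS n) (P ^S n · D P))
    (≈-trans (kill _ (D-^ n)) (·-congˡ (≈-sym (·-assoc _ _ _)))))))
  (sym (trans (const-at (X 0) (P ^S n)) (trans (cong (X 0 ℚ.*_) (^S-at0 n P-at0)) (ℚP.*-identityʳ (X 0)))))

-- Jacobi's identity for the cube of Euler's series; the constant 2 comes from the terms i = 0 and i
-- = -1.
J₁≈ : J 1 ≈ const (ℤ→ℚ (+ 2)) · P ^S 3
J₁≈ = ≈-trans (power-solution 3 (≈-trans J₁-ode (·-congʳ (solve 0 (con (+ 3) := ((con (+ 0) :+ con (+ 1)) :+ con (+ 1)) :+ con (+ 1)) ≈-refl))))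
  (·-congʳ (const-cong J₁-at0))

-- 2 · N! · 2^N, the constant term of μ_NN.
γ : ℕ → ℚ
γ zero    = ℤ→ℚ (+ 2)
γ (suc N) = γ N ℚ.* (ℤ→ℚ (+ suc N) ℚ.* ℤ→ℚ (+ 2))

γ≢0 : ∀ N → γ N ≢ 0ℚ
γ≢0 zero    = 2≢0
γ≢0 (suc N) = *-nonzero (γ≢0 N) (*-nonzero (λ e → suc≢0 (ℤ→ℚ-injective {+ suc N} {+ 0} e)) 2≢0)
  where
  suc≢0 : + suc N ≢ + 0
  suc≢0 ()

μ-power : ∀ N → μ N N ≈ const (γ N) · P ^S (N ℕ.* 3 ℕ.+ 1)
μ-power zero    = ≈-trans G≈ (≈-trans (solve 1 (λ p → p :+ p := con (+ 2) :* (p :* con (+ 1))) ≈-refl P) (·-congʳ (ℤS≈const (+ 2))))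
μ-power (suc N) = ≈-trans (μ-top N) (≈-trans (·-cong (μ-power N) (·-cong (nS≈vS (suc N)) J₁≈))
  (≈-trans (solve 5 (λ g Q n t P → (g :* Q) :* (n :* (t :* (P :* (P :* (P :* con (+ 1)))))) := (g :* (n :* t)) :* (P :* (P :* (P :* Q)))) ≈-refl (const (γ N)) (P ^S (N ℕ.* 3 ℕ.+ 1)) (vS (+ suc N)) (const (ℤ→ℚ (+ 2))) P)
  (·-congʳ (≈-sym (≈-trans (const-* (γ N) _) (·-congˡ (const-* _ _)))))))

-- For even N the reflected index N + 1 - j has the opposite parity, and this sign cancels the sign
-- of antisymmetry.
cf-mirror : ∀ n r → 1 ≤ r → r < 3 ℕ.+ (n ℕ.+ n) → cf (n ℕ.+ n) (3 ℕ.+ (n ℕ.+ n) ∸ r) ≈ cf (n ℕ.+ n) r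
cf-mirror n r 1≤r r<K = ≈-trans (·-cong sign (uN-antisym N (ℤ.pred (+ (K ∸ r))) (ℤ.pred (+ r)) index))
  (solve 2 (λ s u → (:- s) :* (:- u) := s :* u) ≈-refl (sg (ℤ.pred (+ r))) (uN N (ℤ.pred (+ r))))
  where
  N K : ℕ
  N = n ℕ.+ n
  K = 3 ℕ.+ N
  total : + (K ∸ r) ℤ.+ + r ≡ + K
  total = cong +_ (ℕP.m∸n+n≡m (ℕP.<⇒≤ r<K))
  index : ℤ.pred (+ (K ∸ r)) ℤ.+ ℤ.pred (+ r) ≡ + suc N
  index = trans (ZS.solve 2 (λ x r → (ZS.con -[1+ 0 ] ZS.:+ x) ZS.:+ (ZS.con -[1+ 0 ] ZS.:+ r) ZS.:= ZS.con -[1+ 1 ] ZS.:+ (x ZS.:+ r)) refl (+ (K ∸ r)) (+ r)) (cong (λ z → -[1+ 1 ] ℤ.+ z) total)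
  sign : sg (ℤ.pred (+ (K ∸ r))) ≈ ⊝ sg (ℤ.pred (+ r))
  sign = ≈-trans (≡⇒≈ (cong sg (trans (ZS.solve 2 (λ x r → ZS.con -[1+ 0 ] ZS.:+ x ZS.:= (ZS.con -[1+ 1 ] ZS.:+ (x ZS.:+ r)) ZS.:+ (ZS.:- (ZS.con -[1+ 0 ] ZS.:+ r))) refl (+ (K ∸ r)) (+ r)) (cong (λ z → (-[1+ 1 ] ℤ.+ z) ℤ.+ ℤ.- ℤ.pred (+ r)) total))))
    (≈-trans (sg-+ (+ suc N) (ℤ.- ℤ.pred (+ r))) (≈-trans (·-cong (⊝-cong (sg-double (+ n))) (sg-neg (ℤ.pred (+ r)))) (solve 1 (λ x → (:- con (+ 1)) :* x := :- x) ≈-refl (sg (ℤ.pred (+ r))))))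

-- Isolating one component

module Classes (n′ : ℕ) where
  n N : ℕ
  n = suc n′
  N = n ℕ.+ n

  open Rows N public

  module _ (rs : Vec ℕ n) (valid : All Valid rs) where

    coef coef₁ : ℕ → Series
    coef  s = Wsum rs (λ vs → pc vs s ℚ.* vand vs)
    coef₁ s = Wsum rs (λ vs → pc vs s ℚ.* (p₁ ⊡ vand) vs)

    coef-n : coef n ≈ Wsum rs vand
    coef-n = Wsum-cong rs (λ vs → trans (cong (ℚ._* vand vs) (pc-top vs)) (ℚP.*-identityˡ (vand vs)))

    coef₁-n : coef₁ n ≈ Wsum rs (p₁ ⊡ vand)
    coef₁-n = Wsum-cong rs (λ vs → trans (cong (ℚ._* (p₁ ⊡ vand) vs) (pc-top vs)) (ℚP.*-identityˡ ((p₁ ⊡ vand) vs)))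

    coef-n′ : coef n′ ≈ ⊝ Wsum rs (p₁ ⊡ vand)
    coef-n′ = ≈-trans (Wsum-cong rs (λ vs → trans (cong (ℚ._* vand vs) (pc-next vs)) (sym (ℚP.neg-distribˡ-* (p₁ vs) (vand vs))))) (Wsum-neg rs (p₁ ⊡ vand) valid)

    expand : ∀ e (h : Vec ℤ n → ℚ) V → Wsum rs (λ vs → sqℤ V ^ℚ e ℚ.* (pd V vs ℚ.* h vs)) ≈
      sumS (suc n) (λ s → vS V ^S ((e ℕ.+ s) ℕ.+ (e ℕ.+ s)) · Wsum rs (λ vs → pc vs s ℚ.* h vs))
    expand e h V = ≈-trans (Wsum-cong rs (λ vs → trans (cong (λ z → X ^ℚ e ℚ.* (z ℚ.* h vs)) (pd-expand V vs))
        (trans (cong (X ^ℚ e ℚ.*_) (sumTo-*ʳ (suc n) _ (h vs))) (trans (sym (sumTo-*ˡ (suc n) (X ^ℚ e) _))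
          (sumTo-cong (suc n) (λ s → trans (aux (X ^ℚ e) (X ^ℚ s) (pc vs s) (h vs)) (cong (ℚ._* (pc vs s ℚ.* h vs)) (sym (^ℚ-+ X e s)))))))))
      (≈-trans (Wsum-sumTo rs (suc n) (λ s vs → X ^ℚ (e ℕ.+ s) ℚ.* (pc vs s ℚ.* h vs)) valid)
        (sumS-cong (suc n) (λ s → ≈-trans (Wsum-* rs (X ^ℚ (e ℕ.+ s)) (λ vs → pc vs s ℚ.* h vs) valid) (·-congʳ (const-^ V (e ℕ.+ s))))))
      where
      X : ℚ
      X = sqℤ V
      aux : ∀ a b c d → a ℚ.* ((b ℚ.* c) ℚ.* d) ≡ (a ℚ.* b) ℚ.* (c ℚ.* d)
      aux = solve-∀ ℚ-ring
      ^ℚ-+ : ∀ x a b → x ^ℚ (a ℕ.+ b) ≡ x ^ℚ a ℚ.* x ^ℚ b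
      ^ℚ-+ x zero    b = sym (ℚP.*-identityˡ _)
      ^ℚ-+ x (suc a) b = trans (cong (x ℚ.*_) (^ℚ-+ x a b)) (sym (ℚP.*-assoc x _ _))

    Mom-expand : ∀ e h → Mom N (λ V → Wsum rs (λ vs → sqℤ V ^ℚ e ℚ.* (pd V vs ℚ.* h vs))) ≈
      sumS (suc n) (λ s → μ N ((e ℕ.+ s) ℕ.+ (e ℕ.+ s)) · Wsum rs (λ vs → pc vs s ℚ.* h vs))
    Mom-expand e h = ≈-trans (Mom-cong N (expand e h)) (≈-trans (Mom-sumS N (suc n) (λ s V → vS V ^S ((e ℕ.+ s) ℕ.+ (e ℕ.+ s)) · Wsum rs (λ vs → pc vs s ℚ.* h vs)))
      (sumS-cong (suc n) (λ s → Mom-· N (λ V → vS V ^S ((e ℕ.+ s) ℕ.+ (e ℕ.+ s))) _)))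

    -- The factor `pd V` has degree 2n = N in V, so `μ-zero` kills all of its powers except the
    -- leading one.
    Mom-low : ∀ h → Mom N (λ V → Wsum rs (λ vs → pd V vs ℚ.* h vs)) ≈ μ N N · Wsum rs (λ vs → pc vs n ℚ.* h vs)
    Mom-low h = ≈-trans (Mom-cong N (λ V → Wsum-cong rs (λ vs → sym (ℚP.*-identityˡ (pd V vs ℚ.* h vs))))) (≈-trans (Mom-expand 0 h)
      (≈-trans (⊕-congʳ (sumS-0 n (λ s s<n → ·-zeroˡ _ (μ-zero N (s ℕ.+ s) (ℕP.+-mono-< s<n s<n))))) (⊕-identityˡ _)))

    Mom-vand : Mom N (λ V → Wsum rs (λ vs → vand (V ∷ vs))) ≈ μ N N · Wsum rs vand
    Mom-vand = ≈-trans (Mom-low vand) (·-congˡ coef-n)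

    -- The power sum splits as V² plus the part of the remaining rows. In V² `pd V` the power V^N
    -- comes with the subleading coefficient, minus that part, and cancels its contribution; only
    -- the moment of order N + 2 survives.
    Mom-p₁vand : Mom N (λ V → Wsum rs (λ vs → (p₁ ⊡ vand) (V ∷ vs))) ≈ μ N (2 ℕ.+ N) · Wsum rs vand
    Mom-p₁vand = begin
      Mom N (λ V → Wsum rs (λ vs → (p₁ ⊡ vand) (V ∷ vs)))
        ≈⟨ Mom-cong N (λ V → ≈-trans (Wsum-cong rs (λ vs → aux (sqℤ V) (p₁ vs) (pd V vs) (vand vs)))
            (Wsum-+ rs (λ vs → sqℤ V ^ℚ 1 ℚ.* (pd V vs ℚ.* vand vs)) (λ vs → pd V vs ℚ.* (p₁ ⊡ vand) vs))) ⟩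
      Mom N (λ V → Wsum rs (λ vs → sqℤ V ^ℚ 1 ℚ.* (pd V vs ℚ.* vand vs)) ⊕ Wsum rs (λ vs → pd V vs ℚ.* (p₁ ⊡ vand) vs))
        ≈⟨ Mom-⊕ N (λ V → Wsum rs (λ vs → sqℤ V ^ℚ 1 ℚ.* (pd V vs ℚ.* vand vs))) (λ V → Wsum rs (λ vs → pd V vs ℚ.* (p₁ ⊡ vand) vs)) ⟩
      _
        ≈⟨ ⊕-cong (Mom-expand 1 vand) (≈-trans (Mom-low (p₁ ⊡ vand)) (·-congˡ coef₁-n)) ⟩
      ((sumS n′ (λ s → μ N (suc s ℕ.+ suc s) · coef s) ⊕ μ N N · coef n′) ⊕ μ N (suc n ℕ.+ suc n) · coef n) ⊕ μ N N · Wsum rs (p₁ ⊡ vand)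
        ≈⟨ ⊕-congʳ (⊕-cong (⊕-cong (sumS-0 n′ (λ s s<n′ → ·-zeroˡ _ (μ-zero N _ (ℕP.+-mono-< (s≤s s<n′) (s≤s s<n′))))) (·-congˡ coef-n′))
             (·-cong (≡⇒≈ (cong (μ N) (cong suc (ℕP.+-suc n n)))) coef-n)) ⟩
      ((0S ⊕ μ N N · (⊝ Wsum rs (p₁ ⊡ vand))) ⊕ μ N (2 ℕ.+ N) · Wsum rs vand) ⊕ μ N N · Wsum rs (p₁ ⊡ vand)
        ≈⟨ solve 4 (λ g w h v → ((con (+ 0) :+ g :* (:- w)) :+ h :* v) :+ g :* w := h :* v) ≈-refl (μ N N) (Wsum rs (p₁ ⊡ vand)) (μ N (2 ℕ.+ N)) (Wsum rs vand) ⟩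
      μ N (2 ℕ.+ N) · Wsum rs vand ∎
      where
      aux : ∀ X p d v → (X ℚ.+ p) ℚ.* (d ℚ.* v) ≡ (X ℚ.* 1ℚ) ℚ.* (d ℚ.* v) ℚ.+ d ℚ.* (p ℚ.* v)
      aux = solve-∀ ℚ-ring

    module _ (r₀ : ℕ) (1≤r₀ : 1 ≤ r₀) (r₀≤ : r₀ ≤ suc n) (complete : ∀ r → 1 ≤ r → r ≤ suc n → r ≢ r₀ → r ∈ rs) where

      private
        half : ∀ {r} → r ≤ suc n → r < K ∸ r
        half {r} r≤ = ℕP.m+n≤o⇒m≤o∸n (suc r) (ℕP.≤-trans (s≤s (ℕP.+-mono-≤ r≤ r≤)) (ℕP.≤-reflexive (cong (2 ℕ.+_) (ℕP.+-suc n n))))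

        r<K : ∀ {r} → r ≤ suc n → r < K
        r<K {r} r≤ = ℕP.<-≤-trans (half r≤) (ℕP.m∸n≤m K r)

      valid₀ : Valid r₀
      valid₀ = 1≤r₀ , r<K r₀≤

      -- Residue classes of V modulo 2K: V ≡ K contributes nothing, V ≡ ±R_r agree, and a class
      -- already among the rows is killed by antisymmetry.
      Mom-Wsum : ∀ h → IsAlternating (suc n) h → (∀ V vs → h (ℤ.- V ∷ vs) ≡ h (V ∷ vs)) →
        Mom N (λ V → Wsum rs (λ vs → h (V ∷ vs))) ≈ (cf N r₀ ⊕ cf N r₀) · Wsum (r₀ ∷ rs) h
      Mom-Wsum h alt even = ≈-trans (Mom-classes N X) (≈-trans
        (sumS-pick₂ K r₀ (K ∸ r₀) (half r₀≤) (ℕP.∸-monoʳ-< 1≤r₀ (ℕP.<⇒≤ (r<K r₀≤))) others)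
        (≈-trans (⊕-congˡ (·-cong (cf-mirror n r₀ 1≤r₀ (r<K r₀≤)) (mirror (K ∸ r₀) 1≤K∸r₀ (ℕP.∸-monoʳ-< 1≤r₀ (ℕP.<⇒≤ (r<K r₀≤))) r₀ (ℕP.m∸[m∸n]≡n {K} (ℕP.<⇒≤ (r<K r₀≤))))))
          (≈-sym (·-distribʳ _ _ _))))
        where
        1≤K∸r₀ : 1 ≤ K ∸ r₀
        1≤K∸r₀ = ℕP.≤-trans 1≤r₀ (ℕP.<⇒≤ (half r₀≤))
        X : ℤ → Series
        X V = Wsum rs (λ vs → h (V ∷ vs))
        mirror : ∀ r → 1 ≤ r → r < K → ∀ r′ → K ∸ r ≡ r′ → Wsum (r ∷ rs) h ≈ Wsum (r′ ∷ rs) h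
        mirror r 1≤r r<K r′ refl = ≈-trans (Row-mirror r (K ∸ r) X 1≤r (ℕP.m<n⇒0<n∸m r<K))
          (≈-trans (Row-cong (K ∸ r) r (λ V → Wsum-cong rs (even V))) (≡⇒≈ (cong (λ z → Row (K ∸ r) z X) (sym (ℕP.m∸[m∸n]≡n {K} (ℕP.<⇒≤ r<K))))))
        repeated : ∀ r → 1 ≤ r → r ≤ suc n → r ≢ r₀ → Wsum (r ∷ rs) h ≈ 0S
        repeated r 1≤r r≤ r≢ = Wsum-repeat r rs h (complete r 1≤r r≤ r≢) ((1≤r , r<K r≤) ∷ valid) alt
        others : ∀ r → r < K → r ≢ r₀ → r ≢ K ∸ r₀ → cf N r · Wsum (r ∷ rs) h ≈ 0S
        others zero    _   _  _   = ·-zeroˡ _ (·-zeroʳ _ (uN-zero N))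
        others (suc r) r<K r≢ r≢′ with suc r ℕP.≤? suc n
        ... | yes r≤ = ·-zeroʳ _ (repeated (suc r) (s≤s z≤n) r≤ r≢)
        ... | no  r≰ = ·-zeroʳ _ (≈-trans (mirror (suc r) (s≤s z≤n) r<K (K ∸ suc r) refl)
            (repeated (K ∸ suc r) (ℕP.m<n⇒0<n∸m r<K) (ℕP.≤-trans (ℕP.∸-monoʳ-≤ K (ℕP.≰⇒> r≰)) (ℕP.≤-reflexive K∸)) (λ e → r≢′ (trans (sym (ℕP.m∸[m∸n]≡n {K} (ℕP.<⇒≤ r<K))) (cong (K ∸_) e)))))
          where
          K∸ : K ∸ suc (suc n) ≡ suc n
          K∸ = trans (cong (_∸ suc (suc n)) (sym (trans (cong suc (ℕP.+-suc (suc n) n)) refl))) (ℕP.m+n∸m≡n (suc (suc n)) (suc n))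

      W w : Series
      W = Wsum (r₀ ∷ rs) vand
      w = Wsum rs vand

      private
        c₂ : Series
        c₂ = cf N r₀ ⊕ cf N r₀

        sq-neg : ∀ V → sqℤ (ℤ.- V) ≡ sqℤ V
        sq-neg V = trans (cong (λ x → x ℚ.* x) (ℤ→ℚ-neg V)) (aux (ℤ→ℚ V))
          where
          aux : ∀ x → ℚ.- x ℚ.* ℚ.- x ≡ x ℚ.* x
          aux = solve-∀ ℚ-ring

        pd-neg : ∀ {d} V (vs : Vec ℤ d) → pd (ℤ.- V) vs ≡ pd V vs
        pd-neg V []       = refl
        pd-neg V (x ∷ vs) = cong₂ (λ a b → (a ℚ.- sqℤ x) ℚ.* b) (sq-neg V) (pd-neg V vs)

      E₁ : c₂ · W ≈ μ N N · w
      E₁ = ≈-trans (≈-sym (Mom-Wsum vand (vand-alternating (suc n)) (λ V vs → cong (ℚ._* vand vs) (pd-neg V vs)))) Mom-vand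

      -- The analogue of `E₁` one even moment higher. The heat equation turns the inserted power sum
      -- into a derivative of W.
      E₂ : c₂ · ((vS (+ 8) · vS (+ K)) · D W ⊕ ΣR² (r₀ ∷ rs) · W) ≈ μ N (2 ℕ.+ N) · w
      E₂ = ≈-trans (·-congˡ (≈-sym (Wsum-heat (r₀ ∷ rs) vand (valid₀ ∷ valid))))
        (≈-trans (≈-sym (Mom-Wsum (p₁ ⊡ vand) (p₁vand-alternating (suc n))
           (λ V vs → cong₂ ℚ._*_ (cong (ℚ._+ p₁ vs) (sq-neg V)) (cong (ℚ._* vand vs) (pd-neg V vs))))) Mom-p₁vand)

      module _ (ΣR²≈ : ℤS (+ 6) · ΣR² (r₀ ∷ rs) ≈ nS (3 ℕ.+ N) · (b₁ N · b₁ (suc N))) (w₀≢0 : w 0 ≢ 0ℚ) where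

        E₁-at0 : c₂ 0 ℚ.* W 0 ≡ γ N ℚ.* w 0
        E₁-at0 = trans (sym (·-at0 c₂ W)) (trans (at E₁ 0) (trans (·-at0 (μ N N) w)
          (cong (ℚ._* w 0) (trans (at (μ-power N) 0) (trans (const-at (γ N) _) (trans (cong (γ N ℚ.*_) (^S-at0 (N ℕ.* 3 ℕ.+ 1) P-at0)) (ℚP.*-identityʳ (γ N))))))))

        private
          c₂W≢0 : c₂ 0 ℚ.* W 0 ≢ 0ℚ
          c₂W≢0 e = *-nonzero (γ≢0 N) w₀≢0 (trans (sym E₁-at0) e)

          c₂≢0 : c₂ 0 ≢ 0ℚ
          c₂≢0 e = c₂W≢0 (trans (cong (ℚ._* W 0) e) (ℚP.*-zeroˡ (W 0)))

          W≢0 : W 0 ≢ 0ℚ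
          W≢0 e = c₂W≢0 (trans (cong (c₂ 0 ℚ.*_) e) (ℚP.*-zeroʳ (c₂ 0)))

        -- The quotient of `E₂` and `E₁`, cross-multiplied, with the ratio of moments from
        -- `μ-ratio`. The assumed value of the sum of squares is the one for which the terms without
        -- a derivative cancel; the 24 in `H₂≈` and the 8K then leave the common factor 48K.
        W-ode₂ : P · D W ⊕ P · D W ≈ (b₁ N · b₁ (suc N)) · (W · D P)
        W-ode₂ = ·-cancelˡ (ℤS (+ 48) · (vS (+ K) · c₂)) nonzero (begin
          (ℤS (+ 48) · (k · c₂)) · (P · D W ⊕ P · D W)
            ≈⟨ solve 8 (λ k c P p W W′ S h → (con (+ 48) :* (k :* c)) :* (P :* W′ :+ P :* W′)
                 := ((P :+ P) :* con (+ 6)) :* (c :* ((con (+ 8) :* k) :* W′ :+ S :* W)) :- ((P :+ P) :* (c :* W)) :* (con (+ 6) :* S)) ≈-refl k c₂ P (D P) W (D W) S h ⟩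
          ((P ⊕ P) · ℤS (+ 6)) · (c₂ · ((ℤS (+ 8) · k) · D W ⊕ S · W)) ⊖ ((P ⊕ P) · (c₂ · W)) · (ℤS (+ 6) · S)
            ≈⟨ ⊖-cong (·-cong (·-congʳ (≈-sym G≈)) (≈-trans (·-congˡ (⊕-congʳ (·-congʳ (·-congʳ (ℤS≈vS (+ 8)))))) E₂)) (·-congˡ ΣR²≈) ⟩
          (G · ℤS (+ 6)) · (h · w) ⊖ ((P ⊕ P) · (c₂ · W)) · M
            ≈⟨ ⊖-cong (≈-trans (solve 3 (λ G h w → (G :* con (+ 6)) :* (h :* w) := (con (+ 6) :* (h :* G)) :* w) ≈-refl G h w)
                 (≈-trans (·-congʳ (≈-trans (μ-ratio N) (·-congˡ (·-congˡ H₂≈)))) (solve 4 (λ m g H w → (m :* (g :* H)) :* w := (m :* H) :* (g :* w)) ≈-refl M (μ N N) _ w))) ≈-refl ⟩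
          (M · ((ℤS (+ 24) · D P ⊕ P) ⊕ (ℤS (+ 24) · D P ⊕ P))) · (μ N N · w) ⊖ ((P ⊕ P) · (c₂ · W)) · M
            ≈⟨ ⊖-cong (·-congˡ (≈-sym E₁)) ≈-refl ⟩
          (M · ((ℤS (+ 24) · D P ⊕ P) ⊕ (ℤS (+ 24) · D P ⊕ P))) · (c₂ · W) ⊖ ((P ⊕ P) · (c₂ · W)) · M
            ≈⟨ solve 6 (λ k bb P p c W → ((k :* bb) :* ((con (+ 24) :* p :+ P) :+ (con (+ 24) :* p :+ P))) :* (c :* W) :- ((P :+ P) :* (c :* W)) :* (k :* bb)
                 := (con (+ 48) :* (k :* c)) :* (bb :* (W :* p))) ≈-refl (nS (3 ℕ.+ N)) (b₁ N · b₁ (suc N)) P (D P) c₂ W ⟩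
          (ℤS (+ 48) · (nS (3 ℕ.+ N) · c₂)) · ((b₁ N · b₁ (suc N)) · (W · D P))
            ≈⟨ ·-congʳ (·-congˡ (·-congʳ (nS≈vS (3 ℕ.+ N)))) ⟩
          (ℤS (+ 48) · (k · c₂)) · ((b₁ N · b₁ (suc N)) · (W · D P)) ∎)
          where
          k S h M : Series
          k = vS (+ K)
          S = ΣR² (r₀ ∷ rs)
          h = μ N (2 ℕ.+ N)
          M = nS (3 ℕ.+ N) · (b₁ N · b₁ (suc N))
          K≢0 : ℤ→ℚ (+ K) ≢ 0ℚ
          K≢0 e with () ← ℤ→ℚ-injective {+ K} {+ 0} e
          48≢0 : ℤ→ℚ (+ 48) ≢ 0ℚ
          48≢0 ()
          nonzero : (ℤS (+ 48) · (k · c₂)) 0 ≢ 0ℚ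
          nonzero e = *-nonzero 48≢0 (*-nonzero K≢0 c₂≢0) (trans (sym (trans (·-at0 _ (k · c₂)) (cong₂ ℚ._*_ (trans (at (ℤS≈vS (+ 48)) 0) (vS-at0 (+ 48)))
            (trans (·-at0 k c₂) (cong (ℚ._* c₂ 0) (vS-at0 (+ K))))))) e)

        exponent : ℕ
        exponent = suc n ℕ.* suc N

        W-ode : P · D W ≈ nS exponent · (W · D P)
        W-ode = halve (≈-trans W-ode₂ (≈-trans (·-congʳ bb≈) (solve 2 (λ e x → (e :+ e) :* x := e :* x :+ e :* x) ≈-refl (nS exponent) (W · D P))))
          where
          bb≈ : b₁ N · b₁ (suc N) ≈ nS exponent ⊕ nS exponent
          bb≈ = ≈-trans (·-cong (nS≈vS (suc N)) (nS≈vS (2 ℕ.+ N))) (≈-trans (≈-sym (vS-* (+ suc N) (+ (2 ℕ.+ N))))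
            (≈-trans (≡⇒≈ (cong vS (trans (ZS.solve 1 (λ n → (ZS.con (+ 1) ZS.:+ (n ZS.:+ n)) ZS.:* (ZS.con (+ 2) ZS.:+ (n ZS.:+ n)) ZS.:= (ZS.con (+ 1) ZS.:+ n) ZS.:* (ZS.con (+ 1) ZS.:+ (n ZS.:+ n)) ZS.:+ (ZS.con (+ 1) ZS.:+ n) ZS.:* (ZS.con (+ 1) ZS.:+ (n ZS.:+ n))) refl (+ n))
               (cong (λ z → z ℤ.+ z) (sym (ℤP.pos-* (suc n) (suc N))))))) (≈-trans (vS-+ (+ exponent) (+ exponent)) (≈-sym (⊕-cong (nS≈vS exponent) (nS≈vS exponent))))))

        -- `E₁` with W and μ_NN replaced by powers of P. Comparing constant terms in `E₁-at0` trades
        -- the constants γ_N and W(0) for those of w and of the component.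
        row-component : const (w 0) · (cf N r₀ · P ^S exponent) ≈ const (cf N r₀ 0) · (P ^S (N ℕ.* 3 ℕ.+ 1) · w)
        row-component = halve (·-cancelˡ (const (W 0)) (λ e → W≢0 (trans (sym (const-at0 (W 0))) e)) (begin
          const (W 0) · (const (w 0) · (cf N r₀ · P ^S exponent) ⊕ const (w 0) · (cf N r₀ · P ^S exponent))
            ≈⟨ solve 4 (λ W w c Q → W :* (w :* (c :* Q) :+ w :* (c :* Q)) := w :* ((c :+ c) :* (W :* Q))) ≈-refl (const (W 0)) (const (w 0)) (cf N r₀) (P ^S exponent) ⟩
          const (w 0) · (c₂ · (const (W 0) · P ^S exponent))
            ≈⟨ ·-congˡ (≈-trans (·-congˡ (≈-sym (power-solution exponent W-ode))) (≈-trans E₁ (·-congʳ (μ-power N)))) ⟩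
          const (w 0) · ((const (γ N) · P ^S (N ℕ.* 3 ℕ.+ 1)) · w)
            ≈⟨ solve 4 (λ a g Q w → a :* ((g :* Q) :* w) := (g :* a) :* (Q :* w)) ≈-refl (const (w 0)) (const (γ N)) (P ^S (N ℕ.* 3 ℕ.+ 1)) w ⟩
          (const (γ N) · const (w 0)) · (P ^S (N ℕ.* 3 ℕ.+ 1) · w)
            ≈⟨ ·-congʳ (≈-trans (≈-sym (const-* (γ N) (w 0))) (≈-trans (const-cong (trans (sym E₁-at0) (cong (ℚ._* W 0) (⊕-at (cf N r₀) (cf N r₀) 0)))) (≈-trans (const-* _ (W 0)) (·-congʳ (const-+ _ _))))) ⟩
          ((const (cf N r₀ 0) ⊕ const (cf N r₀ 0)) · const (W 0)) · (P ^S (N ℕ.* 3 ℕ.+ 1) · w)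
            ≈⟨ solve 3 (λ c W X → ((c :+ c) :* W) :* X := W :* (c :* X :+ c :* X)) ≈-refl (const (cf N r₀ 0)) (const (W 0)) (P ^S (N ℕ.* 3 ℕ.+ 1) · w) ⟩
          const (W 0) · (const (cf N r₀ 0) · (P ^S (N ℕ.* 3 ℕ.+ 1) · w) ⊕ const (cf N r₀ 0) · (P ^S (N ℕ.* 3 ℕ.+ 1) · w)) ∎))

-- Constant terms and the normalisation of the kernel

conv-at0 : ∀ u j → conv u j 0 ≡ u (j ℤ.+ + 0) 0 ℚ.+ u (j ℤ.+ -[1+ 0 ]) 0
conv-at0 u j = trans (at (sumℤ-raise (conv-tame 0 (λ i → u (j ℤ.+ i))) (s≤s z≤n)) 0) (trans (sumℤ-at0 _) (cong₂ ℚ._+_ (term (+ 0)) (term -[1+ 0 ])))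
  where
  term : ∀ i → (qp 0 · u (j ℤ.+ i)) 0 ≡ u (j ℤ.+ i) 0
  term i = trans (·-at0 (qp 0) (u (j ℤ.+ i))) (trans (cong (ℚ._* u (j ℤ.+ i) 0) qp0-at0) (ℚP.*-identityˡ (u (j ℤ.+ i) 0)))

uN-at0 : ∀ N → (∀ i → uN N -[1+ i ] 0 ≡ 0ℚ) × uN N (+ 0) 0 ≡ 1ℚ
uN-at0 zero = neg , refl
  where
  neg : ∀ i → u₀ -[1+ i ] 0 ≡ 0ℚ
  neg zero    = trans (⊝-at _ 0) (cong ℚ.-_ (0S-at 0))
  neg (suc i) = trans (⊝-at _ 0) (cong ℚ.-_ (trans (·-at0 (q^ (suc i)) (ψ i)) (trans (cong (ℚ._* ψ i 0) (trans (sym (at (qp≈q^ (suc i)) 0)) (qp-at0 i))) (ℚP.*-zeroˡ (ψ i 0)))))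
uN-at0 (suc N) with uN-at0 N
... | neg , one = (λ i → trans (conv-at0 (uN N) -[1+ i ]) (cong₂ ℚ._+_ (neg i) (trans (cong (λ k → uN N -[1+ suc k ] 0) (ℕP.+-identityʳ i)) (neg (suc i))))) ,
  trans (conv-at0 (uN N) (+ 0)) (cong₂ ℚ._+_ one (neg 0))

open Straight using () renaming (a to aS; chain to straightChain; chain≈ to straightChain≈)
open Alternating using () renaming (b to bA)

a₀ : Series
a₀ = aS (+ 0)

-- The single step from 0 to 0 has weight 1, while `chain≈` evaluates it as a(0) u_1(0), and u_1(0)
-- = P.
a₀P : a₀ · P ≈ oneS
a₀P = ≈-trans (·-congˡ (≈-sym c₁≈P)) (≈-trans (·-congʳ (≈-sym (·-identityʳ a₀))) (≈-trans (≈-sym (straightChain≈ 1 0))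
  (≈-trans (tsum-peel (Straight.tame-weight 0 unit)) (≈-trans (⊕-cong
    (≈-trans (·-identityʳ _) (≈-trans (·-identityʳ _) qp0)) (tsum-0 2 (λ l → SR.zeroʳ _))) (⊕-identityʳ oneS)))))

inverse-unique : ∀ {x y} → x · P ≈ oneS → y · P ≈ oneS → x ≈ y
inverse-unique {x} {y} e e′ = ≈-trans (≈-sym (·-identityʳ x)) (≈-trans (·-congˡ (≈-sym e′))
  (≈-trans (solve 3 (λ x y p → x :* (y :* p) := y :* (x :* p)) ≈-refl x y P) (≈-trans (·-congˡ e) (·-identityʳ y))))

-- The single odd step from 0 to 0 has weight 1 as well. It is evaluated as b(0) times u_1(1) +
-- u_1(0), where u_1(1) = 0 by antisymmetry.
b≈a₀ : bA (+ 0) ≈ a₀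
b≈a₀ = inverse-unique (≈-trans (·-congˡ (≈-sym c₁≈P)) (≈-trans
    (solve 2 (λ b c → b :* c := (b :* con (+ 1)) :* (con (+ 0) :+ c)) ≈-refl (bA (+ 0)) c₁)
    (≈-trans (·-congˡ (⊕-congʳ (≈-sym (self-neg (uN-antisym 1 (+ 1) (+ 1) refl))))) (≈-trans (≈-sym (Alternating.oddChain≈ 0 0))
      (≈-trans (tsum-peel (Alternating.tame-weight 1 unit)) (≈-trans (⊕-cong
        (≈-trans (·-identityʳ _) (≈-trans (·-identityʳ _) qp0)) (tsum-0 2 (λ l → SR.zeroʳ _))) (⊕-identityʳ oneS))))))) a₀P

a₀-at0 : a₀ 0 ≡ 1ℚ
a₀-at0 = trans (sym (ℚP.*-identityʳ (a₀ 0))) (trans (cong (a₀ 0 ℚ.*_) (sym P-at0)) (trans (sym (·-at0 a₀ P)) (at a₀P 0)))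

*-cancel-≡ : ∀ {c x y} → c ≢ 0ℚ → c ℚ.* x ≡ c ℚ.* y → x ≡ y
*-cancel-≡ {c} {x} {y} c≢0 e = trans (aux₁ x y) (trans (cong (ℚ._+ y) (*-cancel-0 c≢0 (trans (aux₂ c x y) (trans (cong (ℚ._- c ℚ.* y) e) (ℚP.+-inverseʳ (c ℚ.* y)))))) (ℚP.+-identityˡ y))
  where
  aux₁ : ∀ x y → x ≡ (x ℚ.- y) ℚ.+ y
  aux₁ = solve-∀ ℚ-ring
  aux₂ : ∀ c x y → c ℚ.* (x ℚ.- y) ≡ c ℚ.* x ℚ.- c ℚ.* y
  aux₂ = solve-∀ ℚ-ring

sgq : ℕ → ℚ
sgq zero    = 1ℚ
sgq (suc n) = ℚ.- sgq n

sgn≈sgq : ∀ n → sgn n ≈ const (sgq n)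
sgn≈sgq zero    = ≈-sym const-1
sgn≈sgq (suc n) = ≈-trans (⊝-cong (sgn≈sgq n)) (≈-sym (const-neg _))

sgq-square : ∀ n → sgq n ℚ.* sgq n ≡ 1ℚ
sgq-square zero    = refl
sgq-square (suc n) = trans (aux (sgq n)) (sgq-square n)
  where
  aux : ∀ x → ℚ.- x ℚ.* ℚ.- x ≡ x ℚ.* x
  aux = solve-∀ ℚ-ring

oddℕ : ℕ → ℤ
oddℕ i = + suc (i ℕ.+ i)

oddsFrom : ℕ → (d : ℕ) → Vec ℤ d
oddsFrom i zero    = []
oddsFrom i (suc d) = oddℕ i ∷ oddsFrom (suc i) d

sq-distinct : ∀ i j → i < j → sqℤ (oddℕ i) ℚ.- sqℤ (oddℕ j) ≢ 0ℚ
sq-distinct i j i<j e = ℕP.<⇒≢ (ℕP.*-mono-< {suc (i ℕ.+ i)} {suc (j ℕ.+ j)} (s≤s (ℕP.+-mono-< i<j i<j)) (s≤s (ℕP.+-mono-< i<j i<j)))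
  (ℤP.+-injective (ℤ→ℚ-injective (trans (ℤ→ℚ-* (oddℕ i) (oddℕ i)) (trans eq (sym (ℤ→ℚ-* (oddℕ j) (oddℕ j)))))))
  where
  eq : sqℤ (oddℕ i) ≡ sqℤ (oddℕ j)
  eq = trans (aux (sqℤ (oddℕ i)) (sqℤ (oddℕ j))) (trans (cong (ℚ._+ sqℤ (oddℕ j)) e) (ℚP.+-identityˡ (sqℤ (oddℕ j))))
    where
    aux : ∀ a b → a ≡ (a ℚ.- b) ℚ.+ b
    aux = solve-∀ ℚ-ring

pd-odds≢0 : ∀ i j d → i < j → pd (oddℕ i) (oddsFrom j d) ≢ 0ℚ
pd-odds≢0 i j zero    i<j ()
pd-odds≢0 i j (suc d) i<j = *-nonzero (sq-distinct i j i<j) (pd-odds≢0 i (suc j) d (ℕP.m<n⇒m<1+n i<j))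

vand-odds≢0 : ∀ i d → vand (oddsFrom i d) ≢ 0ℚ
vand-odds≢0 i zero    ()
vand-odds≢0 i (suc d) = *-nonzero (pd-odds≢0 i (suc i) d ℕP.≤-refl) (vand-odds≢0 (suc i) d)

pd-snoc : ∀ x i d → pd x (oddsFrom i (suc d)) ≡ pd x (oddsFrom i d) ℚ.* (sqℤ x ℚ.- sqℤ (oddℕ (i ℕ.+ d)))
pd-snoc x i zero    = trans (cong (λ j → (sqℤ x ℚ.- sqℤ (oddℕ j)) ℚ.* 1ℚ) (sym (ℕP.+-identityʳ i))) (ℚP.*-comm (sqℤ x ℚ.- sqℤ (oddℕ (i ℕ.+ 0))) 1ℚ)
pd-snoc x i (suc d) = trans (cong ((sqℤ x ℚ.- sqℤ (oddℕ i)) ℚ.*_) (pd-snoc x (suc i) d))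
  (trans (sym (ℚP.*-assoc (sqℤ x ℚ.- sqℤ (oddℕ i)) (pd x (oddsFrom (suc i) d)) _))
    (cong (λ j → ((sqℤ x ℚ.- sqℤ (oddℕ i)) ℚ.* pd x (oddsFrom (suc i) d)) ℚ.* (sqℤ x ℚ.- sqℤ (oddℕ j))) (sym (ℕP.+-suc i d))))

-- Bringing the last entry to the front passes d others. The two choices of the omitted row give the
-- same entries in these two orders, so their sums W are compared by this sign.
vand-snoc : ∀ i d → vand (oddsFrom i (suc d)) ≡ sgq d ℚ.* vand (oddℕ (i ℕ.+ d) ∷ oddsFrom i d)
vand-snoc i zero    = refl
vand-snoc i (suc d) = trans (cong₂ ℚ._*_ (pd-snoc (oddℕ i) (suc i) d) (vand-snoc (suc i) d))
  (trans (aux (pd (oddℕ i) (oddsFrom (suc i) d)) (sqℤ (oddℕ i)) (sqℤ y) (sgq d) (pd y (oddsFrom (suc i) d)) (vand (oddsFrom (suc i) d)))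
    (cong (λ j → ℚ.- sgq d ℚ.* (((sqℤ (oddℕ j) ℚ.- sqℤ (oddℕ i)) ℚ.* pd (oddℕ j) (oddsFrom (suc i) d)) ℚ.* (pd (oddℕ i) (oddsFrom (suc i) d) ℚ.* vand (oddsFrom (suc i) d)))) (sym (ℕP.+-suc i d))))
  where
  y : ℤ
  y = oddℕ (suc i ℕ.+ d)
  aux : ∀ p a b s r v → (p ℚ.* (a ℚ.- b)) ℚ.* (s ℚ.* (r ℚ.* v)) ≡ ℚ.- s ℚ.* (((b ℚ.- a) ℚ.* r) ℚ.* (p ℚ.* v))
  aux = solve-∀ ℚ-ring

sumSq : ℕ → ℕ → ℤ
sumSq i zero    = + 0
sumSq i (suc d) = oddℕ i ℤ.* oddℕ i ℤ.+ sumSq (suc i) d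

sumSq-snoc : ∀ i d → sumSq i (suc d) ≡ sumSq i d ℤ.+ oddℕ (i ℕ.+ d) ℤ.* oddℕ (i ℕ.+ d)
sumSq-snoc i zero    = trans (ℤP.+-comm (oddℕ i ℤ.* oddℕ i) (+ 0)) (cong (λ j → + 0 ℤ.+ oddℕ j ℤ.* oddℕ j) (sym (ℕP.+-identityʳ i)))
sumSq-snoc i (suc d) = trans (cong (λ z → oddℕ i ℤ.* oddℕ i ℤ.+ z) (sumSq-snoc (suc i) d))
  (trans (sym (ℤP.+-assoc (oddℕ i ℤ.* oddℕ i) (sumSq (suc i) d) _)) (cong (λ j → (oddℕ i ℤ.* oddℕ i ℤ.+ sumSq (suc i) d) ℤ.+ oddℕ j ℤ.* oddℕ j) (sym (ℕP.+-suc i d))))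

sumSq-closed : ∀ m → + 3 ℤ.* sumSq 0 m ≡ + m ℤ.* (((+ m ℤ.+ + m) ℤ.- + 1) ℤ.* ((+ m ℤ.+ + m) ℤ.+ + 1))
sumSq-closed zero    = refl
sumSq-closed (suc m) = trans (cong (λ z → + 3 ℤ.* z) (sumSq-snoc 0 m)) (trans (ℤP.*-distribˡ-+ (+ 3) (sumSq 0 m) (oddℕ m ℤ.* oddℕ m)) (trans (cong (ℤ._+ + 3 ℤ.* (oddℕ m ℤ.* oddℕ m)) (sumSq-closed m))
  (ZS.solve 1 (λ m → (m ZS.:* (((m ZS.:+ m) ZS.:- ZS.con (+ 1)) ZS.:* ((m ZS.:+ m) ZS.:+ ZS.con (+ 1)))) ZS.:+ ZS.con (+ 3) ZS.:* ((ZS.con (+ 1) ZS.:+ (m ZS.:+ m)) ZS.:* (ZS.con (+ 1) ZS.:+ (m ZS.:+ m)))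
     ZS.:= (ZS.con (+ 1) ZS.:+ m) ZS.:* ((((ZS.con (+ 1) ZS.:+ m) ZS.:+ (ZS.con (+ 1) ZS.:+ m)) ZS.:- ZS.con (+ 1)) ZS.:* (((ZS.con (+ 1) ZS.:+ m) ZS.:+ (ZS.con (+ 1) ZS.:+ m)) ZS.:+ ZS.con (+ 1)))) refl (+ m))))

-- The two identities as identities of series

module Final (n′ : ℕ) where
  open Classes n′ public

  -- Listed downwards, so that R_r = K - 2r runs upwards through the odd numbers from 2i + 1: twice
  -- ρ for i = 0, twice ρ + 1 for i = 1. The omitted row is 1 or n + 1, hence the component u_N(0)
  -- or u_N(n).
  rowsFrom : ℕ → (d : ℕ) → Vec ℕ d
  rowsFrom i zero    = []
  rowsFrom i (suc d) = (suc n ∸ i) ∷ rowsFrom (suc i) d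

  valid-row : ∀ i → i ≤ n → Valid (suc n ∸ i)
  valid-row i i≤n = ℕP.m<n⇒0<n∸m (s≤s i≤n) , ℕP.≤-<-trans (ℕP.m∸n≤m (suc n) i) (s≤s (s≤s (ℕP.≤-trans (ℕP.m≤m+n n n) (ℕP.n≤1+n N))))

  valid-rows : ∀ i d → i ℕ.+ d ≤ suc n → All Valid (rowsFrom i d)
  valid-rows i zero    l = []
  valid-rows i (suc d) l = valid-row i (ℕP.≤-pred (ℕP.≤-trans (ℕP.≤-trans (s≤s (ℕP.m≤m+n i d)) (ℕP.≤-reflexive (sym (ℕP.+-suc i d)))) l)) ∷
    valid-rows (suc i) d (ℕP.≤-trans (ℕP.≤-reflexive (sym (ℕP.+-suc i d))) l)

  ∈-rows : ∀ i d j → i ≤ j → j < i ℕ.+ d → (suc n ∸ j) ∈ rowsFrom i d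
  ∈-rows i zero    j i≤j j< = ⊥-elim (ℕP.<⇒≱ j< (ℕP.≤-trans (ℕP.≤-reflexive (ℕP.+-identityʳ i)) i≤j))
  ∈-rows i (suc d) j i≤j j< with i ℕP.≟ j
  ... | yes refl = here refl
  ... | no  i≢j  = there (∈-rows (suc i) d j (ℕP.≤∧≢⇒< i≤j i≢j) (ℕP.≤-trans j< (ℕP.≤-reflexive (ℕP.+-suc i d))))

  Rr-odd : ∀ i → i ≤ suc n → Rr (suc n ∸ i) ≡ oddℕ i
  Rr-odd i i≤ = trans (cong (ℤ._- + c) K∸c) (ZS.solve 2 (λ i c → (i ZS.:+ (ZS.con (+ 1) ZS.:+ (i ZS.:+ c))) ZS.:- c ZS.:= ZS.con (+ 1) ZS.:+ (i ZS.:+ i)) refl (+ i) (+ c))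
    where
    c : ℕ
    c = suc n ∸ i
    ic : i ℕ.+ c ≡ suc n
    ic = ℕP.m+[n∸m]≡n i≤
    K∸c : + (K ∸ c) ≡ + i ℤ.+ (+ 1 ℤ.+ (+ i ℤ.+ + c))
    K∸c = cong +_ (trans (cong (_∸ c) (trans (cong (2 ℕ.+_) (sym (ℕP.+-suc n n))) (trans (cong (λ m → suc (m ℕ.+ suc n)) (sym ic))
      (trans (cong (λ m → suc ((i ℕ.+ c) ℕ.+ m)) (sym ic)) (NS.solve 2 (λ i c → NS.con 1 NS.:+ ((i NS.:+ c) NS.:+ (i NS.:+ c)) NS.:= (i NS.:+ (NS.con 1 NS.:+ (i NS.:+ c))) NS.:+ c) refl i c)))))
      (ℕP.m+n∸n≡m (i ℕ.+ (1 ℕ.+ (i ℕ.+ c))) c))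

  Rr-rows : ∀ i d → i ℕ.+ d ≤ suc n → Vec.map Rr (rowsFrom i d) ≡ oddsFrom i d
  Rr-rows i zero    l = refl
  Rr-rows i (suc d) l = cong₂ _∷_ (Rr-odd i (ℕP.≤-trans (ℕP.m≤m+n i (suc d)) l)) (Rr-rows (suc i) d (ℕP.≤-trans (ℕP.≤-reflexive (sym (ℕP.+-suc i d))) l))

  ΣR²-rows : ∀ i d → i ℕ.+ d ≤ suc n → ΣR² (rowsFrom i d) ≈ vS (sumSq i d)
  ΣR²-rows i zero    l = ≈-sym const-0
  ΣR²-rows i (suc d) l = ≈-trans (⊕-cong (≈-trans (≡⇒≈ (cong (λ R → vS R · vS R) (Rr-odd i (ℕP.≤-trans (ℕP.m≤m+n i (suc d)) l)))) (≈-sym (vS-* (oddℕ i) (oddℕ i))))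
    (ΣR²-rows (suc i) d (ℕP.≤-trans (ℕP.≤-reflexive (sym (ℕP.+-suc i d))) l))) (≈-sym (vS-+ (oddℕ i ℤ.* oddℕ i) (sumSq (suc i) d)))

  -- The squares of 1, 3, ..., 2n + 1 add up to (n+1)(2n+1)(2n+3)/3, just what the equation for W
  -- requires.
  ΣR²-total : ∀ {x} → x ≈ vS (sumSq 0 (suc n)) → ℤS (+ 6) · x ≈ nS (3 ℕ.+ N) · (b₁ N · b₁ (suc N))
  ΣR²-total e = ≈-trans (·-cong (ℤS≈vS (+ 6)) e) (≈-trans (≈-sym (vS-* (+ 6) (sumSq 0 (suc n)))) (≈-trans (≡⇒≈ (cong vS eq))
    (≈-sym (≈-trans (·-cong (nS≈vS (3 ℕ.+ N)) (≈-trans (·-cong (nS≈vS (suc N)) (nS≈vS (2 ℕ.+ N))) (≈-sym (vS-* (+ suc N) (+ (2 ℕ.+ N)))))) (≈-sym (vS-* (+ (3 ℕ.+ N)) (+ suc N ℤ.* + (2 ℕ.+ N))))))))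
    where
    eq : + 6 ℤ.* sumSq 0 (suc n) ≡ + (3 ℕ.+ N) ℤ.* (+ suc N ℤ.* + (2 ℕ.+ N))
    eq = trans (ZS.solve 1 (λ s → ZS.con (+ 6) ZS.:* s ZS.:= ZS.con (+ 2) ZS.:* (ZS.con (+ 3) ZS.:* s)) refl (sumSq 0 (suc n)))
      (trans (cong (λ z → + 2 ℤ.* z) (sumSq-closed (suc n)))
        (ZS.solve 1 (λ n → ZS.con (+ 2) ZS.:* ((ZS.con (+ 1) ZS.:+ n) ZS.:* ((((ZS.con (+ 1) ZS.:+ n) ZS.:+ (ZS.con (+ 1) ZS.:+ n)) ZS.:- ZS.con (+ 1)) ZS.:* (((ZS.con (+ 1) ZS.:+ n) ZS.:+ (ZS.con (+ 1) ZS.:+ n)) ZS.:+ ZS.con (+ 1))))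
          ZS.:= (ZS.con (+ 3) ZS.:+ (n ZS.:+ n)) ZS.:* ((ZS.con (+ 1) ZS.:+ (n ZS.:+ n)) ZS.:* (ZS.con (+ 2) ZS.:+ (n ZS.:+ n)))) refl (+ n)))

  rows₁ rows₂ : Vec ℕ n
  rows₁ = rowsFrom 0 n
  rows₂ = rowsFrom 1 n

  β : ℕ
  β = 2 ℕ.* n ℕ.* n ∸ n

  private
    le₁ : 0 ℕ.+ n ≤ suc n
    le₁ = ℕP.n≤1+n n

    le₂ : 1 ℕ.+ n ≤ suc n
    le₂ = ℕP.≤-refl

    complete₁ : ∀ r → 1 ≤ r → r ≤ suc n → r ≢ 1 → r ∈ rows₁
    complete₁ r 1≤r r≤ r≢1 = subst (_∈ rows₁) (ℕP.m∸[m∸n]≡n r≤)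
      (∈-rows 0 n (suc n ∸ r) z≤n (ℕP.≤-trans (s≤s (ℕP.∸-monoʳ-≤ (suc n) (ℕP.≤∧≢⇒< 1≤r (λ e → r≢1 (sym e))))) (ℕP.≤-reflexive refl)))

    complete₂ : ∀ r → 1 ≤ r → r ≤ suc n → r ≢ suc n → r ∈ rows₂
    complete₂ r 1≤r r≤ r≢ = subst (_∈ rows₂) (ℕP.m∸[m∸n]≡n r≤)
      (∈-rows 1 n (suc n ∸ r) (ℕP.m<n⇒0<n∸m (ℕP.≤∧≢⇒< r≤ r≢)) (ℕP.∸-monoʳ-< 1≤r r≤))

    Rr-last : Rr 1 ≡ oddℕ n
    Rr-last = trans (cong Rr (sym (ℕP.m+n∸n≡m 1 n))) (Rr-odd n (ℕP.n≤1+n n))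

    ΣR²₁ : ℤS (+ 6) · ΣR² (1 ∷ rows₁) ≈ nS (3 ℕ.+ N) · (b₁ N · b₁ (suc N))
    ΣR²₁ = ΣR²-total (≈-trans (⊕-cong (≈-trans (≡⇒≈ (cong (λ R → vS R · vS R) Rr-last)) (≈-sym (vS-* (oddℕ n) (oddℕ n)))) (ΣR²-rows 0 n le₁))
      (≈-trans (≈-sym (vS-+ (oddℕ n ℤ.* oddℕ n) (sumSq 0 n))) (≡⇒≈ (cong vS (trans (ℤP.+-comm (oddℕ n ℤ.* oddℕ n) (sumSq 0 n)) (sym (sumSq-snoc 0 n)))))))

    ΣR²₂ : ℤS (+ 6) · ΣR² (suc n ∷ rows₂) ≈ nS (3 ℕ.+ N) · (b₁ N · b₁ (suc N))
    ΣR²₂ = ΣR²-total (ΣR²-rows 0 (suc n) ℕP.≤-refl)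

    w₁-at0 : Wsum rows₁ vand 0 ≡ vand (oddsFrom 0 n)
    w₁-at0 = trans (Wsum-at0 rows₁ vand (valid-rows 0 n le₁)) (cong vand (Rr-rows 0 n le₁))

    w₂-at0 : Wsum rows₂ vand 0 ≡ vand (oddsFrom 1 n)
    w₂-at0 = trans (Wsum-at0 rows₂ vand (valid-rows 1 n le₂)) (cong vand (Rr-rows 1 n le₂))

    w₁≢0 : Wsum rows₁ vand 0 ≢ 0ℚ
    w₁≢0 e = vand-odds≢0 0 n (trans (sym w₁-at0) e)

    w₂≢0 : Wsum rows₂ vand 0 ≢ 0ℚ
    w₂≢0 e = vand-odds≢0 1 n (trans (sym w₂-at0) e)

    1≤1+n : 1 ≤ suc n
    1≤1+n = s≤s z≤n

    α e : ℕ
    α = suc n ℕ.* suc N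
    e = N ℕ.* 3 ℕ.+ 1

    -- 2n + (n+1)(2n+1) = (6n+1) + (2n² - n). The powers of P come from the N kernel steps, from W
    -- and from μ_NN; the balance is the exponent in the theorem.
    exponents : N ℕ.+ α ≡ e ℕ.+ β
    exponents = trans (NS.solve 1 (λ x → ((NS.con 1 NS.:+ x) NS.:+ (NS.con 1 NS.:+ x)) NS.:+ (NS.con 2 NS.:+ x) NS.:* (NS.con 1 NS.:+ ((NS.con 1 NS.:+ x) NS.:+ (NS.con 1 NS.:+ x)))
        NS.:= ((((NS.con 1 NS.:+ x) NS.:+ (NS.con 1 NS.:+ x)) NS.:* NS.con 3) NS.:+ NS.con 1) NS.:+ (NS.con 1 NS.:+ x) NS.:* (x NS.:+ (NS.con 1 NS.:+ x))) refl n′)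
      (cong (e ℕ.+_) (sym (trans (cong (_∸ n) (NS.solve 1 (λ x → (NS.con 2 NS.:* (NS.con 1 NS.:+ x)) NS.:* (NS.con 1 NS.:+ x) NS.:= (NS.con 1 NS.:+ x) NS.:* (x NS.:+ (NS.con 1 NS.:+ x)) NS.:+ (NS.con 1 NS.:+ x)) refl n′))
        (ℕP.m+n∸n≡m (n ℕ.* (n′ ℕ.+ n)) n))))

    a₀P^ : ∀ m → a₀ ^S m · P ^S m ≈ oneS
    a₀P^ zero    = ·-identityˡ oneS
    a₀P^ (suc m) = ≈-trans (solve 4 (λ a A p Q → (a :* A) :* (p :* Q) := (a :* p) :* (A :* Q)) ≈-refl a₀ (a₀ ^S m) P (P ^S m)) (≈-trans (·-cong a₀P (a₀P^ m)) (·-identityˡ oneS))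

    conclude : ∀ (s u L w : Series) (w₀ : ℚ) → s · s ≈ oneS → s ≈ const (s 0) → L ≈ a₀ ^S N · u →
      const w₀ · ((s · u) · P ^S α) ≈ const ((s · u) 0) · (P ^S e · w) → const w₀ · L ≈ const (L 0) · (a₀ ^S β · w)
    conclude s u L w w₀ s² s-const L≈ h = begin
      const w₀ · L
        ≈⟨ ≈-trans (≈-sym (·-identityˡ _)) (·-congʳ (≈-sym (a₀P^ β))) ⟩
      (a₀ ^S β · P ^S β) · (const w₀ · L)
        ≈⟨ solve 4 (λ A Q w L → (A :* Q) :* (w :* L) := A :* (w :* (Q :* L))) ≈-refl (a₀ ^S β) (P ^S β) (const w₀) L ⟩
      a₀ ^S β · (const w₀ · (P ^S β · L))
        ≈⟨ ·-congˡ cancelled ⟩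
      a₀ ^S β · (const (L 0) · w)
        ≈⟨ solve 3 (λ A c w → A :* (c :* w) := c :* (A :* w)) ≈-refl (a₀ ^S β) (const (L 0)) w ⟩
      const (L 0) · (a₀ ^S β · w) ∎
      where
      u≈ : u ≈ P ^S N · L
      u≈ = ≈-trans (≈-sym (·-identityˡ u)) (≈-trans (·-congʳ (≈-sym (a₀P^ N))) (≈-trans (solve 3 (λ A Q u → (A :* Q) :* u := Q :* (A :* u)) ≈-refl (a₀ ^S N) (P ^S N) u) (·-congˡ (≈-sym L≈))))
      L₀ : L 0 ≡ u 0
      L₀ = trans (at L≈ 0) (trans (·-at0 (a₀ ^S N) u) (trans (cong (ℚ._* u 0) (^S-at0 N a₀-at0)) (ℚP.*-identityˡ (u 0))))
      cancelled : const w₀ · (P ^S β · L) ≈ const (L 0) · w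
      cancelled = ·-cancelˡ (P ^S e) (λ z → 1≢0 (trans (sym (^S-at0 e P-at0)) z)) (begin
        P ^S e · (const w₀ · (P ^S β · L))
          ≈⟨ solve 4 (λ a w b L → a :* (w :* (b :* L)) := w :* ((a :* b) :* L)) ≈-refl (P ^S e) (const w₀) (P ^S β) L ⟩
        const w₀ · ((P ^S e · P ^S β) · L)
          ≈⟨ ·-congˡ (·-congʳ (≈-trans (≈-sym (^S-+ P e β)) (≈-trans (≡⇒≈ (cong (P ^S_) (sym exponents))) (^S-+ P N α)))) ⟩
        const w₀ · ((P ^S N · P ^S α) · L)
          ≈⟨ solve 4 (λ w a b L → w :* ((a :* b) :* L) := con (+ 1) :* (w :* ((a :* L) :* b))) ≈-refl (const w₀) (P ^S N) (P ^S α) L ⟩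
        oneS · (const w₀ · ((P ^S N · L) · P ^S α))
          ≈⟨ ·-cong (≈-sym s²) (·-congˡ (·-congʳ (≈-sym u≈))) ⟩
        (s · s) · (const w₀ · (u · P ^S α))
          ≈⟨ solve 4 (λ s w u b → (s :* s) :* (w :* (u :* b)) := s :* (w :* ((s :* u) :* b))) ≈-refl s (const w₀) u (P ^S α) ⟩
        s · (const w₀ · ((s · u) · P ^S α))
          ≈⟨ ·-congˡ (≈-trans h (·-congʳ (≈-trans (const-cong (trans (·-at0 s u) (cong (s 0 ℚ.*_) (sym L₀)))) (≈-trans (const-* (s 0) (L 0)) (·-congʳ (≈-sym s-const)))))) ⟩
        s · ((s · const (L 0)) · (P ^S e · w))
          ≈⟨ solve 4 (λ s l p w → s :* ((s :* l) :* (p :* w)) := (s :* s) :* (p :* (l :* w))) ≈-refl s (const (L 0)) (P ^S e) w ⟩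
        (s · s) · (P ^S e · (const (L 0) · w))
          ≈⟨ ≈-trans (·-congʳ s²) (·-identityˡ _) ⟩
        P ^S e · (const (L 0) · w) ∎)
        where
        1≢0 : 1ℚ ≢ 0ℚ
        1≢0 ()

    sgn-const : ∀ m → sgn m ≈ const (sgn m 0)
    sgn-const m = ≈-trans (sgn≈sgq m) (const-cong (sym (trans (at (sgn≈sgq m) 0) (const-at0 (sgq m)))))

    v₁ : ℚ
    v₁ = vand (oddsFrom 0 n)

  L₁ L₂ : Series
  L₁ = straightChain N 0
  L₂ = Alternating.evenChain n 0

  private
    L₁≈ : L₁ ≈ a₀ ^S N · uN N (+ 0)
    L₁≈ = straightChain≈ N 0

    L₂≈ : L₂ ≈ a₀ ^S N · uN N (+ n)
    L₂≈ = ≈-trans (Alternating.evenChain≈ n 0) (·-cong (^S-cong N b≈a₀) (centred≈ n (+ 0)))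

    at0-L : ∀ {L u} → L ≈ a₀ ^S N · u → L 0 ≡ u 0
    at0-L {L} {u} e = trans (at e 0) (trans (·-at0 (a₀ ^S N) u) (trans (cong (ℚ._* u 0) (^S-at0 N a₀-at0)) (ℚP.*-identityˡ (u 0))))

  first-identity : const (vand (oddsFrom 0 n)) · L₁ ≈ a₀ ^S β · Wsum rows₁ vand
  first-identity = ≈-trans (·-congʳ (const-cong (sym w₁-at0))) (≈-trans
    (conclude oneS (uN N (+ 0)) L₁ (Wsum rows₁ vand) _ (·-identityˡ oneS) (≈-sym const-1) L₁≈
      (row-component rows₁ (valid-rows 0 n le₁) 1 (s≤s z≤n) 1≤1+n complete₁ ΣR²₁ w₁≢0))
    (≈-trans (·-congʳ (≈-trans (const-cong (trans (at0-L L₁≈) (proj₂ (uN-at0 N)))) const-1)) (·-identityˡ _)))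

  private
    -- `E₁-at0` for both omitted rows: the two constant terms of W are the same Vandermonde product
    -- up to the sign of `vand-snoc`, which also occurs in `cf`. The constant term of L₂ follows
    -- without evaluating its path sum.
    leading : v₁ ℚ.* L₂ 0 ≡ Wsum rows₂ vand 0
    leading = *-cancel-≡ (γ≢0 N) (trans (move (γ N) v₁ (L₂ 0)) (trans (cong (L₂ 0 ℚ.*_) case₁)
      (trans (signs (L₂ 0) (sgq n) W₁ (sgq-square n)) case₂)))
      where
      W₁ : ℚ
      W₁ = vand (oddℕ n ∷ oddsFrom 0 n)
      move : ∀ g v l → g ℚ.* (v ℚ.* l) ≡ l ℚ.* (g ℚ.* v)
      move = solve-∀ ℚ-ring
      signs : ∀ l s w → s ℚ.* s ≡ 1ℚ → l ℚ.* ((1ℚ ℚ.+ 1ℚ) ℚ.* w) ≡ (s ℚ.* l ℚ.+ s ℚ.* l) ℚ.* (s ℚ.* w)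
      signs l s w e = trans (sym (ℚP.*-identityˡ _)) (trans (cong (ℚ._* (l ℚ.* ((1ℚ ℚ.+ 1ℚ) ℚ.* w))) (sym e)) (aux l s w))
        where
        aux : ∀ l s w → (s ℚ.* s) ℚ.* (l ℚ.* ((1ℚ ℚ.+ 1ℚ) ℚ.* w)) ≡ (s ℚ.* l ℚ.+ s ℚ.* l) ℚ.* (s ℚ.* w)
        aux = solve-∀ ℚ-ring
      case₁ : γ N ℚ.* v₁ ≡ (1ℚ ℚ.+ 1ℚ) ℚ.* W₁
      case₁ = trans (cong (γ N ℚ.*_) (sym w₁-at0)) (trans (sym (E₁-at0 rows₁ (valid-rows 0 n le₁) 1 (s≤s z≤n) 1≤1+n complete₁ ΣR²₁ w₁≢0))
        (cong₂ ℚ._*_ (trans (⊕-at (cf N 1) (cf N 1) 0) (cong₂ ℚ._+_ cf₁ cf₁))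
          (trans (Wsum-at0 (1 ∷ rows₁) vand (valid₀ rows₁ (valid-rows 0 n le₁) 1 (s≤s z≤n) 1≤1+n complete₁ ∷ valid-rows 0 n le₁))
            (cong vand (cong₂ _∷_ Rr-last (Rr-rows 0 n le₁))))))
        where
        cf₁ : cf N 1 0 ≡ 1ℚ
        cf₁ = trans (·-at0 oneS (uN N (+ 0))) (trans (ℚP.*-identityˡ (uN N (+ 0) 0)) (proj₂ (uN-at0 N)))
      case₂ : (sgq n ℚ.* L₂ 0 ℚ.+ sgq n ℚ.* L₂ 0) ℚ.* (sgq n ℚ.* W₁) ≡ γ N ℚ.* Wsum rows₂ vand 0
      case₂ = trans (sym (cong₂ ℚ._*_ (trans (⊕-at (cf N (suc n)) (cf N (suc n)) 0) (cong₂ ℚ._+_ cf₂ cf₂))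
          (trans (Wsum-at0 (suc n ∷ rows₂) vand (valid-rows 0 (suc n) ℕP.≤-refl)) (trans (cong vand (Rr-rows 0 (suc n) ℕP.≤-refl)) (vand-snoc 0 n)))))
        (E₁-at0 rows₂ (valid-rows 1 n le₂) (suc n) (s≤s z≤n) ℕP.≤-refl complete₂ ΣR²₂ w₂≢0)
        where
        cf₂ : cf N (suc n) 0 ≡ sgq n ℚ.* L₂ 0
        cf₂ = trans (·-at0 (sgn n) (uN N (+ n))) (cong₂ ℚ._*_ (trans (at (sgn≈sgq n) 0) (const-at0 (sgq n))) (sym (at0-L L₂≈)))

  second-identity : const (vand (oddsFrom 0 n)) · L₂ ≈ a₀ ^S β · Wsum rows₂ vand
  second-identity = ·-cancelˡ (const w₂) (λ e → w₂≢0 (trans (sym (const-at0 w₂)) e)) (begin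
    const w₂ · (const v₁ · L₂)
      ≈⟨ solve 3 (λ a b c → a :* (b :* c) := b :* (a :* c)) ≈-refl (const w₂) (const v₁) L₂ ⟩
    const v₁ · (const w₂ · L₂)
      ≈⟨ ·-congˡ (conclude (sgn n) (uN N (+ n)) L₂ (Wsum rows₂ vand) w₂ (sgn-square n) (sgn-const n) L₂≈
           (row-component rows₂ (valid-rows 1 n le₂) (suc n) (s≤s z≤n) ℕP.≤-refl complete₂ ΣR²₂ w₂≢0)) ⟩
    const v₁ · (const (L₂ 0) · (a₀ ^S β · Wsum rows₂ vand))
      ≈⟨ ≈-trans (≈-sym (·-assoc _ _ _)) (·-congʳ (≈-trans (≈-sym (const-* v₁ (L₂ 0))) (const-cong leading))) ⟩
    const w₂ · (a₀ ^S β · Wsum rows₂ vand) ∎)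
    where
    w₂ : ℚ
    w₂ = Wsum rows₂ vand 0

-- The pentagonal number theorem

record Agree (n : ℕ) (f g : Series) : Set where
  constructor mkAgree
  field below : ∀ k → k < n → f k ≡ g k
open Agree

agree-trans : ∀ {n f g h} → Agree n f g → Agree n g h → Agree n f h
agree-trans a b .below k l = trans (below a k l) (below b k l)

≈⇒agree : ∀ {n f g} → f ≈ g → Agree n f g
≈⇒agree e .below k _ = at e k

agree-· : ∀ {n f f′ g g′} → Agree n f f′ → Agree n g g′ → Agree n (f · g) (f′ · g′)
agree-· {f = f} {f′} {g} {g′} a b .below k l = trans (·-at f g k) (trans
  (sumTo-cong< (suc k) (λ { i (s≤s i≤k) → cong₂ ℚ._*_ (below a i (ℕP.≤-<-trans i≤k l)) (below b (k ∸ i) (ℕP.≤-<-trans (ℕP.m∸n≤m k i) l)) }))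
  (sym (·-at f′ g′ k)))

agree-⊕ : ∀ {n f f′ g g′} → Agree n f f′ → Agree n g g′ → Agree n (f ⊕ g) (f′ ⊕ g′)
agree-⊕ {f = f} {f′} {g} {g′} a b .below k l =
  trans (⊕-at f g k) (trans (cong₂ ℚ._+_ (below a k l) (below b k l)) (sym (⊕-at f′ g′ k)))

agree-^S : ∀ {n f g} m → Agree n f g → Agree n (f ^S m) (g ^S m)
agree-^S zero    a = ≈⇒agree ≈-refl
agree-^S (suc m) a = agree-· a (agree-^S m a)

poch : ℕ → ℕ → Series
poch k zero    = oneS
poch k (suc e) = qc (suc k) · poch (suc k) e

poch-snoc : ∀ k e → poch k (suc e) ≈ poch k e · qc (suc (k ℕ.+ e))
poch-snoc k zero    = ≈-trans (·-comm _ _) (·-congˡ (≡⇒≈ (cong (λ x → qc (suc x)) (sym (ℕP.+-identityʳ k)))))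
poch-snoc k (suc e) = ≈-trans (·-congˡ (≈-trans (poch-snoc (suc k) e) (·-congˡ (≡⇒≈ (cong (λ x → qc (suc x)) (sym (ℕP.+-suc k e)))))))
  (≈-sym (·-assoc _ _ _))

poch-invPoch : ∀ n → poch 0 n · invPoch n ≈ oneS
poch-invPoch zero    = ·-identityˡ oneS
poch-invPoch (suc n) = ≈-trans (·-congʳ (poch-snoc 0 n)) (≈-trans (·-assoc _ _ _) (≈-trans (·-congˡ (qc-invPoch n)) (poch-invPoch n)))

-- Shanks' finite form of the pentagonal number theorem: with n = k + e the summands are
-- (-1)^k (q^{k+1};q)_{n-k} q^{nk + k(k+1)/2}.
shanks : ℕ → ℕ → Series
shanks k e = (sgn k · poch k e) · q^ ((k ℕ.+ e) ℕ.* k ℕ.+ T k)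

-- The sum over k ≤ m with n = m + e fixed; each step back in k hands one unit to e.
shanksSum : ℕ → ℕ → Series
shanksSum zero    e = shanks 0 e
shanksSum (suc m) e = shanksSum m (suc e) ⊕ shanks (suc m) e

shanks-suc : ∀ k e → shanks k (suc e) ≈ (qc (suc (k ℕ.+ e)) · q^ k) · shanks k e
shanks-suc k e = ≈-trans (·-cong (·-congˡ (poch-snoc k e)) (≈-trans (≡⇒≈ (cong q^ exponent)) (q^-+ k _)))
  (solve 5 (λ s p c x y → (s :* (p :* c)) :* (x :* y) := (c :* x) :* ((s :* p) :* y)) ≈-refl (sgn k) (poch k e) (qc (suc (k ℕ.+ e))) (q^ k) _)
  where
  exponent : (k ℕ.+ suc e) ℕ.* k ℕ.+ T k ≡ k ℕ.+ ((k ℕ.+ e) ℕ.* k ℕ.+ T k)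
  exponent = NS.solve 3 (λ k e t → (k NS.:+ (NS.con 1 NS.:+ e)) NS.:* k NS.:+ t NS.:= k NS.:+ ((k NS.:+ e) NS.:* k NS.:+ t)) refl k e (T k)

shanks-next : ∀ k e → q^ (k ℕ.+ (suc k ℕ.+ suc e)) · shanks k (suc e) ≈ ⊝ (qc (suc k) · shanks (suc k) e)
shanks-next k e = ≈-trans (solve 5 (λ x s c p y → x :* ((s :* (c :* p)) :* y) := (s :* (c :* p)) :* (x :* y)) ≈-refl _ (sgn k) (qc (suc k)) (poch (suc k) e) _)
  (≈-trans (·-congˡ (≈-trans (≈-sym (q^-+ (k ℕ.+ (suc k ℕ.+ suc e)) _)) (≡⇒≈ (cong q^ exponent))))
    (solve 4 (λ s c p x → (s :* (c :* p)) :* x := :- (c :* (((:- s) :* p) :* x))) ≈-refl (sgn k) (qc (suc k)) (poch (suc k) e) _))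
  where
  exponent : (k ℕ.+ (suc k ℕ.+ suc e)) ℕ.+ ((k ℕ.+ suc e) ℕ.* k ℕ.+ T k) ≡ (suc k ℕ.+ e) ℕ.* suc k ℕ.+ T (suc k)
  exponent = NS.solve 3 (λ k e t → (k NS.:+ ((NS.con 1 NS.:+ k) NS.:+ (NS.con 1 NS.:+ e))) NS.:+ ((k NS.:+ (NS.con 1 NS.:+ e)) NS.:* k NS.:+ t)
    NS.:= ((NS.con 1 NS.:+ k) NS.:+ e) NS.:* (NS.con 1 NS.:+ k) NS.:+ (t NS.:+ (NS.con 1 NS.:+ k))) refl k e (T k)

-- When n grows by one, the change of each summand is cancelled by its neighbour through
-- `shanks-next`. Only a boundary term at k = m remains, and for m = n it is the pentagonal term of
-- negative index.
shanksSum-suc : ∀ m e → shanksSum m (suc e) ≈ shanksSum m e ⊖ q^ (m ℕ.+ (suc m ℕ.+ e)) · shanks m e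
shanksSum-suc zero e = ≈-trans (shanks-suc 0 e) (solve 2 (λ x y → ((con (+ 1) :- x) :* con (+ 1)) :* y := y :- x :* y) ≈-refl (q^ (suc e)) (shanks 0 e))
shanksSum-suc (suc m) e = ≈-trans (⊕-cong (shanksSum-suc m (suc e)) (shanks-suc (suc m) e))
  (≈-trans (⊕-congʳ (⊕-congˡ (⊝-cong (shanks-next m e))))
  (≈-trans (solve 4 (λ S x y F → (S :- (:- ((con (+ 1) :- x) :* F))) :+ ((con (+ 1) :- y) :* x) :* F := (S :+ F) :- (x :* y) :* F) ≈-refl
     (shanksSum m (suc e)) (q^ (suc m)) (q^ (suc (suc m ℕ.+ e))) (shanks (suc m) e))
    (⊕-congˡ (⊝-cong (·-congʳ (≈-sym (q^-+ (suc m) (suc (suc m ℕ.+ e)))))))))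

shanks-small : ∀ k e → Agree (suc k ℕ.+ e) (shanks (suc k) e) 0S
shanks-small k e .below j l = trans (at (≈-trans (·-comm (sgn (suc k) · poch (suc k) e) (q^ x)) (·-congʳ (≈-sym (qp≈q^ x)))) j)
  (trans (qp-below x (sgn (suc k) · poch (suc k) e) j (ℕP.<-≤-trans l n≤x)) (sym (0S-at j)))
  where
  n x : ℕ
  n = suc k ℕ.+ e
  x = n ℕ.* suc k ℕ.+ T (suc k)
  n≤x : n ≤ x
  n≤x = ℕP.≤-trans (ℕP.≤-trans (ℕP.≤-reflexive (sym (ℕP.*-identityʳ n))) (ℕP.*-monoʳ-≤ n {1} {suc k} (s≤s z≤n))) (ℕP.m≤m+n (n ℕ.* suc k) (T (suc k)))

-- Summands with k > 0 are divisible by q^n, so below degree n only the product in the summand k = 0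
-- is left.
shanksSum-agree : ∀ m e → Agree (m ℕ.+ e) (shanksSum m e) (poch 0 (m ℕ.+ e))
shanksSum-agree zero e = ≈⇒agree (≈-trans (·-congˡ (≡⇒≈ (cong (λ x → q^ (x ℕ.+ 0)) (ℕP.*-zeroʳ e)))) (solve 1 (λ p → (con (+ 1) :* p) :* con (+ 1) := p) ≈-refl (poch 0 e)))
shanksSum-agree (suc m) e = agree-trans
  (agree-⊕ (subst (λ x → Agree x (shanksSum m (suc e)) (poch 0 x)) (ℕP.+-suc m e) (shanksSum-agree m (suc e))) (shanks-small m e))
  (≈⇒agree (⊕-identityʳ _))

pentagonal : ℤ → Series
pentagonal t = wt 1 2 t · oneS

sgn-+ : ∀ m n → sgn (m ℕ.+ n) ≈ sgn m · sgn n
sgn-+ m n = sg-+ (+ m) (+ n)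

sgn-triple : ∀ b → sg (+ 3 ℤ.* + b) ≈ sgn b
sgn-triple b = ≈-trans (≡⇒≈ (cong sg (ZS.solve 1 (λ b → ZS.con (+ 3) ZS.:* b ZS.:= (b ZS.:+ b) ZS.:+ b) refl (+ b))))
  (≈-trans (sgn-+ (b ℕ.+ b) b) (≈-trans (·-congʳ (≈-trans (sgn-+ b b) (sgn-square b))) (·-identityˡ _)))

shanks-0 : ∀ b → shanks b 0 ≈ pentagonal (+ b)
shanks-0 b = ≈-trans (solve 2 (λ s x → (s :* con (+ 1)) :* x := (s :* x) :* con (+ 1)) ≈-refl (sgn b) _)
  (·-congʳ (·-cong (≈-sym (sgn-triple b)) (≈-trans (≈-sym (qp≈q^ _)) (qp-≡ (exponent b)))))
  where
  exponent : ∀ b → (b ℕ.+ 0) ℕ.* b ℕ.+ T b ≡ eP 2 3 b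
  exponent zero    = refl
  exponent (suc b) = trans (NS.solve 2 (λ b t → ((NS.con 1 NS.:+ b) NS.:+ NS.con 0) NS.:* (NS.con 1 NS.:+ b) NS.:+ (t NS.:+ (NS.con 1 NS.:+ b))
      NS.:= ((b NS.:+ NS.con 0) NS.:* b NS.:+ t) NS.:+ (NS.con 2 NS.:+ NS.con 3 NS.:* b)) refl b (T b)) (cong (ℕ._+ (2 ℕ.+ 3 ℕ.* b)) (exponent b))

shanks-boundary : ∀ b → ⊝ (q^ (b ℕ.+ (suc b ℕ.+ 0)) · shanks b 0) ≈ pentagonal -[1+ b ]
shanks-boundary b = ≈-trans (solve 3 (λ y s x → :- (y :* ((s :* con (+ 1)) :* x)) := ((:- s) :* (y :* x)) :* con (+ 1)) ≈-refl _ (sgn b) _)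
  (·-congʳ (·-cong (≈-sym (≈-trans (≈-sym (sg-neg (+ 3 ℤ.* -[1+ b ]))) (≈-trans (≡⇒≈ (cong sg (ZS.solve 1 (λ x → ZS.:- (ZS.con (+ 3) ZS.:* (ZS.:- x)) ZS.:= ZS.con (+ 3) ZS.:* x) refl (+ suc b)))) (sgn-triple (suc b)))))
    (≈-trans (≈-sym (q^-+ (b ℕ.+ (suc b ℕ.+ 0)) _)) (≈-trans (≈-sym (qp≈q^ _)) (qp-≡ (exponent b))))))
  where
  exponent : ∀ b → (b ℕ.+ (suc b ℕ.+ 0)) ℕ.+ ((b ℕ.+ 0) ℕ.* b ℕ.+ T b) ≡ eP 1 3 (suc b)
  exponent zero    = refl
  exponent (suc b) = trans (NS.solve 2 (λ b t → ((NS.con 1 NS.:+ b) NS.:+ ((NS.con 2 NS.:+ b) NS.:+ NS.con 0)) NS.:+ (((NS.con 1 NS.:+ b) NS.:+ NS.con 0) NS.:* (NS.con 1 NS.:+ b) NS.:+ (t NS.:+ (NS.con 1 NS.:+ b)))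
      NS.:= ((b NS.:+ ((NS.con 1 NS.:+ b) NS.:+ NS.con 0)) NS.:+ ((b NS.:+ NS.con 0) NS.:* b NS.:+ t)) NS.:+ (NS.con 1 NS.:+ NS.con 3 NS.:* (NS.con 1 NS.:+ b))) refl b (T b)) (cong (ℕ._+ (1 ℕ.+ 3 ℕ.* suc b)) (exponent b))

shanksSum-pentagonal : ∀ n → shanksSum n 0 ≈ sumS (suc n) (λ b → pentagonal (+ b)) ⊕ sumS n (λ b → pentagonal -[1+ b ])
shanksSum-pentagonal zero    = ≈-trans (shanks-0 0) (solve 1 (λ x → x := (con (+ 0) :+ x) :+ con (+ 0)) ≈-refl _)
shanksSum-pentagonal (suc n) = ≈-trans (⊕-cong (shanksSum-suc n 0) (shanks-0 (suc n)))
  (≈-trans (⊕-congʳ (⊕-cong (shanksSum-pentagonal n) (shanks-boundary n)))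
    (solve 4 (λ a b c d → ((a :+ b) :+ c) :+ d := (a :+ d) :+ (b :+ c)) ≈-refl _ _ _ _))

P-agree : ∀ n → Agree n P (poch 0 n)
P-agree n .below k l = trans (at (≈-trans (Row-def 1 2 (λ _ → oneS)) (sumℤ-def 1 pentagonal)) k)
  (trans (⊕-at _ _ k) (trans (cong₂ ℚ._+_ (stable (suc n) (Tameℤ.tame₊ tame-pent) (ℕP.≤-trans k+1≤n (ℕP.n≤1+n n))) (stable n (Tameℤ.tame₋ tame-pent) k+1≤n))
  (trans (sym (⊕-at _ _ k)) (trans (sym (at (shanksSum-pentagonal n) k))
    (trans (below (shanksSum-agree n 0) k (ℕP.≤-trans l (ℕP.m≤m+n n 0))) (cong (λ x → poch 0 x k) (ℕP.+-identityʳ n)))))))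
  where
  tame-pent : Tameℤ 1 pentagonal
  tame-pent = tame-wt 1 2 (s≤s z≤n) (λ _ → oneS)
  k+1≤n : k ℕ.+ 1 ≤ n
  k+1≤n = ℕP.≤-trans (ℕP.≤-reflexive (ℕP.+-comm k 1)) l
  stable : ∀ m {F} → Tame 1 F → k ℕ.+ 1 ≤ m → tsum 1 F k ≡ sumS m F k
  stable m {F} t l = trans (sym (tsum-stable t k l)) (sym (sumS-at m F k))

a₀-agree : ∀ n → Agree n (invPoch n) a₀
a₀-agree n = agree-trans (≈⇒agree (≈-trans (≈-sym (·-identityˡ _)) (·-congʳ (≈-sym a₀P))))
  (agree-trans (agree-· (agree-· (≈⇒agree ≈-refl) (P-agree n)) (≈⇒agree ≈-refl))
  (≈⇒agree (≈-trans (·-assoc a₀ (poch 0 n) (invPoch n)) (≈-trans (·-congˡ (poch-invPoch n)) (·-identityʳ a₀)))))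

-- Coefficients of the two sides

coeffShift-nat : ∀ e S k → coeffShiftℤ (+ e) S (+ k) ≡ (qp e · S) k
coeffShift-nat e S k with e ℕP.≤? k
... | yes e≤k with ℕP.m≤n⇒∃[o]m+o≡n e≤k
...   | j , refl with + (e ℕ.+ j) ℤ.- + e in eq
...     | + i      = trans (cong S (ℤP.+-injective (trans (sym eq) (ZS.solve 2 (λ e j → (e ZS.:+ j) ZS.:- e ZS.:= j) refl (+ e) (+ j))))) (sym (qp-shift e S j))
...     | -[1+ i ] = ⊥-elim (neg≢pos (trans (sym eq) (ZS.solve 2 (λ e j → (e ZS.:+ j) ZS.:- e ZS.:= j) refl (+ e) (+ j))))
  where
  neg≢pos : ∀ {i j} → -[1+ i ] ≢ + j
  neg≢pos ()
coeffShift-nat e S k | no e≰k with ℕP.m≤n⇒∃[o]m+o≡n (ℕP.≰⇒> e≰k)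
... | j , refl with + k ℤ.- + (suc k ℕ.+ j) in eq
...   | + i      = ⊥-elim (pos≢neg (trans (sym eq) (ZS.solve 2 (λ k j → k ZS.:- ((ZS.con (+ 1) ZS.:+ k) ZS.:+ j) ZS.:= ZS.:- (ZS.con (+ 1) ZS.:+ j)) refl (+ k) (+ j))))
  where
  pos≢neg : ∀ {i j} → + i ≢ -[1+ j ]
  pos≢neg ()
...   | -[1+ i ] = sym (qp-below (suc k ℕ.+ j) S k (ℕP.m≤m+n (suc k) j))

coeffShift-neg : ∀ e S k → coeffShiftℤ (+ e) S -[1+ k ] ≡ 0ℚ
coeffShift-neg zero    S k = refl
coeffShift-neg (suc e) S k = refl

boxSumℕ-cong : ∀ d B {F G : Vec ℕ d → ℚ} → (∀ v → F v ≡ G v) → boxSumℕ d B F ≡ boxSumℕ d B G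
boxSumℕ-cong zero    B e = e []
boxSumℕ-cong (suc d) B e = sumTo-cong (suc B) (λ i → boxSumℕ-cong d B (λ v → e (i ∷ v)))

boxSumℕ-0 : ∀ d B {F : Vec ℕ d → ℚ} → (∀ v → F v ≡ 0ℚ) → boxSumℕ d B F ≡ 0ℚ
boxSumℕ-0 zero    B e = e []
boxSumℕ-0 (suc d) B e = sumTo-0 (suc B) (λ i _ → boxSumℕ-0 d B (λ v → e (i ∷ v)))

boxN : (d B : ℕ) → (Vec ℕ d → Series) → Series
boxN zero    B F = F []
boxN (suc d) B F = sumS (suc B) (λ i → boxN d B (λ v → F (i ∷ v)))

boxN-at : ∀ d B F k → boxN d B F k ≡ boxSumℕ d B (λ v → F v k)
boxN-at zero    B F k = refl
boxN-at (suc d) B F k = trans (sumS-at (suc B) _ k) (sumTo-cong (suc B) (λ i → boxN-at d B _ k))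

boxN-cong : ∀ d B {F G} → (∀ v → F v ≈ G v) → boxN d B F ≈ boxN d B G
boxN-cong zero    B e = e []
boxN-cong (suc d) B e = sumS-cong (suc B) (λ i → boxN-cong d B (λ v → e (i ∷ v)))

boxN-· : ∀ d B X F → boxN d B (λ v → X · F v) ≈ X · boxN d B F
boxN-· zero    B X F = ≈-refl
boxN-· (suc d) B X F = ≈-trans (sumS-cong (suc B) (λ i → boxN-· d B X _)) (≈-sym (sumS-· (suc B) X _))

-- Sums over paths m → m₁ → … → m_d → 0; a step m → l carries T(l − m − c), with c alternating.
step : ℕ → ℕ → ℕ → ℕ
step c m l = Tℤ (+ l ℤ.- + (m ℕ.+ c))

pathExponent : (c c′ : ℕ) → ℕ → ∀ {d} → Vec ℕ d → ℕ
pathExponent c c′ m []      = step c m 0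
pathExponent c c′ m (l ∷ v) = step c m l ℕ.+ pathExponent c′ c l v

stepWeight : ℕ → ℕ → ℕ → Series
stepWeight c m l = qp (step c m l) · invPoch l

pathSum : ℕ → (c c′ : ℕ) → ℕ → Series
pathSum zero    c c′ m = qp (step c m 0)
pathSum (suc d) c c′ m = tsum (suc (m ℕ.+ c)) (λ l → stepWeight c m l · pathSum d c′ c l)

tame-stepWeight : ∀ c m (F : ℕ → Series) → Tame (suc (m ℕ.+ c)) (λ l → stepWeight c m l · F l)
tame-stepWeight c m F = Kernel.tame-weight c m F

opaque
  unfolding _⊕_

  invPochVec-∷ : ∀ {d} l (v : Vec ℕ d) → invPochVec (l ∷ v) ≈ invPoch l · invPochVec v
  invPochVec-∷ l v = ≈-refl

module _ (k : ℕ) where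

  -- In degrees up to k a step from m reaches only l < m + k + 3, because T(l - m - c) grows at
  -- least linearly and c ≤ 1. So d steps stay inside this box.
  pathBound : ℕ → ℕ → ℕ
  pathBound d m = m ℕ.+ d ℕ.* (k ℕ.+ 3)

  pathSum-box : ∀ d c c′ m B → c ≤ 1 → c′ ≤ 1 → pathBound d m ≤ B →
    Agree (suc k) (boxN d B (λ v → qp (pathExponent c c′ m v) · invPochVec v)) (pathSum d c c′ m)
  pathSum-box zero    c c′ m B c≤ c′≤ b = ≈⇒agree (·-identityʳ _)
  pathSum-box (suc d) c c′ m B c≤ c′≤ b .below j j≤k = trans (at split j)
    (trans (sumS-at (suc B) (λ l → stepWeight c m l · box l) j) (trans (sumTo-extend {M} {suc B} (λ l → (stepWeight c m l · box l) j) M≤ (λ i l → tame (tame-stepWeight c m box) i j (ℕP.≤-trans small l)))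
      (trans (sumTo-cong< M (λ l l<M → below (agree-· {f = stepWeight c m l} {stepWeight c m l} {box l} {pathSum d c′ c l} ≈⇒agree-refl (pathSum-box d c′ c l B c′≤ c≤ (bound l l<M))) j j≤k))
        (tsum-stable (tame-stepWeight c m (pathSum d c′ c)) j small))))
    where
    M : ℕ
    M = m ℕ.+ (k ℕ.+ 3)
    box : ℕ → Series
    box l = boxN d B (λ v → qp (pathExponent c′ c l v) · invPochVec v)
    ≈⇒agree-refl : ∀ {n f} → Agree n f f
    ≈⇒agree-refl = ≈⇒agree ≈-refl
    split : boxN (suc d) B (λ v → qp (pathExponent c c′ m v) · invPochVec v) ≈ sumS (suc B) (λ l → stepWeight c m l · box l)
    split = sumS-cong (suc B) (λ l → ≈-trans (boxN-cong d B (λ v → ≈-trans (·-cong (qp-+ (step c m l) (pathExponent c′ c l v)) (invPochVec-∷ l v))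
        (solve 4 (λ a b x y → (a :* b) :* (x :* y) := (a :* x) :* (b :* y)) ≈-refl (qp (step c m l)) (qp (pathExponent c′ c l v)) (invPoch l) (invPochVec v))))
      (boxN-· d B (stepWeight c m l) (λ v → qp (pathExponent c′ c l v) · invPochVec v)))
    small : j ℕ.+ suc (m ℕ.+ c) ≤ M
    small = ℕP.≤-trans (ℕP.+-mono-≤ (ℕP.≤-pred j≤k) (s≤s (ℕP.+-monoʳ-≤ m c≤)))
      (ℕP.≤-trans (ℕP.≤-reflexive (NS.solve 2 (λ k m → k NS.:+ (NS.con 1 NS.:+ (m NS.:+ NS.con 1)) NS.:= m NS.:+ (k NS.:+ NS.con 2)) refl k m))
        (ℕP.+-monoʳ-≤ m (ℕP.+-monoʳ-≤ k (s≤s (s≤s z≤n)))))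
    M≤ : M ≤ suc B
    M≤ = ℕP.≤-trans (ℕP.+-monoʳ-≤ m (ℕP.m≤m+n (k ℕ.+ 3) (d ℕ.* (k ℕ.+ 3)))) (ℕP.≤-trans b (ℕP.n≤1+n B))
    bound : ∀ l → l < M → pathBound d l ≤ B
    bound l l<M = ℕP.≤-trans (ℕP.≤-trans (ℕP.+-monoˡ-≤ (d ℕ.* (k ℕ.+ 3)) (ℕP.<⇒≤ l<M)) (ℕP.≤-reflexive (ℕP.+-assoc m (k ℕ.+ 3) (d ℕ.* (k ℕ.+ 3))))) b

private
  twice : ∀ {x y} → + 2 ℤ.* x ≡ + 2 ℤ.* y → x ≡ y
  twice {x} {y} = ℤP.*-cancelˡ-≡ (+ 2) x y

-- T(l) on the left is cancelled by the T of the starting point of the next step. Summed along a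
-- path from 0 to 0, only the quadratic form remains.
step₁ : ∀ m l → + step 1 m l ℤ.+ + T l ≡ + T m ℤ.+ (+ (l ℕ.* l) ℤ.- + (m ℕ.* l))
step₁ m l = twice (trans (ℤP.*-distribˡ-+ (+ 2) (+ step 1 m l) (+ T l)) (trans (cong₂ ℤ._+_ (Tℤ-quad (+ l ℤ.- + (m ℕ.+ 1))) (Tℤ-quad (+ l)))
  (trans (ZS.solve 2 (λ m l → (l ZS.:- (m ZS.:+ ZS.con (+ 1))) ZS.:* ((l ZS.:- (m ZS.:+ ZS.con (+ 1))) ZS.:+ ZS.con (+ 1)) ZS.:+ l ZS.:* (l ZS.:+ ZS.con (+ 1))
      ZS.:= m ZS.:* (m ZS.:+ ZS.con (+ 1)) ZS.:+ ZS.con (+ 2) ZS.:* (l ZS.:* l ZS.:- m ZS.:* l)) refl (+ m) (+ l))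
  (trans (cong₂ ℤ._+_ (sym (Tℤ-quad (+ m))) (cong (+ 2 ℤ.*_) (cong₂ ℤ._-_ (sym (ℤP.pos-* l l)) (sym (ℤP.pos-* m l))))) (sym (ℤP.*-distribˡ-+ (+ 2) (+ T m) _))))))

step₀ : ∀ m l → + step 0 m l ℤ.+ + T l ≡ (+ T m ℤ.- + m) ℤ.+ ((+ (l ℕ.* l) ℤ.- + (m ℕ.* l)) ℤ.+ + l)
step₀ m l = twice (trans (ℤP.*-distribˡ-+ (+ 2) (+ step 0 m l) (+ T l)) (trans (cong₂ ℤ._+_ (Tℤ-quad (+ l ℤ.- + (m ℕ.+ 0))) (Tℤ-quad (+ l)))
  (trans (ZS.solve 2 (λ m l → (l ZS.:- (m ZS.:+ ZS.con (+ 0))) ZS.:* ((l ZS.:- (m ZS.:+ ZS.con (+ 0))) ZS.:+ ZS.con (+ 1)) ZS.:+ l ZS.:* (l ZS.:+ ZS.con (+ 1))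
      ZS.:= m ZS.:* (m ZS.:+ ZS.con (+ 1)) ZS.:+ (ZS.con (+ 2) ZS.:* ((l ZS.:* l ZS.:- m ZS.:* l) ZS.:+ l) ZS.:- ZS.con (+ 2) ZS.:* m)) refl (+ m) (+ l))
  (trans (cong₂ (λ x y → x ℤ.+ (+ 2 ℤ.* (y ℤ.+ + l) ℤ.- + 2 ℤ.* + m)) (sym (Tℤ-quad (+ m))) (cong₂ ℤ._-_ (sym (ℤP.pos-* l l)) (sym (ℤP.pos-* m l))))
    (ZS.solve 4 (λ t m x l → ZS.con (+ 2) ZS.:* t ZS.:+ (ZS.con (+ 2) ZS.:* (x ZS.:+ l) ZS.:- ZS.con (+ 2) ZS.:* m) ZS.:= ZS.con (+ 2) ZS.:* ((t ZS.:- m) ZS.:+ (x ZS.:+ l))) refl (+ T m) (+ m) (+ (l ℕ.* l) ℤ.- + (m ℕ.* l)) (+ l))))))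

exponent-straight : ∀ m {d} (v : Vec ℕ d) → + pathExponent 1 1 m v ≡ + T m ℤ.+ (sumSqℕ v ℤ.- adjProd (m ∷ v))
exponent-straight m []      = trans (sym (ℤP.+-identityʳ (+ step 1 m 0))) (trans (step₁ m 0) (cong (λ x → + T m ℤ.+ (+ 0 ℤ.- + x)) (ℕP.*-zeroʳ m)))
exponent-straight m (l ∷ v) = trans (cong (λ z → + step 1 m l ℤ.+ z) (exponent-straight l v))
  (trans (sym (ℤP.+-assoc (+ step 1 m l) (+ T l) (sumSqℕ v ℤ.- adjProd (l ∷ v)))) (trans (cong (ℤ._+ (sumSqℕ v ℤ.- adjProd (l ∷ v))) (step₁ m l))
    (ZS.solve 5 (λ t x y s a → (t ZS.:+ (x ZS.:- y)) ZS.:+ (s ZS.:- a) ZS.:= t ZS.:+ ((x ZS.:+ s) ZS.:- (y ZS.:+ a))) refl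
      (+ T m) (+ (l ℕ.* l)) (+ (m ℕ.* l)) (sumSqℕ v) (adjProd (l ∷ v)))))

-- An even step from m to l contributes l - m besides the quadratic terms, an odd step nothing.
-- Since the two kinds alternate, the linear terms add up with alternating signs.
exponent-even : ∀ m {d} (v : Vec ℕ d) → + pathExponent 0 1 m v ≡ (+ T m ℤ.- + m) ℤ.+ ((sumSqℕ v ℤ.- adjProd (m ∷ v)) ℤ.+ altSum v)
exponent-odd : ∀ m {d} (v : Vec ℕ d) → + pathExponent 1 0 m v ≡ + T m ℤ.+ ((sumSqℕ v ℤ.- adjProd (m ∷ v)) ℤ.- altSum v)

exponent-even m []      = trans (sym (ℤP.+-identityʳ (+ step 0 m 0))) (trans (step₀ m 0) (cong (λ x → (+ T m ℤ.- + m) ℤ.+ ((+ 0 ℤ.- + x) ℤ.+ + 0)) (ℕP.*-zeroʳ m)))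
exponent-even m (l ∷ v) = trans (cong (λ z → + step 0 m l ℤ.+ z) (exponent-odd l v))
  (trans (sym (ℤP.+-assoc (+ step 0 m l) (+ T l) ((sumSqℕ v ℤ.- adjProd (l ∷ v)) ℤ.- altSum v))) (trans (cong (ℤ._+ ((sumSqℕ v ℤ.- adjProd (l ∷ v)) ℤ.- altSum v)) (step₀ m l))
    (ZS.solve 7 (λ t x y l s a b → (t ZS.:+ ((x ZS.:- y) ZS.:+ l)) ZS.:+ ((s ZS.:- a) ZS.:- b) ZS.:= t ZS.:+ (((x ZS.:+ s) ZS.:- (y ZS.:+ a)) ZS.:+ (l ZS.:- b))) refl
      (+ T m ℤ.- + m) (+ (l ℕ.* l)) (+ (m ℕ.* l)) (+ l) (sumSqℕ v) (adjProd (l ∷ v)) (altSum v))))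

exponent-odd m []      = trans (sym (ℤP.+-identityʳ (+ step 1 m 0))) (trans (step₁ m 0) (cong (λ x → + T m ℤ.+ (+ 0 ℤ.- + x)) (ℕP.*-zeroʳ m)) )
exponent-odd m (l ∷ v) = trans (cong (λ z → + step 1 m l ℤ.+ z) (exponent-even l v))
  (trans (ZS.solve 4 (λ s t l z → s ZS.:+ ((t ZS.:- l) ZS.:+ z) ZS.:= (s ZS.:+ t) ZS.:+ (z ZS.:- l)) refl (+ step 1 m l) (+ T l) (+ l) ((sumSqℕ v ℤ.- adjProd (l ∷ v)) ℤ.+ altSum v))
  (trans (cong (ℤ._+ (((sumSqℕ v ℤ.- adjProd (l ∷ v)) ℤ.+ altSum v) ℤ.- + l)) (step₁ m l))
    (ZS.solve 7 (λ t x y l s a b → (t ZS.:+ (x ZS.:- y)) ZS.:+ (((s ZS.:- a) ZS.:+ b) ZS.:- l) ZS.:= t ZS.:+ (((x ZS.:+ s) ZS.:- (y ZS.:+ a)) ZS.:- (l ZS.:- b))) refl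
      (+ T m) (+ (l ℕ.* l)) (+ (m ℕ.* l)) (+ l) (sumSqℕ v) (adjProd (l ∷ v)) (altSum v))))

adjProd-0 : ∀ {d} (v : Vec ℕ d) → adjProd (0 ∷ v) ≡ adjProd v
adjProd-0 []      = refl
adjProd-0 (l ∷ v) = ℤP.+-identityˡ (adjProd (l ∷ v))

halfmCm-path : ∀ {d} (v : Vec ℕ d) → halfmCm v ℤ.+ noLin v ≡ + pathExponent 1 1 0 v
halfmCm-path v = trans (ℤP.+-identityʳ (halfmCm v)) (sym (trans (exponent-straight 0 v)
  (trans (ℤP.+-identityˡ (sumSqℕ v ℤ.- adjProd (0 ∷ v))) (cong (λ a → sumSqℕ v ℤ.- a) (adjProd-0 v)))))

halfmCm-altSum-path : ∀ {d} (v : Vec ℕ d) → halfmCm v ℤ.+ altSum v ≡ + pathExponent 0 1 0 v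
halfmCm-altSum-path v = sym (trans (exponent-even 0 v)
  (trans (ℤP.+-identityˡ ((sumSqℕ v ℤ.- adjProd (0 ∷ v)) ℤ.+ altSum v)) (cong (λ a → (sumSqℕ v ℤ.- a) ℤ.+ altSum v) (adjProd-0 v))))

private
  final-step : ∀ c m → tsum (suc (m ℕ.+ c)) (λ l → stepWeight c m l · unit l) ≈ qp (step c m 0)
  final-step c m = ≈-trans (tsum-peel (tame-stepWeight c m unit)) (≈-trans (⊕-cong (≈-trans (·-identityʳ (stepWeight c m 0)) (·-identityʳ (qp (step c m 0))))
    (tsum-0 (suc (m ℕ.+ c)) (λ l → SR.zeroʳ (stepWeight c m (suc l))))) (⊕-identityʳ (qp (step c m 0))))

straightChain-path : ∀ d m → straightChain (suc d) m ≈ pathSum d 1 1 m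
straightChain-path zero    m = final-step 1 m
straightChain-path (suc d) m = tsum-cong (suc (m ℕ.+ 1)) (λ l → ·-congˡ (straightChain-path d l))

evenChain-path : ∀ k m → Alternating.evenChain (suc k) m ≈ pathSum (suc (k ℕ.+ k)) 0 1 m
oddChain-path : ∀ k m → Alternating.oddChain k m ≈ pathSum (k ℕ.+ k) 1 0 m
evenChain-path k m = tsum-cong (suc (m ℕ.+ 0)) (λ l → ·-congˡ (oddChain-path k l))
oddChain-path k m = ≈-trans (≡⇒≈ (cong (λ x → tsum (suc x) (λ l → (τ (+ l ℤ.- + x) · invPoch l) · Alternating.evenChain k l)) eq)) (next k)
  where
  eq : suc m ℕ.+ 0 ≡ m ℕ.+ 1
  eq = trans (ℕP.+-identityʳ (suc m)) (ℕP.+-comm 1 m)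
  next : ∀ k → tsum (suc (m ℕ.+ 1)) (λ l → stepWeight 1 m l · Alternating.evenChain k l) ≈ pathSum (k ℕ.+ k) 1 0 m
  next zero    = final-step 1 m
  next (suc k) = ≈-trans (tsum-cong (suc (m ℕ.+ 1)) (λ l → ·-congˡ (evenChain-path k l)))
    (≡⇒≈ (cong (λ d → pathSum (suc d) 1 0 m) (sym (ℕP.+-suc k k))))

lhsBox : ∀ d c c′ k B (lin : ∀ {d} → Vec ℕ d → ℤ) → c ≤ 1 → c′ ≤ 1 → (∀ (v : Vec ℕ d) → halfmCm v ℤ.+ lin v ≡ + pathExponent c c′ 0 v) → pathBound k d 0 ≤ B →
  boxSumℕ d B (λ m → coeffShiftℤ (halfmCm m ℤ.+ lin m) (invPochVec m) (+ k)) ≡ pathSum d c c′ 0 k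
lhsBox d c c′ k B lin c≤ c′≤ e b = trans (boxSumℕ-cong d B (λ v → trans (cong (λ x → coeffShiftℤ x (invPochVec v) (+ k)) (e v)) (coeffShift-nat (pathExponent c c′ 0 v) (invPochVec v) k)))
  (trans (sym (boxN-at d B (λ v → qp (pathExponent c c′ 0 v) · invPochVec v) k)) (below (pathSum-box k d c c′ 0 B c≤ c′≤ b) k ℕP.≤-refl))

lhsBox-neg : ∀ d c c′ k B (lin : ∀ {d} → Vec ℕ d → ℤ) → (∀ (v : Vec ℕ d) → halfmCm v ℤ.+ lin v ≡ + pathExponent c c′ 0 v) →
  boxSumℕ d B (λ m → coeffShiftℤ (halfmCm m ℤ.+ lin m) (invPochVec m) -[1+ k ]) ≡ 0ℚ
lhsBox-neg d c c′ k B lin e = boxSumℕ-0 d B (λ v → trans (cong (λ x → coeffShiftℤ x (invPochVec v) -[1+ k ]) (e v)) (coeffShift-neg (pathExponent c c′ 0 v) (invPochVec v) k))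

-- Box sums over ℤ and products of rows

boxZ : (d B : ℕ) → (Vec ℤ d → Series) → Series
boxZ zero    B F = F []
boxZ (suc d) B F = sumS (suc (2 ℕ.* B)) (λ i → boxZ d B (λ v → F ((+ i ℤ.- + B) ∷ v)))

boxZ-at : ∀ d B F k → boxZ d B F k ≡ boxSumℤ d B (λ v → F v k)
boxZ-at zero    B F k = refl
boxZ-at (suc d) B F k = trans (sumS-at (suc (2 ℕ.* B)) _ k) (sumTo-cong (suc (2 ℕ.* B)) (λ i → boxZ-at d B _ k))

boxZ-cong : ∀ d B {F G} → (∀ v → F v ≈ G v) → boxZ d B F ≈ boxZ d B G
boxZ-cong zero    B e = e []
boxZ-cong (suc d) B e = sumS-cong (suc (2 ℕ.* B)) (λ i → boxZ-cong d B (λ v → e ((+ i ℤ.- + B) ∷ v)))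

boxZ-· : ∀ d B X F → boxZ d B (λ v → X · F v) ≈ X · boxZ d B F
boxZ-· zero    B X F = ≈-refl
boxZ-· (suc d) B X F = ≈-trans (sumS-cong (suc (2 ℕ.* B)) (λ i → boxZ-· d B X _)) (≈-sym (sumS-· (suc (2 ℕ.* B)) X _))

boxSumℤ-cong : ∀ d B {F G : Vec ℤ d → ℚ} → (∀ v → F v ≡ G v) → boxSumℤ d B F ≡ boxSumℤ d B G
boxSumℤ-cong zero    B e = e []
boxSumℤ-cong (suc d) B e = sumTo-cong (suc (2 ℕ.* B)) (λ i → boxSumℤ-cong d B (λ v → e ((+ i ℤ.- + B) ∷ v)))

boxSumℤ-0 : ∀ d B {F : Vec ℤ d → ℚ} → (∀ v → F v ≡ 0ℚ) → boxSumℤ d B F ≡ 0ℚ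
boxSumℤ-0 zero    B e = e []
boxSumℤ-0 (suc d) B e = sumTo-0 (suc (2 ℕ.* B)) (λ i _ → boxSumℤ-0 d B (λ v → e ((+ i ℤ.- + B) ∷ v)))

boxSumℤ-*ˡ : ∀ d B c (F : Vec ℤ d → ℚ) → boxSumℤ d B (λ v → c ℚ.* F v) ≡ c ℚ.* boxSumℤ d B F
boxSumℤ-*ˡ zero    B c F = refl
boxSumℤ-*ˡ (suc d) B c F = trans (sumTo-cong (suc (2 ℕ.* B)) (λ i → boxSumℤ-*ˡ d B c _)) (sumTo-*ˡ (suc (2 ℕ.* B)) c _)

sumS-split : ∀ m n F → sumS (m ℕ.+ n) F ≈ sumS m F ⊕ sumS n (λ i → F (m ℕ.+ i))
sumS-split m zero    F = ≈-trans (≡⇒≈ (cong (λ x → sumS x F) (ℕP.+-identityʳ m))) (≈-sym (⊕-identityʳ _))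
sumS-split m (suc n) F = ≈-trans (≡⇒≈ (cong (λ x → sumS x F) (ℕP.+-suc m n))) (≈-trans (⊕-congʳ (sumS-split m n F)) (⊕-assoc _ _ _))

sumS-centred : ∀ B (f : ℤ → Series) → sumS (suc (2 ℕ.* B)) (λ i → f (+ i ℤ.- + B)) ≈ sumS (suc B) (λ i → f (+ i)) ⊕ sumS B (λ i → f -[1+ i ])
sumS-centred B f = ≈-trans (≡⇒≈ (cong (λ m → sumS m (λ i → f (+ i ℤ.- + B))) size))
  (≈-trans (sumS-split B (suc B) _) (≈-trans (⊕-comm _ _) (⊕-cong
    (sumS-cong (suc B) (λ i → ≡⇒≈ (cong f (ZS.solve 2 (λ B i → (B ZS.:+ i) ZS.:- B ZS.:= i) refl (+ B) (+ i)))))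
    (≈-trans (sumS-reverse B _) (sumS-cong< B (λ i i<B → ≡⇒≈ (cong f (negative i i<B))))))))
  where
  size : suc (2 ℕ.* B) ≡ B ℕ.+ suc B
  size = trans (cong (λ x → suc (B ℕ.+ x)) (ℕP.+-identityʳ B)) (sym (ℕP.+-suc B B))
  negative : ∀ i → i < B → + (B ∸ suc i) ℤ.- + B ≡ -[1+ i ]
  negative i i<B = trans (cong (λ x → + (B ∸ suc i) ℤ.- + x) (sym (ℕP.m∸n+n≡m i<B)))
    (ZS.solve 2 (λ a i → a ZS.:- (a ZS.:+ (ZS.con (+ 1) ZS.:+ i)) ZS.:= ZS.:- (ZS.con (+ 1) ZS.:+ i)) refl (+ (B ∸ suc i)) (+ i))

sumℤ-centred : ∀ B {f} → Tameℤ 1 f → Agree B (sumS (suc (2 ℕ.* B)) (λ i → f (+ i ℤ.- + B))) (sumℤ 1 f)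
sumℤ-centred B {f} t .below k k<B = trans (at (sumS-centred B f) k) (trans (⊕-at _ _ k) (trans
  (cong₂ ℚ._+_ (stable (suc B) (tame₊ t) (ℕP.≤-trans k+1≤B (ℕP.n≤1+n B))) (stable B (tame₋ t) k+1≤B))
  (trans (sym (⊕-at _ _ k)) (sym (at (sumℤ-def 1 f) k)))))
  where
  k+1≤B : k ℕ.+ 1 ≤ B
  k+1≤B = ℕP.≤-trans (ℕP.≤-reflexive (ℕP.+-comm k 1)) k<B
  stable : ∀ m {F} → Tame 1 F → k ℕ.+ 1 ≤ m → sumS m F k ≡ tsum 1 F k
  stable m {F} t l = trans (sumS-at m F k) (tsum-stable t k l)

agree-sumℤ : ∀ {n f g} C → (∀ t → Agree n (f t) (g t)) → Agree n (sumℤ C f) (sumℤ C g)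
agree-sumℤ {n} {f} {g} C a .below k l = trans (at (sumℤ-def C f) k) (trans (⊕-at _ _ k) (trans
  (cong₂ ℚ._+_ (part (λ i → + i)) (part -[1+_])) (trans (sym (⊕-at _ _ k)) (sym (at (sumℤ-def C g) k)))))
  where
  part : (s : ℕ → ℤ) → tsum C (λ i → f (s i)) k ≡ tsum C (λ i → g (s i)) k
  part s = trans (tsum-at C (λ i → f (s i)) k) (trans (sumTo-cong (k ℕ.+ C) (λ i → below (a (s i)) k l)) (sym (tsum-at C (λ i → g (s i)) k)))

module RowBox (N : ℕ) where
  open Rows N

  weights : ∀ {d} → Vec ℕ d → Vec ℤ d → Series
  weights []       []       = oneS
  weights (r ∷ rs) (t ∷ ts) = wt r (K ∸ r) t · weights rs ts

  points : ∀ {d} → Vec ℕ d → Vec ℤ d → Vec ℤ d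
  points = zipWith (λ r t → Vr r (K ∸ r) t)

  Wsum-box : ∀ {d} (rs : Vec ℕ d) h B → All Valid rs →
    Agree B (boxZ d B (λ ts → weights rs ts · const (h (points rs ts)))) (Wsum rs h)
  Wsum-box []       h B []       = ≈⇒agree (·-identityˡ _)
  Wsum-box {suc d} (r ∷ rs) h B (v ∷ vr) = agree-trans (≈⇒agree split) (agree-trans
    (sumℤ-centred B (tame-wt r (K ∸ r) (B≥1 v) box))
    (agree-trans (agree-sumℤ 1 (λ t → agree-· {f = wt r (K ∸ r) t} {wt r (K ∸ r) t} {box t} {Wsum rs (λ vs → h (Vr r (K ∸ r) t ∷ vs))}
        (≈⇒agree ≈-refl) (Wsum-box rs (λ vs → h (Vr r (K ∸ r) t ∷ vs)) B vr)))
      (≈⇒agree (≈-sym (Row-def r (K ∸ r) (λ V → Wsum rs (λ vs → h (V ∷ vs))))))))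
    where
    box : ℤ → Series
    box t = boxZ d B (λ ts → weights rs ts · const (h (Vr r (K ∸ r) t ∷ points rs ts)))
    split : boxZ (suc d) B (λ ts → weights (r ∷ rs) ts · const (h (points (r ∷ rs) ts))) ≈ sumS (suc (2 ℕ.* B)) (λ i → wt r (K ∸ r) (+ i ℤ.- + B) · box (+ i ℤ.- + B))
    split = sumS-cong (suc (2 ℕ.* B)) (λ i → ≈-trans (boxZ-cong d B (λ ts → ·-assoc _ _ _)) (boxZ-· d B (wt r (K ∸ r) (+ i ℤ.- + B)) _))

  -- The integer |v| - |w| of the theorem, as v - w has the entries K t. Likewise `totalExponent` is
  -- the quotient of ||v||² - ||w||² by 2K.
  parity : ∀ {d} → Vec ℕ d → Vec ℤ d → ℤ
  parity []       []       = + 0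
  parity (r ∷ rs) (t ∷ ts) = + (r ℕ.+ (K ∸ r)) ℤ.* t ℤ.+ parity rs ts

  totalExponent : ∀ {d} → Vec ℕ d → Vec ℤ d → ℕ
  totalExponent []       []       = 0
  totalExponent (r ∷ rs) (t ∷ ts) = expo r (K ∸ r) t ℕ.+ totalExponent rs ts

  weights≈ : ∀ {d} (rs : Vec ℕ d) ts → weights rs ts ≈ sg (parity rs ts) · qp (totalExponent rs ts)
  weights≈ []       []       = ≈-sym (≈-trans (·-identityˡ _) qp0)
  weights≈ (r ∷ rs) (t ∷ ts) = ≈-trans (·-congˡ (weights≈ rs ts))
    (≈-trans (solve 4 (λ a b c d → (a :* b) :* (c :* d) := (a :* c) :* (b :* d)) ≈-refl (sg (+ (r ℕ.+ (K ∸ r)) ℤ.* t)) (qp (expo r (K ∸ r) t)) (sg (parity rs ts)) (qp (totalExponent rs ts)))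
      (·-cong (≈-sym (sg-+ (+ (r ℕ.+ (K ∸ r)) ℤ.* t) (parity rs ts))) (≈-sym (qp-+ (expo r (K ∸ r) t) (totalExponent rs ts)))))

  weighted-term : ∀ {d} (rs : Vec ℕ d) ts c S k →
    (S · (weights rs ts · const c)) k ≡ c ℚ.* (sgq ℤ.∣ parity rs ts ∣ ℚ.* (qp (totalExponent rs ts) · S) k)
  weighted-term rs ts c S k = trans (at (≈-trans (·-congˡ (·-congʳ (≈-trans (weights≈ rs ts) (·-congʳ (sgn≈sgq ℤ.∣ parity rs ts ∣)))))
      (solve 4 (λ S s e c → S :* ((s :* e) :* c) := c :* (s :* (e :* S))) ≈-refl S (const s) (qp (totalExponent rs ts)) (const c))) k)
    (trans (at (const-· c (const s · (qp (totalExponent rs ts) · S))) k) (trans (∙-at c _ k) (cong (c ℚ.*_)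
      (trans (at (const-· s (qp (totalExponent rs ts) · S)) k) (∙-at s _ k)))))
    where
    s : ℚ
    s = sgq ℤ.∣ parity rs ts ∣

  rowBox : ∀ {d} (rs : Vec ℕ d) h S k B → All Valid rs → k < B →
    boxSumℤ d B (λ ts → h (points rs ts) ℚ.* (sgq ℤ.∣ parity rs ts ∣ ℚ.* (qp (totalExponent rs ts) · S) k)) ≡ (S · Wsum rs h) k
  rowBox {d} rs h S k B v k<B = trans (boxSumℤ-cong d B (λ ts → sym (weighted-term rs ts (h (points rs ts)) S k)))
    (trans (sym (boxZ-at d B (λ ts → S · (weights rs ts · const (h (points rs ts)))) k)) (trans (at (boxZ-· d B S _) k)
      (below (agree-· {f = S} {S} {boxZ d B (λ ts → weights rs ts · const (h (points rs ts)))} {Wsum rs h} (≈⇒agree ≈-refl) (Wsum-box rs h B v)) k k<B)))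

-- From doubled integers back to half-integers

÷'-* : ∀ {p q} → q ≢ 0ℚ → (p ÷' q) ℚ.* q ≡ p
÷'-* {p} {q} q≢0 with q ℚP.≟ 0ℚ
... | yes e = ⊥-elim (q≢0 e)
... | no q≢0′ = trans (ℚP.*-assoc p (ℚ.1/ q) q) (trans (cong (p ℚ.*_) (ℚP.*-inverseˡ q)) (ℚP.*-identityʳ p))
  where instance _ = ℚ.≢-nonZero q≢0′

÷'-unique : ∀ {p q x} → q ≢ 0ℚ → p ≡ x ℚ.* q → p ÷' q ≡ x
÷'-unique {p} {q} {x} q≢0 e = *-cancel-≡ q≢0 (trans (ℚP.*-comm q (p ÷' q)) (trans (÷'-* q≢0) (trans e (ℚP.*-comm x q))))

negOnePow-sgq : ∀ z → negOnePow (ℤ→ℚ z) ≡ sgq ℤ.∣ z ∣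
negOnePow-sgq z = trans (cong negOnePow (ℤ→ℚ-mkℚ z)) (parity ℤ.∣ z ∣)
  where
  neg-neg : ∀ x → x ≡ ℚ.- (ℚ.- x)
  neg-neg = solve-∀ ℚ-ring
  parity : ∀ m → (if (m % 2) ℕ.≡ᵇ 0 then 1ℚ else (ℚ.- 1ℚ)) ≡ sgq m
  parity zero          = refl
  parity (suc zero)    = refl
  parity (suc (suc m)) = trans (parity m) (neg-neg (sgq m))

coeffShiftℚ-ℤ : ∀ e S k → coeffShiftℚ (ℤ→ℚ e) S k ≡ coeffShiftℤ e S k
coeffShiftℚ-ℤ e S k with (k ℚ./ 1) ℚ.- ℤ→ℚ e | trans (sym (trans (ℤ→ℚ-+ k (ℤ.- e)) (cong (ℤ→ℚ k ℚ.+_) (ℤ→ℚ-neg e)))) (ℤ→ℚ-mkℚ (k ℤ.- e))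
... | _ | refl with k ℤ.- e
...   | + j      = refl
...   | -[1+ j ] = refl

half : ℤ → ℚ
half x = ℚ.½ ℚ.* ℤ→ℚ x

halves : ∀ {d} → Vec ℤ d → Vec ℚ d
halves = Vec.map half

half-shift : ∀ R Z → half (R ℤ.+ (Z ℤ.+ Z)) ≡ half R ℚ.+ ℤ→ℚ Z
half-shift R Z = trans (cong (ℚ.½ ℚ.*_) (trans (ℤ→ℚ-+ R (Z ℤ.+ Z)) (cong (ℤ→ℚ R ℚ.+_) (ℤ→ℚ-+ Z Z))))
  (trans (aux ℚ.½ (ℤ→ℚ R) (ℤ→ℚ Z)) (cong (half R ℚ.+_) (ℚP.*-identityˡ (ℤ→ℚ Z))))
  where
  aux : ∀ h r z → h ℚ.* (r ℚ.+ (z ℚ.+ z)) ≡ h ℚ.* r ℚ.+ (h ℚ.+ h) ℚ.* z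
  aux = solve-∀ ℚ-ring

sq-half : ∀ x → sq (half x) ≡ (ℚ.½ ℚ.* ℚ.½) ℚ.* sqℤ x
sq-half x = aux ℚ.½ (ℤ→ℚ x)
  where
  aux : ∀ h x → (h ℚ.* x) ℚ.* (h ℚ.* x) ≡ (h ℚ.* h) ℚ.* (x ℚ.* x)
  aux = solve-∀ ℚ-ring

rhoFrom-halves : ∀ i d → rhoFrom i d ≡ halves (oddsFrom i d)
rhoFrom-halves i zero    = refl
rhoFrom-halves i (suc d) = cong₂ _∷_ (÷'-unique {ℕtoℚ (2 ℕ.* i ℕ.+ 1)} {ℕtoℚ 2} {half (oddℕ i)} (λ ())
    (trans (cong ℕtoℚ (NS.solve 1 (λ i → NS.con 2 NS.:* i NS.:+ NS.con 1 NS.:= NS.con 1 NS.:+ (i NS.:+ i)) refl i)) (sym (trans (aux ℚ.½ (ℤ→ℚ (oddℕ i)) (ℕtoℚ 2)) (ℚP.*-identityˡ (ℤ→ℚ (oddℕ i)))))))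
  (rhoFrom-halves (suc i) d)
  where
  aux : ∀ h x t → (h ℚ.* x) ℚ.* t ≡ (h ℚ.* t) ℚ.* x
  aux = solve-∀ ℚ-ring

addScalar-halves : ∀ i d → addScalar (halves (oddsFrom i d)) 1ℚ ≡ halves (oddsFrom (suc i) d)
addScalar-halves i zero    = refl
addScalar-halves i (suc d) = cong₂ _∷_ (trans (sym (half-shift (oddℕ i) (+ 1)))
    (cong half (ZS.solve 1 (λ i → (ZS.con (+ 1) ZS.:+ (i ZS.:+ i)) ZS.:+ (ZS.con (+ 1) ZS.:+ ZS.con (+ 1)) ZS.:= ZS.con (+ 1) ZS.:+ ((ZS.con (+ 1) ZS.:+ i) ZS.:+ (ZS.con (+ 1) ZS.:+ i))) refl (+ i))))
  (addScalar-halves (suc i) d)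

ξ-factor : ∀ x x′ y y′ → sqℤ y ℚ.- sqℤ y′ ≢ 0ℚ →
  ((sq (half x) ℚ.- sq (half x′)) ÷' (sq (half y) ℚ.- sq (half y′))) ℚ.* (sqℤ y ℚ.- sqℤ y′) ≡ sqℤ x ℚ.- sqℤ x′
ξ-factor x x′ y y′ y≢ = *-cancel-≡ {¼} (λ ()) (trans (move ¼ (p ÷' r) (sqℤ y) (sqℤ y′)) (trans
  (cong ((p ÷' r) ℚ.*_) (sym (quarter y y′))) (trans (÷'-* {p} {r} (λ e → y≢ (*-cancel-0 {¼} (λ ()) (trans (sym (collect ¼ (sqℤ y) (sqℤ y′))) (trans (sym (quarter y y′)) e))))) (trans (quarter x x′) (collect ¼ (sqℤ x) (sqℤ x′))))))
  where
  ¼ p r : ℚ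
  ¼ = ℚ.½ ℚ.* ℚ.½
  p = sq (half x) ℚ.- sq (half x′)
  r = sq (half y) ℚ.- sq (half y′)
  quarter : ∀ u v → sq (half u) ℚ.- sq (half v) ≡ ¼ ℚ.* sqℤ u ℚ.- ¼ ℚ.* sqℤ v
  quarter u v = cong₂ ℚ._-_ (sq-half u) (sq-half v)
  collect : ∀ c a b → c ℚ.* a ℚ.- c ℚ.* b ≡ c ℚ.* (a ℚ.- b)
  collect = solve-∀ ℚ-ring
  move : ∀ c f a b → c ℚ.* (f ℚ.* (a ℚ.- b)) ≡ f ℚ.* (c ℚ.* a ℚ.- c ℚ.* b)
  move = solve-∀ ℚ-ring

ratios : ∀ {d} → ℚ → ℚ → Vec ℚ d → Vec ℚ d → ℚ
ratios x y xs ys = prodV (zipWith (λ x′ y′ → (sq x ℚ.- sq x′) ÷' (sq y ℚ.- sq y′)) xs ys)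

*-interchange : ∀ a b c d → (a ℚ.* b) ℚ.* (c ℚ.* d) ≡ (a ℚ.* c) ℚ.* (b ℚ.* d)
*-interchange = solve-∀ ℚ-ring

ξ-row : ∀ {d} x (xs : Vec ℤ d) i j → i < j → ratios (half x) (half (oddℕ i)) (halves xs) (halves (oddsFrom j d)) ℚ.* pd (oddℕ i) (oddsFrom j d) ≡ pd x xs
ξ-row x []        i j i<j = refl
ξ-row {suc d} x (x′ ∷ xs) i j i<j = trans
  (*-interchange ((sq (half x) ℚ.- sq (half x′)) ÷' (sq (half (oddℕ i)) ℚ.- sq (half (oddℕ j)))) (ratios (half x) (half (oddℕ i)) (halves xs) (halves (oddsFrom (suc j) d)))
    (sqℤ (oddℕ i) ℚ.- sqℤ (oddℕ j)) (pd (oddℕ i) (oddsFrom (suc j) d)))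
  (cong₂ ℚ._*_ (ξ-factor x x′ (oddℕ i) (oddℕ j) (sq-distinct i j i<j)) (ξ-row x xs i (suc j) (ℕP.m<n⇒m<1+n i<j)))

-- The factor 1/4 from squaring halves cancels in every ratio, so ξ is a quotient of two Vandermonde
-- products in doubled entries. Its denominator at i = 0 is the constant multiplying the path sums
-- in both identities.
ξ-vand : ∀ {d} (xs : Vec ℤ d) i → ξ (halves xs) (halves (oddsFrom i d)) ℚ.* vand (oddsFrom i d) ≡ vand xs
ξ-vand []       i = refl
ξ-vand {suc d} (x ∷ xs) i = trans
  (*-interchange (ratios (half x) (half (oddℕ i)) (halves xs) (halves (oddsFrom (suc i) d))) (ξ (halves xs) (halves (oddsFrom (suc i) d)))
    (pd (oddℕ i) (oddsFrom (suc i) d)) (vand (oddsFrom (suc i) d)))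
  (cong₂ ℚ._*_ (ξ-row x xs i (suc i) ℕP.≤-refl) (ξ-vand xs (suc i)))

opaque
  unfolding _⊕_

  powS≈ : ∀ f m → powS f m ≈ f ^S m
  powS≈ f zero    = ≈-refl
  powS≈ f (suc m) = ≈-trans (·-comm (powS f m) f) (·-congˡ {f} {powS f m} {f ^S m} (powS≈ f m))

cancel-summand : ∀ a b → (a ℚ.+ b) ℚ.- a ≡ b
cancel-summand = solve-∀ ℚ-ring

module _ {N : ℕ} where
  open Rows N
  open RowBox N

  valid-sum : ∀ {r} → Valid r → r ℕ.+ (K ∸ r) ≡ K
  valid-sum (_ , r<K) = ℕP.m+[n∸m]≡n (ℕP.<⇒≤ r<K)

  half-point : ∀ r t → half (Vr r (K ∸ r) t) ≡ half (Rr r) ℚ.+ ℤ→ℚ (+ (r ℕ.+ (K ∸ r)) ℤ.* t)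
  half-point r t = trans (cong (λ z → half (Rr r ℤ.+ z)) (ℤP.*-distribˡ-+ (+ (r ℕ.+ (K ∸ r))) t t)) (half-shift (Rr r) (+ (r ℕ.+ (K ∸ r)) ℤ.* t))

  shiftBy-points : ∀ {d} (rs : Vec ℕ d) ts → All Valid rs → shiftBy K (halves (Vec.map Rr rs)) ts ≡ halves (points rs ts)
  shiftBy-points []       []       []       = refl
  shiftBy-points (r ∷ rs) (t ∷ ts) (v ∷ vr) = cong₂ _∷_ (trans (cong (λ m → half (Rr r) ℚ.+ ℤ→ℚ (+ m ℤ.* t)) (sym (valid-sum v))) (sym (half-point r t))) (shiftBy-points rs ts vr)

  sumV-points : ∀ {d} (rs : Vec ℕ d) ts → sumV (halves (points rs ts)) ≡ sumV (halves (Vec.map Rr rs)) ℚ.+ ℤ→ℚ (parity rs ts)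
  sumV-points []       []       = refl
  sumV-points (r ∷ rs) (t ∷ ts) = trans (cong₂ ℚ._+_ (half-point r t) (sumV-points rs ts))
    (trans (+-interchange (half (Rr r)) (ℤ→ℚ z) (sumV (halves (Vec.map Rr rs))) (ℤ→ℚ (parity rs ts)))
      (cong ((half (Rr r) ℚ.+ sumV (halves (Vec.map Rr rs))) ℚ.+_) (sym (ℤ→ℚ-+ z (parity rs ts)))))
    where
    z : ℤ
    z = + (r ℕ.+ (K ∸ r)) ℤ.* t

  -- `V-square` divided by 4, summed over the rows: 8K becomes 2K, the denominator of the exponent
  -- in the theorem.
  normSq-points : ∀ {d} (rs : Vec ℕ d) ts → All Valid rs →
    normSq (halves (points rs ts)) ≡ normSq (halves (Vec.map Rr rs)) ℚ.+ ℤ→ℚ (+ totalExponent rs ts) ℚ.* ℤ→ℚ (+ 2 ℤ.* + K)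
  normSq-points []       []       []       = sym (trans (ℚP.+-identityˡ _) (ℚP.*-zeroˡ (ℤ→ℚ (+ 2 ℤ.* + K))))
  normSq-points (r ∷ rs) (t ∷ ts) (v ∷ vr) = trans (cong₂ ℚ._+_ head (normSq-points rs ts vr))
    (trans (regroup (sq (half (Rr r))) (ℤ→ℚ (+ e)) (ℤ→ℚ (+ 2 ℤ.* + K)) (normSq (halves (Vec.map Rr rs))) (ℤ→ℚ (+ totalExponent rs ts)))
      (cong (λ x → (sq (half (Rr r)) ℚ.+ normSq (halves (Vec.map Rr rs))) ℚ.+ x ℚ.* ℤ→ℚ (+ 2 ℤ.* + K)) (sym (ℤ→ℚ-+ (+ e) (+ totalExponent rs ts)))))
    where
    e : ℕ
    e = expo r (K ∸ r) t
    V : ℤ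
    V = Vr r (K ∸ r) t
    regroup : ∀ a e k b f → (a ℚ.+ e ℚ.* k) ℚ.+ (b ℚ.+ f ℚ.* k) ≡ (a ℚ.+ b) ℚ.+ (e ℚ.+ f) ℚ.* k
    regroup = solve-∀ ℚ-ring
    aux : ∀ q a k e r → q ℚ.* ((a ℚ.* k) ℚ.* e ℚ.+ r) ≡ q ℚ.* r ℚ.+ e ℚ.* ((q ℚ.* a) ℚ.* k)
    aux = solve-∀ ℚ-ring
    square : sqℤ V ≡ (ℤ→ℚ (+ 8) ℚ.* ℤ→ℚ (+ K)) ℚ.* ℤ→ℚ (+ e) ℚ.+ sqℤ (Rr r)
    square = trans (sym (ℤ→ℚ-* V V)) (trans (cong ℤ→ℚ (V-square r (K ∸ r) t))
      (trans (ℤ→ℚ-+ ((+ 8 ℤ.* + (r ℕ.+ (K ∸ r))) ℤ.* + e) (Rr r ℤ.* Rr r)) (cong₂ ℚ._+_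
        (trans (ℤ→ℚ-* (+ 8 ℤ.* + (r ℕ.+ (K ∸ r))) (+ e)) (cong (ℚ._* ℤ→ℚ (+ e)) (trans (ℤ→ℚ-* (+ 8) (+ (r ℕ.+ (K ∸ r)))) (cong (λ m → ℤ→ℚ (+ 8) ℚ.* ℤ→ℚ (+ m)) (valid-sum v)))))
        (ℤ→ℚ-* (Rr r) (Rr r)))))
    head : sq (half V) ≡ sq (half (Rr r)) ℚ.+ ℤ→ℚ (+ e) ℚ.* ℤ→ℚ (+ 2 ℤ.* + K)
    head = trans (sq-half V) (trans (cong ((ℚ.½ ℚ.* ℚ.½) ℚ.*_) square)
      (trans (aux (ℚ.½ ℚ.* ℚ.½) (ℤ→ℚ (+ 8)) (ℤ→ℚ (+ K)) (ℤ→ℚ (+ e)) (sqℤ (Rr r)))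
        (cong₂ (λ x y → x ℚ.+ ℤ→ℚ (+ e) ℚ.* y) (sym (sq-half (Rr r))) (sym (ℤ→ℚ-* (+ 2) (+ K))))))

-- Comparison of coefficients

module Coefficientwise (n′ : ℕ) where
  open Final n′
  open RowBox N

  v₁ : ℚ
  v₁ = vand (oddsFrom 0 n)

  v₁≢0 : v₁ ≢ 0ℚ
  v₁≢0 = vand-odds≢0 0 n

  rhsTerm : Vec ℚ n → ℕ → ℤ → Vec ℤ n → ℚ
  rhsTerm w B k t = let v = shiftBy (2 ℕ.* n ℕ.+ 3) w t in
    ξ v (ρ n) ℚ.* negOnePow (sumV v ℚ.- sumV w)
      ℚ.* coeffShiftℚ ((normSq v ℚ.- normSq w) ÷' ℕtoℚ (2 ℕ.* (2 ℕ.* n ℕ.+ 3))) (powS (invPoch B) β) k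

  module _ (rs : Vec ℕ n) (valid : All Valid rs) where

    rhsTerm-points : ∀ B k ts → v₁ ℚ.* rhsTerm (halves (Vec.map Rr rs)) B k ts ≡
      vand (points rs ts) ℚ.* (sgq ℤ.∣ parity rs ts ∣ ℚ.* coeffShiftℤ (+ totalExponent rs ts) (powS (invPoch B) β) k)
    rhsTerm-points B k ts = trans (cong (λ m → v₁ ℚ.* term m (ρ n)) M≡K) (trans (cong (λ y → v₁ ℚ.* term K y) (rhoFrom-halves 0 n))
      (trans (cong (λ v → v₁ ℚ.* termAt K (halves (oddsFrom 0 n)) v) (shiftBy-points rs ts valid))
      (trans (cong₂ (λ s c → v₁ ℚ.* ((ξ pts (halves (oddsFrom 0 n)) ℚ.* s) ℚ.* c)) sign shift)
      (trans (move v₁ (ξ pts (halves (oddsFrom 0 n))) sgn′ coeff) (cong (ℚ._* (sgn′ ℚ.* coeff)) (ξ-vand (points rs ts) 0))))))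
      where
      origin pts : Vec ℚ n
      origin = halves (Vec.map Rr rs)
      pts = halves (points rs ts)
      termAt : ℕ → Vec ℚ n → Vec ℚ n → ℚ
      termAt m y v = ξ v y ℚ.* negOnePow (sumV v ℚ.- sumV origin) ℚ.* coeffShiftℚ ((normSq v ℚ.- normSq origin) ÷' ℕtoℚ (2 ℕ.* m)) (powS (invPoch B) β) k
      term : ℕ → Vec ℚ n → ℚ
      term m y = termAt m y (shiftBy m origin ts)
      M≡K : 2 ℕ.* n ℕ.+ 3 ≡ K
      M≡K = NS.solve 1 (λ n → NS.con 2 NS.:* n NS.:+ NS.con 3 NS.:= NS.con 3 NS.:+ (n NS.:+ n)) refl n
      sgn′ coeff : ℚ
      sgn′ = sgq ℤ.∣ parity rs ts ∣
      coeff = coeffShiftℤ (+ totalExponent rs ts) (powS (invPoch B) β) k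
      move : ∀ v x s c → v ℚ.* ((x ℚ.* s) ℚ.* c) ≡ (x ℚ.* v) ℚ.* (s ℚ.* c)
      move = solve-∀ ℚ-ring
      sign : negOnePow (sumV pts ℚ.- sumV origin) ≡ sgq ℤ.∣ parity rs ts ∣
      sign = trans (cong negOnePow (trans (cong (ℚ._- sumV origin) (sumV-points rs ts)) (cancel-summand (sumV origin) (ℤ→ℚ (parity rs ts))))) (negOnePow-sgq (parity rs ts))
      2K≢0 : ℕtoℚ (2 ℕ.* K) ≢ 0ℚ
      2K≢0 e with ℤ→ℚ-injective {+ (2 ℕ.* K)} {+ 0} e
      ... | ()
      shift : coeffShiftℚ ((normSq pts ℚ.- normSq origin) ÷' ℕtoℚ (2 ℕ.* K)) (powS (invPoch B) β) k ≡ coeffShiftℤ (+ totalExponent rs ts) (powS (invPoch B) β) k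
      shift = trans (cong (λ e → coeffShiftℚ e (powS (invPoch B) β) k) (÷'-unique {normSq pts ℚ.- normSq origin} {ℕtoℚ (2 ℕ.* K)} {ℤ→ℚ (+ totalExponent rs ts)} 2K≢0
          (trans (cong (ℚ._- normSq origin) (normSq-points rs ts valid)) (trans (cancel-summand (normSq origin) _) (cong (λ z → ℤ→ℚ (+ totalExponent rs ts) ℚ.* ℤ→ℚ z) (sym (ℤP.pos-* 2 K)))))))
        (coeffShiftℚ-ℤ (+ totalExponent rs ts) (powS (invPoch B) β) k)

    rhs-coeff : ∀ B k → k < B → v₁ ℚ.* rhsCoeff n (halves (Vec.map Rr rs)) B (+ k) ≡ (a₀ ^S β · Wsum rs vand) k
    rhs-coeff B k k<B = trans (sym (boxSumℤ-*ˡ n B v₁ (rhsTerm (halves (Vec.map Rr rs)) B (+ k))))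
      (trans (boxSumℤ-cong n B (λ ts → trans (rhsTerm-points B (+ k) ts) (cong (λ x → vand (points rs ts) ℚ.* (sgq ℤ.∣ parity rs ts ∣ ℚ.* x)) (coeffShift-nat (totalExponent rs ts) S k))))
      (trans (rowBox rs vand S k B valid k<B)
        (below (agree-· {f = S} {a₀ ^S β} {Wsum rs vand} {Wsum rs vand} (agree-trans (≈⇒agree (powS≈ (invPoch B) β)) (agree-^S β (a₀-agree B))) (≈⇒agree ≈-refl)) k k<B)))
      where
      S : Series
      S = powS (invPoch B) β

    rhs-neg : ∀ B k → v₁ ℚ.* rhsCoeff n (halves (Vec.map Rr rs)) B -[1+ k ] ≡ 0ℚ
    rhs-neg B k = trans (sym (boxSumℤ-*ˡ n B v₁ (rhsTerm (halves (Vec.map Rr rs)) B -[1+ k ])))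
      (boxSumℤ-0 n B (λ ts → trans (rhsTerm-points B -[1+ k ] ts) (vanish (vand (points rs ts)) (sgq ℤ.∣ parity rs ts ∣) (coeffShift-neg (totalExponent rs ts) (powS (invPoch B) β) k))))
      where
      vanish : ∀ a b {c} → c ≡ 0ℚ → a ℚ.* (b ℚ.* c) ≡ 0ℚ
      vanish a b e = trans (cong (λ c → a ℚ.* (b ℚ.* c)) e) (trans (cong (a ℚ.*_) (ℚP.*-zeroʳ b)) (ℚP.*-zeroʳ a))

  Stable : (∀ {d} → Vec ℕ d → ℤ) → Vec ℚ n → ℤ → Set
  Stable lin w k = ∃ λ B₀ → (B B′ : ℕ) → B₀ ≤ B → B₀ ≤ B′ → lhsCoeff n lin B k ≡ rhsCoeff n w B′ k

  conclude : ∀ (lin : ∀ {d} → Vec ℕ d → ℤ) c c′ L rs → c ≤ 1 → c′ ≤ 1 → All Valid rs → (∀ {d} (v : Vec ℕ d) → halfmCm v ℤ.+ lin v ≡ + pathExponent c c′ 0 v) →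
    L ≈ pathSum (2 ℕ.* n ∸ 1) c c′ 0 → const v₁ · L ≈ a₀ ^S β · Wsum rs vand → ∀ k → Stable lin (halves (Vec.map Rr rs)) k
  -- The summand b lets the left box contain all paths that matter in degree k; k + 1 gives k < B′,
  -- which makes both the box of theta terms and the truncated product on the right exact in degree
  -- k.
  conclude lin c c′ L rs c≤ c′≤ valid path L≈ id (+ k) = b ℕ.+ suc k , λ B B′ l l′ → *-cancel-≡ v₁≢0
    (trans (cong (v₁ ℚ.*_) (trans (lhsBox d c c′ k B lin c≤ c′≤ path (ℕP.≤-trans (ℕP.m≤m+n b (suc k)) l)) (sym (at L≈ k))))
    (trans (sym (trans (at (const-· v₁ L) k) (∙-at v₁ L k))) (trans (at id k) (sym (rhs-coeff rs valid B′ k (ℕP.≤-trans (ℕP.m≤n+m (suc k) b) l′))))))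
    where
    d b : ℕ
    d = 2 ℕ.* n ∸ 1
    b = pathBound k d 0
  conclude lin c c′ L rs c≤ c′≤ valid path L≈ id -[1+ k ] = 0 , λ B B′ _ _ → trans (lhsBox-neg (2 ℕ.* n ∸ 1) c c′ k B lin path)
    (sym (*-cancel-0 v₁≢0 (rhs-neg rs valid B′ k)))

  private
    row₁ : halves (Vec.map Rr rows₁) ≡ ρ n
    row₁ = trans (cong halves (Rr-rows 0 n (ℕP.n≤1+n n))) (sym (rhoFrom-halves 0 n))

    row₂ : halves (Vec.map Rr rows₂) ≡ addScalar (ρ n) 1ℚ
    row₂ = trans (cong halves (Rr-rows 1 n ℕP.≤-refl)) (trans (sym (addScalar-halves 0 n)) (cong (λ w → addScalar w 1ℚ) (sym (rhoFrom-halves 0 n))))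

  first-equality : ∀ k → Stable noLin (ρ n) k
  first-equality k = subst (λ w → Stable noLin w k) row₁ (conclude noLin 1 1 L₁ rows₁ (s≤s z≤n) (s≤s z≤n) (valid-rows 0 n (ℕP.n≤1+n n)) halfmCm-path
    (≈-trans (straightChain-path (n′ ℕ.+ n) 0) (≡⇒≈ (cong (λ d → pathSum (n′ ℕ.+ d) 1 1 0) (sym (ℕP.+-identityʳ n))))) first-identity k)

  second-equality : ∀ k → Stable altSum (addScalar (ρ n) 1ℚ) k
  second-equality k = subst (λ w → Stable altSum w k) row₂ (conclude altSum 0 1 L₂ rows₂ z≤n (s≤s z≤n) (valid-rows 1 n ℕP.≤-refl) halfmCm-altSum-path
    (≈-trans (evenChain-path n′ 0) (≡⇒≈ (cong (λ d → pathSum d 0 1 0) (trans (sym (ℕP.+-suc n′ n′)) (cong (n′ ℕ.+_) (sym (ℕP.+-identityʳ n))))))) second-identity k)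

theorem1p2 : (n : ℕ) → 1 ≤ n →
    ((k : ℤ) → ∃ λ B₀ → (B B′ : ℕ) → B₀ ≤ B → B₀ ≤ B′ →
    lhsCoeff n noLin B k ≡ rhsCoeff n (ρ n) B′ k)
    × ((k : ℤ) → ∃ λ B₀ → (B B′ : ℕ) → B₀ ≤ B → B₀ ≤ B′ →
    lhsCoeff n altSum B k ≡ rhsCoeff n (addScalar (ρ n) 1ℚ) B′ k)
theorem1p2 (suc n′) _ = Coefficientwise.first-equality n′ , Coefficientwise.second-equality n′
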